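{- Let $\pi$ be a degree sequence of some tree with boundary, and let $\mathcal{T}_\pi$ be the class of all trees with boundary with degree sequence $\pi$. A tree $G\in\mathcal{T}_\pi$ has the Faber-Krahn property in $\mathcal{T}_\pi$ if and only if $G$ is an SLO$^\ast$-tree. Such a $G$ is uniquely determined up to isomorphism.
   Context: A tree with boundary is a finite tree $G=(V,E)$ whose vertex set is partitioned into the set $\partial V$ of boundary vertices, which are exactly the vertices of degree $1$, and the set $V_0$ of interior vertices, which are exactly the vertices of degree at least $2$; both sets are nonempty. The degree sequence of $G$ is the multiset of its vertex degrees. The Dirichlet operator $\Delta_0$ is the principal submatrix of the graph Laplacian $D-A$ of $G$ (degrees taken in $G$) indexed by $V_0$; $\lambda(G)$ is its smallest eigenvalue. $G$ has the Faber-Krahn property in a class $\mathcal{C}\ni G$ if $\lambda(G)\le\lambda(H)$ for all $H\in\mathcal{C}$. For a tree with a chosen root $v_0$, the height of $v$ is $h(v)=\mathrm{dist}(v,v_0)$; if $v,w$ are adjacent and $h(w)=h(v)+1$, then $v$ is the parent of $w$ and $w$ a child of $v$. A total order $\prec$ on $V$ is spiral-like (SLO) for root $v_0$ if: (S1) $v\prec w$ implies $h(v)\le h(w)$; (S2) if $v_1\prec v_2$ then every child of $v_1$ precedes every child of $v_2$; (S3) if $v\prec w$ and $v\in\partial V$ then $w\in\partial V$. It is an SLO$^\ast$-ordering if additionally (S4) for interior vertices $v\prec w$ implies $d_v\le d_w$ ($d_v$ the degree). An SLO$^\ast$-tree is a tree with boundary admitting an SLO$^\ast$-ordering for some root. 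-}

module Defs where

open import Data.Bool using (Bool; false; T; if_then_else_)
open import Data.Fin using (Fin; zero; suc; fromℕ; inject₁)
open import Data.Fin.Properties using (_≟_)
open import Data.Fin.Subset using (∣_∣)
import Data.Integer as ℤ
open import Data.Integer using (ℤ; +_)
open import Data.List using (List; map; allFin; filter; length; lookup)
open import Data.List.Relation.Binary.Permutation.Propositional using (_↭_)
import Data.Nat as ℕ
open import Data.Nat using (ℕ; _⊔_)
import Data.Nat.Properties as ℕ
open import Data.Product using (Σ-syntax; ∃; ∃₂; ∃-syntax; _×_; _,_)
import Data.Rational as ℚ
open import Data.Rational using (ℚ; 0ℚ; 1ℚ; ½)
import Data.Rational.Properties as ℚ
open import Data.Rational.Solver using (module +-*-Solver)
open import Data.Vec using (tabulate)
open import Data.Vec.Functional using (Vector; foldr)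
open import Function.Bundles using (_↔_; Inverse)
open import Function.Definitions using (Injective)
open import Level using (0ℓ)
open import Relation.Binary using (Rel; IsStrictTotalOrder)
open import Relation.Binary.PropositionalEquality using (_≡_; refl; sym; trans; cong; subst)
open import Relation.Nullary using (¬_)
open import Relation.Nullary.Decidable using (⌊_⌋)

record ℝ : Set where
  constructor mkℝ
  field
    seq    : ℕ → ℚ
    cauchy : ∀ ε → 0ℚ ℚ.< ε → ∃[ N ] (∀ m n → N ℕ.≤ m → N ℕ.≤ n → ℚ.∣ seq m ℚ.- seq n ∣ ℚ.< ε)

open ℝ public

infix  4 _≈_ _≤_
infixl 6 _+_
infixl 7 _*_

_≈_ : Rel ℝ 0ℓ
x ≈ y = ∀ ε → 0ℚ ℚ.< ε → ∃[ N ] (∀ n → N ℕ.≤ n → ℚ.∣ seq x n ℚ.- seq y n ∣ ℚ.< ε)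

_≤_ : Rel ℝ 0ℓ
x ≤ y = ∀ ε → 0ℚ ℚ.< ε → ∃[ N ] (∀ n → N ℕ.≤ n → seq x n ℚ.< seq y n ℚ.+ ε)

fromℚ : ℚ → ℝ
fromℚ q = mkℝ (λ _ → q) λ ε 0<ε → 0 , λ _ _ _ _ →
  subst (ℚ._< ε) (sym (cong ℚ.∣_∣ (ℚ.+-inverseʳ q))) 0<ε

fromℤ : ℤ → ℝ
fromℤ i = fromℚ (i ℚ./ 1)

0ℝ : ℝ
0ℝ = fromℚ 0ℚ

private
  ½*-pos : ∀ {ε} → 0ℚ ℚ.< ε → 0ℚ ℚ.< ½ ℚ.* ε
  ½*-pos {ε} 0<ε =
    ℚ.positive⁻¹ (½ ℚ.* ε) {{ℚ.pos*pos⇒pos ½ ε {{ℚ.positive 0<ε}}}}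

  ½+½ : ∀ ε → ½ ℚ.* ε ℚ.+ ½ ℚ.* ε ≡ ε
  ½+½ ε = trans (sym (ℚ.*-distribʳ-+ ε ½ ½)) (ℚ.*-identityˡ ε)

  split : ∀ {a b c ε} → c ≡ a ℚ.+ b → ℚ.∣ a ∣ ℚ.< ½ ℚ.* ε → ℚ.∣ b ∣ ℚ.< ½ ℚ.* ε → ℚ.∣ c ∣ ℚ.< ε
  split {a} {b} {c} {ε} refl p q = ℚ.≤-<-trans (ℚ.∣p+q∣≤∣p∣+∣q∣ a b)
    (subst (ℚ.∣ a ∣ ℚ.+ ℚ.∣ b ∣ ℚ.<_) (½+½ ε) (ℚ.+-mono-< p q))

  +-split : ∀ a b c d → (a ℚ.+ b) ℚ.- (c ℚ.+ d) ≡ (a ℚ.- c) ℚ.+ (b ℚ.- d)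
  +-split = solve 4 (λ a b c d → (a :+ b) :- (c :+ d) := (a :- c) :+ (b :- d)) refl
    where open +-*-Solver

  *-split : ∀ a b c d → (a ℚ.* b) ℚ.- (c ℚ.* d) ≡ a ℚ.* (b ℚ.- d) ℚ.+ d ℚ.* (a ℚ.- c)
  *-split = solve 4 (λ a b c d → (a :* b) :- (c :* d) := a :* (b :- d) :+ d :* (a :- c)) refl
    where open +-*-Solver

  bounded : ∀ x → ∃[ B ] (0ℚ ℚ.< B × ∃[ N ] (∀ n → N ℕ.≤ n → ℚ.∣ seq x n ∣ ℚ.≤ B))
  bounded x with cauchy x 1ℚ (ℚ.positive⁻¹ 1ℚ)
  ... | N , close = 1ℚ ℚ.+ ℚ.∣ seq x N ∣
      , ℚ.+-mono-<-≤ (ℚ.positive⁻¹ 1ℚ) (ℚ.0≤∣p∣ (seq x N))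
      , N , λ n N≤n →
        ℚ.≤-trans
          (subst (λ z → ℚ.∣ z ∣ ℚ.≤ ℚ.∣ seq x n ℚ.- seq x N ∣ ℚ.+ ℚ.∣ seq x N ∣)
                 (telescope (seq x n) (seq x N))
                 (ℚ.∣p+q∣≤∣p∣+∣q∣ (seq x n ℚ.- seq x N) (seq x N)))
          (ℚ.+-monoˡ-≤ ℚ.∣ seq x N ∣ (ℚ.<⇒≤ (close n N N≤n ℕ.≤-refl)))
    where
    telescope : ∀ a b → (a ℚ.- b) ℚ.+ b ≡ a
    telescope = solve 2 (λ a b → (a :- b) :+ b := a) refl
      where open +-*-Solver

  shrink : ∀ {B ε} → 0ℚ ℚ.< B → 0ℚ ℚ.< ε → ∃[ δ ] (0ℚ ℚ.< δ × B ℚ.* δ ≡ ε)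
  shrink {B} {ε} 0<B 0<ε = B⁻¹ ℚ.* ε
    , ℚ.positive⁻¹ (B⁻¹ ℚ.* ε) {{ℚ.pos*pos⇒pos B⁻¹ {{ℚ.1/pos⇒pos B {{B-pos}}}} ε {{ℚ.positive 0<ε}}}}
    , trans (sym (ℚ.*-assoc B B⁻¹ ε))
        (trans (cong (ℚ._* ε) (ℚ.*-inverseʳ B {{B-nz}})) (ℚ.*-identityˡ ε))
    where
    B-pos : ℚ.Positive B
    B-pos = ℚ.positive 0<B
    B-nz : ℚ.NonZero B
    B-nz = ℚ.pos⇒nonZero B {{B-pos}}
    B⁻¹ : ℚ
    B⁻¹ = (ℚ.1/ B) {{B-nz}}

  *-small : ∀ {B δ ε} a b → 0ℚ ℚ.< B → B ℚ.* δ ≡ ε →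
            ℚ.∣ a ∣ ℚ.≤ B → ℚ.∣ b ∣ ℚ.< δ → ℚ.∣ a ℚ.* b ∣ ℚ.< ε
  *-small {B} {δ} a b 0<B refl a≤B b<δ =
    subst (ℚ._< B ℚ.* δ) (sym (ℚ.∣p*q∣≡∣p∣*∣q∣ a b))
      (ℚ.≤-<-trans
        (ℚ.*-monoʳ-≤-nonNeg ℚ.∣ b ∣ {{ℚ.nonNegative (ℚ.0≤∣p∣ b)}} a≤B)
        (ℚ.*-monoʳ-<-pos B {{ℚ.positive 0<B}} b<δ))

_+_ : ℝ → ℝ → ℝ
x + y = mkℝ (λ n → seq x n ℚ.+ seq y n) λ ε 0<ε →
  let (M , p) = cauchy x (½ ℚ.* ε) (½*-pos 0<ε)
      (N , q) = cauchy y (½ ℚ.* ε) (½*-pos 0<ε)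
  in M ⊔ N , λ m n ≤m ≤n →
    split (+-split (seq x m) (seq y m) (seq x n) (seq y n))
      (p m n (ℕ.m⊔n≤o⇒m≤o M N ≤m) (ℕ.m⊔n≤o⇒m≤o M N ≤n))
      (q m n (ℕ.m⊔n≤o⇒n≤o M N ≤m) (ℕ.m⊔n≤o⇒n≤o M N ≤n))

_*_ : ℝ → ℝ → ℝ
x * y = mkℝ (λ n → seq x n ℚ.* seq y n) λ ε 0<ε →
  let (B , 0<B , K , x≤B)  = bounded x
      (C , 0<C , L , y≤C)  = bounded y
      (δ , 0<δ , Bδ≡½ε)    = shrink 0<B (½*-pos 0<ε)
      (γ , 0<γ , Cγ≡½ε)    = shrink 0<C (½*-pos 0<ε)
      (M , p)              = cauchy x γ 0<γ
      (N , q)              = cauchy y δ 0<δ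
  in (K ⊔ L) ⊔ (M ⊔ N) , λ m n ≤m ≤n →
    let K⊔L≤m = ℕ.m⊔n≤o⇒m≤o (K ⊔ L) (M ⊔ N) ≤m
        K⊔L≤n = ℕ.m⊔n≤o⇒m≤o (K ⊔ L) (M ⊔ N) ≤n
        M⊔N≤m = ℕ.m⊔n≤o⇒n≤o (K ⊔ L) (M ⊔ N) ≤m
        M⊔N≤n = ℕ.m⊔n≤o⇒n≤o (K ⊔ L) (M ⊔ N) ≤n
    in split (*-split (seq x m) (seq y m) (seq x n) (seq y n))
         (*-small (seq x m) (seq y m ℚ.- seq y n) 0<B Bδ≡½ε
           (x≤B m (ℕ.m⊔n≤o⇒m≤o K L K⊔L≤m))
           (q m n (ℕ.m⊔n≤o⇒n≤o M N M⊔N≤m) (ℕ.m⊔n≤o⇒n≤o M N M⊔N≤n)))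
         (*-small (seq y n) (seq x m ℚ.- seq x n) 0<C Cγ≡½ε
           (y≤C n (ℕ.m⊔n≤o⇒n≤o K L K⊔L≤n))
           (p m n (ℕ.m⊔n≤o⇒m≤o M N M⊔N≤m) (ℕ.m⊔n≤o⇒m≤o M N M⊔N≤n)))

Matrix : Set → ℕ → Set
Matrix A n = Fin n → Fin n → A

sum : ∀ {n} → Vector ℝ n → ℝ
sum = foldr _+_ 0ℝ

_·_ : ∀ {n} → Matrix ℝ n → Vector ℝ n → Vector ℝ n
(M · f) i = sum (λ j → M i j * f j)

IsEigenvalue : ∀ {n} → Matrix ℝ n → ℝ → Set
IsEigenvalue {n} M μ =
  Σ[ f ∈ Vector ℝ n ] ¬ (∀ i → f i ≈ 0ℝ) × (∀ i → (M · f) i ≈ μ * f i)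

IsSmallestEigenvalue : ∀ {n} → Matrix ℝ n → ℝ → Set
IsSmallestEigenvalue M μ = IsEigenvalue M μ × (∀ ν → IsEigenvalue M ν → μ ≤ ν)

-- A principal submatrix provided vs has no repetitions.
principalSubmatrix : ∀ {A n} → Matrix A n → (vs : List (Fin n)) → Matrix A (length vs)
principalSubmatrix M vs i j = M (lookup vs i) (lookup vs j)

record Graph : Set where
  field
    order   : ℕ
    adj     : Fin order → Fin order → Bool
    adj-sym : ∀ u v → adj u v ≡ adj v u
    no-loop : ∀ v → adj v v ≡ false

  V : Set
  V = Fin order

  Adj : V → V → Set
  Adj u v = T (adj u v)

  deg : V → ℕ
  deg v = ∣ tabulate (adj v) ∣

  data Walk : V → V → ℕ → Set where
    []  : ∀ {v} → Walk v v 0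
    _∷_ : ∀ {u v w k} → Adj u v → Walk v w k → Walk u w (ℕ.suc k)

  IsDist : V → V → ℕ → Set
  IsDist u v d = Walk u v d × (∀ k → Walk u v k → d ℕ.≤ k)

  Connected : Set
  Connected = ∀ u v → ∃[ k ] Walk u v k

  -- A cycle c 0 , … , c k with k + 1 ≥ 3 distinct vertices.
  record Cycle : Set where
    field
      k        : ℕ
      2≤k      : 2 ℕ.≤ k
      c        : Fin (ℕ.suc k) → V
      distinct : Injective _≡_ _≡_ c
      step     : ∀ (i : Fin k) → Adj (c (inject₁ i)) (c (suc i))
      close    : Adj (c (fromℕ k)) (c zero)

  IsTree : Set
  IsTree = Connected × ¬ Cycle

  degreeSequence : List ℕ
  degreeSequence = map deg (allFin order)

  laplacian : Matrix ℤ order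
  laplacian u v =
    (if ⌊ u ≟ v ⌋ then + deg u else + 0) ℤ.- (if adj u v then + 1 else + 0)

record _≅_ (G H : Graph) : Set where
  private
    module G = Graph G
    module H = Graph H
  field
    bijection : G.V ↔ H.V
  open Inverse bijection using (to)
  field
    preserves : ∀ u v → H.adj (to u) (to v) ≡ G.adj u v

record TreeWithBoundary : Set where
  field
    graph : Graph
  open Graph graph public

  IsBoundary : V → Set
  IsBoundary v = deg v ≡ 1

  IsInterior : V → Set
  IsInterior v = 2 ℕ.≤ deg v

  field
    isTree      : IsTree
    -- With deg-pos, boundary and interior vertices partition V.
    deg-pos     : ∀ v → 1 ℕ.≤ deg v
    hasBoundary : ∃ IsBoundary
    hasInterior : ∃ IsInterior

  interior : List V
  interior = filter (λ v → 2 ℕ.≤? deg v) (allFin order)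

  dirichlet : Matrix ℤ (length interior)
  dirichlet = principalSubmatrix laplacian interior

  -- λ(G) = μ, as a relation between G and the real number μ.
  Isλ : ℝ → Set
  Isλ = IsSmallestEigenvalue (λ i j → fromℤ (dirichlet i j))

-- The class of trees with boundary with degree sequence π.  Degree sequences
-- are multisets, hence lists up to permutation.
𝒯 : List ℕ → TreeWithBoundary → Set
𝒯 π G = TreeWithBoundary.degreeSequence G ↭ π

-- λ(G) ≤ λ(H); a smallest eigenvalue is unique up to ≈, so the choice of the
-- two witnesses is immaterial.
_≤λ_ : TreeWithBoundary → TreeWithBoundary → Set
G ≤λ H = ∃[ μ ] ∃[ ν ] (G.Isλ μ × H.Isλ ν × μ ≤ ν)
  where
  module G = TreeWithBoundary G
  module H = TreeWithBoundary H

FaberKrahn : (TreeWithBoundary → Set) → TreeWithBoundary → Set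
FaberKrahn 𝒞 G = 𝒞 G × (∀ H → 𝒞 H → G ≤λ H)

module _ (G : TreeWithBoundary) where
  open TreeWithBoundary G

  record IsSLO (root : V) (_≺_ : Rel V 0ℓ) : Set where
    field
      isStrictTotalOrder : IsStrictTotalOrder _≡_ _≺_
      h                  : V → ℕ
      h-dist             : ∀ v → IsDist v root (h v)

    Child : V → V → Set
    Child v w = Adj v w × h w ≡ ℕ.suc (h v)

    field
      S1 : ∀ {v w} → v ≺ w → h v ℕ.≤ h w
      S2 : ∀ {v₁ v₂ w₁ w₂} → v₁ ≺ v₂ → Child v₁ w₁ → Child v₂ w₂ → w₁ ≺ w₂
      S3 : ∀ {v w} → v ≺ w → IsBoundary v → IsBoundary w

  record IsSLO* (root : V) (_≺_ : Rel V 0ℓ) : Set where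
    field
      isSLO : IsSLO root _≺_
      S4    : ∀ {v w} → IsInterior v → IsInterior w → v ≺ w → deg v ℕ.≤ deg w

  IsSLO*Tree : Set₁
  IsSLO*Tree = ∃₂ IsSLO*

{-# OPTIONS --safe #-}
module Submission where

-- Number the vertices of a tree so that a nonnegative function g decreases
-- and the leaves come last.  With δ p = g p - g (p + 1), summation by parts
-- writes the Dirichlet energy as Σ δ p δ q N(p,q), where N(p,q) counts the edges
-- from the first min(p,q) vertices to the vertices after the first max(p,q).
-- If j ≤ k, a forest has N(j,k) ≥ D j - (j - 1) - (k - 1) and N(j,k) ≥ 0, D j being
-- the sum of the first j degrees, and the larger of the two bounds is attained
-- when the numbering is breadth first with increasing interior degrees, which
-- is what an SLO*-ordering amounts to.  Rearranging the positive eigenfunction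
-- of a tree therefore does not increase the Rayleigh quotient.  In the case of
-- equality the rearrangement g is an eigenfunction of the breadth-first tree.
-- There a tie between two vertices forces all their other neighbours to tie,
-- so the level sets of g determine the tree up to a permutation inside each of
-- them, and selection sort finds a breadth-first numbering.
-- Ties of reals are undecidable, so this part is carried out inside a double
-- negation.  The eigenvalue itself is constructed by power iteration.

open import Defs renaming (_+_ to _+ᴰ_; _*_ to _*ᴰ_; _≤_ to _≤ᴰ_; _≈_ to _≈ᴰ_; sum to sumᴰ)
open import Algebra.Bundles using (CommutativeRing; CommutativeSemiring)
import Algebra.Properties.CommutativeMonoid.Sum as MonoidSum
import Algebra.Properties.Semiring.Sum as SemiringSum
import Algebra.Solver.Ring
open import Algebra.Solver.Ring.AlmostCommutativeRing using (_-Raw-AlmostCommutative⟶_; fromCommutativeRing)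
open import Data.Bool using (Bool; true; false; T; if_then_else_; _∨_)
import Data.Bool.Properties as Bool
open import Data.Empty using (⊥; ⊥-elim)
open import Data.Fin using (Fin; zero; suc; toℕ; fromℕ<; punchOut)
open import Data.Fin.Permutation using (Permutation; permutation)
import Data.Fin.Properties as Fin
open import Data.Fin.Subset using (∣_∣)
import Data.Integer as ℤ
open import Data.Integer using (ℤ; +_)
import Data.Integer.Properties as ℤ
import Data.List as List
open import Data.List using (List; []; _∷_; length; lookup; filter; map; allFin)
open import Data.List.Membership.Propositional.Properties using (∈-filter⁺; ∈-filter⁻; ∈-allFin; ∈-lookup)
import Data.List.Properties as List
open import Data.List.Relation.Binary.Permutation.Propositional using (_↭_)
open import Data.List.Relation.Binary.Permutation.Propositional.Properties using (↭-length) renaming (map⁺ to ↭-map⁺)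
import Data.List.Relation.Unary.All as All
open import Data.List.Relation.Unary.AllPairs using (_∷_)
open import Data.List.Relation.Unary.Any using (index)
open import Data.List.Relation.Unary.Any.Properties using (lookup-index)
open import Data.List.Relation.Unary.Unique.Propositional using (Unique)
open import Data.List.Relation.Unary.Unique.Propositional.Properties using (allFin⁺) renaming (filter⁺ to unique-filter⁺)
open import Data.Maybe using (Maybe; just; nothing)
open import Data.Nat using (ℕ; zero; suc; _+_; _*_; _∸_; _≤_; _<_; _⊔_; _⊓_; z≤n; s≤s; s≤s⁻¹)
open import Data.Nat.Induction using (<-rec)
open import Data.Nat.ListAction using () renaming (sum to sumˡ)
open import Data.Nat.ListAction.Properties using (sum-↭)
import Data.Nat.Properties as ℕ
open import Data.Nat.Solver using () renaming (module +-*-Solver to ℕ-Solver)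
open import Data.Product using (∃; ∃₂; ∃-syntax; Σ-syntax; _×_; _,_; proj₁; proj₂)
import Data.Rational as ℚ
open import Data.Rational using (ℚ; 0ℚ; 1ℚ; ½)
import Data.Rational.Properties as ℚ
open import Data.Rational.Solver using (module +-*-Solver)
import Data.Rational.Unnormalised as ℚᵘ
import Data.Rational.Unnormalised.Properties as ℚᵘ
open import Data.Sum using (_⊎_; inj₁; inj₂; [_,_]′)
import Data.Vec as Vec
open import Data.Vec using (Vec; []; _∷_; tabulate)
open import Data.Vec.Properties using (lookup∘tabulate)
open import Function using (_∘_; id; case_of_)
open import Function.Bundles using (_⇔_; mk⇔; mk↔ₛ′; Inverse)
open import Level using (0ℓ)
open import Relation.Binary using (Rel; IsStrictTotalOrder; Tri; tri<; tri≈; tri>)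
open import Relation.Binary.PropositionalEquality using (_≡_; _≢_; refl; sym; trans; cong; cong₂; subst; subst₂; module ≡-Reasoning) renaming (isEquivalence to ≡-isEquivalence)
import Relation.Binary.Reasoning.Setoid as SetoidReasoning
open import Relation.Binary.Structures.Biased using (isStrictTotalOrderᶜ)
open import Relation.Nullary using (¬_; Dec; yes; no; contradiction; _×-dec_; ¬?)
open import Relation.Nullary.Decidable using (¬¬-excluded-middle; decidable-stable; ⌊_⌋)

-- Rational inequalities

-- No spectral theorem is used. A positive eigenfunction with eigenvalue μ turns the form of Δ₀ - μ
-- into a sum of squares, so μ is the smallest eigenvalue, and equality in the Rayleigh bound forces
-- proportionality along the edges. The relation `_≤λ_` asks for actual eigenvalues with
-- eigenvectors, hence the power iteration, applied to a multiple of the identity minus Δ₀. The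
-- forest bound on N(j,k) comes from the case j = k: with e(j,k) the number of ordered adjacent
-- pairs between two initial segments, 2 e(j,k) ≤ e(j,j) + e(k,k). In the equality case a term δ p δ
-- q N(p,q) carries information only where g drops at both p and q. Only the numbers of edges
-- between whole level sets of g are therefore known for H, and everything finer has to come from
-- the eigenvalue equation on the breadth-first tree. A breadth-first tree S has to be built from
-- the degree sequence beforehand: minimality of G is tested against S, and the goal under the
-- double negation becomes an isomorphism of G with S.

0<½* : ∀ {ε} → 0ℚ ℚ.< ε → 0ℚ ℚ.< ½ ℚ.* ε
0<½* {ε} 0<ε = ℚ.positive⁻¹ (½ ℚ.* ε) {{ℚ.pos*pos⇒pos ½ ε {{ℚ.positive 0<ε}}}}

½+½ : ∀ ε → ½ ℚ.* ε ℚ.+ ½ ℚ.* ε ≡ ε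
½+½ ε = trans (sym (ℚ.*-distribʳ-+ ε ½ ½)) (ℚ.*-identityˡ ε)

p≤∣p∣ : ∀ p → p ℚ.≤ ℚ.∣ p ∣
p≤∣p∣ p with ℚ.≤-total 0ℚ p
... | inj₁ 0≤p = ℚ.≤-reflexive (sym (ℚ.0≤p⇒∣p∣≡p 0≤p))
... | inj₂ p≤0 = ℚ.≤-trans p≤0 (ℚ.0≤∣p∣ p)

-p≤∣p∣ : ∀ p → ℚ.- p ℚ.≤ ℚ.∣ p ∣
-p≤∣p∣ p = subst (ℚ.- p ℚ.≤_) (ℚ.∣-p∣≡∣p∣ p) (p≤∣p∣ (ℚ.- p))

∣∣<-intro : ∀ {p ε} → p ℚ.< ε → ℚ.- p ℚ.< ε → ℚ.∣ p ∣ ℚ.< ε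
∣∣<-intro {p} p<ε -p<ε with ℚ.∣p∣≡p∨∣p∣≡-p p
... | inj₁ eq = subst (ℚ._< _) (sym eq) p<ε
... | inj₂ eq = subst (ℚ._< _) (sym eq) -p<ε

∣∣≤-intro : ∀ {p ε} → p ℚ.≤ ε → ℚ.- p ℚ.≤ ε → ℚ.∣ p ∣ ℚ.≤ ε
∣∣≤-intro {p} p≤ε -p≤ε with ℚ.∣p∣≡p∨∣p∣≡-p p
... | inj₁ eq = subst (ℚ._≤ _) (sym eq) p≤ε
... | inj₂ eq = subst (ℚ._≤ _) (sym eq) -p≤ε

∣-∣-swap : ∀ p q → ℚ.∣ p ℚ.- q ∣ ≡ ℚ.∣ q ℚ.- p ∣
∣-∣-swap p q = trans (cong ℚ.∣_∣ (solve 2 (λ p q → p :- q := :- (q :- p)) refl p q)) (ℚ.∣-p∣≡∣p∣ (q ℚ.- p))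
  where open +-*-Solver

∣-∣-triangle : ∀ p q r → ℚ.∣ p ℚ.- r ∣ ℚ.≤ ℚ.∣ p ℚ.- q ∣ ℚ.+ ℚ.∣ q ℚ.- r ∣
∣-∣-triangle p q r = subst (λ z → ℚ.∣ z ∣ ℚ.≤ ℚ.∣ p ℚ.- q ∣ ℚ.+ ℚ.∣ q ℚ.- r ∣)
  (solve 3 (λ p q r → (p :- q) :+ (q :- r) := p :- r) refl p q r)
  (ℚ.∣p+q∣≤∣p∣+∣q∣ (p ℚ.- q) (q ℚ.- r))
  where open +-*-Solver

-ᵣ+ᵣ : ∀ p q → p ≡ q ℚ.+ (p ℚ.- q)
-ᵣ+ᵣ = solve 2 (λ p q → p := q :+ (p :- q)) refl
  where open +-*-Solver

p-q<r⇒p<q+r : ∀ {p q r} → p ℚ.- q ℚ.< r → p ℚ.< q ℚ.+ r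
p-q<r⇒p<q+r {p} {q} {r} lt = subst (ℚ._< q ℚ.+ r) (sym (-ᵣ+ᵣ p q)) (ℚ.+-monoʳ-< q lt)

p<q+r⇒p-q<r : ∀ {p q r} → p ℚ.< q ℚ.+ r → p ℚ.- q ℚ.< r
p<q+r⇒p-q<r {p} {q} {r} lt = subst (p ℚ.- q ℚ.<_)
  (solve 2 (λ q r → q :+ r :- q := r) refl q r) (ℚ.+-monoˡ-< (ℚ.- q) lt)
  where open +-*-Solver

p≤q⇒0≤q-p : ∀ {p q} → p ℚ.≤ q → 0ℚ ℚ.≤ q ℚ.- p
p≤q⇒0≤q-p {p} {q} le = subst (ℚ._≤ q ℚ.- p) (ℚ.+-inverseʳ p) (ℚ.+-monoˡ-≤ (ℚ.- p) le)

0≤q-p⇒p≤q : ∀ {p q} → 0ℚ ℚ.≤ q ℚ.- p → p ℚ.≤ q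
0≤q-p⇒p≤q {p} {q} le = subst₂ ℚ._≤_ (ℚ.+-identityʳ p) (sym (-ᵣ+ᵣ q p)) (ℚ.+-monoʳ-≤ p le)

0≤-* : ∀ {p q} → 0ℚ ℚ.≤ p → 0ℚ ℚ.≤ q → 0ℚ ℚ.≤ p ℚ.* q
0≤-* {p} {q} 0≤p 0≤q = ℚ.nonNegative⁻¹ (p ℚ.* q)
  {{ℚ.nonNeg*nonNeg⇒nonNeg p {{ℚ.nonNegative 0≤p}} q {{ℚ.nonNegative 0≤q}}}}

0≤-+ : ∀ {p q} → 0ℚ ℚ.≤ p → 0ℚ ℚ.≤ q → 0ℚ ℚ.≤ p ℚ.+ q
0≤-+ = ℚ.+-mono-≤

0<-* : ∀ {p q} → 0ℚ ℚ.< p → 0ℚ ℚ.< q → 0ℚ ℚ.< p ℚ.* q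
0<-* {p} {q} 0<p 0<q = ℚ.positive⁻¹ (p ℚ.* q)
  {{ℚ.pos*pos⇒pos p {{ℚ.positive 0<p}} q {{ℚ.positive 0<q}}}}

*-monoʳ-≤ : ∀ {p q} r → 0ℚ ℚ.≤ r → p ℚ.≤ q → r ℚ.* p ℚ.≤ r ℚ.* q
*-monoʳ-≤ r 0≤r = ℚ.*-monoˡ-≤-nonNeg r {{ℚ.nonNegative 0≤r}}

*-mono-≤ : ∀ {p q r s} → 0ℚ ℚ.≤ p → 0ℚ ℚ.≤ s → p ℚ.≤ q → r ℚ.≤ s → p ℚ.* r ℚ.≤ q ℚ.* s
*-mono-≤ {p} {q} {r} {s} 0≤p 0≤s p≤q r≤s =
  ℚ.≤-trans (*-monoʳ-≤ p 0≤p r≤s) (ℚ.*-monoʳ-≤-nonNeg s {{ℚ.nonNegative 0≤s}} p≤q)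

0≤p*p : ∀ p → 0ℚ ℚ.≤ p ℚ.* p
0≤p*p p = subst (0ℚ ℚ.≤_) (∣p∣²≡p² (ℚ.∣p∣≡p∨∣p∣≡-p p)) (0≤-* (ℚ.0≤∣p∣ p) (ℚ.0≤∣p∣ p))
  where
  open +-*-Solver
  ∣p∣²≡p² : ∀ {p q} → q ≡ p ⊎ q ≡ ℚ.- p → q ℚ.* q ≡ p ℚ.* p
  ∣p∣²≡p² (inj₁ refl) = refl
  ∣p∣²≡p² {p} (inj₂ refl) = solve 1 (λ p → (:- p) :* (:- p) := p :* p) refl p

module _ {p : ℚ} (0<p : 0ℚ ℚ.< p) where
  private
    p-pos : ℚ.Positive p
    p-pos = ℚ.positive 0<p

  inv : ℚ
  inv = (ℚ.1/ p) {{ℚ.pos⇒nonZero p {{p-pos}}}}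

  *-inv : p ℚ.* inv ≡ 1ℚ
  *-inv = ℚ.*-inverseʳ p {{ℚ.pos⇒nonZero p {{p-pos}}}}

  0<inv : 0ℚ ℚ.< inv
  0<inv = ℚ.positive⁻¹ inv {{ℚ.1/pos⇒pos p {{p-pos}}}}

  *-*-inv : ∀ q → p ℚ.* (inv ℚ.* q) ≡ q
  *-*-inv q = trans (sym (ℚ.*-assoc p inv q)) (trans (cong (ℚ._* q) *-inv) (ℚ.*-identityˡ q))

-- The ordered ring of Cauchy reals

infix  8 -ᴰ_

-ᴰ_ : ℝ → ℝ
-ᴰ x = mkℝ (λ n → ℚ.- seq x n) λ ε 0<ε →
  let (N , p) = cauchy x ε 0<ε in N , λ m n N≤m N≤n →
    subst (ℚ._< ε) (trans (∣-∣-swap (seq x m) (seq x n)) (cong ℚ.∣_∣ (lemma (seq x n) (seq x m)))) (p m n N≤m N≤n)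
  where
  open +-*-Solver
  lemma : ∀ a b → a ℚ.- b ≡ (ℚ.- b) ℚ.- (ℚ.- a)
  lemma = solve 2 (λ a b → a :- b := (:- b) :- (:- a)) refl

1ℝ : ℝ
1ℝ = fromℚ 1ℚ

eventually : ∀ {P Q : ℕ → Set} → ∃[ N ] (∀ n → N ≤ n → P n) → ∃[ N ] (∀ n → N ≤ n → Q n) →
             ∃[ N ] (∀ n → N ≤ n → P n × Q n)
eventually (M , p) (N , q) = M ⊔ N , λ n le →
  p n (ℕ.m⊔n≤o⇒m≤o M N le) , q n (ℕ.m⊔n≤o⇒n≤o M N le)

eventually-map : ∀ {P Q : ℕ → Set} → (∀ n → P n → Q n) → ∃[ N ] (∀ n → N ≤ n → P n) → ∃[ N ] (∀ n → N ≤ n → Q n)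
eventually-map f (N , p) = N , λ n le → f n (p n le)

pointwise-≈ᴰ : ∀ {x y} → (∀ n → seq x n ≡ seq y n) → x ≈ᴰ y
pointwise-≈ᴰ {x} {y} eq ε 0<ε = 0 , λ n _ →
  subst (ℚ._< ε) (sym (cong ℚ.∣_∣ (trans (cong (ℚ._- seq y n) (eq n)) (ℚ.+-inverseʳ (seq y n))))) 0<ε

≈ᴰ-refl : ∀ {x} → x ≈ᴰ x
≈ᴰ-refl {x} = pointwise-≈ᴰ {x} {x} λ _ → refl

≈ᴰ-sym : ∀ {x y} → x ≈ᴰ y → y ≈ᴰ x
≈ᴰ-sym {x} {y} p ε 0<ε = eventually-map (λ n → subst (ℚ._< ε) (∣-∣-swap (seq x n) (seq y n))) (p ε 0<ε)

≈ᴰ-trans : ∀ {x y z} → x ≈ᴰ y → y ≈ᴰ z → x ≈ᴰ z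
≈ᴰ-trans {x} {y} {z} p q ε 0<ε = eventually-map
  (λ n (a , b) → ℚ.≤-<-trans (∣-∣-triangle (seq x n) (seq y n) (seq z n))
     (subst (_ ℚ.<_) (½+½ ε) (ℚ.+-mono-< a b)))
  (eventually (p (½ ℚ.* ε) (0<½* 0<ε)) (q (½ ℚ.* ε) (0<½* 0<ε)))

+ᴰ-cong : ∀ {x x′ y y′} → x ≈ᴰ x′ → y ≈ᴰ y′ → x +ᴰ y ≈ᴰ x′ +ᴰ y′
+ᴰ-cong {x} {x′} {y} {y′} p q ε 0<ε = eventually-map
  (λ n (a , b) → subst (λ z → ℚ.∣ z ∣ ℚ.< ε)
     (solve 4 (λ a b c d → (a :- c) :+ (b :- d) := (a :+ b) :- (c :+ d)) refl (seq x n) (seq y n) (seq x′ n) (seq y′ n))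
     (ℚ.≤-<-trans (ℚ.∣p+q∣≤∣p∣+∣q∣ (seq x n ℚ.- seq x′ n) (seq y n ℚ.- seq y′ n))
       (subst (_ ℚ.<_) (½+½ ε) (ℚ.+-mono-< a b))))
  (eventually (p (½ ℚ.* ε) (0<½* 0<ε)) (q (½ ℚ.* ε) (0<½* 0<ε)))
  where open +-*-Solver

-ᴰ-cong : ∀ {x y} → x ≈ᴰ y → -ᴰ x ≈ᴰ -ᴰ y
-ᴰ-cong {x} {y} p ε 0<ε = eventually-map
  (λ n → subst (ℚ._< ε) (trans (∣-∣-swap (seq x n) (seq y n)) (cong ℚ.∣_∣
     (solve 2 (λ a b → b :- a := (:- a) :- (:- b)) refl (seq x n) (seq y n)))))
  (p ε 0<ε)
  where open +-*-Solver

cauchy-bounded : ∀ x → ∃[ B ] (0ℚ ℚ.< B × ∃[ N ] (∀ n → N ≤ n → ℚ.∣ seq x n ∣ ℚ.≤ B))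
cauchy-bounded x with cauchy x 1ℚ (ℚ.positive⁻¹ 1ℚ)
... | N , close = 1ℚ ℚ.+ ℚ.∣ seq x N ∣
    , ℚ.+-mono-<-≤ (ℚ.positive⁻¹ 1ℚ) (ℚ.0≤∣p∣ (seq x N))
    , N , λ n N≤n → ℚ.≤-trans
        (subst (λ z → ℚ.∣ z ∣ ℚ.≤ ℚ.∣ seq x n ℚ.- seq x N ∣ ℚ.+ ℚ.∣ seq x N ∣)
          (solve 2 (λ a b → (a :- b) :+ b := a) refl (seq x n) (seq x N))
          (ℚ.∣p+q∣≤∣p∣+∣q∣ (seq x n ℚ.- seq x N) (seq x N)))
        (ℚ.+-monoˡ-≤ ℚ.∣ seq x N ∣ (ℚ.<⇒≤ (close n N N≤n ℕ.≤-refl)))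
  where open +-*-Solver

*-small : ∀ (s y z : ℕ → ℚ) → ∃[ B ] (0ℚ ℚ.< B × ∃[ N ] (∀ n → N ≤ n → ℚ.∣ s n ∣ ℚ.≤ B)) →
  (∀ ε → 0ℚ ℚ.< ε → ∃[ N ] (∀ n → N ≤ n → ℚ.∣ y n ℚ.- z n ∣ ℚ.< ε)) →
  ∀ ε → 0ℚ ℚ.< ε → ∃[ N ] (∀ n → N ≤ n → ℚ.∣ s n ℚ.* y n ℚ.- s n ℚ.* z n ∣ ℚ.< ε)
*-small s y z (B , 0<B , s≤B) p ε 0<ε = eventually-map
  (λ n (a , b) → subst (λ w → ℚ.∣ w ∣ ℚ.< ε) (lemma (s n) (y n) (z n))
     (subst₂ ℚ._<_ (sym (ℚ.∣p*q∣≡∣p∣*∣q∣ (s n) (y n ℚ.- z n))) (*-*-inv 0<B ε)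
       (ℚ.≤-<-trans (ℚ.*-monoʳ-≤-nonNeg _ {{ℚ.nonNegative (ℚ.0≤∣p∣ (y n ℚ.- z n))}} a)
         (ℚ.*-monoʳ-<-pos B {{ℚ.positive 0<B}} b))))
  (eventually s≤B (p (inv 0<B ℚ.* ε) (0<-* (0<inv 0<B) 0<ε)))
  where
  open +-*-Solver
  lemma : ∀ x y z → x ℚ.* (y ℚ.- z) ≡ x ℚ.* y ℚ.- x ℚ.* z
  lemma = solve 3 (λ x y z → x :* (y :- z) := x :* y :- x :* z) refl

*ᴰ-congˡ : ∀ {x y z} → y ≈ᴰ z → x *ᴰ y ≈ᴰ x *ᴰ z
*ᴰ-congˡ {x} {y} {z} = *-small (seq x) (seq y) (seq z) (cauchy-bounded x)

*ᴰ-comm : ∀ x y → x *ᴰ y ≈ᴰ y *ᴰ x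
*ᴰ-comm x y = pointwise-≈ᴰ {x *ᴰ y} {y *ᴰ x} λ n → ℚ.*-comm (seq x n) (seq y n)

*ᴰ-cong : ∀ {x x′ y y′} → x ≈ᴰ x′ → y ≈ᴰ y′ → x *ᴰ y ≈ᴰ x′ *ᴰ y′
*ᴰ-cong {x} {x′} {y} {y′} p q =
  ≈ᴰ-trans {x *ᴰ y} {x *ᴰ y′} {x′ *ᴰ y′} (*ᴰ-congˡ {x} {y} {y′} q)
  (≈ᴰ-trans {x *ᴰ y′} {y′ *ᴰ x} {x′ *ᴰ y′} (*ᴰ-comm x y′)
  (≈ᴰ-trans {y′ *ᴰ x} {y′ *ᴰ x′} {x′ *ᴰ y′} (*ᴰ-congˡ {y′} {x} {x′} p) (*ᴰ-comm y′ x′)))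

opaque
  infixl 6 _+ʳ_
  infixl 7 _*ʳ_
  infix  8 -ʳ_
  infix  4 _≈_ _≤ʳ_

  -- Sealed copies of the operations and relations. The originals unfold to statements about
  -- sequences of rationals, from which the reals involved cannot be inferred.
  _+ʳ_ _*ʳ_ : ℝ → ℝ → ℝ
  x +ʳ y = x +ᴰ y
  x *ʳ y = x *ᴰ y

  -ʳ_ : ℝ → ℝ
  -ʳ x = -ᴰ x

  _≈_ _≤ʳ_ : ℝ → ℝ → Set
  x ≈ y = x ≈ᴰ y
  x ≤ʳ y = x ≤ᴰ y

infixl 6 _-ʳ_

_-ʳ_ : ℝ → ℝ → ℝ
x -ʳ y = x +ʳ (-ʳ y)

opaque
  unfolding _+ʳ_

  ≈-refl : ∀ {x} → x ≈ x
  ≈-refl {x} = ≈ᴰ-refl {x}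

  ≈-sym : ∀ {x y} → x ≈ y → y ≈ x
  ≈-sym {x} {y} = ≈ᴰ-sym {x} {y}

  ≈-trans : ∀ {x y z} → x ≈ y → y ≈ z → x ≈ z
  ≈-trans {x} {y} {z} = ≈ᴰ-trans {x} {y} {z}

  +ʳ-cong : ∀ {x x′ y y′} → x ≈ x′ → y ≈ y′ → x +ʳ y ≈ x′ +ʳ y′
  +ʳ-cong {x} {x′} {y} {y′} = +ᴰ-cong {x} {x′} {y} {y′}

  *ʳ-cong : ∀ {x x′ y y′} → x ≈ x′ → y ≈ y′ → x *ʳ y ≈ x′ *ʳ y′
  *ʳ-cong {x} {x′} {y} {y′} = *ᴰ-cong {x} {x′} {y} {y′}

  -ʳ-cong : ∀ {x y} → x ≈ y → -ʳ x ≈ -ʳ y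
  -ʳ-cong {x} {y} = -ᴰ-cong {x} {y}

  pointwise-≈ : ∀ {x y} → (∀ n → seq x n ≡ seq y n) → x ≈ y
  pointwise-≈ {x} {y} = pointwise-≈ᴰ {x} {y}

  seq-+ : ∀ x y n → seq (x +ʳ y) n ≡ seq x n ℚ.+ seq y n
  seq-+ x y n = refl

  seq-* : ∀ x y n → seq (x *ʳ y) n ≡ seq x n ℚ.* seq y n
  seq-* x y n = refl

  seq-neg : ∀ x n → seq (-ʳ x) n ≡ ℚ.- seq x n
  seq-neg x n = refl

  +ʳ-assoc : ∀ x y z → x +ʳ y +ʳ z ≈ x +ʳ (y +ʳ z)
  +ʳ-assoc x y z = pointwise-≈ {x +ʳ y +ʳ z} {x +ʳ (y +ʳ z)} λ n → ℚ.+-assoc (seq x n) (seq y n) (seq z n)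

  +ʳ-comm : ∀ x y → x +ʳ y ≈ y +ʳ x
  +ʳ-comm x y = pointwise-≈ {x +ʳ y} {y +ʳ x} λ n → ℚ.+-comm (seq x n) (seq y n)

  +ʳ-identityˡ : ∀ x → 0ℝ +ʳ x ≈ x
  +ʳ-identityˡ x = pointwise-≈ {0ℝ +ʳ x} {x} λ n → ℚ.+-identityˡ (seq x n)

  +ʳ-identityʳ : ∀ x → x +ʳ 0ℝ ≈ x
  +ʳ-identityʳ x = pointwise-≈ {x +ʳ 0ℝ} {x} λ n → ℚ.+-identityʳ (seq x n)

  +ʳ-inverseˡ : ∀ x → (-ʳ x) +ʳ x ≈ 0ℝ
  +ʳ-inverseˡ x = pointwise-≈ {(-ʳ x) +ʳ x} {0ℝ} λ n → ℚ.+-inverseˡ (seq x n)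

  +ʳ-inverseʳ : ∀ x → x +ʳ (-ʳ x) ≈ 0ℝ
  +ʳ-inverseʳ x = pointwise-≈ {x +ʳ (-ʳ x)} {0ℝ} λ n → ℚ.+-inverseʳ (seq x n)

  *ʳ-assoc : ∀ x y z → x *ʳ y *ʳ z ≈ x *ʳ (y *ʳ z)
  *ʳ-assoc x y z = pointwise-≈ {x *ʳ y *ʳ z} {x *ʳ (y *ʳ z)} λ n → ℚ.*-assoc (seq x n) (seq y n) (seq z n)

  *ʳ-comm : ∀ x y → x *ʳ y ≈ y *ʳ x
  *ʳ-comm x y = pointwise-≈ {x *ʳ y} {y *ʳ x} λ n → ℚ.*-comm (seq x n) (seq y n)

  *ʳ-identityˡ : ∀ x → 1ℝ *ʳ x ≈ x
  *ʳ-identityˡ x = pointwise-≈ {1ℝ *ʳ x} {x} λ n → ℚ.*-identityˡ (seq x n)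

  *ʳ-identityʳ : ∀ x → x *ʳ 1ℝ ≈ x
  *ʳ-identityʳ x = pointwise-≈ {x *ʳ 1ℝ} {x} λ n → ℚ.*-identityʳ (seq x n)

  *ʳ-distribˡ : ∀ x y z → x *ʳ (y +ʳ z) ≈ x *ʳ y +ʳ x *ʳ z
  *ʳ-distribˡ x y z = pointwise-≈ {x *ʳ (y +ʳ z)} {x *ʳ y +ʳ x *ʳ z} λ n → ℚ.*-distribˡ-+ (seq x n) (seq y n) (seq z n)

  *ʳ-distribʳ : ∀ x y z → (y +ʳ z) *ʳ x ≈ y *ʳ x +ʳ z *ʳ x
  *ʳ-distribʳ x y z = pointwise-≈ {(y +ʳ z) *ʳ x} {y *ʳ x +ʳ z *ʳ x} λ n → ℚ.*-distribʳ-+ (seq x n) (seq y n) (seq z n)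

ℝ-commutativeRing : CommutativeRing 0ℓ 0ℓ
ℝ-commutativeRing = record
  { Carrier = ℝ ; _≈_ = _≈_ ; _+_ = _+ʳ_ ; _*_ = _*ʳ_ ; -_ = -ʳ_ ; 0# = 0ℝ ; 1# = 1ℝ
  ; isCommutativeRing = record
    { isRing = record
      { +-isAbelianGroup = record
        { isGroup = record
          { isMonoid = record
            { isSemigroup = record
              { isMagma = record
                { isEquivalence = record { refl = ≈-refl ; sym = ≈-sym ; trans = ≈-trans }
                ; ∙-cong = +ʳ-cong }
              ; assoc = +ʳ-assoc }
            ; identity = +ʳ-identityˡ , +ʳ-identityʳ }
          ; inverse = +ʳ-inverseˡ , +ʳ-inverseʳ
          ; ⁻¹-cong = -ʳ-cong }
        ; comm = +ʳ-comm }
      ; *-cong = *ʳ-cong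
      ; *-assoc = *ʳ-assoc
      ; *-identity = *ʳ-identityˡ , *ʳ-identityʳ
      ; distrib = *ʳ-distribˡ , *ʳ-distribʳ }
    ; *-comm = *ʳ-comm } }

module ℝR = CommutativeRing ℝ-commutativeRing

fromℚ-morphism : CommutativeRing.rawRing ℚ.+-*-commutativeRing -Raw-AlmostCommutative⟶ fromCommutativeRing ℝ-commutativeRing
fromℚ-morphism = record
  { ⟦_⟧ = fromℚ
  ; +-homo = λ p q → pointwise-≈ λ n → sym (seq-+ (fromℚ p) (fromℚ q) n)
  ; *-homo = λ p q → pointwise-≈ λ n → sym (seq-* (fromℚ p) (fromℚ q) n)
  ; -‿homo = λ p → pointwise-≈ λ n → sym (seq-neg (fromℚ p) n)
  ; 0-homo = ≈-refl
  ; 1-homo = ≈-refl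
  }

fromℚ-≟ : ∀ p q → Maybe (fromℚ p ≈ fromℚ q)
fromℚ-≟ p q with p ℚ.≟ q
... | yes refl = just ≈-refl
... | no _ = nothing

module ℝ-Solver = Algebra.Solver.Ring (CommutativeRing.rawRing ℚ.+-*-commutativeRing)
  (fromCommutativeRing ℝ-commutativeRing) fromℚ-morphism fromℚ-≟

-- The order of the Cauchy reals

opaque
  unfolding _+ʳ_

  -- Strict positivity with a rational witness. By the next two lemmas `0ℝ ≤ʳ x` is the negation of
  -- `Pos (-ʳ x)`; the order is thus stable under double negation, which admits undecidable case
  -- distinctions in proofs of inequalities.
  Pos : ℝ → Set
  Pos x = ∃[ ε ] (0ℚ ℚ.< ε × ∃[ N ] (∀ n → N ≤ n → ε ℚ.≤ seq x n))

  -- Rationals can be compared: if some term beyond the modulus for ε/2 were at most -ε, all later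
  -- terms would be at most -ε/2, a witness of `Pos (-ʳ x)`.
  ¬Pos-⇒0≤ : ∀ {x} → ¬ Pos (-ʳ x) → 0ℝ ≤ʳ x
  ¬Pos-⇒0≤ {x} ¬pos ε 0<ε =
    let δ = ½ ℚ.* ε
        0<δ = 0<½* 0<ε
        N , close = cauchy x δ 0<δ
    in N , λ n N≤n → case ε ℚ.≤? ℚ.- seq x n of λ where
      (no ≰) → subst (ℚ._< seq x n ℚ.+ ε) (ℚ.+-inverseʳ (seq x n)) (ℚ.+-monoʳ-< (seq x n) (ℚ.≰⇒> ≰))
      (yes ε≤-xₙ) → ⊥-elim (¬pos (δ , 0<δ , N , λ m N≤m →
        0≤q-p⇒p≤q (subst (0ℚ ℚ.≤_)
          (trans (sum³ (ℚ.- seq x n) ε δ (seq x n ℚ.- seq x m)) (cong₂ ℚ._-_ (cancel (seq x n) (seq x m)) (half ε)))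
          (0≤-+ (p≤q⇒0≤q-p ε≤-xₙ) (p≤q⇒0≤q-p {ℚ.- (seq x n ℚ.- seq x m)} {δ} (ℚ.≤-trans (-p≤∣p∣ _) (ℚ.<⇒≤ (close n m N≤n N≤m))))))))
    where
    open +-*-Solver
    sum³ : ∀ a e d b → (a ℚ.- e) ℚ.+ (d ℚ.- (ℚ.- b)) ≡ (a ℚ.+ b) ℚ.- (e ℚ.- d)
    sum³ = solve 4 (λ a e d b → (a :- e) :+ (d :- (:- b)) := (a :+ b) :- (e :- d)) refl
    cancel : ∀ a b → (ℚ.- a) ℚ.+ (a ℚ.- b) ≡ ℚ.- b
    cancel = solve 2 (λ a b → (:- a) :+ (a :- b) := :- b) refl
    half : ∀ e → e ℚ.- ½ ℚ.* e ≡ ½ ℚ.* e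
    half = solve 1 (λ e → e :- con ½ :* e := con ½ :* e) refl

  0≤⇒¬Pos- : ∀ {x} → 0ℝ ≤ʳ x → ¬ Pos (-ʳ x)
  0≤⇒¬Pos- {x} 0≤x (ε , 0<ε , N , ε≤) with 0≤x ε 0<ε
  ... | M , 0<x+ε = ℚ.<-irrefl refl
    (ℚ.<-≤-trans (p<q+r⇒p-q<r {0ℚ} {seq x n} {ε} (0<x+ε n (ℕ.m≤m⊔n M N)))
      (subst (ε ℚ.≤_) (sym (ℚ.+-identityˡ _)) (ε≤ n (ℕ.m≤n⊔m M N))))
    where
    n : ℕ
    n = M ⊔ N

  0≤-resp-≈ : ∀ {x y} → x ≈ y → 0ℝ ≤ʳ x → 0ℝ ≤ʳ y
  0≤-resp-≈ {x} {y} x≈y 0≤x ε 0<ε = eventually-map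
    (λ n (a , b) → ℚ.<-trans a (subst (seq x n ℚ.+ ½ ℚ.* ε ℚ.<_) (assoc½ (seq y n))
      (ℚ.+-monoˡ-< (½ ℚ.* ε) (p-q<r⇒p<q+r {seq x n} {seq y n} (ℚ.≤-<-trans (p≤∣p∣ _) b)))))
    (eventually (0≤x (½ ℚ.* ε) (0<½* 0<ε)) (x≈y (½ ℚ.* ε) (0<½* 0<ε)))
    where
    assoc½ : ∀ a → a ℚ.+ ½ ℚ.* ε ℚ.+ ½ ℚ.* ε ≡ a ℚ.+ ε
    assoc½ a = trans (ℚ.+-assoc a _ _) (cong (a ℚ.+_) (½+½ ε))

  0≤ʳ-+ : ∀ {x y} → 0ℝ ≤ʳ x → 0ℝ ≤ʳ y → 0ℝ ≤ʳ x +ʳ y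
  0≤ʳ-+ {x} {y} p q ε 0<ε = eventually-map
    (λ n (a , b) → subst (0ℚ ℚ.<_) (trans (lemma (seq x n) (seq y n) (½ ℚ.* ε)) (cong (seq x n ℚ.+ seq y n ℚ.+_) (½+½ ε))) (ℚ.+-mono-< a b))
    (eventually (p (½ ℚ.* ε) (0<½* 0<ε)) (q (½ ℚ.* ε) (0<½* 0<ε)))
    where
    open +-*-Solver
    lemma : ∀ a b e → (a ℚ.+ e) ℚ.+ (b ℚ.+ e) ≡ (a ℚ.+ b) ℚ.+ (e ℚ.+ e)
    lemma = solve 3 (λ a b e → (a :+ e) :+ (b :+ e) := (a :+ b) :+ (e :+ e)) refl

  0≤∧0≤-⇒≈0 : ∀ {x} → 0ℝ ≤ʳ x → 0ℝ ≤ʳ -ʳ x → x ≈ 0ℝ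
  0≤∧0≤-⇒≈0 {x} p q ε 0<ε = eventually-map
    (λ n (a , b) → ∣∣<-intro
      (subst (ℚ._< ε) (neg-neg (seq x n)) (p<q+r⇒p-q<r {0ℚ} {ℚ.- seq x n} b))
      (subst (ℚ._< ε) (neg (seq x n)) (p<q+r⇒p-q<r {0ℚ} {seq x n} a)))
    (eventually (p ε 0<ε) (q ε 0<ε))
    where
    open +-*-Solver
    neg-neg : ∀ a → 0ℚ ℚ.- (ℚ.- a) ≡ a ℚ.- 0ℚ
    neg-neg = solve 1 (λ a → con 0ℚ :- (:- a) := a :- con 0ℚ) refl
    neg : ∀ a → 0ℚ ℚ.- a ≡ ℚ.- (a ℚ.- 0ℚ)
    neg = solve 1 (λ a → con 0ℚ :- a := :- (a :- con 0ℚ)) refl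

  ≤⇒0≤- : ∀ {x y} → x ≤ʳ y → 0ℝ ≤ʳ y -ʳ x
  ≤⇒0≤- {x} {y} p ε 0<ε = eventually-map
    (λ n a → subst₂ ℚ._<_ (ℚ.+-inverseʳ (seq x n)) (lemma (seq y n) ε (seq x n)) (ℚ.+-monoˡ-< (ℚ.- seq x n) a))
    (p ε 0<ε)
    where
    open +-*-Solver
    lemma : ∀ a e b → a ℚ.+ e ℚ.- b ≡ a ℚ.- b ℚ.+ e
    lemma = solve 3 (λ a e b → a :+ e :- b := a :- b :+ e) refl

  0≤-⇒≤ : ∀ {x y} → 0ℝ ≤ʳ y -ʳ x → x ≤ʳ y
  0≤-⇒≤ {x} {y} p ε 0<ε = eventually-map
    (λ n a → subst₂ ℚ._<_ (ℚ.+-identityʳ (seq x n)) (lemma (seq y n) ε (seq x n)) (ℚ.+-monoʳ-< (seq x n) a))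
    (p ε 0<ε)
    where
    open +-*-Solver
    lemma : ∀ a e b → b ℚ.+ (a ℚ.- b ℚ.+ e) ≡ a ℚ.+ e
    lemma = solve 3 (λ a e b → b :+ (a :- b :+ e) := a :+ e) refl

  Pos-resp-≈ : ∀ {x y} → x ≈ y → Pos x → Pos y
  Pos-resp-≈ {x} {y} x≈y (ε , 0<ε , p) = ½ ℚ.* ε , 0<½* 0<ε , eventually-map
    (λ n (a , b) → 0≤q-p⇒p≤q (subst (0ℚ ℚ.≤_) (lemma (seq x n) (seq y n) ε)
      (0≤-+ (p≤q⇒0≤q-p a) (p≤q⇒0≤q-p (ℚ.≤-trans (p≤∣p∣ _) (ℚ.<⇒≤ b))))))
    (eventually p (x≈y (½ ℚ.* ε) (0<½* 0<ε)))
    where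
    open +-*-Solver
    lemma : ∀ a b e → (a ℚ.- e) ℚ.+ (½ ℚ.* e ℚ.- (a ℚ.- b)) ≡ b ℚ.- ½ ℚ.* e
    lemma = solve 3 (λ a b e → (a :- e) :+ (con ½ :* e :- (a :- b)) := b :- con ½ :* e) refl

  Pos-* : ∀ {x y} → Pos x → Pos y → Pos (x *ʳ y)
  Pos-* (ε , 0<ε , p) (δ , 0<δ , q) = ε ℚ.* δ , 0<-* 0<ε 0<δ , eventually-map
    (λ n (a , b) → *-mono-≤ (ℚ.<⇒≤ 0<ε) (ℚ.≤-trans (ℚ.<⇒≤ 0<δ) b) a b)
    (eventually p q)

  Pos-fromℚ : ∀ {q} → 0ℚ ℚ.< q → Pos (fromℚ q)
  Pos-fromℚ {q} 0<q = q , 0<q , 0 , λ _ _ → ℚ.≤-refl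

  0≤-pointwise : ∀ {x} → (∀ n → 0ℚ ℚ.≤ seq x n) → 0ℝ ≤ʳ x
  0≤-pointwise {x} p ε 0<ε = 0 , λ n _ → ℚ.+-mono-≤-< (p n) 0<ε

  0≤x² : ∀ x → 0ℝ ≤ʳ x *ʳ x
  0≤x² x = 0≤-pointwise {x *ʳ x} λ n → 0≤p*p (seq x n)

  ≈ᴰ⇒≈ : ∀ {x y} → x ≈ᴰ y → x ≈ y
  ≈ᴰ⇒≈ p = p

  ≈⇒≈ᴰ : ∀ {x y} → x ≈ y → x ≈ᴰ y
  ≈⇒≈ᴰ p = p

  ≤ᴰ⇒≤ʳ : ∀ {x y} → x ≤ᴰ y → x ≤ʳ y
  ≤ᴰ⇒≤ʳ p = p

  ≤ʳ⇒≤ᴰ : ∀ {x y} → x ≤ʳ y → x ≤ᴰ y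
  ≤ʳ⇒≤ᴰ p = p

module ≈-Reasoning = SetoidReasoning ℝR.setoid

module _ where
  open ≈-Reasoning
  open ℝ-Solver

  -ʳ-involutive : ∀ x → -ʳ (-ʳ x) ≈ x
  -ʳ-involutive = solve 1 (λ x → :- (:- x) := x) ≈-refl

  0≤-stable : ∀ {x} → ¬ ¬ (0ℝ ≤ʳ x) → 0ℝ ≤ʳ x
  0≤-stable nn = ¬Pos-⇒0≤ λ p → nn λ q → 0≤⇒¬Pos- q p

  ≤ʳ-stable : ∀ {x y} → ¬ ¬ (x ≤ʳ y) → x ≤ʳ y
  ≤ʳ-stable nn = 0≤-⇒≤ (0≤-stable λ k → nn λ p → k (≤⇒0≤- p))

  ≈-⇒-≈0 : ∀ {x y} → x ≈ y → x -ʳ y ≈ 0ℝ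
  ≈-⇒-≈0 {x} {y} p = ≈-trans (+ʳ-cong p ≈-refl) (+ʳ-inverseʳ y)

  -≈0⇒≈ : ∀ {x y} → x -ʳ y ≈ 0ℝ → x ≈ y
  -≈0⇒≈ {x} {y} p = begin
    x              ≈⟨ solve 2 (λ x y → x := (x :- y) :+ y) ≈-refl x y ⟩
    (x -ʳ y) +ʳ y  ≈⟨ +ʳ-cong p ≈-refl ⟩
    0ℝ +ʳ y        ≈⟨ +ʳ-identityˡ y ⟩
    y              ∎

  ≤ʳ-antisym : ∀ {x y} → x ≤ʳ y → y ≤ʳ x → x ≈ y
  ≤ʳ-antisym {x} {y} p q = -≈0⇒≈ (0≤∧0≤-⇒≈0 (≤⇒0≤- q)
    (0≤-resp-≈ (solve 2 (λ x y → y :- x := :- (x :- y)) ≈-refl x y) (≤⇒0≤- p)))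

  0≤0 : 0ℝ ≤ʳ 0ℝ
  0≤0 = 0≤-pointwise λ _ → ℚ.≤-refl

  ≈⇒≤ʳ : ∀ {x y} → x ≈ y → x ≤ʳ y
  ≈⇒≤ʳ p = 0≤-⇒≤ (0≤-resp-≈ (≈-sym (≈-⇒-≈0 (≈-sym p))) 0≤0)

  ≤ʳ-trans : ∀ {x y z} → x ≤ʳ y → y ≤ʳ z → x ≤ʳ z
  ≤ʳ-trans {x} {y} {z} p q = 0≤-⇒≤ (0≤-resp-≈
    (solve 3 (λ x y z → (y :- x) :+ (z :- y) := z :- x) ≈-refl x y z) (0≤ʳ-+ (≤⇒0≤- p) (≤⇒0≤- q)))

  ≤ʳ-resp : ∀ {x x′ y y′} → x ≈ x′ → y ≈ y′ → x ≤ʳ y → x′ ≤ʳ y′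
  ≤ʳ-resp p q le = ≤ʳ-trans (≈⇒≤ʳ (≈-sym p)) (≤ʳ-trans le (≈⇒≤ʳ q))

  ≤ʳ-+-nonneg : ∀ {x y r} → y ≈ x +ʳ r → 0ℝ ≤ʳ r → x ≤ʳ y
  ≤ʳ-+-nonneg {x} {y} {r} p 0≤r = 0≤-⇒≤ (0≤-resp-≈
    (≈-trans (solve 2 (λ x r → r := x :+ r :- x) ≈-refl x r) (+ʳ-cong (≈-sym p) ≈-refl)) 0≤r)

  -- If `-ʳ x` were positive too, so would be its product with `x`, the negative of a square.
  Pos⇒0≤ : ∀ {x} → Pos x → 0ℝ ≤ʳ x
  Pos⇒0≤ {x} p = ¬Pos-⇒0≤ λ q → 0≤⇒¬Pos- {x *ʳ x} (0≤x² x)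
    (Pos-resp-≈ (solve 1 (λ x → x :* (:- x) := :- (x :* x)) ≈-refl x) (Pos-* p q))

  Pos⇒≉0 : ∀ {x} → Pos x → ¬ x ≈ 0ℝ
  Pos⇒≉0 p x≈0 = 0≤⇒¬Pos- 0≤0 (Pos-resp-≈ (≈-trans x≈0 (solve 0 (con 0ℚ := :- con 0ℚ) ≈-refl)) p)

  0≤∧¬Pos⇒≈0 : ∀ {x} → 0ℝ ≤ʳ x → ¬ Pos x → x ≈ 0ℝ
  0≤∧¬Pos⇒≈0 {x} 0≤x ¬p = 0≤∧0≤-⇒≈0 0≤x (¬Pos-⇒0≤ λ q → ¬p (Pos-resp-≈ (-ʳ-involutive x) q))

  *ʳ-zeroˡ : ∀ {x y} → x ≈ 0ℝ → x *ʳ y ≈ 0ℝ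
  *ʳ-zeroˡ {x} {y} p = ≈-trans (*ʳ-cong p ≈-refl) (ℝR.zeroˡ y)

  *ʳ-zeroʳ : ∀ {x y} → y ≈ 0ℝ → x *ʳ y ≈ 0ℝ
  *ʳ-zeroʳ {x} {y} p = ≈-trans (*ʳ-cong ≈-refl p) (ℝR.zeroʳ x)

  -- Under the double negation each factor is positive or zero, which replaces estimates on the
  -- sequences.
  0≤ʳ-* : ∀ {x y} → 0ℝ ≤ʳ x → 0ℝ ≤ʳ y → 0ℝ ≤ʳ x *ʳ y
  0≤ʳ-* {x} {y} 0≤x 0≤y = 0≤-stable λ k →
    ¬¬-excluded-middle {A = Pos x} λ where
      (no ¬px) → k (≈⇒≤ʳ (≈-sym (*ʳ-zeroˡ (0≤∧¬Pos⇒≈0 0≤x ¬px))))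
      (yes px) → ¬¬-excluded-middle {A = Pos y} λ where
        (no ¬py) → k (≈⇒≤ʳ (≈-sym (*ʳ-zeroʳ (0≤∧¬Pos⇒≈0 0≤y ¬py))))
        (yes py) → k (Pos⇒0≤ (Pos-* px py))

  Pos-*-cancel-0≤ : ∀ {x y} → Pos x → 0ℝ ≤ʳ x *ʳ y → 0ℝ ≤ʳ y
  Pos-*-cancel-0≤ {x} {y} px p = ¬Pos-⇒0≤ λ q → 0≤⇒¬Pos- p
    (Pos-resp-≈ (solve 2 (λ x y → x :* (:- y) := :- (x :* y)) ≈-refl x y) (Pos-* px q))

  Pos-*-cancel-≈0 : ∀ {x y} → Pos x → x *ʳ y ≈ 0ℝ → y ≈ 0ℝ
  Pos-*-cancel-≈0 {x} {y} px p = 0≤∧0≤-⇒≈0 (Pos-*-cancel-0≤ px (≈⇒≤ʳ (≈-sym p)))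
    (Pos-*-cancel-0≤ px (≈⇒≤ʳ (begin
      0ℝ             ≈⟨ solve 0 (con 0ℚ := :- con 0ℚ) ≈-refl ⟩
      -ʳ 0ℝ          ≈⟨ -ʳ-cong p ⟨
      -ʳ (x *ʳ y)    ≈⟨ solve 2 (λ x y → :- (x :* y) := x :* (:- y)) ≈-refl x y ⟩
      x *ʳ (-ʳ y)    ∎)))

  ≰ʳ⇒≥ʳ : ∀ {x y} → ¬ x ≤ʳ y → y ≤ʳ x
  ≰ʳ⇒≥ʳ {x} {y} p = 0≤-⇒≤ (¬Pos-⇒0≤ λ q → p (0≤-⇒≤ (Pos⇒0≤
    (Pos-resp-≈ (solve 2 (λ x y → :- (x :- y) := y :- x) ≈-refl x y) q))))

  x²≈0⇒x≈0 : ∀ {x} → x *ʳ x ≈ 0ℝ → x ≈ 0ℝ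
  x²≈0⇒x≈0 {x} p = 0≤∧0≤-⇒≈0
    (¬Pos-⇒0≤ λ q → Pos⇒≉0 (Pos-* q q) (≈-trans (solve 1 (λ x → (:- x) :* (:- x) := x :* x) ≈-refl x) p))
    (¬Pos-⇒0≤ λ q → Pos⇒≉0 (Pos-* q q) (≈-trans (solve 1 (λ x → (:- (:- x)) :* (:- (:- x)) := x :* x) ≈-refl x) p))

  0≤-sum-zeroˡ : ∀ {x y} → 0ℝ ≤ʳ x → 0ℝ ≤ʳ y → x +ʳ y ≈ 0ℝ → x ≈ 0ℝ
  0≤-sum-zeroˡ {x} {y} 0≤x 0≤y p = 0≤∧0≤-⇒≈0 0≤x (0≤-resp-≈ (begin
    y                    ≈⟨ solve 2 (λ x y → y := (x :+ y) :- x) ≈-refl x y ⟩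
    (x +ʳ y) -ʳ x        ≈⟨ +ʳ-cong p ≈-refl ⟩
    0ℝ -ʳ x              ≈⟨ +ʳ-identityˡ _ ⟩
    -ʳ x                 ∎) 0≤y)

  0≤-sum-zeroʳ : ∀ {x y} → 0ℝ ≤ʳ x → 0ℝ ≤ʳ y → x +ʳ y ≈ 0ℝ → y ≈ 0ℝ
  0≤-sum-zeroʳ 0≤x 0≤y p = 0≤-sum-zeroˡ 0≤y 0≤x (≈-trans (+ʳ-comm _ _) p)

-- Integers inside the reals

/1-homo-+ : ∀ i j → (i ℤ.+ j) ℚ./ 1 ≡ (i ℚ./ 1) ℚ.+ (j ℚ./ 1)
/1-homo-+ i j = ℚ.toℚᵘ-injective (ℚᵘ.≃-trans (ℚ.toℚᵘ-fromℚᵘ (ℚᵘ.mkℚᵘ (i ℤ.+ j) 0))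
  (ℚᵘ.≃-trans (ℚᵘ.*≡* (cong (ℤ._* ℤ.1ℤ) (cong₂ ℤ._+_ (sym (ℤ.*-identityʳ i)) (sym (ℤ.*-identityʳ j)))))
  (ℚᵘ.≃-sym (ℚᵘ.≃-trans (ℚ.toℚᵘ-homo-+ (i ℚ./ 1) (j ℚ./ 1))
    (ℚᵘ.+-cong (ℚ.toℚᵘ-fromℚᵘ (ℚᵘ.mkℚᵘ i 0)) (ℚ.toℚᵘ-fromℚᵘ (ℚᵘ.mkℚᵘ j 0)))))))

/1-homo-neg : ∀ i → (ℤ.- i) ℚ./ 1 ≡ ℚ.- (i ℚ./ 1)
/1-homo-neg i = ℚ.toℚᵘ-injective (ℚᵘ.≃-trans (ℚ.toℚᵘ-fromℚᵘ (ℚᵘ.mkℚᵘ (ℤ.- i) 0))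
  (ℚᵘ.≃-sym (ℚᵘ.≃-trans (ℚ.toℚᵘ-homo‿- (i ℚ./ 1)) (ℚᵘ.-‿cong (ℚ.toℚᵘ-fromℚᵘ (ℚᵘ.mkℚᵘ i 0))))))

/1-mono-≤ : ∀ {i j} → i ℤ.≤ j → i ℚ./ 1 ℚ.≤ j ℚ./ 1
/1-mono-≤ {i} {j} le = ℚ.toℚᵘ-cancel-≤ (ℚᵘ.≤-respˡ-≃ (ℚᵘ.≃-sym (ℚ.toℚᵘ-fromℚᵘ (ℚᵘ.mkℚᵘ i 0)))
  (ℚᵘ.≤-respʳ-≃ (ℚᵘ.≃-sym (ℚ.toℚᵘ-fromℚᵘ (ℚᵘ.mkℚᵘ j 0)))
    (ℚᵘ.*≤* (ℤ.*-monoʳ-≤-nonNeg ℤ.1ℤ le))))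

fromℤ-sub : ∀ i j → fromℤ (i ℤ.- j) ≈ fromℤ i -ʳ fromℤ j
fromℤ-sub i j = pointwise-≈ λ n → trans (/1-homo-+ i (ℤ.- j))
  (sym (trans (seq-+ _ _ n) (cong (i ℚ./ 1 ℚ.+_) (trans (seq-neg _ n) (sym (/1-homo-neg j))))))

opaque
  ι : ℕ → ℝ
  ι k = fromℤ (+ k)

  fromℤ-+ : ∀ k → fromℤ (+ k) ≈ ι k
  fromℤ-+ k = ≈-refl

  ι-0 : ι 0 ≈ 0ℝ
  ι-0 = ≈-refl

  ι-1 : ι 1 ≈ 1ℝ
  ι-1 = ≈-refl

  ι-+ : ∀ a b → ι (a + b) ≈ ι a +ʳ ι b
  ι-+ a b = pointwise-≈ {ι (a + b)} {ι a +ʳ ι b} λ n → trans (/1-homo-+ (+ a) (+ b)) (sym (seq-+ (ι a) (ι b) n))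

  ι-nonneg : ∀ a → 0ℝ ≤ʳ ι a
  ι-nonneg a = 0≤-pointwise λ _ → /1-mono-≤ {+ 0} {+ a} (ℤ.+≤+ z≤n)

  ι-pos : ∀ a → Pos (ι (suc a))
  ι-pos a = Pos-fromℚ (ℚ.<-≤-trans (ℚ.positive⁻¹ 1ℚ) (/1-mono-≤ {+ 1} {+ suc a} (ℤ.+≤+ (s≤s z≤n))))

ι-mono : ∀ {a b} → a ≤ b → ι a ≤ʳ ι b
ι-mono {a} {b} a≤b = ≤ʳ-+-nonneg
  (subst (λ z → ι z ≈ ι a +ʳ ι (b ∸ a)) (ℕ.m+[n∸m]≡n a≤b) (ι-+ a (b ∸ a))) (ι-nonneg (b ∸ a))

-- Sums over initial segments of ℕ

module RangeSum (R : CommutativeSemiring 0ℓ 0ℓ) where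
  private
    module S = CommutativeSemiring R
    module FS = MonoidSum S.+-commutativeMonoid
  open SetoidReasoning S.setoid

  ∑ : ℕ → (ℕ → S.Carrier) → S.Carrier
  ∑ zero    f = S.0#
  ∑ (suc n) f = ∑ n f S.+ f n

  ∑-cong : ∀ n {f g} → (∀ i → i < n → f i S.≈ g i) → ∑ n f S.≈ ∑ n g
  ∑-cong zero    eq = S.refl
  ∑-cong (suc n) eq = S.+-cong (∑-cong n λ i i<n → eq i (ℕ.m<n⇒m<1+n i<n)) (eq n ℕ.≤-refl)

  ∑-zero : ∀ n {f} → (∀ i → i < n → f i S.≈ S.0#) → ∑ n f S.≈ S.0#
  ∑-zero zero    eq = S.refl
  ∑-zero (suc n) eq = S.trans (S.+-cong (∑-zero n λ i i<n → eq i (ℕ.m<n⇒m<1+n i<n)) (eq n ℕ.≤-refl)) (S.+-identityˡ S.0#)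

  interchange : ∀ a b c d → (a S.+ b) S.+ (c S.+ d) S.≈ (a S.+ c) S.+ (b S.+ d)
  interchange a b c d = begin
    (a S.+ b) S.+ (c S.+ d)  ≈⟨ S.+-assoc a b _ ⟩
    a S.+ (b S.+ (c S.+ d))  ≈⟨ S.+-congˡ (S.+-assoc b c d) ⟨
    a S.+ ((b S.+ c) S.+ d)  ≈⟨ S.+-congˡ (S.+-congʳ (S.+-comm b c)) ⟩
    a S.+ ((c S.+ b) S.+ d)  ≈⟨ S.+-congˡ (S.+-assoc c b d) ⟩
    a S.+ (c S.+ (b S.+ d))  ≈⟨ S.+-assoc a c _ ⟨
    (a S.+ c) S.+ (b S.+ d)  ∎

  ∑-+ : ∀ n f g → ∑ n (λ i → f i S.+ g i) S.≈ ∑ n f S.+ ∑ n g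
  ∑-+ zero    f g = S.sym (S.+-identityˡ S.0#)
  ∑-+ (suc n) f g = S.trans (S.+-congʳ (∑-+ n f g)) (interchange _ _ _ _)

  ∑-*ˡ : ∀ n c f → c S.* ∑ n f S.≈ ∑ n (λ i → c S.* f i)
  ∑-*ˡ zero    c f = S.zeroʳ c
  ∑-*ˡ (suc n) c f = S.trans (S.distribˡ c _ _) (S.+-congʳ (∑-*ˡ n c f))

  ∑-swap : ∀ m n (f : ℕ → ℕ → S.Carrier) → ∑ m (λ i → ∑ n (f i)) S.≈ ∑ n (λ j → ∑ m λ i → f i j)
  ∑-swap zero    n f = S.sym (∑-zero n λ _ _ → S.refl)
  ∑-swap (suc m) n f = S.trans (S.+-congʳ (∑-swap m n f)) (S.sym (∑-+ n (λ j → ∑ m λ i → f i j) (f m)))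

  ∑-front : ∀ n f → ∑ (suc n) f S.≈ f 0 S.+ ∑ n (f ∘ suc)
  ∑-front zero    f = S.+-comm S.0# (f 0)
  ∑-front (suc n) f = S.trans (S.+-congʳ (∑-front n f)) (S.+-assoc _ _ _)

  sum≈∑ : ∀ n (f : Fin n → S.Carrier) F → (∀ i → f i S.≈ F (toℕ i)) → FS.sum f S.≈ ∑ n F
  sum≈∑ zero    f F eq = S.refl
  sum≈∑ (suc n) f F eq = S.trans
    (S.+-cong (eq zero) (sum≈∑ n (f ∘ suc) (F ∘ suc) (eq ∘ suc))) (S.sym (∑-front n F))

open RangeSum ℕ.+-*-commutativeSemiring public

module Σʳ = RangeSum ℝR.commutativeSemiring

∑ʳ : ℕ → (ℕ → ℝ) → ℝ
∑ʳ = Σʳ.∑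

χ : ∀ {P : Set} → Dec P → ℕ
χ (yes _) = 1
χ (no _)  = 0

χ-yes : ∀ {P : Set} (d : Dec P) → P → χ d ≡ 1
χ-yes (yes _) p = refl
χ-yes (no ¬p) p = contradiction p ¬p

χ-no : ∀ {P : Set} (d : Dec P) → ¬ P → χ d ≡ 0
χ-no (yes p) ¬p = contradiction p ¬p
χ-no (no _)  ¬p = refl

∑-mono : ∀ n {f g} → (∀ i → i < n → f i ≤ g i) → ∑ n f ≤ ∑ n g
∑-mono zero    le = z≤n
∑-mono (suc n) le = ℕ.+-mono-≤ (∑-mono n λ i i<n → le i (ℕ.m<n⇒m<1+n i<n)) (le n ℕ.≤-refl)

term≤∑ : ∀ n f {i} → i < n → f i ≤ ∑ n f
term≤∑ (suc n) f {i} i<1+n with i ℕ.≟ n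
... | yes refl = ℕ.m≤n+m (f n) (∑ n f)
... | no i≢n   = ℕ.≤-trans (term≤∑ n f (ℕ.≤∧≢⇒< (s≤s⁻¹ i<1+n) i≢n)) (ℕ.m≤m+n (∑ n f) (f n))

∑-mono-range : ∀ {m n} f → m ≤ n → ∑ m f ≤ ∑ n f
∑-mono-range {m} {n} f m≤n = subst (λ k → ∑ m f ≤ ∑ k f) (ℕ.m+[n∸m]≡n m≤n) (extend (n ∸ m))
  where
  extend : ∀ k → ∑ m f ≤ ∑ (m + k) f
  extend zero    = ℕ.≤-reflexive (cong (λ k → ∑ k f) (sym (ℕ.+-identityʳ m)))
  extend (suc k) = subst (λ l → ∑ m f ≤ ∑ l f) (sym (ℕ.+-suc m k)) (ℕ.≤-trans (extend k) (ℕ.m≤m+n _ _))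

∑-const : ∀ n c → ∑ n (λ _ → c) ≡ n * c
∑-const zero    c = refl
∑-const (suc n) c = trans (cong (_+ c) (∑-const n c)) (ℕ.+-comm (n * c) c)

+-squeeze : ∀ {a b c d} → a ≤ c → b ≤ d → c + d ≤ a + b → a ≡ c × b ≡ d
+-squeeze {a} {b} {c} {d} a≤c b≤d le =
    ℕ.≤-antisym a≤c (ℕ.+-cancelʳ-≤ d c a (ℕ.≤-trans le (ℕ.+-monoʳ-≤ a b≤d)))
  , ℕ.≤-antisym b≤d (ℕ.+-cancelˡ-≤ c d b (ℕ.≤-trans le (ℕ.+-monoˡ-≤ b a≤c)))

∑-squeeze : ∀ n {f g} → (∀ i → i < n → f i ≤ g i) → ∑ n g ≤ ∑ n f → ∀ i → i < n → f i ≡ g i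
∑-squeeze (suc n) {f} {g} le sum≤ i i<1+n
  with +-squeeze (∑-mono n {f} {g} λ i i<n → le i (ℕ.m<n⇒m<1+n i<n)) (le n ℕ.≤-refl) sum≤ | i ℕ.≟ n
... | _  , eq | yes refl = eq
... | eq , _  | no i≢n   = ∑-squeeze n (λ i i<n → le i (ℕ.m<n⇒m<1+n i<n)) (ℕ.≤-reflexive (sym eq)) i (ℕ.≤∧≢⇒< (s≤s⁻¹ i<1+n) i≢n)

∑-witness : ∀ n f → 1 ≤ ∑ n f → ∃[ i ] (i < n × 1 ≤ f i)
∑-witness (suc n) f le with f n in eq
... | suc k = n , ℕ.≤-refl , subst (1 ≤_) (sym eq) (s≤s z≤n)
... | zero with ∑-witness n f (subst (1 ≤_) (ℕ.+-identityʳ _) le)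
...   | i , i<n , 1≤ = i , ℕ.m<n⇒m<1+n i<n , 1≤

∑-χ-< : ∀ n {k} (f : ℕ → ℕ) → k ≤ n → ∑ n (λ i → χ (i ℕ.<? k) * f i) ≡ ∑ k f
∑-χ-< n {k} f k≤n = go n k≤n
  where
  inside : ∀ m → m ≤ k → ∑ m (λ i → χ (i ℕ.<? k) * f i) ≡ ∑ m f
  inside m m≤k = ∑-cong m λ i i<m → trans (cong (_* f i) (χ-yes (i ℕ.<? k) (ℕ.<-≤-trans i<m m≤k))) (ℕ.*-identityˡ (f i))
  go : ∀ n → k ≤ n → ∑ n (λ i → χ (i ℕ.<? k) * f i) ≡ ∑ k f
  go n k≤n with ℕ.m≤n⇒m<n∨m≡n k≤n
  ... | inj₂ refl = inside k ℕ.≤-refl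
  go (suc n) k≤n | inj₁ k<n = trans (cong₂ _+_ (go n (s≤s⁻¹ k<n))
    (cong (_* f n) (χ-no (n ℕ.<? k) (ℕ.≤⇒≯ (s≤s⁻¹ k<n))))) (ℕ.+-identityʳ _)

∑-χ-≡ : ∀ n {k} → k < n → ∑ n (λ i → χ (k ℕ.≟ i)) ≡ 1
∑-χ-≡ (suc n) {k} k<1+n with k ℕ.≟ n
... | yes refl = cong (_+ 1) (∑-zero n λ i i<n → χ-no (k ℕ.≟ i) λ { refl → ℕ.<-irrefl refl i<n })
... | no k≢n   = trans (ℕ.+-identityʳ _) (∑-χ-≡ n (ℕ.≤∧≢⇒< (s≤s⁻¹ k<1+n) k≢n))

∑-χ-≢ : ∀ n {k} → n ≤ k → ∑ n (λ i → χ (k ℕ.≟ i)) ≡ 0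
∑-χ-≢ n {k} n≤k = ∑-zero n λ i i<n → χ-no (k ℕ.≟ i) λ { refl → ℕ.<⇒≱ i<n n≤k }

-- Real sums

∑ʳ-nonneg : ∀ n {f} → (∀ i → i < n → 0ℝ ≤ʳ f i) → 0ℝ ≤ʳ ∑ʳ n f
∑ʳ-nonneg zero    le = 0≤0
∑ʳ-nonneg (suc n) le = 0≤ʳ-+ (∑ʳ-nonneg n λ i i<n → le i (ℕ.m<n⇒m<1+n i<n)) (le n ℕ.≤-refl)

∑ʳ-nonneg-zero : ∀ n {f} → (∀ i → i < n → 0ℝ ≤ʳ f i) → ∑ʳ n f ≈ 0ℝ → ∀ i → i < n → f i ≈ 0ℝ
∑ʳ-nonneg-zero (suc n) {f} le eq i i<1+n with i ℕ.≟ n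
... | yes refl = 0≤-sum-zeroʳ (∑ʳ-nonneg n λ i i<n → le i (ℕ.m<n⇒m<1+n i<n)) (le n ℕ.≤-refl) eq
... | no i≢n = ∑ʳ-nonneg-zero n (λ i i<n → le i (ℕ.m<n⇒m<1+n i<n))
    (0≤-sum-zeroˡ (∑ʳ-nonneg n λ i i<n → le i (ℕ.m<n⇒m<1+n i<n)) (le n ℕ.≤-refl) eq) i (ℕ.≤∧≢⇒< (s≤s⁻¹ i<1+n) i≢n)

∑ʳ-neg : ∀ n f → -ʳ (∑ʳ n f) ≈ ∑ʳ n (λ i → -ʳ f i)
∑ʳ-neg zero    f = solve 0 (:- con 0ℚ := con 0ℚ) ≈-refl
  where
  open ℝ-Solver

∑ʳ-neg (suc n) f = ≈-trans (solve 2 (λ x y → :- (x :+ y) := :- x :+ :- y) ≈-refl (∑ʳ n f) (f n)) (+ʳ-cong (∑ʳ-neg n f) ≈-refl)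
  where open ℝ-Solver

∑ʳ-sub : ∀ n f g → ∑ʳ n (λ i → f i -ʳ g i) ≈ ∑ʳ n f -ʳ ∑ʳ n g
∑ʳ-sub n f g = ≈-trans (Σʳ.∑-+ n f (λ i → -ʳ g i)) (+ʳ-cong ≈-refl (≈-sym (∑ʳ-neg n g)))

ι-∑ : ∀ n f → ι (∑ n f) ≈ ∑ʳ n (λ i → ι (f i))
ι-∑ zero    f = ι-0
ι-∑ (suc n) f = ≈-trans (ι-+ (∑ n f) (f n)) (+ʳ-cong (ι-∑ n f) ≈-refl)

abel-summation : ∀ n (u x : ℕ → ℝ) →
  ∑ʳ n (λ i → u i *ʳ x i) ≈ ∑ʳ n (λ p → (u p -ʳ u (suc p)) *ʳ ∑ʳ (suc p) x) +ʳ u n *ʳ ∑ʳ n x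
abel-summation zero    u x = ≈-sym (≈-trans (+ʳ-identityˡ _) (*ʳ-zeroʳ ≈-refl))
abel-summation (suc n) u x = ≈-trans (+ʳ-cong (abel-summation n u x) ≈-refl)
  (solve 5 (λ T u v X y → (T :+ u :* X) :+ u :* y := (T :+ (u :- v) :* (X :+ y)) :+ v :* (X :+ y)) ≈-refl
     (∑ʳ n (λ p → (u p -ʳ u (suc p)) *ʳ ∑ʳ (suc p) x)) (u n) (u (suc n)) (∑ʳ n x) (x n))
  where open ℝ-Solver

-- Geometric sequences of rationals

pow : ℚ → ℕ → ℚ
pow θ zero    = 1ℚ
pow θ (suc l) = θ ℚ.* pow θ l

opaque
  archimedean : ∀ D {a} → 0ℚ ℚ.< a → ∃[ N ] (D ℚ.< (+ N ℚ./ 1) ℚ.* a)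
  archimedean D {a} 0<a = N , subst (ℚ._< (+ N ℚ./ 1) ℚ.* a)
      (trans (ℚ.*-assoc D (inv 0<a) a) (trans (cong (D ℚ.*_) (trans (ℚ.*-comm (inv 0<a) a) (*-inv 0<a))) (ℚ.*-identityʳ D)))
      (ℚ.*-monoˡ-<-pos a {{ℚ.positive 0<a}} r<N)
    where
    r : ℚ
    r = D ℚ.* inv 0<a
    N : ℕ
    -- The denominator being at least 1, a rational is at most the absolute value of its numerator.
    N = suc ℤ.∣ ℚ.↥ r ∣
    i≤+∣i∣ : ∀ i → i ℤ.≤ + ℤ.∣ i ∣
    i≤+∣i∣ (+ n) = ℤ.≤-refl
    i≤+∣i∣ (ℤ.-[1+ n ]) = ℤ.-≤+
    numerator< : ℚ.↥ r ℤ.* + 1 ℤ.< + N ℤ.* ℚ.↧ r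
    numerator< = ℤ.<-≤-trans
      (subst (ℤ._< + N) (sym (ℤ.*-identityʳ (ℚ.↥ r))) (ℤ.≤-<-trans (i≤+∣i∣ (ℚ.↥ r)) (ℤ.+<+ ℕ.≤-refl)))
      (subst (ℤ._≤ + N ℤ.* ℚ.↧ r) (ℤ.*-identityʳ (+ N)) (ℤ.*-monoˡ-≤-nonNeg (+ N) (ℤ.+≤+ (s≤s z≤n))))
    r<N : r ℚ.< + N ℚ./ 1
    r<N = ℚ.toℚᵘ-cancel-< (ℚᵘ.<-respʳ-≃ (ℚᵘ.≃-sym (ℚ.toℚᵘ-fromℚᵘ (ℚᵘ.mkℚᵘ (+ N) 0))) (ℚᵘ.*<*
      (subst₂ (λ u d → u ℤ.* + 1 ℤ.< + N ℤ.* d) (sym (ℚ.↥ᵘ-toℚᵘ r)) (sym (ℚ.↧ᵘ-toℚᵘ r)) numerator<)))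

module Geometric (κ : ℚ) (0<κ : 0ℚ ℚ.< κ) (κ≤1 : κ ℚ.≤ 1ℚ) where
  open +-*-Solver

  θ : ℚ
  θ = 1ℚ ℚ.- κ

  0≤θ : 0ℚ ℚ.≤ θ
  0≤θ = p≤q⇒0≤q-p κ≤1

  0≤pow : ∀ l → 0ℚ ℚ.≤ pow θ l
  0≤pow zero    = ℚ.<⇒≤ (ℚ.positive⁻¹ 1ℚ)
  0≤pow (suc l) = 0≤-* 0≤θ (0≤pow l)

  pow-antitone : ∀ l d → pow θ (d + l) ℚ.≤ pow θ l
  pow-antitone l zero    = ℚ.≤-refl
  pow-antitone l (suc d) = ℚ.≤-trans
    (0≤q-p⇒p≤q (subst (0ℚ ℚ.≤_) (identity κ (pow θ (d + l))) (0≤-* (ℚ.<⇒≤ 0<κ) (0≤pow (d + l))))) (pow-antitone l d)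
    where
    identity : ∀ κ p → κ ℚ.* p ≡ p ℚ.- (1ℚ ℚ.- κ) ℚ.* p
    identity = solve 2 (λ κ p → κ :* p := p :- (con 1ℚ :- κ) :* p) refl

  -- The left side does not increase with `l`, since (1 - κ)(1 + (l + 1)κ) = 1 + lκ - (l + 1)κ².
  -- Geometric decay is thereby reduced to decay like 1/l, which the Archimedean property handles.
  bernoulli : ∀ l → pow θ l ℚ.* (1ℚ ℚ.+ (+ l ℚ./ 1) ℚ.* κ) ℚ.≤ 1ℚ
  bernoulli zero = ℚ.≤-reflexive (identity κ)
    where
    identity : ∀ κ → 1ℚ ℚ.* (1ℚ ℚ.+ 0ℚ ℚ.* κ) ≡ 1ℚ
    identity = solve 1 (λ κ → con 1ℚ :* (con 1ℚ :+ con 0ℚ :* κ) := con 1ℚ) refl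
  bernoulli (suc l) = ℚ.≤-trans (0≤q-p⇒p≤q (subst (0ℚ ℚ.≤_)
      (trans (identity κ (pow θ l) (+ l ℚ./ 1))
        (cong (λ z → pow θ l ℚ.* (1ℚ ℚ.+ (+ l ℚ./ 1) ℚ.* κ) ℚ.- (θ ℚ.* pow θ l) ℚ.* (1ℚ ℚ.+ z ℚ.* κ))
          (sym (/1-homo-+ (+ 1) (+ l)))))
      (0≤-* (0≤pow l) (0≤-* (0≤p*p κ) (0≤-+ {1ℚ} (ℚ.<⇒≤ (ℚ.positive⁻¹ 1ℚ)) (/1-mono-≤ {+ 0} {+ l} (ℤ.+≤+ z≤n)))))))
      (bernoulli l)
    where
    identity : ∀ κ p l → p ℚ.* ((κ ℚ.* κ) ℚ.* (1ℚ ℚ.+ l)) ≡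
      p ℚ.* (1ℚ ℚ.+ l ℚ.* κ) ℚ.- ((1ℚ ℚ.- κ) ℚ.* p) ℚ.* (1ℚ ℚ.+ (1ℚ ℚ.+ l) ℚ.* κ)
    identity = solve 3 (λ κ p l → p :* ((κ :* κ) :* (con 1ℚ :+ l)) :=
      p :* (con 1ℚ :+ l :* κ) :- ((con 1ℚ :- κ) :* p) :* (con 1ℚ :+ (con 1ℚ :+ l) :* κ)) refl

  opaque
    pow-small : ∀ D → 0ℚ ℚ.≤ D → ∀ ε → 0ℚ ℚ.< ε → ∃[ N ] (∀ l → N ≤ l → D ℚ.* pow θ l ℚ.< ε)
    pow-small D 0≤D ε 0<ε with archimedean D (0<-* 0<κ 0<ε)
    ... | N , D< = N , λ l N≤l → ℚ.≤-<-trans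
        (*-monoʳ-≤ D 0≤D (subst (λ l → pow θ l ℚ.≤ pow θ N) (ℕ.m∸n+n≡m N≤l) (pow-antitone N (l ∸ N))))
        (ℚ.*-cancelˡ-<-nonNeg (1ℚ ℚ.+ n ℚ.* κ) {{ℚ.nonNegative (0≤-+ {1ℚ} (ℚ.<⇒≤ (ℚ.positive⁻¹ 1ℚ)) 0≤nκ)}}
          (ℚ.≤-<-trans
            (subst₂ ℚ._≤_ (identity₁ D (pow θ N) (1ℚ ℚ.+ n ℚ.* κ)) (ℚ.*-identityʳ D) (*-monoʳ-≤ D 0≤D (bernoulli N)))
            (ℚ.<-≤-trans D< (0≤q-p⇒p≤q (subst (0ℚ ℚ.≤_) (identity₂ n κ ε) (ℚ.<⇒≤ 0<ε))))))
      where
      n : ℚ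
      n = + N ℚ./ 1
      0≤nκ : 0ℚ ℚ.≤ n ℚ.* κ
      0≤nκ = 0≤-* (/1-mono-≤ {+ 0} {+ N} (ℤ.+≤+ z≤n)) (ℚ.<⇒≤ 0<κ)
      identity₁ : ∀ D p q → D ℚ.* (p ℚ.* q) ≡ q ℚ.* (D ℚ.* p)
      identity₁ = solve 3 (λ D p q → D :* (p :* q) := q :* (D :* p)) refl
      identity₂ : ∀ n κ ε → ε ≡ (1ℚ ℚ.+ n ℚ.* κ) ℚ.* ε ℚ.- n ℚ.* (κ ℚ.* ε)
      identity₂ = solve 3 (λ n κ ε → ε := (con 1ℚ :+ n :* κ) :* ε :- n :* (κ :* ε)) refl

  opaque
    geometric⇒cauchy : ∀ D → 0ℚ ℚ.≤ D → (s : ℕ → ℚ) → (∀ l → ℚ.∣ s (suc l) ℚ.- s l ∣ ℚ.≤ D ℚ.* pow θ l) →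
      ∀ ε → 0ℚ ℚ.< ε → ∃[ N ] (∀ m n → N ≤ m → N ≤ n → ℚ.∣ s m ℚ.- s n ∣ ℚ.< ε)
    geometric⇒cauchy D 0≤D s step ε 0<ε with pow-small D 0≤D (κ ℚ.* ε) (0<-* 0<κ 0<ε)
    ... | N , small = N , λ m n N≤m N≤n → [ (λ n≤m → close n m N≤n n≤m)
                                          , (λ m≤n → subst (ℚ._< ε) (∣-∣-swap (s n) (s m)) (close m n N≤m m≤n)) ]′ (ℕ.≤-total n m)
      where
      -- The geometric series in closed form, multiplied by κ = 1 - θ to avoid a division.
      tail : ∀ l d → κ ℚ.* ℚ.∣ s (d + l) ℚ.- s l ∣ ℚ.≤ D ℚ.* (pow θ l ℚ.- pow θ (d + l))
      tail l zero = ℚ.≤-reflexive (trans (cong (λ z → κ ℚ.* ℚ.∣ z ∣) (ℚ.+-inverseʳ (s l)))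
        (trans (ℚ.*-zeroʳ κ) (sym (trans (cong (D ℚ.*_) (ℚ.+-inverseʳ (pow θ l))) (ℚ.*-zeroʳ D)))))
      tail l (suc d) = ℚ.≤-trans (*-monoʳ-≤ κ (ℚ.<⇒≤ 0<κ) (∣-∣-triangle (s (suc d + l)) (s (d + l)) (s l)))
        (subst₂ ℚ._≤_ (sym (ℚ.*-distribˡ-+ κ _ _)) (identity κ D (pow θ l) (pow θ (d + l)))
          (ℚ.+-mono-≤ (*-monoʳ-≤ κ (ℚ.<⇒≤ 0<κ) (step (d + l))) (tail l d)))
        where
        identity : ∀ κ D p q → κ ℚ.* (D ℚ.* q) ℚ.+ D ℚ.* (p ℚ.- q) ≡ D ℚ.* (p ℚ.- (1ℚ ℚ.- κ) ℚ.* q)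
        identity = solve 4 (λ κ D p q → κ :* (D :* q) :+ D :* (p :- q) := D :* (p :- (con 1ℚ :- κ) :* q)) refl
      close : ∀ n m → N ≤ n → n ≤ m → ℚ.∣ s m ℚ.- s n ∣ ℚ.< ε
      close n m N≤n n≤m = ℚ.*-cancelˡ-<-nonNeg κ {{ℚ.nonNegative (ℚ.<⇒≤ 0<κ)}}
        (ℚ.≤-<-trans (subst (λ m → κ ℚ.* ℚ.∣ s m ℚ.- s n ∣ ℚ.≤ D ℚ.* (pow θ n ℚ.- pow θ m)) (ℕ.m∸n+n≡m n≤m) (tail n (m ∸ n)))
          (ℚ.≤-<-trans (*-monoʳ-≤ D 0≤D (0≤q-p⇒p≤q (subst (0ℚ ℚ.≤_) (identity (pow θ n) (pow θ m)) (0≤pow m)))) (small n N≤n)))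
        where
        identity : ∀ p q → q ≡ p ℚ.- (p ℚ.- q)
        identity = solve 2 (λ p q → q := p :- (p :- q)) refl

-- Power iteration for positive operators

module _ {n : ℕ} where

  record Linear (L : (Fin n → ℚ) → Fin n → ℚ) : Set where
    field
      ext : ∀ {u v} → (∀ i → u i ≡ v i) → ∀ i → L u i ≡ L v i
      lin : ∀ a b u v i → L (λ j → a ℚ.* u j ℚ.+ b ℚ.* v j) i ≡ a ℚ.* L u i ℚ.+ b ℚ.* L v i

-- In the application `P` is a power of `T` with all entries at least 1, which `P-reach` expresses.
-- The iteration runs with `P`, since `T` may have zero entries; the limit is an eigenvector of `T`
-- because the two commute.
module PowerIteration {k : ℕ} (P T : (Fin (suc k) → ℚ) → Fin (suc k) → ℚ)
  (P-linear : Linear P) (T-linear : Linear T)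
  (P-reach : ∀ w → (∀ i → 0ℚ ℚ.≤ w i) → ∀ i j → w j ℚ.≤ P w i)
  (T-P-comm : ∀ w i → T (P w) i ≡ P (T w) i)
  (C : ℚ) (P1≤C : ∀ i → P (λ _ → 1ℚ) i ℚ.≤ C)
  (c : ℚ) (0≤T1 : ∀ i → 0ℚ ℚ.≤ T (λ _ → 1ℚ) i) (T1≤c : ∀ i → T (λ _ → 1ℚ) i ℚ.≤ c) where

  open +-*-Solver

  0<1 : 0ℚ ℚ.< 1ℚ
  0<1 = ℚ.positive⁻¹ 1ℚ

  x : ℕ → Fin (suc k) → ℚ
  x zero    i = 1ℚ
  x (suc l) i = P (x l) i

  0<x : ∀ l i → 0ℚ ℚ.< x l i
  0<x zero    i = 0<1
  0<x (suc l) i = ℚ.<-≤-trans (0<x l i) (P-reach (x l) (λ j → ℚ.<⇒≤ (0<x l j)) i i)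

  x-increasing : ∀ l i j → x l j ℚ.≤ x (suc l) i
  x-increasing l = P-reach (x l) (λ j → ℚ.<⇒≤ (0<x l j))

  1≤C : 1ℚ ℚ.≤ C
  1≤C = ℚ.≤-trans (x-increasing 0 zero zero) (P1≤C zero)

  0≤C : 0ℚ ℚ.≤ C
  0≤C = ℚ.≤-trans (ℚ.<⇒≤ 0<1) 1≤C

  -- `P-reach` makes `P` nonnegative; this is applied to the vector Y - y.
  P-bound : ∀ y Y → 0ℚ ℚ.≤ Y → (∀ i → y i ℚ.≤ Y) → ∀ i → P y i ℚ.≤ C ℚ.* Y
  P-bound y Y 0≤Y y≤Y i = ℚ.≤-trans (0≤q-p⇒p≤q (subst (0ℚ ℚ.≤_)
      (trans (Linear.lin P-linear Y (ℚ.- 1ℚ) (λ _ → 1ℚ) y i) (identity Y (P (λ _ → 1ℚ) i) (P y i)))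
      (ℚ.≤-trans (0≤w i) (P-reach w 0≤w i i))))
      (ℚ.*-monoʳ-≤-nonNeg Y {{ℚ.nonNegative 0≤Y}} (P1≤C i))
    where
    w : Fin (suc k) → ℚ
    w j = Y ℚ.* 1ℚ ℚ.+ (ℚ.- 1ℚ) ℚ.* y j
    0≤w : ∀ j → 0ℚ ℚ.≤ w j
    0≤w j = subst (0ℚ ℚ.≤_) (solve 2 (λ Y y → Y :- y := Y :* con 1ℚ :+ (:- con 1ℚ) :* y) refl Y (y j)) (p≤q⇒0≤q-p (y≤Y j))
    identity : ∀ Y p q → Y ℚ.* p ℚ.+ (ℚ.- 1ℚ) ℚ.* q ≡ p ℚ.* Y ℚ.- q
    identity = solve 3 (λ Y p q → Y :* p :+ (:- con 1ℚ) :* q := p :* Y :- q) refl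

  -- After one application of `P` every coordinate dominates all previous ones, while `P` raises an
  -- upper bound at most by the factor `C`.
  harnack : ∀ l i j → x l i ℚ.≤ C ℚ.* x l j
  harnack zero    i j = subst (1ℚ ℚ.≤_) (sym (ℚ.*-identityʳ C)) 1≤C
  harnack (suc l) i j = P-bound (x l) (x (suc l) j) (ℚ.<⇒≤ (0<x (suc l) j)) (λ i → x-increasing l j i) i

  0<C² : 0ℚ ℚ.< C ℚ.* C
  0<C² = 0<-* (ℚ.<-≤-trans 0<1 1≤C) (ℚ.<-≤-trans 0<1 1≤C)

  -- One factor `C` is the growth under `P`, the other the spread of the coordinates in `harnack`;
  -- together they bound every entry of `x (suc l)` by C² times `x l zero`.
  κ : ℚ
  κ = inv 0<C²

  κ≤1 : κ ℚ.≤ 1ℚ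
  κ≤1 = subst₂ ℚ._≤_ (ℚ.*-identityʳ κ) (trans (ℚ.*-comm κ _) (*-inv 0<C²))
    (*-monoʳ-≤ κ (ℚ.<⇒≤ (0<inv 0<C²)) (ℚ.≤-trans 1≤C (subst (ℚ._≤ C ℚ.* C) (ℚ.*-identityʳ C) (*-monoʳ-≤ C 0≤C 1≤C))))

  open Geometric κ (0<inv 0<C²) κ≤1

  κx≤x : ∀ l i → κ ℚ.* x (suc l) i ℚ.≤ x l zero
  κx≤x l i = subst (κ ℚ.* x (suc l) i ℚ.≤_)
    (trans (cong (κ ℚ.*_) (sym (ℚ.*-assoc C C (x l zero))))
      (trans (solve 3 (λ κ D x → κ :* (D :* x) := D :* (κ :* x)) refl κ (C ℚ.* C) (x l zero)) (*-*-inv 0<C² (x l zero))))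
    (*-monoʳ-≤ κ (ℚ.<⇒≤ (0<inv 0<C²))
      (P-bound (x l) (C ℚ.* x l zero) (0≤-* 0≤C (ℚ.<⇒≤ (0<x l zero))) (λ j → harnack l j zero) i))

  x⁻¹ : ∀ l i → ℚ
  x⁻¹ l i = inv (0<x l i)

  0≤x⁻¹ : ∀ l i → 0ℚ ℚ.≤ x⁻¹ l i
  0≤x⁻¹ l i = ℚ.<⇒≤ (0<inv (0<x l i))

  -- Every entry of `P w` is at least `w zero`, whereas κ times any entry of `x (suc l)` is at most
  -- `x l zero`. This uniform lower bound is the source of the geometric convergence.
  contraction : ∀ l w → (∀ i → 0ℚ ℚ.≤ w i) → ∀ i → (κ ℚ.* (w zero ℚ.* x⁻¹ l zero)) ℚ.* x (suc l) i ℚ.≤ P w i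
  contraction l w 0≤w i = ℚ.≤-trans
    (subst₂ ℚ._≤_ (solve 3 (λ w κ x → w :* (κ :* x) := (κ :* w) :* x) refl (w zero ℚ.* x⁻¹ l zero) κ (x (suc l) i))
       (trans (solve 3 (λ w y x → (w :* y) :* x := x :* (y :* w)) refl (w zero) (x⁻¹ l zero) (x l zero)) (*-*-inv (0<x l zero) (w zero)))
       (*-monoʳ-≤ (w zero ℚ.* x⁻¹ l zero) (0≤-* (0≤w zero) (0≤x⁻¹ l zero)) (κx≤x l i)))
    (P-reach w 0≤w i zero)

  -- Both ends of the bracket m l · x l ≤ U (x l) ≤ M l · x l move towards the
  -- quotient at one index, so that the gap shrinks by exactly the factor 1 - κ.
  module Bracket (U : (Fin (suc k) → ℚ) → Fin (suc k) → ℚ) (U-linear : Linear U)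
    (U-P-comm : ∀ w i → U (P w) i ≡ P (U w) i) (m₀ M₀ : ℚ)
    (m₀≤ : ∀ i → m₀ ℚ.≤ U (λ _ → 1ℚ) i) (≤M₀ : ∀ i → U (λ _ → 1ℚ) i ℚ.≤ M₀) where

    ρ : ℕ → ℚ
    ρ l = U (x l) zero ℚ.* x⁻¹ l zero

    m M : ℕ → ℚ
    m zero    = m₀
    m (suc l) = m l ℚ.+ κ ℚ.* (ρ l ℚ.- m l)
    M zero    = M₀
    M (suc l) = M l ℚ.- κ ℚ.* (M l ℚ.- ρ l)

    quotient : ∀ l a b → (a ℚ.* U (x l) zero ℚ.+ b ℚ.* x l zero) ℚ.* x⁻¹ l zero ≡ a ℚ.* ρ l ℚ.+ b
    quotient l a b = trans (identity a b (U (x l) zero) (x l zero) (x⁻¹ l zero))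
      (trans (cong (λ z → a ℚ.* ρ l ℚ.+ b ℚ.* z) (*-inv (0<x l zero))) (cong (a ℚ.* ρ l ℚ.+_) (ℚ.*-identityʳ b)))
      where
      identity : ∀ a b u x y → (a ℚ.* u ℚ.+ b ℚ.* x) ℚ.* y ≡ a ℚ.* (u ℚ.* y) ℚ.+ b ℚ.* (x ℚ.* y)
      identity = solve 5 (λ a b u x y → (a :* u :+ b :* x) :* y := a :* (u :* y) :+ b :* (x :* y)) refl

    private
      P-combination : ∀ l a b i → P (λ j → a ℚ.* U (x l) j ℚ.+ b ℚ.* x l j) i ≡ a ℚ.* U (x (suc l)) i ℚ.+ b ℚ.* x (suc l) i
      P-combination l a b i = trans (Linear.lin P-linear a b (U (x l)) (x l) i)
        (cong (λ z → a ℚ.* z ℚ.+ b ℚ.* x (suc l) i) (sym (trans (Linear.ext U-linear (λ _ → refl) i) (U-P-comm (x l) i))))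

      -- The contraction applied to the slack of one end of the bracket; a = 1 gives the lower end
      -- and a = -1 the upper one.
      advance : ∀ l a b → (∀ i → 0ℚ ℚ.≤ a ℚ.* U (x l) i ℚ.+ b ℚ.* x l i) → ∀ i →
        0ℚ ℚ.≤ (a ℚ.* U (x (suc l)) i ℚ.+ b ℚ.* x (suc l) i) ℚ.- (κ ℚ.* (a ℚ.* ρ l ℚ.+ b)) ℚ.* x (suc l) i
      advance l a b 0≤w i = p≤q⇒0≤q-p (subst₂ ℚ._≤_ (cong (λ z → (κ ℚ.* z) ℚ.* x (suc l) i) (quotient l a b)) (P-combination l a b i)
        (contraction l (λ j → a ℚ.* U (x l) j ℚ.+ b ℚ.* x l j) 0≤w i))

    lower : ∀ l i → 0ℚ ℚ.≤ 1ℚ ℚ.* U (x l) i ℚ.+ (ℚ.- m l) ℚ.* x l i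
    lower zero    i = subst (0ℚ ℚ.≤_) (identity (U (x 0) i) m₀) (p≤q⇒0≤q-p (subst (m₀ ℚ.≤_) (Linear.ext U-linear (λ _ → refl) i) (m₀≤ i)))
      where
      identity : ∀ u m → u ℚ.- m ≡ 1ℚ ℚ.* u ℚ.+ (ℚ.- m) ℚ.* 1ℚ
      identity = solve 2 (λ u m → u :- m := con 1ℚ :* u :+ (:- m) :* con 1ℚ) refl
    lower (suc l) i = subst (0ℚ ℚ.≤_) (identity (U (x (suc l)) i) (m l) κ (ρ l) (x (suc l) i)) (advance l 1ℚ (ℚ.- m l) (lower l) i)
      where
      identity : ∀ u m κ ρ x → (1ℚ ℚ.* u ℚ.+ (ℚ.- m) ℚ.* x) ℚ.- (κ ℚ.* (1ℚ ℚ.* ρ ℚ.+ ℚ.- m)) ℚ.* x ≡ 1ℚ ℚ.* u ℚ.+ (ℚ.- (m ℚ.+ κ ℚ.* (ρ ℚ.- m))) ℚ.* x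
      identity = solve 5 (λ u m κ ρ x → (con 1ℚ :* u :+ (:- m) :* x) :- (κ :* (con 1ℚ :* ρ :+ :- m)) :* x := con 1ℚ :* u :+ (:- (m :+ κ :* (ρ :- m))) :* x) refl

    upper : ∀ l i → 0ℚ ℚ.≤ (ℚ.- 1ℚ) ℚ.* U (x l) i ℚ.+ M l ℚ.* x l i
    upper zero    i = subst (0ℚ ℚ.≤_) (identity (U (x 0) i) M₀) (p≤q⇒0≤q-p (subst (ℚ._≤ M₀) (Linear.ext U-linear (λ _ → refl) i) (≤M₀ i)))
      where
      identity : ∀ u m → m ℚ.- u ≡ (ℚ.- 1ℚ) ℚ.* u ℚ.+ m ℚ.* 1ℚ
      identity = solve 2 (λ u m → m :- u := (:- con 1ℚ) :* u :+ m :* con 1ℚ) refl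
    upper (suc l) i = subst (0ℚ ℚ.≤_) (identity (U (x (suc l)) i) (M l) κ (ρ l) (x (suc l) i)) (advance l (ℚ.- 1ℚ) (M l) (upper l) i)
      where
      identity : ∀ u m κ ρ x → ((ℚ.- 1ℚ) ℚ.* u ℚ.+ m ℚ.* x) ℚ.- (κ ℚ.* ((ℚ.- 1ℚ) ℚ.* ρ ℚ.+ m)) ℚ.* x ≡ (ℚ.- 1ℚ) ℚ.* u ℚ.+ (m ℚ.- κ ℚ.* (m ℚ.- ρ)) ℚ.* x
      identity = solve 5 (λ u m κ ρ x → ((:- con 1ℚ) :* u :+ m :* x) :- (κ :* ((:- con 1ℚ) :* ρ :+ m)) :* x := (:- con 1ℚ) :* u :+ (m :- κ :* (m :- ρ)) :* x) refl

    gap : ∀ l → M l ℚ.- m l ≡ (M₀ ℚ.- m₀) ℚ.* pow θ l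
    gap zero    = sym (ℚ.*-identityʳ _)
    gap (suc l) = trans (identity₁ κ (M l) (m l) (ρ l)) (trans (cong (θ ℚ.*_) (gap l)) (identity₂ θ (M₀ ℚ.- m₀) (pow θ l)))
      where
      identity₁ : ∀ κ M m ρ → (M ℚ.- κ ℚ.* (M ℚ.- ρ)) ℚ.- (m ℚ.+ κ ℚ.* (ρ ℚ.- m)) ≡ (1ℚ ℚ.- κ) ℚ.* (M ℚ.- m)
      identity₁ = solve 4 (λ κ M m ρ → (M :- κ :* (M :- ρ)) :- (m :+ κ :* (ρ :- m)) := (con 1ℚ :- κ) :* (M :- m)) refl
      identity₂ : ∀ θ D p → θ ℚ.* (D ℚ.* p) ≡ D ℚ.* (θ ℚ.* p)
      identity₂ = solve 3 (λ θ D p → θ :* (D :* p) := D :* (θ :* p)) refl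

    0≤M₀-m₀ : 0ℚ ℚ.≤ M₀ ℚ.- m₀
    0≤M₀-m₀ = p≤q⇒0≤q-p (ℚ.≤-trans (m₀≤ zero) (≤M₀ zero))

    0≤gap : ∀ l → 0ℚ ℚ.≤ M l ℚ.- m l
    0≤gap l = subst (0ℚ ℚ.≤_) (sym (gap l)) (0≤-* 0≤M₀-m₀ (0≤pow l))

    m-step : ∀ l → ℚ.∣ m (suc l) ℚ.- m l ∣ ℚ.≤ (M₀ ℚ.- m₀) ℚ.* pow θ l
    m-step l = subst₂ ℚ._≤_ (trans (sym (ℚ.0≤p⇒∣p∣≡p (0≤-* (ℚ.<⇒≤ (0<inv 0<C²)) 0≤ρ-m))) (cong ℚ.∣_∣ (identity₁ (m l) (κ ℚ.* (ρ l ℚ.- m l))))) (gap l)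
      (0≤q-p⇒p≤q (subst (0ℚ ℚ.≤_) (identity₂ κ (ρ l) (m l) (M l))
        (0≤-+ (0≤-* (p≤q⇒0≤q-p κ≤1) 0≤ρ-m) 0≤M-ρ)))
      where
      0≤ρ-m : 0ℚ ℚ.≤ ρ l ℚ.- m l
      0≤ρ-m = subst (0ℚ ℚ.≤_) (trans (quotient l 1ℚ (ℚ.- m l)) (cong (ℚ._- m l) (ℚ.*-identityˡ (ρ l)))) (0≤-* (lower l zero) (0≤x⁻¹ l zero))
      0≤M-ρ : 0ℚ ℚ.≤ (ℚ.- 1ℚ) ℚ.* ρ l ℚ.+ M l
      0≤M-ρ = subst (0ℚ ℚ.≤_) (quotient l (ℚ.- 1ℚ) (M l)) (0≤-* (upper l zero) (0≤x⁻¹ l zero))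
      identity₁ : ∀ a b → b ≡ a ℚ.+ b ℚ.- a
      identity₁ = solve 2 (λ a b → b := a :+ b :- a) refl
      identity₂ : ∀ κ ρ m M → (1ℚ ℚ.- κ) ℚ.* (ρ ℚ.- m) ℚ.+ ((ℚ.- 1ℚ) ℚ.* ρ ℚ.+ M) ≡ (M ℚ.- m) ℚ.- κ ℚ.* (ρ ℚ.- m)
      identity₂ = solve 4 (λ κ ρ m M → (con 1ℚ :- κ) :* (ρ :- m) :+ ((:- con 1ℚ) :* ρ :+ M) := (M :- m) :- κ :* (ρ :- m)) refl

  -- The bracket of `P` controls how far the normalised iterates move, and the bracket of `T`
  -- produces the eigenvalue.
  module BP = Bracket P P-linear (λ _ _ → refl) 1ℚ C (λ i → P-reach (λ _ → 1ℚ) (λ _ → ℚ.<⇒≤ 0<1) i i) P1≤C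
  module BT = Bracket T T-linear T-P-comm 0ℚ c 0≤T1 T1≤c

  -- Normalisation by an arbitrary coordinate: the limit of `f l j i` is then the inverse of that of
  -- `f l i j`, and no reciprocal of a real has to be formed.
  f : ∀ l i j → ℚ
  f l i j = x l i ℚ.* x⁻¹ l j

  0≤f : ∀ l i j → 0ℚ ℚ.≤ f l i j
  0≤f l i j = 0≤-* (ℚ.<⇒≤ (0<x l i)) (0≤x⁻¹ l j)

  f*x : ∀ l i j → f l i j ℚ.* x l j ≡ x l i
  f*x l i j = trans (solve 3 (λ x y z → (x :* y) :* z := z :* (y :* x)) refl (x l i) (x⁻¹ l j) (x l j)) (*-*-inv (0<x l j) (x l i))

  -- The product of X with the difference is `x (suc l) i` minus `f l i j` times X. Both of these
  -- lie between the multiples of `x l i` by `BP.m l` and `BP.M l`, since `f l i j` times `x l j` is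
  -- `x l i`.
  f-difference : ∀ l i j → let g = BP.M l ℚ.- BP.m l ; X = x (suc l) j in
    X ℚ.* (f (suc l) i j ℚ.- f l i j) ℚ.≤ g ℚ.* x l i × X ℚ.* ℚ.- (f (suc l) i j ℚ.- f l i j) ℚ.≤ g ℚ.* x l i
  f-difference l i j =
      0≤q-p⇒p≤q (subst (0ℚ ℚ.≤_)
        (trans (identity₁ (BP.m l) (BP.M l) (x (suc l) i) (x (suc l) j) (x l i) (x l j) φ)
          (trans (cong (λ z → (BP.M l ℚ.* x l i ℚ.- BP.m l ℚ.* z) ℚ.- (x (suc l) i ℚ.- x (suc l) j ℚ.* φ)) (f*x l i j))
          (trans (cong (λ z → (BP.M l ℚ.* x l i ℚ.- BP.m l ℚ.* x l i) ℚ.- (z ℚ.- x (suc l) j ℚ.* φ)) (sym (f*x (suc l) i j)))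
            (identity₃ (BP.m l) (BP.M l) (x (suc l) j) (x l i) φ φ′))))
        (0≤-+ (BP.upper l i) (0≤-* (0≤f l i j) (BP.lower l j))))
    , 0≤q-p⇒p≤q (subst (0ℚ ℚ.≤_)
        (trans (identity₂ (BP.m l) (BP.M l) (x (suc l) i) (x (suc l) j) (x l i) (x l j) φ)
          (trans (cong (λ z → (BP.M l ℚ.* z ℚ.- BP.m l ℚ.* x l i) ℚ.- (x (suc l) j ℚ.* φ ℚ.- x (suc l) i)) (f*x l i j))
          (trans (cong (λ z → (BP.M l ℚ.* x l i ℚ.- BP.m l ℚ.* x l i) ℚ.- (x (suc l) j ℚ.* φ ℚ.- z)) (sym (f*x (suc l) i j)))
            (identity₄ (BP.m l) (BP.M l) (x (suc l) j) (x l i) φ φ′))))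
        (0≤-+ (BP.lower l i) (0≤-* (0≤f l i j) (BP.upper l j))))
    where
    φ φ′ : ℚ
    φ = f l i j
    φ′ = f (suc l) i j
    identity₁ : ∀ m M Y X p q f → (ℚ.- 1ℚ ℚ.* Y ℚ.+ M ℚ.* p) ℚ.+ f ℚ.* (1ℚ ℚ.* X ℚ.+ (ℚ.- m) ℚ.* q) ≡ (M ℚ.* p ℚ.- m ℚ.* (f ℚ.* q)) ℚ.- (Y ℚ.- X ℚ.* f)
    identity₁ = solve 7 (λ m M Y X p q f → (:- con 1ℚ :* Y :+ M :* p) :+ f :* (con 1ℚ :* X :+ (:- m) :* q) := (M :* p :- m :* (f :* q)) :- (Y :- X :* f)) refl
    identity₂ : ∀ m M Y X p q f → (1ℚ ℚ.* Y ℚ.+ (ℚ.- m) ℚ.* p) ℚ.+ f ℚ.* (ℚ.- 1ℚ ℚ.* X ℚ.+ M ℚ.* q) ≡ (M ℚ.* (f ℚ.* q) ℚ.- m ℚ.* p) ℚ.- (X ℚ.* f ℚ.- Y)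
    identity₂ = solve 7 (λ m M Y X p q f → (con 1ℚ :* Y :+ (:- m) :* p) :+ f :* (:- con 1ℚ :* X :+ M :* q) := (M :* (f :* q) :- m :* p) :- (X :* f :- Y)) refl
    identity₃ : ∀ m M X p f f′ → (M ℚ.* p ℚ.- m ℚ.* p) ℚ.- (f′ ℚ.* X ℚ.- X ℚ.* f) ≡ (M ℚ.- m) ℚ.* p ℚ.- X ℚ.* (f′ ℚ.- f)
    identity₃ = solve 6 (λ m M X p f f′ → (M :* p :- m :* p) :- (f′ :* X :- X :* f) := (M :- m) :* p :- X :* (f′ :- f)) refl
    identity₄ : ∀ m M X p f f′ → (M ℚ.* p ℚ.- m ℚ.* p) ℚ.- (X ℚ.* f ℚ.- f′ ℚ.* X) ≡ (M ℚ.- m) ℚ.* p ℚ.- X ℚ.* ℚ.- (f′ ℚ.- f)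
    identity₄ = solve 6 (λ m M X p f f′ → (M :* p :- m :* p) :- (X :* f :- f′ :* X) := (M :- m) :* p :- X :* :- (f′ :- f)) refl

  f-step : ∀ i j l → ℚ.∣ f (suc l) i j ℚ.- f l i j ∣ ℚ.≤ (C ℚ.* (C ℚ.- 1ℚ)) ℚ.* pow θ l
  f-step i j l = subst (ℚ.∣ f (suc l) i j ℚ.- f l i j ∣ ℚ.≤_)
      (trans (cong (C ℚ.*_) (BP.gap l)) (sym (ℚ.*-assoc C (C ℚ.- 1ℚ) (pow θ l))))
      (∣∣≤-intro (cancel (proj₁ (f-difference l i j))) (cancel (proj₂ (f-difference l i j))))
    where
    g : ℚ
    g = BP.M l ℚ.- BP.m l
    gx≤ : g ℚ.* x l i ℚ.≤ x (suc l) j ℚ.* (C ℚ.* g)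
    gx≤ = subst (g ℚ.* x l i ℚ.≤_) (solve 3 (λ g C X → g :* (C :* X) := X :* (C :* g)) refl g C (x (suc l) j))
      (*-monoʳ-≤ g (BP.0≤gap l) (ℚ.≤-trans (harnack l i j) (*-monoʳ-≤ C 0≤C (x-increasing l j j))))
    cancel : ∀ {d} → x (suc l) j ℚ.* d ℚ.≤ g ℚ.* x l i → d ℚ.≤ C ℚ.* g
    cancel le = ℚ.*-cancelˡ-≤-pos (x (suc l) j) {{ℚ.positive (0<x (suc l) j)}} (ℚ.≤-trans le gx≤)

  ratio : Fin (suc k) → Fin (suc k) → ℝ
  ratio i j = mkℝ (λ l → f l i j) (geometric⇒cauchy (C ℚ.* (C ℚ.- 1ℚ)) (0≤-* 0≤C (p≤q⇒0≤q-p 1≤C)) (λ l → f l i j) (f-step i j))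

  eigenvalue : ℝ
  eigenvalue = mkℝ BT.m (geometric⇒cauchy (c ℚ.- 0ℚ) BT.0≤M₀-m₀ BT.m BT.m-step)

  ratio-inverse : ∀ i j l → f l i j ℚ.* f l j i ≡ 1ℚ
  ratio-inverse i j l = trans (identity (x l i) (x⁻¹ l j) (x l j) (x⁻¹ l i))
    (trans (cong₂ ℚ._*_ (*-inv (0<x l i)) (*-inv (0<x l j))) (ℚ.*-identityˡ 1ℚ))
    where
    identity : ∀ a b c d → (a ℚ.* b) ℚ.* (c ℚ.* d) ≡ (a ℚ.* d) ℚ.* (c ℚ.* b)
    identity = solve 4 (λ a b c d → (a :* b) :* (c :* d) := (a :* d) :* (c :* b)) refl

  f≤C : ∀ l i j → f l i j ℚ.≤ C
  f≤C l i j = ℚ.*-cancelʳ-≤-pos (x l j) {{ℚ.positive (0<x l j)}} (subst (ℚ._≤ C ℚ.* x l j) (sym (f*x l i j)) (harnack l i j))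

  1≤C*f : ∀ l i j → 1ℚ ℚ.≤ C ℚ.* f l i j
  1≤C*f l i j = subst (ℚ._≤ C ℚ.* f l i j) (ratio-inverse j i l)
    (ℚ.*-monoʳ-≤-nonNeg (f l i j) {{ℚ.nonNegative (0≤f l i j)}} (f≤C l j i))

  -- After division by `x l zero` the bracket of `T` places the residue between 0 and the gap times
  -- `f l i zero`, and this factor is at most `C`.
  eigen-residue : ∀ i ε → 0ℚ ℚ.< ε → ∃[ N ] (∀ l → N ≤ l → ℚ.∣ T (x l) i ℚ.* x⁻¹ l zero ℚ.- BT.m l ℚ.* f l i zero ∣ ℚ.< ε)
  eigen-residue i ε 0<ε = eventually-map bounded (pow-small (C ℚ.* (c ℚ.- 0ℚ)) (0≤-* 0≤C BT.0≤M₀-m₀) ε 0<ε)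
    where
    residue : ℕ → ℚ
    residue l = T (x l) i ℚ.* x⁻¹ l zero ℚ.- BT.m l ℚ.* f l i zero
    identity₁ : ∀ t m x y → (1ℚ ℚ.* t ℚ.+ (ℚ.- m) ℚ.* x) ℚ.* y ≡ t ℚ.* y ℚ.- m ℚ.* (x ℚ.* y)
    identity₁ = solve 4 (λ t m x y → (con 1ℚ :* t :+ (:- m) :* x) :* y := t :* y :- m :* (x :* y)) refl
    identity₂ : ∀ t M m x y → ((ℚ.- 1ℚ) ℚ.* t ℚ.+ M ℚ.* x) ℚ.* y ≡ (x ℚ.* y) ℚ.* (M ℚ.- m) ℚ.- (t ℚ.* y ℚ.- m ℚ.* (x ℚ.* y))
    identity₂ = solve 5 (λ t M m x y → ((:- con 1ℚ) :* t :+ M :* x) :* y := (x :* y) :* (M :- m) :- (t :* y :- m :* (x :* y))) refl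
    bounded : ∀ l → (C ℚ.* (c ℚ.- 0ℚ)) ℚ.* pow θ l ℚ.< ε → ℚ.∣ residue l ∣ ℚ.< ε
    bounded l small = ℚ.≤-<-trans (ℚ.≤-trans
      (subst (ℚ._≤ f l i zero ℚ.* (BT.M l ℚ.- BT.m l))
        (sym (ℚ.0≤p⇒∣p∣≡p (subst (0ℚ ℚ.≤_) (identity₁ (T (x l) i) (BT.m l) (x l i) (x⁻¹ l zero)) (0≤-* (BT.lower l i) (0≤x⁻¹ l zero)))))
        (0≤q-p⇒p≤q (subst (0ℚ ℚ.≤_) (identity₂ (T (x l) i) (BT.M l) (BT.m l) (x l i) (x⁻¹ l zero)) (0≤-* (BT.upper l i) (0≤x⁻¹ l zero)))))
      (subst (f l i zero ℚ.* (BT.M l ℚ.- BT.m l) ℚ.≤_) (trans (cong (C ℚ.*_) (BT.gap l)) (sym (ℚ.*-assoc C (c ℚ.- 0ℚ) (pow θ l))))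
        (ℚ.*-monoʳ-≤-nonNeg _ {{ℚ.nonNegative (BT.0≤gap l)}} (f≤C l i zero)))) small

-- The Perron eigenvector of a nonnegative matrix

module ℚΣ = SemiringSum (CommutativeRing.semiring ℚ.+-*-commutativeRing)
module ℝΣ = SemiringSum ℝR.semiring

sumℚ-nonneg : ∀ {n} (t : Fin n → ℚ) → (∀ i → 0ℚ ℚ.≤ t i) → 0ℚ ℚ.≤ ℚΣ.sum t
sumℚ-nonneg {zero}  t 0≤t = ℚ.≤-refl
sumℚ-nonneg {suc n} t 0≤t = 0≤-+ (0≤t zero) (sumℚ-nonneg (t ∘ suc) (0≤t ∘ suc))

term≤sumℚ : ∀ {n} (t : Fin n → ℚ) → (∀ i → 0ℚ ℚ.≤ t i) → ∀ i → t i ℚ.≤ ℚΣ.sum t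
term≤sumℚ {suc n} t 0≤t zero = subst (ℚ._≤ ℚΣ.sum t) (ℚ.+-identityʳ (t zero))
  (ℚ.+-monoʳ-≤ (t zero) (sumℚ-nonneg (t ∘ suc) (0≤t ∘ suc)))
term≤sumℚ {suc n} t 0≤t (suc i) = ℚ.≤-trans (term≤sumℚ (t ∘ suc) (0≤t ∘ suc) i)
  (subst (ℚ._≤ ℚΣ.sum t) (ℚ.+-identityˡ _) (ℚ.+-monoˡ-≤ (ℚΣ.sum (t ∘ suc)) (0≤t zero)))

seq-sum : ∀ {n} (t : Fin n → ℝ) l → seq (ℝΣ.sum t) l ≡ ℚΣ.sum (λ j → seq (t j) l)
seq-sum {zero}  t l = refl
seq-sum {suc n} t l = trans (seq-+ (t zero) (ℝΣ.sum (t ∘ suc)) l) (cong (seq (t zero) l ℚ.+_) (seq-sum (t ∘ suc) l))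

opaque
  unfolding Pos

  Pos-intro : ∀ {y δ} → 0ℚ ℚ.< δ → (∀ l → δ ℚ.≤ seq y l) → Pos y
  Pos-intro {y} {δ} 0<δ le = δ , 0<δ , 0 , λ l _ → le l

apply : ∀ {n} → (Fin n → Fin n → ℚ) → (Fin n → ℚ) → Fin n → ℚ
apply B w i = ℚΣ.sum (λ j → B i j ℚ.* w j)

iterate : ∀ {A : Set} → (A → A) → ℕ → A → A
iterate T zero    w = w
iterate T (suc N) w = T (iterate T N w)

record PerronVector {n : ℕ} (B : Fin n → Fin n → ℚ) : Set where
  field
    σ      : ℝ
    v v⁻¹  : Fin n → ℝ
    v-pos  : ∀ i → Pos (v i)
    v-inv  : ∀ i → v i *ʳ v⁻¹ i ≈ 1ℝ
    eigen  : ∀ i → ℝΣ.sum (λ j → fromℚ (B i j) *ʳ v j) ≈ σ *ʳ v i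

module _ {n : ℕ} (B : Fin n → Fin n → ℚ) where

  apply-linear : Linear (apply B)
  apply-linear = record
    { ext = λ eq i → ℚΣ.sum-cong-≗ λ j → cong (B i j ℚ.*_) (eq j)
    ; lin = λ a b u v i → trans
        (ℚΣ.sum-cong-≗ λ j → identity (B i j) a b (u j) (v j))
        (trans (ℚΣ.∑-distrib-+ (λ j → a ℚ.* (B i j ℚ.* u j)) (λ j → b ℚ.* (B i j ℚ.* v j)))
          (sym (cong₂ ℚ._+_ (ℚΣ.*-distribˡ-sum a (λ j → B i j ℚ.* u j)) (ℚΣ.*-distribˡ-sum b (λ j → B i j ℚ.* v j))))) }
    where
    open +-*-Solver
    identity : ∀ B a b u v → B ℚ.* (a ℚ.* u ℚ.+ b ℚ.* v) ≡ a ℚ.* (B ℚ.* u) ℚ.+ b ℚ.* (B ℚ.* v)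
    identity = solve 5 (λ B a b u v → B :* (a :* u :+ b :* v) := a :* (B :* u) :+ b :* (B :* v)) refl

  iterate-linear : ∀ N → Linear (iterate (apply B) N)
  iterate-linear zero = record { ext = λ eq → eq ; lin = λ _ _ _ _ _ → refl }
  iterate-linear (suc N) = record
    { ext = λ eq → Linear.ext apply-linear (Linear.ext (iterate-linear N) eq)
    ; lin = λ a b u v i → trans (Linear.ext apply-linear (Linear.lin (iterate-linear N) a b u v) i)
        (Linear.lin apply-linear a b (iterate (apply B) N u) (iterate (apply B) N v) i) }

  iterate-comm : ∀ N w i → apply B (iterate (apply B) N w) i ≡ iterate (apply B) N (apply B w) i
  iterate-comm zero    w i = refl
  iterate-comm (suc N) w i = Linear.ext apply-linear (iterate-comm N w) i

perron : ∀ {k} (B : Fin (suc k) → Fin (suc k) → ℚ) → (∀ i j → 0ℚ ℚ.≤ B i j) → (N : ℕ) →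
  (∀ w → (∀ i → 0ℚ ℚ.≤ w i) → ∀ i j → w j ℚ.≤ iterate (apply B) N w i) → PerronVector B
perron {k} B 0≤B N reach = record
  { σ = eigenvalue ; v = λ i → ratio i zero ; v⁻¹ = λ i → ratio zero i
  ; v-pos = λ i → Pos-intro (0<inv 0<C) λ l →
      subst₂ ℚ._≤_ (ℚ.*-identityʳ (inv 0<C)) (trans (sym (ℚ.*-assoc (inv 0<C) C (f l i zero)))
        (trans (cong (ℚ._* f l i zero) (trans (ℚ.*-comm (inv 0<C) C) (*-inv 0<C))) (ℚ.*-identityˡ (f l i zero))))
        (*-monoʳ-≤ (inv 0<C) (ℚ.<⇒≤ (0<inv 0<C)) (1≤C*f l i zero))
  ; v-inv = λ i → pointwise-≈ λ l → trans (seq-* (ratio i zero) (ratio zero i) l) (ratio-inverse i zero l)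
  ; eigen = λ i → ≈ᴰ⇒≈ λ ε 0<ε → eventually-map
      (λ l → subst (λ z → ℚ.∣ z ∣ ℚ.< ε) (cong₂ ℚ._-_ (sym (lhs i l)) (sym (seq-* eigenvalue (ratio i zero) l))))
      (eigen-residue i ε 0<ε) }
  where
  op P : (Fin (suc k) → ℚ) → Fin (suc k) → ℚ
  op = apply B
  P = iterate op N
  0≤1 : 0ℚ ℚ.≤ 1ℚ
  0≤1 = ℚ.<⇒≤ (ℚ.positive⁻¹ 1ℚ)
  0≤op1 : ∀ i → 0ℚ ℚ.≤ op (λ _ → 1ℚ) i
  0≤op1 i = sumℚ-nonneg (λ j → B i j ℚ.* 1ℚ) λ j → 0≤-* (0≤B i j) 0≤1
  0≤P1 : ∀ i → 0ℚ ℚ.≤ P (λ _ → 1ℚ) i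
  0≤P1 i = ℚ.≤-trans 0≤1 (reach (λ _ → 1ℚ) (λ _ → 0≤1) i i)
  C : ℚ
  -- The sum of all entries of the matrix of `P`, a common bound of its row sums.
  C = ℚΣ.sum (P (λ _ → 1ℚ))
  open PowerIteration P op (iterate-linear B N) (apply-linear B) reach (iterate-comm B N)
    C (term≤sumℚ (P (λ _ → 1ℚ)) 0≤P1) (ℚΣ.sum (op (λ _ → 1ℚ))) 0≤op1 (term≤sumℚ (op (λ _ → 1ℚ)) 0≤op1)
  0<C : 0ℚ ℚ.< C
  0<C = ℚ.<-≤-trans 0<1 1≤C
  lhs : ∀ i l → seq (ℝΣ.sum (λ j → fromℚ (B i j) *ʳ ratio j zero)) l ≡ op (x l) i ℚ.* x⁻¹ l zero
  lhs i l = trans (seq-sum (λ j → fromℚ (B i j) *ʳ ratio j zero) l)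
    (trans (ℚΣ.sum-cong-≗ λ j → trans (seq-* (fromℚ (B i j)) (ratio j zero) l) (sym (ℚ.*-assoc (B i j) (x l j) (x⁻¹ l zero))))
      (sym (ℚΣ.*-distribʳ-sum (x⁻¹ l zero) (λ j → B i j ℚ.* x l j))))

module ℕΣ = SemiringSum ℕ.+-*-semiring

sum-mono : ∀ {n} {f g : Fin n → ℕ} → (∀ i → f i ≤ g i) → ℕΣ.sum f ≤ ℕΣ.sum g
sum-mono {zero}  le = z≤n
sum-mono {suc n} le = ℕ.+-mono-≤ (le zero) (sum-mono (le ∘ suc))

sum-mono-< : ∀ {n} {f g : Fin n → ℕ} → (∀ i → f i ≤ g i) → ∀ k → f k < g k → ℕΣ.sum f < ℕΣ.sum g
sum-mono-< {suc n} le zero    lt = ℕ.+-mono-<-≤ lt (sum-mono (le ∘ suc))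
sum-mono-< {suc n} le (suc k) lt = ℕ.+-mono-≤-< (le zero) (sum-mono-< (le ∘ suc) k lt)

sum-ones : ∀ n → ℕΣ.sum {n} (λ _ → 1) ≡ n
sum-ones zero    = refl
sum-ones (suc n) = cong suc (sum-ones n)

χ≤1 : ∀ {P : Set} (d : Dec P) → χ d ≤ 1
χ≤1 (yes _) = ℕ.≤-refl
χ≤1 (no _)  = z≤n

-- Numberings of finite sets

-- A bijection between `Fin n` and the numbers below `n`. Since `at` is total, with arbitrary values
-- from `n` on, graphs become arrays on ℕ and sums over initial segments carry no bounds in their
-- indices.
record Numbering (n : ℕ) : Set where
  field
    at     : ℕ → Fin n
    pos    : Fin n → ℕ
    pos<n  : ∀ v → pos v < n
    at-pos : ∀ v → at (pos v) ≡ v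
    pos-at : ∀ i → i < n → pos (at i) ≡ i

  toPermutation : Permutation n n
  toPermutation = permutation (λ i → at (toℕ i)) (λ v → fromℕ< (pos<n v))
    (λ v → trans (cong at (Fin.toℕ-fromℕ< (pos<n v))) (at-pos v))
    (λ i → Fin.toℕ-injective (trans (Fin.toℕ-fromℕ< _) (pos-at (toℕ i) (Fin.toℕ<n i))))

  sum-at : ∀ (φ : Fin n → ℕ) → ℕΣ.sum φ ≡ ∑ n (φ ∘ at)
  sum-at φ = trans (ℕΣ.sum-permute φ toPermutation) (sum≈∑ n _ (φ ∘ at) λ _ → refl)

  sum-atʳ : ∀ (φ : Fin n → ℝ) → ℝΣ.sum φ ≈ ∑ʳ n (φ ∘ at)
  sum-atʳ φ = ≈-trans (ℝΣ.sum-permute φ toPermutation) (Σʳ.sum≈∑ n _ (φ ∘ at) λ _ → ≈-refl)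

module _ {n : ℕ} {_≺_ : Rel (Fin n) 0ℓ} (sto : IsStrictTotalOrder _≡_ _≺_) where
  private
    module O = IsStrictTotalOrder sto

  rank : Fin n → ℕ
  rank v = ℕΣ.sum (λ u → χ (u O.<? v))

  rank-mono : ∀ {u v} → u ≺ v → rank u < rank v
  rank-mono {u} {v} u≺v = sum-mono-< le u
      (subst₂ _<_ (sym (χ-no (u O.<? u) (O.irrefl refl))) (sym (χ-yes (u O.<? v) u≺v)) (s≤s z≤n))
    where
    le : ∀ w → χ (w O.<? u) ≤ χ (w O.<? v)
    le w with w O.<? u
    ... | no _    = z≤n
    ... | yes w≺u = ℕ.≤-reflexive (sym (χ-yes (w O.<? v) (O.trans w≺u u≺v)))

  rank<n : ∀ v → rank v < n
  rank<n v = subst (rank v <_) (sum-ones n) (sum-mono-< (λ w → χ≤1 (w O.<? v)) v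
    (subst (_< 1) (sym (χ-no (v O.<? v) (O.irrefl refl))) (s≤s z≤n)))

  rank-injective : ∀ {u v} → rank u ≡ rank v → u ≡ v
  rank-injective {u} {v} eq with O.compare u v
  ... | tri< u≺v _ _ = contradiction eq (ℕ.<⇒≢ (rank-mono u≺v))
  ... | tri≈ _ u≡v _ = u≡v
  ... | tri> _ _ v≺u = contradiction (sym eq) (ℕ.<⇒≢ (rank-mono v≺u))

  rank-surjective : ∀ i → i < n → ∃[ v ] rank v ≡ i
  rank-surjective i i<n = hit n rank rank<n rank-injective i i<n
    where
    hit : ∀ n (r : Fin n → ℕ) → (∀ v → r v < n) → (∀ {u v} → r u ≡ r v → u ≡ v) → ∀ i → i < n → ∃[ v ] r v ≡ i
    hit (suc n) r r<n r-inj i i<n with Fin.any? (λ v → r v ℕ.≟ i)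
    ... | yes found = found
    ... | no none = ⊥-elim (ℕ.<-irrefl refl (Fin.injective⇒≤ {f = g} g-inj))
      where
      avoid : ∀ v → fromℕ< i<n ≢ fromℕ< (r<n v)
      avoid v eq = none (v , sym (Fin.fromℕ<-injective i (r v) i<n (r<n v) eq))
      g : Fin (suc n) → Fin n
      g v = punchOut (avoid v)
      g-inj : ∀ {u v} → g u ≡ g v → u ≡ v
      g-inj {u} {v} eq = r-inj (Fin.fromℕ<-injective (r u) (r v) (r<n u) (r<n v) (Fin.punchOut-injective (avoid u) (avoid v) eq))

  opaque
    numbering : Fin n → Numbering n
    numbering v₀ = record
      { at = at ; pos = rank ; pos<n = rank<n
      ; at-pos = λ v → rank-injective (rank-at (rank v) (rank<n v)) ; pos-at = rank-at }
      where
      at : ℕ → Fin n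
      at i with i ℕ.<? n
      ... | yes i<n = proj₁ (rank-surjective i i<n)
      ... | no _    = v₀
      rank-at : ∀ i → i < n → rank (at i) ≡ i
      rank-at i i<n with i ℕ.<? n
      ... | yes i<n′ = proj₂ (rank-surjective i i<n′)
      ... | no ¬i<n  = contradiction i<n ¬i<n

    numbering-mono : ∀ v₀ {u v} → u ≺ v → Numbering.pos (numbering v₀) u < Numbering.pos (numbering v₀) v
    numbering-mono _ = rank-mono

-- Edge counts of adjacency arrays

∑-δ : ∀ n {v} (f : ℕ → ℕ) → v < n → ∑ n (λ i → χ (v ℕ.≟ i) * f i) ≡ f v
∑-δ (suc n) {v} f v<1+n with v ℕ.≟ n
... | yes refl = trans (cong₂ _+_ (∑-zero n λ i i<n → cong (_* f i) (χ-no (v ℕ.≟ i) λ { refl → ℕ.<-irrefl refl i<n })) (ℕ.+-identityʳ (f v))) refl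
... | no v≢n = trans (ℕ.+-identityʳ _) (∑-δ n f (ℕ.≤∧≢⇒< (s≤s⁻¹ v<1+n) v≢n))

record IsAdjacency (n : ℕ) (a : ℕ → ℕ → ℕ) : Set where
  field
    a≤1    : ∀ i j → a i j ≤ 1
    a-sym  : ∀ i j → a i j ≡ a j i
    a-diag : ∀ i → a i i ≡ 0

module EdgeCount {n : ℕ} {a : ℕ → ℕ → ℕ} (adjacency : IsAdjacency n a) where
  open IsAdjacency adjacency

  -- For an indicator `s` this is twice the number of edges inside the set, as ordered pairs are
  -- counted.
  edges : (ℕ → ℕ) → ℕ
  edges s = ∑ n λ u → s u * ∑ n λ w → s w * a u w

  edges-cong : ∀ {s t} → (∀ i → i < n → s i ≡ t i) → edges s ≡ edges t
  edges-cong eq = ∑-cong n λ u u<n → cong₂ _*_ (eq u u<n) (∑-cong n λ w w<n → cong (_* a u w) (eq w w<n))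

  edges-insert : ∀ s v → v < n → edges (λ i → s i + χ (v ℕ.≟ i)) ≡ edges s + 2 * ∑ n (λ w → s w * a v w)
  edges-insert s v v<n = begin
    (∑ n λ u → (s u + χ (v ℕ.≟ u)) * ∑ n (λ w → (s w + χ (v ℕ.≟ w)) * a u w))
      ≡⟨ ∑-cong n (λ u _ → trans (cong ((s u + χ (v ℕ.≟ u)) *_) (inner u)) (ℕ.*-distribʳ-+ (r u + a u v) (s u) (χ (v ℕ.≟ u)))) ⟩
    (∑ n λ u → s u * (r u + a u v) + χ (v ℕ.≟ u) * (r u + a u v))
      ≡⟨ ∑-+ n (λ u → s u * (r u + a u v)) (λ u → χ (v ℕ.≟ u) * (r u + a u v)) ⟩
    ∑ n (λ u → s u * (r u + a u v)) + ∑ n (λ u → χ (v ℕ.≟ u) * (r u + a u v))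
      ≡⟨ cong₂ _+_ (trans (∑-cong n λ u _ → ℕ.*-distribˡ-+ (s u) (r u) (a u v)) (∑-+ n (λ u → s u * r u) (λ u → s u * a u v)))
           (∑-δ n (λ u → r u + a u v) v<n) ⟩
    (edges s + ∑ n (λ u → s u * a u v)) + (r v + a v v)
      ≡⟨ cong₂ (λ p q → (edges s + p) + (r v + q)) (∑-cong n λ u _ → cong (s u *_) (a-sym u v)) (a-diag v) ⟩
    (edges s + r v) + (r v + 0)
      ≡⟨ ℕ.+-assoc (edges s) (r v) (r v + 0) ⟩
    edges s + 2 * r v ∎
    where
    open ≡-Reasoning
    r : ℕ → ℕ
    r u = ∑ n λ w → s w * a u w
    inner : ∀ u → ∑ n (λ w → (s w + χ (v ℕ.≟ w)) * a u w) ≡ r u + a u v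
    inner u = trans (∑-cong n λ w _ → ℕ.*-distribʳ-+ (a u w) (s w) (χ (v ℕ.≟ w)))
      (trans (∑-+ n (λ w → s w * a u w) (λ w → χ (v ℕ.≟ w) * a u w)) (cong (λ z → r u + z) (∑-δ n (a u) v<n)))

  -- Ordered adjacent pairs between two initial segments; edges inside the smaller one count twice.
  e : ℕ → ℕ → ℕ
  e j k = ∑ j λ x → ∑ k λ y → a x y

  e-sym : ∀ j k → e j k ≡ e k j
  e-sym j k = trans (∑-swap j k a) (∑-cong k λ y _ → ∑-cong j λ x _ → a-sym x y)

  e-suc : ∀ j → e (suc j) (suc j) ≡ e j j + 2 * ∑ j (λ x → a x j)
  e-suc j = begin
    ∑ j (λ x → ∑ j (a x) + a x j) + (∑ j (a j) + a j j)
      ≡⟨ cong₂ _+_ (∑-+ j (λ x → ∑ j (a x)) (λ x → a x j)) (cong (λ z → ∑ j (a j) + z) (a-diag j)) ⟩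
    (e j j + ∑ j (λ x → a x j)) + (∑ j (a j) + 0)
      ≡⟨ cong (λ z → (e j j + ∑ j (λ x → a x j)) + (z + 0)) (∑-cong j λ x _ → a-sym j x) ⟩
    (e j j + ∑ j (λ x → a x j)) + (∑ j (λ x → a x j) + 0)
      ≡⟨ ℕ.+-assoc (e j j) (∑ j (λ x → a x j)) (∑ j (λ x → a x j) + 0) ⟩
    e j j + 2 * ∑ j (λ x → a x j) ∎
    where open ≡-Reasoning

  e-sum : ∀ k → e k k ≡ 2 * ∑ k (λ i → ∑ i (λ x → a x i))
  e-sum zero    = refl
  e-sum (suc k) = trans (e-suc k) (trans (cong (_+ 2 * ∑ k (λ x → a x k)) (e-sum k))
    (sym (ℕ.*-distribˡ-+ 2 (∑ k (λ i → ∑ i (λ x → a x i))) (∑ k (λ x → a x k)))))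

  edges-prefix : ∀ {j} → j ≤ n → edges (λ i → χ (i ℕ.<? j)) ≡ e j j
  edges-prefix {j} j≤n = trans (∑-χ-< n (λ u → ∑ n λ w → χ (w ℕ.<? j) * a u w) j≤n) (∑-cong j λ u _ → ∑-χ-< n (a u) j≤n)

  -- The right side exceeds the left by the ordered adjacent pairs inside the positions from `j` to
  -- j + t - 1. This reduces bounds for rectangles to bounds for squares.
  e-convex : ∀ j t → e j (j + t) + e j (j + t) ≤ e j j + e (j + t) (j + t)
  e-convex j zero    = ℕ.≤-reflexive (cong₂ _+_ (cong (e j) (ℕ.+-identityʳ j)) (cong (λ k → e k (j + 0)) (sym (ℕ.+-identityʳ j))))
  e-convex j (suc t) = subst (λ k → e j k + e j k ≤ e j j + e k k) (sym (ℕ.+-suc j t)) (begin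
    e j (suc k) + e j (suc k)                          ≡⟨ cong₂ _+_ split split ⟩
    (e j k + c) + (e j k + c)                          ≡⟨ solve 2 (λ x y → (x :+ y) :+ (x :+ y) := (x :+ x) :+ con 2 :* y) refl (e j k) c ⟩
    (e j k + e j k) + 2 * c                            ≤⟨ ℕ.+-mono-≤ (e-convex j t) (ℕ.*-monoʳ-≤ 2 (∑-mono-range (λ x → a x k) (ℕ.m≤m+n j t))) ⟩
    (e j j + e k k) + 2 * ∑ k (λ x → a x k)            ≡⟨ ℕ.+-assoc (e j j) (e k k) _ ⟩
    e j j + (e k k + 2 * ∑ k (λ x → a x k))            ≡⟨ cong (λ z → e j j + z) (e-suc k) ⟨
    e j j + e (suc k) (suc k)                          ∎)
    where
    open ℕ.≤-Reasoning
    open ℕ-Solver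
    k c : ℕ
    k = j + t
    c = ∑ j (λ x → a x k)
    split : e j (suc k) ≡ e j k + c
    split = ∑-+ j (λ x → ∑ k (a x)) (λ x → a x k)

  module Forest
    (leaf : ∀ (s : ℕ → ℕ) → (∀ i → s i ≤ 1) → ∀ k → k < n → s k ≡ 1 → ∃[ v ] (v < n × s v ≡ 1 × ∑ n (λ w → s w * a v w) ≤ 1)) where

    -- Deleting a vertex with at most one neighbour in the set loses at most one edge; the bound
    -- follows by induction on the size.
    edges-bound : ∀ m s → (∀ i → s i ≤ 1) → ∑ n s ≡ suc m → edges s ≤ 2 * m
    edges-bound m s s≤1 size with ∑-witness n s (subst (1 ≤_) (sym size) (s≤s z≤n))
    ... | k , k<n , 1≤sk with leaf s s≤1 k k<n (ℕ.≤-antisym (s≤1 k) 1≤sk)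
    ... | v , v<n , sv≡1 , degree≤1 = subst (_≤ 2 * m) (sym edges-s) (bound m s′-size)
      where
      s′ : ℕ → ℕ
      s′ i = s i ∸ χ (v ℕ.≟ i)
      s-split : ∀ i → s i ≡ s′ i + χ (v ℕ.≟ i)
      s-split i with v ℕ.≟ i
      ... | no _     = sym (ℕ.+-identityʳ (s i))
      ... | yes refl = trans sv≡1 (cong (λ z → z ∸ 1 + 1) (sym sv≡1))
      edges-s : edges s ≡ edges s′ + 2 * ∑ n (λ w → s′ w * a v w)
      edges-s = trans (edges-cong λ i _ → s-split i) (edges-insert s′ v v<n)
      s′-size : ∑ n s′ ≡ m
      s′-size = ℕ.+-cancelʳ-≡ 1 (∑ n s′) m (trans (cong (λ z → ∑ n s′ + z) (sym (∑-χ-≡ n v<n)))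
        (trans (sym (∑-+ n s′ (λ i → χ (v ℕ.≟ i)))) (trans (sym (∑-cong n λ i _ → s-split i)) (trans size (ℕ.+-comm 1 m)))))
      degree′≤1 : ∑ n (λ w → s′ w * a v w) ≤ 1
      degree′≤1 = ℕ.≤-trans (∑-mono n λ w _ → ℕ.*-monoˡ-≤ (a v w) (ℕ.m∸n≤m (s w) (χ (v ℕ.≟ w)))) degree≤1
      bound : ∀ m → ∑ n s′ ≡ m → edges s′ + 2 * ∑ n (λ w → s′ w * a v w) ≤ 2 * m
      bound zero size′ = ℕ.≤-reflexive (cong₂ (λ p q → p + 2 * q)
          (∑-zero n λ u u<n → cong (_* ∑ n (λ w → s′ w * a u w)) (s′≡0 u u<n)) (∑-zero n λ w w<n → cong (_* a v w) (s′≡0 w w<n)))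
        where
        s′≡0 : ∀ i → i < n → s′ i ≡ 0
        s′≡0 i i<n = ℕ.n≤0⇒n≡0 (subst (s′ i ≤_) size′ (term≤∑ n s′ i<n))
      bound (suc m) size′ = ℕ.≤-trans
        (ℕ.+-mono-≤ (edges-bound m s′ (λ i → ℕ.≤-trans (ℕ.m∸n≤m (s i) (χ (v ℕ.≟ i))) (s≤1 i)) size′) (ℕ.*-monoʳ-≤ 2 degree′≤1))
        (ℕ.≤-reflexive (trans (ℕ.+-comm (2 * m) 2) (sym (ℕ.*-distribˡ-+ 2 1 m))))

    -- The forest bound for the first `j` positions together with one later position, not
    -- necessarily the next. If the segment already has the maximal number of edges, it sends at
    -- most one edge to each later position.
    prefix-bound : ∀ j i → j ≤ i → i < n → e j j + 2 * ∑ j (λ x → a x i) ≤ 2 * j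
    prefix-bound j i j≤i i<n = subst (_≤ 2 * j) edges-eq
        (edges-bound j s s≤1 (trans (∑-+ n (λ x → χ (x ℕ.<? j)) (λ x → χ (i ℕ.≟ x))) (trans (cong₂ _+_ size (∑-χ-≡ n i<n)) (ℕ.+-comm j 1))))
      where
      j≤n : j ≤ n
      j≤n = ℕ.≤-trans j≤i (ℕ.<⇒≤ i<n)
      s : ℕ → ℕ
      s x = χ (x ℕ.<? j) + χ (i ℕ.≟ x)
      s≤1 : ∀ x → s x ≤ 1
      s≤1 x with x ℕ.<? j | i ℕ.≟ x
      ... | yes x<j | yes refl = contradiction j≤i (ℕ.<⇒≱ x<j)
      ... | yes _   | no _     = ℕ.≤-refl
      ... | no _    | yes _    = ℕ.≤-refl
      ... | no _    | no _     = z≤n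
      size : ∑ n (λ x → χ (x ℕ.<? j)) ≡ j
      size = trans (∑-cong n λ x _ → sym (ℕ.*-identityʳ _)) (trans (∑-χ-< n (λ _ → 1) j≤n) (trans (∑-const j 1) (ℕ.*-identityʳ j)))
      edges-eq : edges s ≡ e j j + 2 * ∑ j (λ x → a x i)
      edges-eq = trans (edges-insert (λ x → χ (x ℕ.<? j)) i i<n)
        (cong₂ (λ p q → p + 2 * q) (edges-prefix j≤n) (trans (∑-χ-< n (a i) j≤n) (∑-cong j λ x _ → a-sym i x)))

  module Connectivity
    (crossing : ∀ (s : ℕ → ℕ) → (∀ i → s i ≤ 1) → ∀ k l → k < n → l < n → s k ≡ 1 → s l ≡ 0 →
                ∃₂ λ u v → u < n × v < n × s u ≡ 1 × s v ≡ 0 × a v u ≡ 1) where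

    -- The set grows by the far end of an edge that leaves it, so that each new vertex brings at
    -- least one edge.
    grow : ∀ m → m < n → ∃[ s ] ((∀ i → s i ≤ 1) × ∑ n s ≡ suc m × 2 * m ≤ edges s)
    grow zero 0<n = (λ i → χ (0 ℕ.≟ i)) , (λ i → χ≤1 (0 ℕ.≟ i)) , ∑-χ-≡ n 0<n , z≤n
    grow (suc m) 1+m<n with grow m (ℕ.<⇒≤ 1+m<n)
    ... | s , s≤1 , size , bound
      with ∑-witness n s (subst (1 ≤_) (sym size) (s≤s z≤n))
         | ∑-witness n (λ i → 1 ∸ s i) (co-size)
      where
      co-size : 1 ≤ ∑ n (λ i → 1 ∸ s i)
      co-size = ℕ.+-cancelˡ-≤ (suc m) 1 _ (subst₂ _≤_ (ℕ.+-comm 1 (suc m))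
        (trans (sym (trans (∑-const n 1) (ℕ.*-identityʳ n)))
          (trans (∑-cong n λ i _ → sym (ℕ.m+[n∸m]≡n (s≤1 i))) (trans (∑-+ n s (λ i → 1 ∸ s i)) (cong (_+ ∑ n (λ i → 1 ∸ s i)) size)))) 1+m<n)
    ... | k , k<n , 1≤sk | l , l<n , 1≤1-sl
      with crossing s s≤1 k l k<n l<n (ℕ.≤-antisym (s≤1 k) 1≤sk) (zero-of (s l) 1≤1-sl)
      where
      zero-of : ∀ x → 1 ≤ 1 ∸ x → x ≡ 0
      zero-of zero    _ = refl
      zero-of (suc x) le = contradiction (subst (1 ≤_) (ℕ.0∸n≡0 x) le) λ ()
    ... | u , v , u<n , v<n , su≡1 , sv≡0 , avu≡1 = (λ i → s i + χ (v ℕ.≟ i)) , s′≤1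
      , trans (∑-+ n s (λ i → χ (v ℕ.≟ i))) (trans (cong₂ _+_ size (∑-χ-≡ n v<n)) (ℕ.+-comm (suc m) 1))
      , subst₂ _≤_ (trans (ℕ.+-comm (2 * m) 2) (sym (ℕ.*-distribˡ-+ 2 1 m))) (sym (edges-insert s v v<n))
          (ℕ.+-mono-≤ bound (ℕ.*-monoʳ-≤ 2 (ℕ.≤-trans (ℕ.≤-reflexive (sym (cong₂ _*_ su≡1 avu≡1))) (term≤∑ n (λ w → s w * a v w) u<n))))
      where
      s′≤1 : ∀ i → s i + χ (v ℕ.≟ i) ≤ 1
      s′≤1 i with v ℕ.≟ i
      ... | yes refl = ℕ.≤-reflexive (cong (_+ 1) sv≡0)
      ... | no _     = subst (_≤ 1) (sym (ℕ.+-identityʳ (s i))) (s≤1 i)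

    connected-bound : ∀ m → n ≡ suc m → 2 * m ≤ e n n
    connected-bound m refl with grow m ℕ.≤-refl
    ... | s , s≤1 , size , bound = ℕ.≤-trans bound (ℕ.≤-reflexive (trans (edges-cong full) (edges-prefix ℕ.≤-refl)))
      where
      full : ∀ i → i < n → s i ≡ χ (i ℕ.<? n)
      full i i<n = trans (∑-squeeze n (λ i _ → s≤1 i) (ℕ.≤-reflexive (trans (trans (∑-const n 1) (ℕ.*-identityʳ n)) (sym size))) i i<n)
        (sym (χ-yes (i ℕ.<? n) i<n))

-- Cycles in graphs of minimum degree two

bit : Bool → ℕ
bit b = if b then 1 else 0

bit≤1 : ∀ b → bit b ≤ 1
bit≤1 true  = ℕ.≤-refl
bit≤1 false = z≤n

T⇒bit : ∀ {b} → T b → bit b ≡ 1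
T⇒bit {true} _ = refl

bit⇒T : ∀ {b} → 1 ≤ bit b → T b
bit⇒T {true} _ = _

∣tabulate∣ : ∀ {n} (f : Fin n → Bool) → ∣ tabulate f ∣ ≡ ℕΣ.sum (bit ∘ f)
∣tabulate∣ {zero}  f = refl
∣tabulate∣ {suc n} f with f zero
... | true  = cong suc (∣tabulate∣ (f ∘ suc))
... | false = ∣tabulate∣ (f ∘ suc)

another : ∀ {n} (φ : Fin n → ℕ) → (∀ i → φ i ≤ 1) → 2 ≤ ℕΣ.sum φ → ∀ u → ∃[ w ] (w ≢ u × 1 ≤ φ w)
another φ φ≤1 2≤ u with Fin.any? (λ w → (¬? (w Fin.≟ u)) ×-dec (1 ℕ.≤? φ w))
... | yes found = found
... | no none = contradiction 2≤ (ℕ.<⇒≱ (s≤s (ℕ.≤-trans (sum-mono le) (single u))))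
  where
  le : ∀ w → φ w ≤ χ (u Fin.≟ w)
  le w with u Fin.≟ w
  ... | yes refl = φ≤1 u
  ... | no u≢w   = s≤s⁻¹ (ℕ.≰⇒> λ 1≤ → none (w , u≢w ∘ sym , 1≤))
  single : ∀ {n} (u : Fin n) → ℕΣ.sum (λ w → χ (u Fin.≟ w)) ≤ 1
  single {suc n} zero = ℕ.≤-reflexive (cong suc (zeros n))
    where
    zeros : ∀ n → ℕΣ.sum {n} (λ w → 0) ≡ 0
    zeros zero    = refl
    zeros (suc n) = zeros n
  single {suc n} (suc u) = ℕ.≤-trans (sum-mono λ w → shift w) (single u)
    where
    shift : ∀ w → χ (suc u Fin.≟ suc w) ≤ χ (u Fin.≟ w)
    shift w with u Fin.≟ w
    ... | yes refl = ℕ.≤-refl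
    ... | no _     = z≤n

module _ (G : Graph) where
  open Graph G

  deg≡sum : ∀ v → deg v ≡ ℕΣ.sum (λ w → bit (adj v w))
  deg≡sum v = ∣tabulate∣ (adj v)

  module _ (c : ℕ → V) (c-adj : ∀ i → Adj (c i) (c (suc i))) (c-nonbacktracking : ∀ i → c (2 + i) ≢ c i) where

    -- A closed stretch of the walk either has distinct vertices, so that it is
    -- a cycle, or it contains a shorter closed stretch.
    closed⇒cycle : ∀ g i → c i ≡ c (i + suc g) → Cycle
    closed⇒cycle = <-rec _ step
      where
      step : ∀ g → (∀ {h} → h < g → ∀ i → c i ≡ c (i + suc h) → Cycle) → ∀ i → c i ≡ c (i + suc g) → Cycle
      step g rec i eq with Fin.any? {suc g} (λ y → Fin.any? {suc g} (λ x → (toℕ x ℕ.<? toℕ y) ×-dec (c (i + toℕ x) Fin.≟ c (i + toℕ y))))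
      ... | yes (y , x , x<y , eq′) = rec h<g (i + toℕ x) (trans eq′ (cong c y≡))
        where
        h : ℕ
        h = toℕ y ∸ suc (toℕ x)
        y-split : toℕ y ≡ toℕ x + suc h
        y-split = sym (trans (ℕ.+-suc (toℕ x) h) (ℕ.m+[n∸m]≡n x<y))
        y≡ : i + toℕ y ≡ i + toℕ x + suc h
        y≡ = trans (cong (λ z → i + z) y-split) (sym (ℕ.+-assoc i (toℕ x) (suc h)))
        h<g : h < g
        h<g = ℕ.≤-trans (ℕ.≤-trans (ℕ.m≤n+m (suc h) (toℕ x)) (ℕ.≤-reflexive (sym y-split))) (s≤s⁻¹ (Fin.toℕ<n y))
      ... | no none = record
        { k = g ; 2≤k = 2≤g g eq
        ; c = λ x → c (i + toℕ x)
        ; distinct = distinct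
        ; step = λ x → subst₂ Adj (cong (λ z → c (i + z)) (sym (Fin.toℕ-inject₁ x))) (cong c (sym (ℕ.+-suc i (toℕ x)))) (c-adj (i + toℕ x))
        ; close = subst₂ Adj (cong (λ z → c (i + z)) (sym (Fin.toℕ-fromℕ g)))
            (trans (cong c (sym (ℕ.+-suc i g))) (trans (sym eq) (cong c (sym (ℕ.+-identityʳ i))))) (c-adj (i + g)) }
        where
        2≤g : ∀ g → c i ≡ c (i + suc g) → 2 ≤ g
        2≤g 0 eq = ⊥-elim (subst T (no-loop (c i)) (subst (Adj (c i)) (sym (trans eq (cong c (ℕ.+-comm i 1)))) (c-adj i)))
        2≤g 1 eq = contradiction (sym (trans eq (cong c (ℕ.+-comm i 2)))) (c-nonbacktracking i)
        2≤g (suc (suc g)) eq = s≤s (s≤s z≤n)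
        distinct : ∀ {x y} → c (i + toℕ x) ≡ c (i + toℕ y) → x ≡ y
        distinct {x} {y} eq′ with Fin.<-cmp x y
        ... | tri< x<y _ _ = contradiction (y , x , x<y , eq′) none
        ... | tri≈ _ x≡y _ = x≡y
        ... | tri> _ _ y<x = contradiction (x , y , y<x , sym eq′) none

    walk⇒cycle : Cycle
    walk⇒cycle with Fin.pigeonhole (ℕ.n<1+n order) (λ i → c (toℕ i))
    ... | i , j , i<j , eq = closed⇒cycle (toℕ j ∸ suc (toℕ i)) (toℕ i)
      (trans eq (cong c (sym (trans (ℕ.+-suc (toℕ i) _) (ℕ.m+[n∸m]≡n i<j)))))

  -- If every vertex of the set had two neighbours in it, a walk inside the set could continue
  -- forever without turning back, and a repeated vertex would close a cycle.
  acyclic⇒leaf : ¬ Cycle → ∀ (s : V → ℕ) → (∀ v → s v ≤ 1) → ∀ v₀ → s v₀ ≡ 1 →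
    ∃[ v ] (s v ≡ 1 × ℕΣ.sum (λ w → s w * bit (adj v w)) ≤ 1)
  acyclic⇒leaf acyclic s s≤1 v₀ sv₀ with Fin.any? (λ v → (s v ℕ.≟ 1) ×-dec (ℕΣ.sum (λ w → s w * bit (adj v w)) ℕ.≤? 1))
  ... | yes found = found
  ... | no none = ⊥-elim (acyclic (walk⇒cycle c c-adj c-nonbacktracking))
    where
    State : Set
    State = V × ∃[ v ] (s v ≡ 1)
    next : ∀ u v → s v ≡ 1 → ∃[ w ] (w ≢ u × 1 ≤ s w * bit (adj v w))
    next u v sv = another (λ w → s w * bit (adj v w)) (λ w → ℕ.*-mono-≤ (s≤1 w) (bit≤1 (adj v w)))
      (ℕ.≰⇒> λ le → none (v , sv , le)) u
    step : State → State
    step (u , v , sv) = let w , _ , 1≤ = next u v sv in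
      v , w , ℕ.≤-antisym (s≤1 w) (ℕ.≤-trans 1≤ (ℕ.≤-trans (ℕ.*-monoʳ-≤ (s w) (bit≤1 (adj v w))) (ℕ.≤-reflexive (ℕ.*-identityʳ (s w)))))
    state : ℕ → State
    -- A state is the previous and the current vertex; at the start `v₀` stands in for its own
    -- predecessor.
    state zero    = v₀ , v₀ , sv₀
    state (suc i) = step (state i)
    c : ℕ → V
    c i = proj₁ (proj₂ (state i))
    c-adj : ∀ i → Adj (c i) (c (suc i))
    c-adj i = let u , v , sv = state i
                  w , _ , 1≤ = next u v sv
              in bit⇒T (ℕ.≤-trans 1≤ (ℕ.≤-trans (ℕ.*-monoˡ-≤ (bit (adj v w)) (s≤1 w)) (ℕ.≤-reflexive (ℕ.*-identityˡ _))))
    c-nonbacktracking : ∀ i → c (2 + i) ≢ c i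
    c-nonbacktracking i = let u , v , sv = state (suc i) in proj₁ (proj₂ (next u v sv))

  connected⇒crossing : Connected → ∀ (s : V → ℕ) → (∀ v → s v ≤ 1) → ∀ k l → s k ≡ 1 → s l ≡ 0 →
    ∃₂ λ u v → s u ≡ 1 × s v ≡ 0 × Adj v u
  connected⇒crossing connected s s≤1 k l sk sl = cross (proj₂ (connected k l)) sk
    where
    cross : ∀ {k m} → Walk k l m → s k ≡ 1 → ∃₂ λ u v → s u ≡ 1 × s v ≡ 0 × Adj v u
    cross [] sk = contradiction (trans (sym sk) sl) λ ()
    cross {k} (_∷_ {v = v} e w) sk with s v ℕ.≟ 1
    ... | yes sv = cross w sv
    ... | no sv≢1 = k , v , sk , ℕ.n<1⇒n≡0 (ℕ.≤∧≢⇒< (s≤1 v) sv≢1) , subst T (adj-sym k v) e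

-- The quadratic form of a Dirichlet operator

module Energy {n : ℕ} {a : ℕ → ℕ → ℕ} (adjacency : IsAdjacency n a) (d : ℕ → ℕ) where
  open IsAdjacency adjacency
  open ℝ-Solver
  open ≈-Reasoning

  Δ : (ℕ → ℝ) → ℕ → ℝ
  Δ g i = ι (d i) *ʳ g i -ʳ ∑ʳ n (λ j → ι (a i j) *ʳ g j)

  energy : (ℕ → ℝ) → ℝ
  energy g = ∑ʳ n (λ i → g i *ʳ Δ g i)

  norm : (ℕ → ℝ) → ℝ
  norm g = ∑ʳ n (λ i → g i *ʳ g i)

  Supported : (ℕ → ℝ) → Set
  Supported g = ∀ i → i < n → ¬ 2 ≤ d i → g i ≈ 0ℝ

  Harmonic : ℝ → (ℕ → ℝ) → Set
  Harmonic ν g = ∀ i → i < n → 2 ≤ d i → Δ g i ≈ ν *ʳ g i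

  0≤norm : ∀ g → 0ℝ ≤ʳ norm g
  0≤norm g = ∑ʳ-nonneg n λ i _ → 0≤x² (g i)

  norm-definite : ∀ g → norm g ≈ 0ℝ → ∀ i → i < n → g i ≈ 0ℝ
  norm-definite g eq i i<n = x²≈0⇒x≈0 (∑ʳ-nonneg-zero n (λ i _ → 0≤x² (g i)) eq i i<n)

  harmonic-energy : ∀ {ν g} → Supported g → Harmonic ν g → energy g ≈ ν *ʳ norm g
  harmonic-energy {ν} {g} supp harm = ≈-trans (Σʳ.∑-cong n term) (≈-sym (Σʳ.∑-*ˡ n ν (λ i → g i *ʳ g i)))
    where
    term : ∀ i → i < n → g i *ʳ Δ g i ≈ ν *ʳ (g i *ʳ g i)
    term i i<n with 2 ℕ.≤? d i
    ... | yes 2≤d = ≈-trans (*ʳ-cong ≈-refl (harm i i<n 2≤d)) (solve 2 (λ g ν → g :* (ν :* g) := ν :* (g :* g)) ≈-refl (g i) ν)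
    ... | no ¬2≤d = ≈-trans (*ʳ-zeroˡ (supp i i<n ¬2≤d)) (≈-sym (*ʳ-zeroʳ (*ʳ-zeroˡ (supp i i<n ¬2≤d))))

  -- Jacobi's substitution g = h φ turns the form of Δ - μ into a sum of squares.
  module Jacobi (μ : ℝ) (φ φ⁻¹ : ℕ → ℝ) (φ-supp : Supported φ) (φ-harm : Harmonic μ φ)
    (φ-pos : ∀ i → i < n → 2 ≤ d i → Pos (φ i)) (φ-inv : ∀ i → i < n → 2 ≤ d i → φ i *ʳ φ⁻¹ i ≈ 1ℝ)
    (g : ℕ → ℝ) (g-supp : Supported g) where

    h : ℕ → ℝ
    h i = g i *ʳ φ⁻¹ i

    hφ≈g : ∀ i → i < n → h i *ʳ φ i ≈ g i
    hφ≈g i i<n with 2 ℕ.≤? d i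
    ... | yes 2≤d = ≈-trans (solve 3 (λ g p q → g :* p :* q := g :* (q :* p)) ≈-refl (g i) (φ⁻¹ i) (φ i))
          (≈-trans (*ʳ-cong ≈-refl (φ-inv i i<n 2≤d)) (*ʳ-identityʳ (g i)))
    ... | no ¬2≤d = ≈-trans (*ʳ-zeroʳ (φ-supp i i<n ¬2≤d)) (≈-sym (g-supp i i<n ¬2≤d))

    0≤φ : ∀ i → i < n → 0ℝ ≤ʳ φ i
    0≤φ i i<n with 2 ℕ.≤? d i
    ... | yes 2≤d = Pos⇒0≤ (φ-pos i i<n 2≤d)
    ... | no ¬2≤d = ≈⇒≤ʳ (≈-sym (φ-supp i i<n ¬2≤d))

    square : ℕ → ℕ → ℝ
    square i j = (ι (a i j) *ʳ (φ i *ʳ φ j)) *ʳ ((h i -ʳ h j) *ʳ (h i -ʳ h j))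

    0≤square : ∀ i j → i < n → j < n → 0ℝ ≤ʳ square i j
    0≤square i j i<n j<n = 0≤ʳ-* (0≤ʳ-* (ι-nonneg (a i j)) (0≤ʳ-* (0≤φ i i<n) (0≤φ j j<n))) (0≤x² (h i -ʳ h j))

    squares : ℝ
    squares = ∑ʳ n λ i → ∑ʳ n λ j → square i j

    0≤squares : 0ℝ ≤ʳ squares
    0≤squares = ∑ʳ-nonneg n λ i i<n → ∑ʳ-nonneg n λ j j<n → 0≤square i j i<n j<n

    private
      row : ℕ → ℝ
      row i = ∑ʳ n λ j → ι (a i j) *ʳ φ j

      φ-row : ∀ i → i < n → φ i *ʳ row i ≈ (ι (d i) -ʳ μ) *ʳ (φ i *ʳ φ i)
      φ-row i i<n with 2 ℕ.≤? d i
      ... | no ¬2≤d = ≈-trans (*ʳ-zeroˡ (φ-supp i i<n ¬2≤d)) (≈-sym (*ʳ-zeroʳ (*ʳ-zeroˡ (φ-supp i i<n ¬2≤d))))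
      ... | yes 2≤d = begin
        φ i *ʳ row i
          ≈⟨ solve 3 (λ D p r → p :* r := p :* (D :* p :- (D :* p :- r))) ≈-refl (ι (d i)) (φ i) (row i) ⟩
        φ i *ʳ (ι (d i) *ʳ φ i -ʳ Δ φ i)
          ≈⟨ *ʳ-cong ≈-refl (+ʳ-cong ≈-refl (-ʳ-cong (φ-harm i i<n 2≤d))) ⟩
        φ i *ʳ (ι (d i) *ʳ φ i -ʳ μ *ʳ φ i)
          ≈⟨ solve 3 (λ D m p → p :* (D :* p :- m :* p) := (D :- m) :* (p :* p)) ≈-refl (ι (d i)) μ (φ i) ⟩
        (ι (d i) -ʳ μ) *ʳ (φ i *ʳ φ i) ∎

      diagonal : ℝ
      diagonal = ∑ʳ n λ i → (ι (d i) -ʳ μ) *ʳ (g i *ʳ g i)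

      cross : ℝ
      cross = ∑ʳ n λ i → ∑ʳ n λ j → ι (a i j) *ʳ (g i *ʳ g j)

      part : ℕ → ℕ → ℝ
      part i j = (ι (a i j) *ʳ (φ i *ʳ φ j)) *ʳ (h i *ʳ h i)

      part-sum : ∑ʳ n (λ i → ∑ʳ n λ j → part i j) ≈ diagonal
      part-sum = Σʳ.∑-cong n λ i i<n → begin
        ∑ʳ n (λ j → part i j)
          ≈⟨ Σʳ.∑-cong n (λ j _ → solve 4 (λ a p q h → (a :* (p :* q)) :* (h :* h) := (h :* h :* p) :* (a :* q)) ≈-refl (ι (a i j)) (φ i) (φ j) (h i)) ⟩
        ∑ʳ n (λ j → (h i *ʳ h i *ʳ φ i) *ʳ (ι (a i j) *ʳ φ j))
          ≈⟨ Σʳ.∑-*ˡ n (h i *ʳ h i *ʳ φ i) (λ j → ι (a i j) *ʳ φ j) ⟨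
        (h i *ʳ h i *ʳ φ i) *ʳ row i
          ≈⟨ *ʳ-assoc (h i *ʳ h i) (φ i) (row i) ⟩
        (h i *ʳ h i) *ʳ (φ i *ʳ row i)
          ≈⟨ *ʳ-cong ≈-refl (φ-row i i<n) ⟩
        (h i *ʳ h i) *ʳ ((ι (d i) -ʳ μ) *ʳ (φ i *ʳ φ i))
          ≈⟨ solve 3 (λ h D p → (h :* h) :* (D :* (p :* p)) := D :* ((h :* p) :* (h :* p))) ≈-refl (h i) (ι (d i) -ʳ μ) (φ i) ⟩
        (ι (d i) -ʳ μ) *ʳ ((h i *ʳ φ i) *ʳ (h i *ʳ φ i))
          ≈⟨ *ʳ-cong ≈-refl (*ʳ-cong (hφ≈g i i<n) (hφ≈g i i<n)) ⟩
        (ι (d i) -ʳ μ) *ʳ (g i *ʳ g i) ∎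

      part-sum′ : ∑ʳ n (λ i → ∑ʳ n λ j → part j i) ≈ diagonal
      part-sum′ = ≈-trans (Σʳ.∑-swap n n (λ i j → part j i)) part-sum

      square-split : ∀ i j → i < n → j < n → square i j ≈ (part i j +ʳ part j i) -ʳ (ι (a i j) *ʳ (g i *ʳ g j) +ʳ ι (a i j) *ʳ (g i *ʳ g j))
      square-split i j i<n j<n = begin
        square i j
          ≈⟨ solve 5 (λ a p q h k → (a :* (p :* q)) :* ((h :- k) :* (h :- k)) :=
               ((a :* (p :* q)) :* (h :* h) :+ (a :* (q :* p)) :* (k :* k)) :- (a :* ((h :* p) :* (k :* q)) :+ a :* ((h :* p) :* (k :* q))))
               ≈-refl (ι (a i j)) (φ i) (φ j) (h i) (h j) ⟩
        (part i j +ʳ (ι (a i j) *ʳ (φ j *ʳ φ i)) *ʳ (h j *ʳ h j)) -ʳ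
          (ι (a i j) *ʳ ((h i *ʳ φ i) *ʳ (h j *ʳ φ j)) +ʳ ι (a i j) *ʳ ((h i *ʳ φ i) *ʳ (h j *ʳ φ j)))
          ≈⟨ +ʳ-cong (+ʳ-cong ≈-refl (*ʳ-cong (*ʳ-cong (ℝR.reflexive (cong ι (a-sym i j))) ≈-refl) ≈-refl))
               (-ʳ-cong (+ʳ-cong gg gg)) ⟩
        (part i j +ʳ part j i) -ʳ (ι (a i j) *ʳ (g i *ʳ g j) +ʳ ι (a i j) *ʳ (g i *ʳ g j)) ∎
        where
        gg : ι (a i j) *ʳ ((h i *ʳ φ i) *ʳ (h j *ʳ φ j)) ≈ ι (a i j) *ʳ (g i *ʳ g j)
        gg = *ʳ-cong ≈-refl (*ʳ-cong (hφ≈g i i<n) (hφ≈g j j<n))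

      energy-split : energy g -ʳ μ *ʳ norm g ≈ diagonal -ʳ cross
      energy-split = begin
        energy g -ʳ μ *ʳ norm g
          ≈⟨ +ʳ-cong ≈-refl (-ʳ-cong (Σʳ.∑-*ˡ n μ (λ i → g i *ʳ g i))) ⟩
        energy g -ʳ ∑ʳ n (λ i → μ *ʳ (g i *ʳ g i))
          ≈⟨ ∑ʳ-sub n (λ i → g i *ʳ Δ g i) (λ i → μ *ʳ (g i *ʳ g i)) ⟨
        ∑ʳ n (λ i → g i *ʳ Δ g i -ʳ μ *ʳ (g i *ʳ g i))
          ≈⟨ Σʳ.∑-cong n (λ i _ → term i) ⟩
        ∑ʳ n (λ i → (ι (d i) -ʳ μ) *ʳ (g i *ʳ g i) -ʳ ∑ʳ n (λ j → ι (a i j) *ʳ (g i *ʳ g j)))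
          ≈⟨ ∑ʳ-sub n (λ i → (ι (d i) -ʳ μ) *ʳ (g i *ʳ g i)) (λ i → ∑ʳ n (λ j → ι (a i j) *ʳ (g i *ʳ g j))) ⟩
        diagonal -ʳ cross ∎
        where
        term : ∀ i → g i *ʳ Δ g i -ʳ μ *ʳ (g i *ʳ g i) ≈ (ι (d i) -ʳ μ) *ʳ (g i *ʳ g i) -ʳ ∑ʳ n (λ j → ι (a i j) *ʳ (g i *ʳ g j))
        term i = begin
          g i *ʳ (ι (d i) *ʳ g i -ʳ ∑ʳ n (λ j → ι (a i j) *ʳ g j)) -ʳ μ *ʳ (g i *ʳ g i)
            ≈⟨ solve 4 (λ g D m r → g :* (D :* g :- r) :- m :* (g :* g) := (D :- m) :* (g :* g) :- g :* r) ≈-refl (g i) (ι (d i)) μ (∑ʳ n (λ j → ι (a i j) *ʳ g j)) ⟩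
          (ι (d i) -ʳ μ) *ʳ (g i *ʳ g i) -ʳ g i *ʳ ∑ʳ n (λ j → ι (a i j) *ʳ g j)
            ≈⟨ +ʳ-cong ≈-refl (-ʳ-cong (≈-trans (Σʳ.∑-*ˡ n (g i) (λ j → ι (a i j) *ʳ g j))
                 (Σʳ.∑-cong n λ j _ → solve 3 (λ g a k → g :* (a :* k) := a :* (g :* k)) ≈-refl (g i) (ι (a i j)) (g j)))) ⟩
          (ι (d i) -ʳ μ) *ʳ (g i *ʳ g i) -ʳ ∑ʳ n (λ j → ι (a i j) *ʳ (g i *ʳ g j)) ∎

    -- The double sum meets every edge in both directions, whence the form appears twice. The
    -- diagonal of the expanded squares is evaluated by the eigenvalue equation of φ.
    jacobi : squares ≈ (energy g -ʳ μ *ʳ norm g) +ʳ (energy g -ʳ μ *ʳ norm g)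
    jacobi = begin
      squares
        ≈⟨ Σʳ.∑-cong n (λ i i<n → Σʳ.∑-cong n λ j j<n → square-split i j i<n j<n) ⟩
      ∑ʳ n (λ i → ∑ʳ n λ j → (part i j +ʳ part j i) -ʳ (ι (a i j) *ʳ (g i *ʳ g j) +ʳ ι (a i j) *ʳ (g i *ʳ g j)))
        ≈⟨ Σʳ.∑-cong n (λ i _ → ≈-trans (∑ʳ-sub n (λ j → part i j +ʳ part j i) (λ j → ι (a i j) *ʳ (g i *ʳ g j) +ʳ ι (a i j) *ʳ (g i *ʳ g j)))
             (+ʳ-cong (Σʳ.∑-+ n (part i) (λ j → part j i)) (-ʳ-cong (Σʳ.∑-+ n (λ j → ι (a i j) *ʳ (g i *ʳ g j)) (λ j → ι (a i j) *ʳ (g i *ʳ g j)))))) ⟩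
      ∑ʳ n (λ i → (∑ʳ n (part i) +ʳ ∑ʳ n (λ j → part j i)) -ʳ (c i +ʳ c i))
        ≈⟨ ∑ʳ-sub n (λ i → ∑ʳ n (part i) +ʳ ∑ʳ n (λ j → part j i)) (λ i → c i +ʳ c i) ⟩
      ∑ʳ n (λ i → ∑ʳ n (part i) +ʳ ∑ʳ n (λ j → part j i)) -ʳ ∑ʳ n (λ i → c i +ʳ c i)
        ≈⟨ +ʳ-cong (≈-trans (Σʳ.∑-+ n (λ i → ∑ʳ n (part i)) (λ i → ∑ʳ n (λ j → part j i))) (+ʳ-cong part-sum part-sum′)) (-ʳ-cong (Σʳ.∑-+ n c c)) ⟩
      (diagonal +ʳ diagonal) -ʳ (cross +ʳ cross)
        ≈⟨ solve 2 (λ D c → (D :+ D) :- (c :+ c) := (D :- c) :+ (D :- c)) ≈-refl diagonal cross ⟩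
      (diagonal -ʳ cross) +ʳ (diagonal -ʳ cross)
        ≈⟨ +ʳ-cong energy-split energy-split ⟨
      (energy g -ʳ μ *ʳ norm g) +ʳ (energy g -ʳ μ *ʳ norm g) ∎
      where
      c : ℕ → ℝ
      c i = ∑ʳ n (λ j → ι (a i j) *ʳ (g i *ʳ g j))

    rayleigh : 0ℝ ≤ʳ energy g -ʳ μ *ʳ norm g
    rayleigh = Pos-*-cancel-0≤ (ι-pos 1) (0≤-resp-≈ (≈-trans jacobi
      (≈-trans (solve 1 (λ x → x :+ x := (con 1ℚ :+ con 1ℚ) :* x) ≈-refl (energy g -ʳ μ *ʳ norm g))
        (*ʳ-cong (≈-sym (≈-trans (ι-+ 1 1) (+ʳ-cong ι-1 ι-1))) ≈-refl))) 0≤squares)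

    -- All squares must vanish, and on an edge between interior vertices the coefficient of the
    -- square is positive.
    rayleigh-equality : energy g -ʳ μ *ʳ norm g ≈ 0ℝ → ∀ i j → i < n → j < n → 2 ≤ d i → 2 ≤ d j → a i j ≡ 1 → h i ≈ h j
    rayleigh-equality eq i j i<n j<n 2≤di 2≤dj aij = -≈0⇒≈ (x²≈0⇒x≈0 (Pos-*-cancel-≈0
        (Pos-* (subst (λ z → Pos (ι z)) (sym aij) (ι-pos 0)) (Pos-* (φ-pos i i<n 2≤di) (φ-pos j j<n 2≤dj)))
        (∑ʳ-nonneg-zero n (λ j j<n → 0≤square i j i<n j<n)
          (∑ʳ-nonneg-zero n (λ i i<n → ∑ʳ-nonneg n λ j j<n → 0≤square i j i<n j<n) squares≈0 i i<n) j j<n)))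
      where
      squares≈0 : squares ≈ 0ℝ
      squares≈0 = ≈-trans jacobi (≈-trans (+ʳ-cong eq eq) (+ʳ-identityˡ 0ℝ))

  -- The Rayleigh bound for `g` reads μ ‖g‖² ≤ ν ‖g‖². Positivity of the norm is available only
  -- under a double negation, which stability of the order absorbs.
  harmonic-minimal : ∀ {μ φ φ⁻¹} → Supported φ → Harmonic μ φ →
    (∀ i → i < n → 2 ≤ d i → Pos (φ i)) → (∀ i → i < n → 2 ≤ d i → φ i *ʳ φ⁻¹ i ≈ 1ℝ) →
    ∀ {ν g} → Supported g → Harmonic ν g → ¬ (∀ i → i < n → g i ≈ 0ℝ) → μ ≤ʳ ν
  harmonic-minimal {μ} {φ} {φ⁻¹} φ-supp φ-harm φ-pos φ-inv {ν} {g} g-supp g-harm g≉0 = 0≤-⇒≤ (0≤-stable λ k →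
    ¬¬-excluded-middle {A = Pos (norm g)} λ where
      (no ¬pos) → g≉0 (norm-definite g (0≤∧¬Pos⇒≈0 (0≤norm g) ¬pos))
      (yes pos) → k (Pos-*-cancel-0≤ pos (0≤-resp-≈
        (≈-trans (+ʳ-cong (harmonic-energy g-supp g-harm) ≈-refl)
          (solve 3 (λ n m N → n :* N :- m :* N := N :* (n :- m)) ≈-refl ν μ (norm g)))
        (Jacobi.rayleigh μ φ φ⁻¹ φ-supp φ-harm φ-pos φ-inv g g-supp))))

-- Trees as adjacency arrays

unique⇒lookup-injective : ∀ {A : Set} {xs : List A} → Unique xs → ∀ {i j} → lookup xs i ≡ lookup xs j → i ≡ j
unique⇒lookup-injective (_ ∷ _)  {zero}  {zero}  eq = refl
unique⇒lookup-injective (x∉ ∷ _) {zero}  {suc j} eq = contradiction eq (All.lookup x∉ (∈-lookup j))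
unique⇒lookup-injective (x∉ ∷ _) {suc i} {zero}  eq = contradiction (sym eq) (All.lookup x∉ (∈-lookup i))
unique⇒lookup-injective (_ ∷ u)  {suc i} {suc j} eq = cong suc (unique⇒lookup-injective u eq)

sum-filter : ∀ {A : Set} {P : A → Set} (P? : ∀ x → Dec (P x)) (φ : A → ℝ) → (∀ x → ¬ P x → φ x ≈ 0ℝ) →
  ∀ {n} (h : Fin n → A) → ℝΣ.sum (λ j → φ (lookup (filter P? (List.tabulate h)) j)) ≈ ℝΣ.sum (φ ∘ h)
sum-filter P? φ φ≈0 {zero}  h = ≈-refl
sum-filter P? φ φ≈0 {suc n} h with P? (h zero)
... | yes _ = +ʳ-cong ≈-refl (sum-filter P? φ φ≈0 (h ∘ suc))
... | no ¬p = ≈-trans (sum-filter P? φ φ≈0 (h ∘ suc)) (≈-sym (≈-trans (+ʳ-cong (φ≈0 (h zero) ¬p) ≈-refl) (+ʳ-identityˡ _)))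

opaque
  unfolding _+ʳ_

  sumᴰ⇒sum : ∀ {n} (A g : Fin n → ℝ) {y} → sumᴰ (λ j → A j *ᴰ g j) ≈ᴰ y → ℝΣ.sum (λ j → A j *ʳ g j) ≈ y
  sumᴰ⇒sum A g p = p

  sum⇒sumᴰ : ∀ {n} (A g : Fin n → ℝ) {y} → ℝΣ.sum (λ j → A j *ʳ g j) ≈ y → sumᴰ (λ j → A j *ᴰ g j) ≈ᴰ y
  sum⇒sumᴰ A g p = p

  *ᴰ≈*ʳ : ∀ x y → x *ᴰ y ≈ x *ʳ y
  *ᴰ≈*ʳ x y = ≈-refl {x *ʳ y}

sum-δʳ : ∀ {n} (u : Fin n) (x : ℝ) (g : Fin n → ℝ) → ℝΣ.sum (λ w → (if ⌊ u Fin.≟ w ⌋ then x else 0ℝ) *ʳ g w) ≈ x *ʳ g u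
sum-δʳ {suc n} zero x g = ≈-trans (+ʳ-cong ≈-refl (≈-trans (ℝΣ.sum-cong-≋ λ w → *ʳ-zeroˡ {y = g (suc w)} ≈-refl) (zeros n))) (+ʳ-identityʳ _)
  where
  zeros : ∀ n → ℝΣ.sum {n} (λ _ → 0ℝ) ≈ 0ℝ
  zeros zero    = ≈-refl
  zeros (suc n) = ≈-trans (+ʳ-identityˡ _) (zeros n)
sum-δʳ {suc n} (suc u) x g = ≈-trans (+ʳ-cong (*ʳ-zeroˡ ≈-refl) (≈-trans (ℝΣ.sum-cong-≋ shift) (sum-δʳ u x (g ∘ suc)))) (+ʳ-identityˡ _)
  where
  shift : ∀ w → (if ⌊ suc u Fin.≟ suc w ⌋ then x else 0ℝ) *ʳ g (suc w) ≈ (if ⌊ u Fin.≟ w ⌋ then x else 0ℝ) *ʳ g (suc w)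
  shift w with u Fin.≟ w
  ... | yes _ = ≈-refl
  ... | no _  = ≈-refl

module Tree (G : TreeWithBoundary) where
  open TreeWithBoundary G public

  interior? : ∀ v → Dec (IsInterior v)
  interior? v = 2 ℕ.≤? deg v

  ¬interior⇒boundary : ∀ {v} → ¬ IsInterior v → deg v ≡ 1
  ¬interior⇒boundary {v} ¬int = ℕ.≤-antisym (s≤s⁻¹ (ℕ.≰⇒> ¬int)) (deg-pos v)

  size : ℕ
  size = length interior

  vertex : Fin size → V
  vertex = lookup interior

  vertex-interior : ∀ i → IsInterior (vertex i)
  vertex-interior i = proj₂ (∈-filter⁻ interior? {xs = allFin order} (∈-lookup i))

  vertex-injective : ∀ {i j} → vertex i ≡ vertex j → i ≡ j
  vertex-injective = unique⇒lookup-injective (unique-filter⁺ interior? (allFin⁺ order))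

  index-of : ∀ v → IsInterior v → ∃[ i ] vertex i ≡ v
  index-of v int = let v∈ = ∈-filter⁺ interior? (∈-allFin v) int in index v∈ , sym (lookup-index v∈)

  Δᵥ : (V → ℝ) → V → ℝ
  Δᵥ F v = ι (deg v) *ʳ F v -ʳ ℝΣ.sum (λ w → ι (bit (adj v w)) *ʳ F w)

  record IsEigenfunction (ν : ℝ) (F : V → ℝ) : Set where
    field
      boundary : ∀ v → ¬ IsInterior v → F v ≈ 0ℝ
      eigen    : ∀ v → IsInterior v → Δᵥ F v ≈ ν *ʳ F v

  laplacian≈ : ∀ u w → fromℤ (laplacian u w) ≈ (if ⌊ u Fin.≟ w ⌋ then ι (deg u) else 0ℝ) -ʳ ι (bit (adj u w))
  laplacian≈ u w = ≈-trans (fromℤ-sub (if ⌊ u Fin.≟ w ⌋ then + deg u else + 0) (if adj u w then + 1 else + 0)) (+ʳ-cong diagonal (-ʳ-cong off))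
    where
    diagonal : fromℤ (if ⌊ u Fin.≟ w ⌋ then + deg u else + 0) ≈ (if ⌊ u Fin.≟ w ⌋ then ι (deg u) else 0ℝ)
    diagonal with ⌊ u Fin.≟ w ⌋
    ... | true  = fromℤ-+ (deg u)
    ... | false = ≈-refl
    off : fromℤ (if adj u w then + 1 else + 0) ≈ ι (bit (adj u w))
    off with adj u w
    ... | true  = fromℤ-+ 1
    ... | false = fromℤ-+ 0

  laplacian-sum : ∀ F v → ℝΣ.sum (λ w → fromℤ (laplacian v w) *ʳ F w) ≈ Δᵥ F v
  laplacian-sum F v = begin
    ℝΣ.sum (λ w → fromℤ (laplacian v w) *ʳ F w)
      ≈⟨ ℝΣ.sum-cong-≋ (λ w → ≈-trans (*ʳ-cong (laplacian≈ v w) ≈-refl)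
           (solve 3 (λ x b f → (x :- b) :* f := x :* f :+ (:- con 1ℚ) :* (b :* f)) ≈-refl
             (if ⌊ v Fin.≟ w ⌋ then ι (deg v) else 0ℝ) (ι (bit (adj v w))) (F w))) ⟩
    ℝΣ.sum (λ w → (if ⌊ v Fin.≟ w ⌋ then ι (deg v) else 0ℝ) *ʳ F w +ʳ (-ʳ 1ℝ) *ʳ (ι (bit (adj v w)) *ʳ F w))
      ≈⟨ ℝΣ.∑-distrib-+ (λ w → (if ⌊ v Fin.≟ w ⌋ then ι (deg v) else 0ℝ) *ʳ F w) (λ w → (-ʳ 1ℝ) *ʳ (ι (bit (adj v w)) *ʳ F w)) ⟩
    ℝΣ.sum (λ w → (if ⌊ v Fin.≟ w ⌋ then ι (deg v) else 0ℝ) *ʳ F w) +ʳ ℝΣ.sum (λ w → (-ʳ 1ℝ) *ʳ (ι (bit (adj v w)) *ʳ F w))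
      ≈⟨ +ʳ-cong (sum-δʳ v (ι (deg v)) F) (≈-sym (ℝΣ.*-distribˡ-sum (-ʳ 1ℝ) (λ w → ι (bit (adj v w)) *ʳ F w))) ⟩
    ι (deg v) *ʳ F v +ʳ (-ʳ 1ℝ) *ʳ ℝΣ.sum (λ w → ι (bit (adj v w)) *ʳ F w)
      ≈⟨ solve 2 (λ x s → x :+ (:- con 1ℚ) :* s := x :- s) ≈-refl (ι (deg v) *ʳ F v) (ℝΣ.sum (λ w → ι (bit (adj v w)) *ʳ F w)) ⟩
    Δᵥ F v ∎
    where
    open ℝ-Solver
    open ≈-Reasoning

  extend : (Fin size → ℝ) → V → ℝ
  extend g v with interior? v
  ... | yes int = g (proj₁ (index-of v int))
  ... | no _    = 0ℝ

  extend-vertex : ∀ g i → extend g (vertex i) ≡ g i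
  extend-vertex g i with interior? (vertex i)
  ... | yes int = cong g (vertex-injective (proj₂ (index-of (vertex i) int)))
  ... | no ¬int = contradiction (vertex-interior i) ¬int

  extend-boundary : ∀ g v → ¬ IsInterior v → extend g v ≈ 0ℝ
  extend-boundary g v ¬int with interior? v
  ... | yes int = contradiction int ¬int
  ... | no _    = ≈-refl

  dirichlet-sum : ∀ g i → ℝΣ.sum (λ j → fromℤ (dirichlet i j) *ʳ g j) ≈ Δᵥ (extend g) (vertex i)
  dirichlet-sum g i = ≈-trans
    (ℝΣ.sum-cong-≋ λ j → *ʳ-cong ≈-refl (ℝR.reflexive (sym (extend-vertex g j))))
    (≈-trans (sum-filter interior? (λ w → fromℤ (laplacian (vertex i) w) *ʳ extend g w) (λ w ¬int → *ʳ-zeroʳ (extend-boundary g w ¬int)) id)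
      (laplacian-sum (extend g) (vertex i)))

  extend-eigenfunction : ∀ {ν g} → (∀ i → ℝΣ.sum (λ j → fromℤ (dirichlet i j) *ʳ g j) ≈ ν *ʳ g i) → IsEigenfunction ν (extend g)
  extend-eigenfunction {ν} {g} eq = record { boundary = extend-boundary g ; eigen = eigen }
    where
    eigen : ∀ v → IsInterior v → Δᵥ (extend g) v ≈ ν *ʳ extend g v
    eigen v int with index-of v int
    ... | i , refl = ≈-trans (≈-sym (dirichlet-sum g i)) (≈-trans (eq i) (*ʳ-cong ≈-refl (ℝR.reflexive (sym (extend-vertex g i)))))

  module Numbered (ν : Numbering order) where
    open Numbering ν public

    n : ℕ
    n = order

    a : ℕ → ℕ → ℕ
    a i j = bit (adj (at i) (at j))

    d : ℕ → ℕ
    d i = deg (at i)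

    adjacency : IsAdjacency n a
    adjacency = record
      { a≤1 = λ i j → bit≤1 (adj (at i) (at j))
      ; a-sym = λ i j → cong bit (adj-sym (at i) (at j))
      ; a-diag = λ i → cong bit (no-loop (at i)) }

    open IsAdjacency adjacency public
    open EdgeCount adjacency public
    open Energy adjacency d public

    d≡∑ : ∀ i → d i ≡ ∑ n (a i)
    d≡∑ i = trans (deg≡sum graph (at i)) (sum-at (λ w → bit (adj (at i) w)))

    leaf : ∀ s → (∀ i → s i ≤ 1) → ∀ k → k < n → s k ≡ 1 → ∃[ v ] (v < n × s v ≡ 1 × ∑ n (λ w → s w * a v w) ≤ 1)
    leaf s s≤1 k k<n sk with acyclic⇒leaf graph (proj₂ isTree) (s ∘ pos) (s≤1 ∘ pos) (at k) (trans (cong s (pos-at k k<n)) sk)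
    ... | v , sv , le = pos v , pos<n v , sv , subst (_≤ 1) (trans (sum-at (λ w → s (pos w) * bit (adj v w)))
          (∑-cong n λ w w<n → cong₂ (λ x y → s x * bit (adj y (at w))) (pos-at w w<n) (sym (at-pos v)))) le

    crossing : ∀ s → (∀ i → s i ≤ 1) → ∀ k l → k < n → l < n → s k ≡ 1 → s l ≡ 0 →
      ∃₂ λ u v → u < n × v < n × s u ≡ 1 × s v ≡ 0 × a v u ≡ 1
    crossing s s≤1 k l k<n l<n sk sl
      with connected⇒crossing graph (proj₁ isTree) (s ∘ pos) (s≤1 ∘ pos) (at k) (at l) (trans (cong s (pos-at k k<n)) sk) (trans (cong s (pos-at l l<n)) sl)
    ... | u , v , su , sv , edge = pos u , pos v , pos<n u , pos<n v , su , sv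
        , trans (cong₂ (λ x y → bit (adj x y)) (at-pos v) (at-pos u)) (T⇒bit edge)

    open Forest leaf public
    open Connectivity crossing public

    e-bound : ∀ j → j < n → e (suc j) (suc j) ≤ 2 * j
    e-bound j j<n = subst (_≤ 2 * j) (sym (e-suc j)) (prefix-bound j j ℕ.≤-refl j<n)

    e-row : ∀ j → e j n ≡ ∑ j d
    e-row j = ∑-cong j λ i _ → sym (d≡∑ i)

    e-total : ∀ m → n ≡ suc m → e n n ≡ 2 * m
    e-total m n≡ = ℕ.≤-antisym (subst (λ k → e k k ≤ 2 * m) (sym n≡) (e-bound m (subst (m <_) (sym n≡) ℕ.≤-refl)))
      (connected-bound m n≡)

    array-supported : ∀ {μ F} → IsEigenfunction μ F → Supported (F ∘ at)
    array-supported ef i _ = IsEigenfunction.boundary ef (at i)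

    array-harmonic : ∀ {μ F} → IsEigenfunction μ F → Harmonic μ (F ∘ at)
    array-harmonic {μ} {F} ef i _ int = ≈-trans
      (+ʳ-cong ≈-refl (-ʳ-cong (≈-sym (sum-atʳ (λ w → ι (bit (adj (at i) w)) *ʳ F w)))))
      (IsEigenfunction.eigen ef (at i) int)

-- The smallest Dirichlet eigenvalue

term≤sum : ∀ {n} (φ : Fin n → ℕ) i → φ i ≤ ℕΣ.sum φ
term≤sum φ zero    = ℕ.m≤m+n (φ zero) _
term≤sum φ (suc i) = ℕ.≤-trans (term≤sum (φ ∘ suc) i) (ℕ.m≤n+m _ (φ zero))

two≤sum : ∀ {n} (φ : Fin n → ℕ) {u y} → u ≢ y → 1 ≤ φ u → 1 ≤ φ y → 2 ≤ ℕΣ.sum φ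
two≤sum φ {zero}  {zero}  u≢y p q = contradiction refl u≢y
two≤sum φ {zero}  {suc y} u≢y p q = ℕ.+-mono-≤ p (ℕ.≤-trans q (term≤sum (φ ∘ suc) y))
two≤sum φ {suc u} {zero}  u≢y p q = ℕ.+-mono-≤ q (ℕ.≤-trans p (term≤sum (φ ∘ suc) u))
two≤sum φ {suc u} {suc y} u≢y p q = ℕ.≤-trans (two≤sum (φ ∘ suc) (u≢y ∘ cong suc) p q) (ℕ.m≤n+m _ (φ zero))

⌊≟⌋-refl : ∀ {n} (i : Fin n) → ⌊ i Fin.≟ i ⌋ ≡ true
⌊≟⌋-refl i with i Fin.≟ i
... | yes _  = refl
... | no i≢i = contradiction refl i≢i

⌊≟⌋-≢ : ∀ {n} {i j : Fin n} → i ≢ j → ⌊ i Fin.≟ j ⌋ ≡ false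
⌊≟⌋-≢ {i = i} {j} i≢j with i Fin.≟ j
... | yes i≡j = contradiction i≡j i≢j
... | no _    = refl

module Chains {n : ℕ} (b : Fin n → Fin n → ℕ) where

  B : Fin n → Fin n → ℚ
  B i j = + b i j ℚ./ 1

  0≤B : ∀ i j → 0ℚ ℚ.≤ B i j
  0≤B i j = /1-mono-≤ {+ 0} {+ b i j} (ℤ.+≤+ z≤n)

  data Chain : ℕ → Fin n → Fin n → Set where
    []  : ∀ {i} → Chain 0 i i
    _∷_ : ∀ {l i j k} → 1 ≤ b i j → Chain l j k → Chain (suc l) i k

  apply-nonneg : ∀ w → (∀ i → 0ℚ ℚ.≤ w i) → ∀ i → 0ℚ ℚ.≤ apply B w i
  apply-nonneg w 0≤w i = sumℚ-nonneg (λ j → B i j ℚ.* w j) λ j → 0≤-* (0≤B i j) (0≤w j)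

  iterate-nonneg : ∀ l w → (∀ i → 0ℚ ℚ.≤ w i) → ∀ i → 0ℚ ℚ.≤ iterate (apply B) l w i
  iterate-nonneg zero    w 0≤w = 0≤w
  iterate-nonneg (suc l) w 0≤w = apply-nonneg (iterate (apply B) l w) (iterate-nonneg l w 0≤w)

  -- The entries are natural numbers, so a link has weight at least 1 and the value is passed on
  -- without loss.
  chain-reach : ∀ {l i j} → Chain l i j → ∀ w → (∀ i → 0ℚ ℚ.≤ w i) → w j ℚ.≤ iterate (apply B) l w i
  chain-reach [] w 0≤w = ℚ.≤-refl
  chain-reach {suc l} {i} (_∷_ {j = j} link c) w 0≤w = ℚ.≤-trans (chain-reach c w 0≤w) (ℚ.≤-trans
    (subst (ℚ._≤ B i j ℚ.* u j) (ℚ.*-identityˡ (u j))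
      (ℚ.*-monoʳ-≤-nonNeg (u j) {{ℚ.nonNegative (iterate-nonneg l w 0≤w j)}} (/1-mono-≤ {+ 1} {+ b i j} (ℤ.+≤+ link))))
    (term≤sumℚ (λ j → B i j ℚ.* u j) (λ j → 0≤-* (0≤B i j) (iterate-nonneg l w 0≤w j)) j))
    where
    u : Fin n → ℚ
    u = iterate (apply B) l w

  module _ (loop : ∀ i → 1 ≤ b i i) where

    -- Loops bring the chains between all pairs to one common length, so that a single power of the
    -- matrix reaches every index from every other.
    pad : ∀ m {l i j} → Chain l i j → Chain (m + l) i j
    pad zero    c = c
    pad (suc m) c = loop _ ∷ pad m c

    opaque
      chains⇒perron : (∀ i j → ∃[ l ] Chain l i j) → Fin n → PerronVector B
      chains⇒perron chain i₀ = from i₀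
        where
        N : ℕ
        N = ℕΣ.sum λ i → ℕΣ.sum λ j → proj₁ (chain i j)
        length≤N : ∀ i j → proj₁ (chain i j) ≤ N
        length≤N i j = ℕ.≤-trans (term≤sum (λ j → proj₁ (chain i j)) j) (term≤sum (λ i → ℕΣ.sum λ j → proj₁ (chain i j)) i)
        reach : ∀ w → (∀ i → 0ℚ ℚ.≤ w i) → ∀ i j → w j ℚ.≤ iterate (apply B) N w i
        reach w 0≤w i j = chain-reach (subst (λ m → Chain m i j) (ℕ.m∸n+n≡m (length≤N i j)) (pad (N ∸ proj₁ (chain i j)) (proj₂ (chain i j)))) w 0≤w
        from : Fin n → PerronVector B
        from i = inhabited i B 0≤B N reach
          where
          inhabited : ∀ {n} → Fin n → (B : Fin n → Fin n → ℚ) → (∀ i j → 0ℚ ℚ.≤ B i j) → (N : ℕ) →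
            (∀ w → (∀ i → 0ℚ ℚ.≤ w i) → ∀ i j → w j ℚ.≤ iterate (apply B) N w i) → PerronVector B
          inhabited {suc k} _ = perron

module Ground (G : TreeWithBoundary) where
  open Tree G

  -- Larger than every degree, so that `shift` times the identity minus Δ₀ has nonnegative entries
  -- and a positive diagonal. Its positive eigenvector belongs to the smallest eigenvalue of Δ₀.
  shift : ℕ
  shift = suc order

  b : Fin size → Fin size → ℕ
  b i j = if ⌊ i Fin.≟ j ⌋ then shift ∸ deg (vertex i) else bit (adj (vertex i) (vertex j))

  deg≤order : ∀ v → deg v ≤ order
  deg≤order v = subst₂ _≤_ (sym (deg≡sum graph v)) (sum-ones order) (sum-mono λ w → bit≤1 (adj v w))

  b-diagonal : ∀ i → b i i ≡ shift ∸ deg (vertex i)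
  b-diagonal i = cong (λ c → if c then shift ∸ deg (vertex i) else bit (adj (vertex i) (vertex i))) (⌊≟⌋-refl i)

  b-off-diagonal : ∀ {i j} → i ≢ j → b i j ≡ bit (adj (vertex i) (vertex j))
  b-off-diagonal {i} {j} i≢j = cong (λ c → if c then shift ∸ deg (vertex i) else bit (adj (vertex i) (vertex j))) (⌊≟⌋-≢ i≢j)

  open Chains b

  loop : ∀ i → 1 ≤ b i i
  loop i = subst (1 ≤_) (sym (b-diagonal i)) (ℕ.m<n⇒0<n∸m (s≤s (deg≤order (vertex i))))

  link : ∀ i j → Adj (vertex i) (vertex j) → 1 ≤ b i j
  link i j edge with i Fin.≟ j
  ... | yes refl = ⊥-elim (subst T (no-loop (vertex i)) edge)
  ... | no _     = ℕ.≤-reflexive (sym (T⇒bit edge))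

  -- A boundary vertex has one neighbour, so a walk passing through it returns at once to where it
  -- came from, and the detour can be cut out. The bound `f` makes the recursion structural although
  -- a cut removes two steps.
  walk⇒chain : ∀ f {m u v} → m ≤ f → Walk u v m → ∀ i j → vertex i ≡ u → vertex j ≡ v → ∃[ l ] Chain l i j
  walk⇒chain f _ [] i j refl eq with vertex-injective eq
  ... | refl = 0 , []
  walk⇒chain f _ (edge ∷ []) i j refl refl = 1 , link i j edge ∷ []
  walk⇒chain (suc f) (s≤s le) (_∷_ {v = x} edge (_∷_ {v = y} edge′ w)) i j refl refl with interior? x
  ... | yes int = let i′ , eq = index-of x int
                      l , c = walk⇒chain f le (edge′ ∷ w) i′ j eq refl
                  in suc l , link i i′ (subst (Adj (vertex i)) (sym eq) edge) ∷ c
  ... | no ¬int with vertex i Fin.≟ y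
  ...   | yes eq = walk⇒chain f (ℕ.<⇒≤ le) w i j eq refl
  ...   | no u≢y = contradiction
    (subst (2 ≤_) (sym (deg≡sum graph x)) (two≤sum (λ w → bit (adj x w)) u≢y
      (ℕ.≤-reflexive (sym (T⇒bit (subst T (adj-sym (vertex i) x) edge)))) (ℕ.≤-reflexive (sym (T⇒bit edge′))))) ¬int

  i₀ : Fin size
  i₀ = proj₁ (index-of (proj₁ hasInterior) (proj₂ hasInterior))

  open PerronVector (chains⇒perron loop (λ i j → walk⇒chain _ ℕ.≤-refl (proj₂ (proj₁ isTree (vertex i) (vertex j))) i j refl refl) i₀)

  μ : ℝ
  μ = ι shift -ʳ σ

  dirichlet≈ : ∀ i j → fromℤ (dirichlet i j) ≈ (if ⌊ i Fin.≟ j ⌋ then ι shift else 0ℝ) -ʳ fromℚ (B i j)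
  dirichlet≈ i j = ≈-trans (laplacian≈ (vertex i) (vertex j)) (≈-trans (cases (i Fin.≟ j)) (+ʳ-cong ≈-refl (-ʳ-cong (≈-sym (fromℤ-+ (b i j))))))
    where
    open ℝ-Solver
    cases : Dec (i ≡ j) → (if ⌊ vertex i Fin.≟ vertex j ⌋ then ι (deg (vertex i)) else 0ℝ) -ʳ ι (bit (adj (vertex i) (vertex j)))
      ≈ (if ⌊ i Fin.≟ j ⌋ then ι shift else 0ℝ) -ʳ ι (b i j)
    cases (yes refl) = ≈-trans
      (+ʳ-cong (ℝR.reflexive (cong (λ b → if b then ι (deg (vertex i)) else 0ℝ) (⌊≟⌋-refl (vertex i))))
        (-ʳ-cong (≈-trans (ℝR.reflexive (cong (λ b → ι (bit b)) (no-loop (vertex i)))) ι-0)))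
      (≈-trans (solve 2 (λ p q → p :- con 0ℚ := (q :+ p) :- q) ≈-refl (ι (deg (vertex i))) (ι (shift ∸ deg (vertex i))))
        (+ʳ-cong (≈-trans (≈-sym (ι-+ (shift ∸ deg (vertex i)) (deg (vertex i))))
          (≈-trans (ℝR.reflexive (cong ι (ℕ.m∸n+n≡m (ℕ.≤-trans (deg≤order (vertex i)) (ℕ.n≤1+n order)))))
            (ℝR.reflexive (cong (λ b → if b then ι shift else 0ℝ) (sym (⌊≟⌋-refl i))))))
          (-ʳ-cong (ℝR.reflexive (cong ι (sym (b-diagonal i)))))))
    cases (no i≢j) = +ʳ-cong
      (≈-trans (ℝR.reflexive (cong (λ b → if b then ι (deg (vertex i)) else 0ℝ) (⌊≟⌋-≢ (i≢j ∘ vertex-injective))))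
        (ℝR.reflexive (cong (λ b → if b then ι shift else 0ℝ) (sym (⌊≟⌋-≢ i≢j)))))
      (-ʳ-cong (ℝR.reflexive (cong ι (sym (b-off-diagonal i≢j)))))

  dirichlet-eigen : ∀ i → ℝΣ.sum (λ j → fromℤ (dirichlet i j) *ʳ v j) ≈ μ *ʳ v i
  dirichlet-eigen i = begin
    ℝΣ.sum (λ j → fromℤ (dirichlet i j) *ʳ v j)
      ≈⟨ ℝΣ.sum-cong-≋ (λ j → ≈-trans (*ʳ-cong (dirichlet≈ i j) ≈-refl)
           (solve 3 (λ x b f → (x :- b) :* f := x :* f :+ (:- con 1ℚ) :* (b :* f)) ≈-refl
             (if ⌊ i Fin.≟ j ⌋ then ι shift else 0ℝ) (fromℚ (B i j)) (v j))) ⟩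
    ℝΣ.sum (λ j → (if ⌊ i Fin.≟ j ⌋ then ι shift else 0ℝ) *ʳ v j +ʳ (-ʳ 1ℝ) *ʳ (fromℚ (B i j) *ʳ v j))
      ≈⟨ ℝΣ.∑-distrib-+ (λ j → (if ⌊ i Fin.≟ j ⌋ then ι shift else 0ℝ) *ʳ v j) (λ j → (-ʳ 1ℝ) *ʳ (fromℚ (B i j) *ʳ v j)) ⟩
    ℝΣ.sum (λ j → (if ⌊ i Fin.≟ j ⌋ then ι shift else 0ℝ) *ʳ v j) +ʳ ℝΣ.sum (λ j → (-ʳ 1ℝ) *ʳ (fromℚ (B i j) *ʳ v j))
      ≈⟨ +ʳ-cong (sum-δʳ i (ι shift) v) (≈-trans (≈-sym (ℝΣ.*-distribˡ-sum (-ʳ 1ℝ) (λ j → fromℚ (B i j) *ʳ v j))) (*ʳ-cong ≈-refl (eigen i))) ⟩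
    ι shift *ʳ v i +ʳ (-ʳ 1ℝ) *ʳ (σ *ʳ v i)
      ≈⟨ solve 3 (λ s t v → s :* v :+ (:- con 1ℚ) :* (t :* v) := (s :- t) :* v) ≈-refl (ι shift) σ (v i) ⟩
    μ *ʳ v i ∎
    where
    open ℝ-Solver
    open ≈-Reasoning

  F F⁻¹ : V → ℝ
  F   = extend v
  F⁻¹ = extend v⁻¹

  F-eigenfunction : IsEigenfunction μ F
  F-eigenfunction = extend-eigenfunction dirichlet-eigen

  F-pos : ∀ v → IsInterior v → Pos (F v)
  F-pos u int with index-of u int
  ... | i , refl = subst Pos (sym (extend-vertex v i)) (v-pos i)

  F-inv : ∀ v → IsInterior v → F v *ʳ F⁻¹ v ≈ 1ℝ
  F-inv u int with index-of u int
  ... | i , refl = ≈-trans (ℝR.reflexive (cong₂ _*ʳ_ (extend-vertex v i) (extend-vertex v⁻¹ i))) (v-inv i)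

  isλ : Isλ μ
  isλ = (v , (λ all → Pos⇒≉0 (v-pos i₀) (≈ᴰ⇒≈ (all i₀)))
           , (λ i → sum⇒sumᴰ (λ j → fromℤ (dirichlet i j)) v (≈-trans (dirichlet-eigen i) (≈-sym (*ᴰ≈*ʳ μ (v i))))))
      , λ ν (g , g≉0 , eq) → ≤ʳ⇒≤ᴰ (minimal ν g g≉0
          (λ i → ≈-trans (sumᴰ⇒sum (λ j → fromℤ (dirichlet i j)) g (eq i)) (*ᴰ≈*ʳ ν (g i))))
    where
    open Numbered (numbering Fin.<-isStrictTotalOrder (vertex i₀))
    minimal : ∀ ν g → ¬ (∀ i → g i ≈ᴰ 0ℝ) → (∀ i → ℝΣ.sum (λ j → fromℤ (dirichlet i j) *ʳ g j) ≈ ν *ʳ g i) → μ ≤ʳ ν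
    minimal ν g g≉0 eq = harmonic-minimal (array-supported F-eigenfunction) (array-harmonic F-eigenfunction)
      (λ i _ → F-pos (at i)) (λ i _ → F-inv (at i))
      (array-supported g-eigenfunction) (array-harmonic g-eigenfunction)
      λ all → g≉0 λ i → ≈⇒≈ᴰ (subst (_≈ 0ℝ) (trans (cong (extend g) (at-pos (vertex i))) (extend-vertex g i)) (all (pos (vertex i)) (pos<n (vertex i))))
      where
      g-eigenfunction : IsEigenfunction ν (extend g)
      g-eigenfunction = extend-eigenfunction eq

  μ-unique : ∀ {ν} → Isλ ν → ν ≈ μ
  μ-unique {ν} (eig , min) = ≤ʳ-antisym (≤ᴰ⇒≤ʳ {ν} {μ} (min μ (proj₁ isλ))) (≤ᴰ⇒≤ʳ {μ} {ν} (proj₂ isλ ν eig))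

module _ (G H : TreeWithBoundary) where
  private
    module G = Ground G
    module H = Ground H

  ≤⇒≤λ : G.μ ≤ʳ H.μ → G ≤λ H
  ≤⇒≤λ le = G.μ , H.μ , G.isλ , H.isλ , ≤ʳ⇒≤ᴰ le

  ≤λ⇒≤ : G ≤λ H → G.μ ≤ʳ H.μ
  ≤λ⇒≤ (μ , ν , μ-λ , ν-λ , le) = ≤ʳ-resp (G.μ-unique {μ} μ-λ) (H.μ-unique {ν} ν-λ) (≤ᴰ⇒≤ʳ {μ} {ν} le)

-- Breadth-first arrays

-- The root has no parent; par 0 is a junk value outside the array.
record IsBFS (n : ℕ) (a : ℕ → ℕ → ℕ) (d : ℕ → ℕ) : Set where
  field
    par            : ℕ → ℕ
    par-root       : n ≤ par 0
    par<           : ∀ i → i < n → 1 ≤ i → par i < i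
    par-mono       : ∀ i j → 1 ≤ i → i ≤ j → j < n → par i ≤ par j
    a≡             : ∀ i j → i < n → j < n → a i j ≡ χ (par j ℕ.≟ i) + χ (par i ℕ.≟ j)
    interior-first : ∀ i j → i ≤ j → j < n → 2 ≤ d j → 2 ≤ d i
    d-mono         : ∀ i j → i ≤ j → j < n → 2 ≤ d j → d i ≤ d j

χ-1≤ : ∀ {P : Set} (d : Dec P) → 1 ≤ χ d → P
χ-1≤ (yes p) _ = p
χ-1≤ (no _) ()

∑-χ-par : ∀ k p → ∑ k (λ i → χ (p ℕ.≟ i)) ≡ χ (p ℕ.<? k)
∑-χ-par k p with p ℕ.<? k
... | yes p<k = ∑-χ-≡ k p<k
... | no p≮k  = ∑-χ-≢ k (ℕ.≮⇒≥ p≮k)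

∑-ones : ∀ k → ∑ k (λ _ → 1) ≡ k
∑-ones k = trans (∑-const k 1) (ℕ.*-identityʳ k)

∑-all-but-first : ∀ k f → f 0 ≡ 0 → (∀ i → 1 ≤ i → i ≤ k → f i ≡ 1) → ∑ (suc k) f ≡ k
∑-all-but-first k f f0 f1 = trans (∑-front k f) (trans (cong₂ _+_ f0 (∑-cong k λ i i<k → f1 (suc i) (s≤s z≤n) i<k)) (∑-ones k))

module BFSCount {n : ℕ} {a : ℕ → ℕ → ℕ} {d : ℕ → ℕ} (adjacency : IsAdjacency n a)
  (d≡∑ : ∀ i → d i ≡ ∑ n (a i)) (bfs : IsBFS n a d) where
  open EdgeCount adjacency
  open IsBFS bfs

  cnt : ℕ → ℕ → ℕ
  cnt j k = ∑ k λ w → χ (par w ℕ.<? j)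

  -- The second member of an adjacent pair is a child or the parent of the first. Pairs of the
  -- former kind are counted by `cnt` according to the child; of the latter kind there is one for
  -- each of the positions 1 to `j`.
  e-bfs : ∀ j k → suc j ≤ k → k ≤ n → e (suc j) k ≡ j + cnt (suc j) k
  e-bfs j k j<k k≤n = begin
    ∑ (suc j) (λ x → ∑ k (a x))
      ≡⟨ ∑-cong (suc j) (λ x x≤j → trans (∑-cong k λ y y<k → a≡ x y (ℕ.<-≤-trans (ℕ.≤-trans x≤j j<k) k≤n) (ℕ.<-≤-trans y<k k≤n))
           (∑-+ k (λ y → χ (par y ℕ.≟ x)) (λ y → χ (par x ℕ.≟ y)))) ⟩
    ∑ (suc j) (λ x → ∑ k (λ y → χ (par y ℕ.≟ x)) + ∑ k (λ y → χ (par x ℕ.≟ y)))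
      ≡⟨ ∑-+ (suc j) (λ x → ∑ k (λ y → χ (par y ℕ.≟ x))) (λ x → ∑ k (λ y → χ (par x ℕ.≟ y))) ⟩
    ∑ (suc j) (λ x → ∑ k (λ y → χ (par y ℕ.≟ x))) + ∑ (suc j) (λ x → ∑ k (λ y → χ (par x ℕ.≟ y)))
      ≡⟨ cong₂ _+_ (trans (∑-swap (suc j) k (λ x y → χ (par y ℕ.≟ x))) (∑-cong k λ y _ → ∑-χ-par (suc j) (par y)))
           (trans (∑-cong (suc j) λ x _ → ∑-χ-par k (par x)) (∑-all-but-first j (λ x → χ (par x ℕ.<? k)) root below)) ⟩
    cnt (suc j) k + j
      ≡⟨ ℕ.+-comm (cnt (suc j) k) j ⟩
    j + cnt (suc j) k ∎
    where
    open ≡-Reasoning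
    root : χ (par 0 ℕ.<? k) ≡ 0
    root = χ-no (par 0 ℕ.<? k) (ℕ.≤⇒≯ (ℕ.≤-trans k≤n par-root))
    below : ∀ i → 1 ≤ i → i ≤ j → χ (par i ℕ.<? k) ≡ 1
    below i 1≤i i≤j = χ-yes (par i ℕ.<? k) (ℕ.<-trans (par< i (ℕ.<-≤-trans i<k k≤n) 1≤i) i<k)
      where
      i<k : i < k
      i<k = ℕ.≤-trans (s≤s i≤j) j<k

  degree-sum : ∀ j → suc j ≤ n → ∑ (suc j) d ≡ j + cnt (suc j) n
  degree-sum j j<n = trans (∑-cong (suc j) λ i _ → d≡∑ i) (e-bfs j n j<n ℕ.≤-refl)

  cnt-full : ∀ j k → suc k ≤ n → (∀ i → 1 ≤ i → i ≤ k → par i < suc j) → suc j ≤ n → cnt (suc j) (suc k) ≡ k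
  cnt-full j k k<n all j<n = ∑-all-but-first k (λ w → χ (par w ℕ.<? suc j))
    (χ-no (par 0 ℕ.<? suc j) (ℕ.≤⇒≯ (ℕ.≤-trans j<n par-root))) (λ i 1≤i i≤k → χ-yes (par i ℕ.<? suc j) (all i 1≤i i≤k))

  e-square : ∀ j → suc j ≤ n → e (suc j) (suc j) ≡ j + j
  e-square j j<n = trans (e-bfs j (suc j) ℕ.≤-refl j<n)
    (cong (λ z → j + z) (cnt-full j j j<n (λ i 1≤i i≤j → ℕ.m<n⇒m<1+n (ℕ.<-≤-trans (par< i (ℕ.≤-trans (s≤s i≤j) j<n) 1≤i) i≤j)) j<n))

  -- If the parent of position k + 1 is at most `j`, monotonicity of `par` gives the same for all of
  -- 1 to `k`, and the forest bound is attained. Otherwise no later position has a parent up to `j`,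
  -- and no edge leads from the first j + 1 positions beyond the first k + 1.
  e-dichotomy : ∀ j k → j ≤ k → suc k ≤ n → (e (suc j) (suc k) ≡ j + k) ⊎ (e (suc j) (suc k) ≡ ∑ (suc j) d)
  e-dichotomy j k j≤k k<n with suc k ℕ.<? n
  ... | no ¬lt = inj₂ (trans (cong (e (suc j)) (ℕ.≤-antisym k<n (ℕ.≮⇒≥ ¬lt))) (∑-cong (suc j) λ i _ → sym (d≡∑ i)))
  ... | yes 1+k<n with par (suc k) ℕ.<? suc j
  ...   | yes p = inj₁ (trans (e-bfs j (suc k) (s≤s j≤k) k<n) (cong (λ z → j + z)
            (cnt-full j k k<n (λ i 1≤i i≤k → ℕ.≤-<-trans (par-mono i (suc k) 1≤i (ℕ.m≤n⇒m≤1+n i≤k) 1+k<n) p) (ℕ.≤-trans (s≤s j≤k) k<n))))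
  ...   | no ¬p = inj₂ (trans (e-bfs j (suc k) (s≤s j≤k) k<n)
            (trans (cong (λ z → j + z) (sym (extend (n ∸ suc k) (ℕ.≤-reflexive (ℕ.m+[n∸m]≡n k<n)))))
              (trans (cong (λ z → j + cnt (suc j) z) (ℕ.m+[n∸m]≡n k<n)) (sym (degree-sum j (ℕ.≤-trans (s≤s j≤k) k<n))))))
    where
    extend : ∀ t → suc k + t ≤ n → cnt (suc j) (suc k + t) ≡ cnt (suc j) (suc k)
    extend zero    le = cong (cnt (suc j)) (ℕ.+-identityʳ (suc k))
    extend (suc t) le = trans (cong (cnt (suc j)) (ℕ.+-suc (suc k) t))
      (trans (cong₂ _+_ (extend t (ℕ.≤-trans (ℕ.+-monoʳ-≤ (suc k) (ℕ.n≤1+n t)) le))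
        (χ-no (par (suc k + t) ℕ.<? suc j) λ lt → ¬p (ℕ.≤-<-trans
          (par-mono (suc k) (suc k + t) (s≤s z≤n) (ℕ.m≤m+n (suc k) t) (ℕ.≤-trans (ℕ.≤-reflexive (sym (ℕ.+-suc (suc k) t))) le)) lt)))
        (ℕ.+-identityʳ _))

-- A monotone `par` is determined by the numbers of positions whose parent is at most p, and by
-- `degree-sum` these are read off from the sums of the first degrees.
bfs-unique : ∀ {n a a′ d d′} → IsAdjacency n a → IsAdjacency n a′ → (∀ i → d i ≡ ∑ n (a i)) → (∀ i → d′ i ≡ ∑ n (a′ i)) →
  IsBFS n a d → IsBFS n a′ d′ → (∀ i → i < n → d i ≡ d′ i) → ∀ i j → i < n → j < n → a i j ≡ a′ i j
bfs-unique {n} {a} {a′} {d} {d′} adj adj′ d≡∑ d′≡∑ bfs bfs′ d≡d′ i j i<n j<n =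
  trans (B.a≡ i j i<n j<n) (trans (cong₂ _+_ (same i j i<n j<n) (same j i j<n i<n)) (sym (B′.a≡ i j i<n j<n)))
  where
  module B  = IsBFS bfs
  module B′ = IsBFS bfs′
  not-less : ∀ {a a′ d d′} (adj : IsAdjacency n a) (adj′ : IsAdjacency n a′) (d≡∑ : ∀ i → d i ≡ ∑ n (a i)) (d′≡∑ : ∀ i → d′ i ≡ ∑ n (a′ i))
    (bfs : IsBFS n a d) (bfs′ : IsBFS n a′ d′) → (∀ i → i < n → d i ≡ d′ i) →
    ∀ w → w < n → 1 ≤ w → ¬ (IsBFS.par bfs w < IsBFS.par bfs′ w)
  not-less {d = d} {d′} adj adj′ d≡∑ d′≡∑ bfs bfs′ d≡d′ (suc w) w<n _ lt = ℕ.<-irrefl refl (ℕ.≤-trans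
      (ℕ.≤-trans (ℕ.≤-reflexive (sym (C.cnt-full p (suc w) w<n all p<n))) (∑-mono-range (λ w → χ (Q.par w ℕ.<? suc p)) w<n))
      (ℕ.≤-trans (ℕ.≤-reflexive (ℕ.+-cancelˡ-≡ p (C.cnt (suc p) n) (C′.cnt (suc p) n)
        (trans (sym (C.degree-sum p p<n)) (trans (∑-cong (suc p) λ i i≤p → d≡d′ i (ℕ.<-≤-trans i≤p p<n)) (C′.degree-sum p p<n)))))
        few))
    where
    module Q  = IsBFS bfs
    module Q′ = IsBFS bfs′
    module C  = BFSCount adj d≡∑ bfs
    module C′ = BFSCount adj′ d′≡∑ bfs′
    p : ℕ
    p = Q.par (suc w)
    p<n : suc p ≤ n
    p<n = ℕ.<-trans (Q.par< (suc w) w<n (s≤s z≤n)) w<n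
    all : ∀ i → 1 ≤ i → i ≤ suc w → Q.par i < suc p
    all i 1≤i i≤w = s≤s (Q.par-mono i (suc w) 1≤i i≤w w<n)
    term : ∀ i → i < n → χ (Q′.par i ℕ.<? suc p) ≤ χ (1 ℕ.≤? i) * χ (i ℕ.<? suc w)
    term i i<n with Q′.par i ℕ.<? suc p
    ... | no _ = z≤n
    term zero i<n | yes q = contradiction (ℕ.≤-trans p<n Q′.par-root) (ℕ.<⇒≱ q)
    term (suc i) i<n | yes q with suc i ℕ.<? suc w
    ... | yes _ = ℕ.≤-refl
    ... | no ¬i<w = contradiction (ℕ.≤-trans q lt) (ℕ.≤⇒≯ (Q′.par-mono (suc w) (suc i) (s≤s z≤n) (ℕ.≮⇒≥ ¬i<w) i<n))
    few : C′.cnt (suc p) n ≤ w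
    few = ℕ.≤-trans (∑-mono n term) (ℕ.≤-trans (ℕ.≤-reflexive (trans (∑-cong n λ i _ → ℕ.*-comm (χ (1 ℕ.≤? i)) (χ (i ℕ.<? suc w)))
      (∑-χ-< n (λ i → χ (1 ℕ.≤? i)) (ℕ.<⇒≤ w<n))))
      (ℕ.≤-reflexive (∑-all-but-first w (λ i → χ (1 ℕ.≤? i)) refl (λ i 1≤i _ → χ-yes (1 ℕ.≤? i) 1≤i))))
  par≡ : ∀ w → w < n → 1 ≤ w → B.par w ≡ B′.par w
  par≡ w w<n 1≤w = ℕ.≤-antisym
    (ℕ.≮⇒≥ (not-less adj′ adj d′≡∑ d≡∑ bfs′ bfs (λ i i<n → sym (d≡d′ i i<n)) w w<n 1≤w))
    (ℕ.≮⇒≥ (not-less adj adj′ d≡∑ d′≡∑ bfs bfs′ d≡d′ w w<n 1≤w))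
  same : ∀ i j → i < n → j < n → χ (B.par j ℕ.≟ i) ≡ χ (B′.par j ℕ.≟ i)
  same i zero i<n _ = trans (χ-no (B.par 0 ℕ.≟ i) λ { refl → ℕ.<⇒≱ i<n B.par-root })
    (sym (χ-no (B′.par 0 ℕ.≟ i) λ { refl → ℕ.<⇒≱ i<n B′.par-root }))
  same i (suc j) i<n j<n = cong (λ p → χ (p ℕ.≟ i)) (par≡ (suc j) j<n (s≤s z≤n))

module Parents {n : ℕ} {a : ℕ → ℕ → ℕ} (adjacency : IsAdjacency n a)
  (one-earlier : ∀ i → 1 ≤ i → i < n → ∑ i (λ x → a x i) ≡ 1) where
  open IsAdjacency adjacency

  opaque
    parent : ∀ i → 1 ≤ i → i < n → ∃[ k ] (k < i × 1 ≤ a k i)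
    parent i 1≤i i<n = ∑-witness i (λ x → a x i) (ℕ.≤-reflexive (sym (one-earlier i 1≤i i<n)))

  a-parent : ∀ i k → i < n → k < i → 1 ≤ a k i → ∀ x → x < i → a x i ≡ χ (k ℕ.≟ x)
  a-parent i k i<n k<i 1≤ x x<i = sym (∑-squeeze i le
      (ℕ.≤-reflexive (trans (one-earlier i (ℕ.≤-trans (s≤s z≤n) k<i) i<n) (sym (∑-χ-≡ i k<i)))) x x<i)
    where
    le : ∀ x → x < i → χ (k ℕ.≟ x) ≤ a x i
    le x _ with k ℕ.≟ x
    ... | yes refl = 1≤
    ... | no _     = z≤n

  parent-unique : ∀ i k k′ → i < n → k < i → k′ < i → 1 ≤ a k i → 1 ≤ a k′ i → k ≡ k′
  parent-unique i k k′ i<n k<i k′<i p q = χ-1≤ (k ℕ.≟ k′) (subst (1 ≤_) (a-parent i k i<n k<i p k′ k′<i) q)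

  parents⇒bfs : ∀ {d} → (∀ {i i′ k k′} → i < i′ → i′ < n → k < i → k′ < i′ → 1 ≤ a k i → 1 ≤ a k′ i′ → k ≤ k′) →
    (∀ i j → i ≤ j → j < n → 2 ≤ d j → 2 ≤ d i) → (∀ i j → i ≤ j → j < n → 2 ≤ d j → d i ≤ d j) → IsBFS n a d
  parents⇒bfs ordered interior-first d-mono = record
    { par = par ; par-root = ℕ.≤-refl
    ; par< = λ i i<n 1≤i → proj₁ (par-spec i 1≤i i<n)
    ; par-mono = par-mono
    ; a≡ = form
    ; interior-first = interior-first
    ; d-mono = d-mono }
    where
    par : ℕ → ℕ
    par zero = n
    par (suc i) with suc i ℕ.<? n
    ... | yes i<n = proj₁ (parent (suc i) (s≤s z≤n) i<n)
    ... | no _    = 0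
    par-spec : ∀ i → 1 ≤ i → i < n → par i < i × 1 ≤ a (par i) i
    par-spec (suc i) _ i<n with suc i ℕ.<? n
    ... | yes i<n′ = proj₂ (parent (suc i) (s≤s z≤n) i<n′)
    ... | no ¬i<n  = contradiction i<n ¬i<n
    par-mono : ∀ i j → 1 ≤ i → i ≤ j → j < n → par i ≤ par j
    par-mono i j 1≤i i≤j j<n with ℕ.m≤n⇒m<n∨m≡n i≤j
    ... | inj₂ refl = ℕ.≤-refl
    ... | inj₁ i<j =
      let p<i , 1≤p = par-spec i 1≤i (ℕ.<-trans i<j j<n)
          q<j , 1≤q = par-spec j (ℕ.≤-trans 1≤i i≤j) j<n
      in ordered i<j j<n p<i q<j 1≤p 1≤q
    not-parent : ∀ x y → x < y → y < n → par x ≢ y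
    not-parent zero    y _   y<n refl = ℕ.<-irrefl refl y<n
    not-parent (suc x) y x<y y<n refl = ℕ.<-asym x<y (proj₁ (par-spec (suc x) (s≤s z≤n) (ℕ.<-trans x<y y<n)))
    forward : ∀ x y → x < y → y < n → a x y ≡ χ (par y ℕ.≟ x) + χ (par x ℕ.≟ y)
    forward x y x<y y<n = let p<y , 1≤p = par-spec y (ℕ.≤-trans (s≤s z≤n) x<y) y<n in
      trans (a-parent y (par y) y<n p<y 1≤p x x<y) (sym (trans (cong (λ z → χ (par y ℕ.≟ x) + z) (χ-no (par x ℕ.≟ y) (not-parent x y x<y y<n))) (ℕ.+-identityʳ _)))
    no-fixpoint : ∀ x → x < n → par x ≢ x
    no-fixpoint zero    x<n eq = ℕ.<-irrefl (sym eq) x<n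
    no-fixpoint (suc x) x<n eq = ℕ.<-irrefl eq (proj₁ (par-spec (suc x) (s≤s z≤n) x<n))
    form : ∀ x y → x < n → y < n → a x y ≡ χ (par y ℕ.≟ x) + χ (par x ℕ.≟ y)
    form x y x<n y<n with ℕ.<-cmp x y
    ... | tri< x<y _ _ = forward x y x<y y<n
    ... | tri> _ _ y<x = trans (a-sym x y) (trans (forward y x y<x x<n) (ℕ.+-comm (χ (par x ℕ.≟ y)) _))
    ... | tri≈ _ refl _ = trans (a-diag x) (sym (cong₂ _+_ (χ-no (par x ℕ.≟ x) (no-fixpoint x x<n)) (χ-no (par x ℕ.≟ x) (no-fixpoint x x<n))))

-- Degree sequences with interior vertices first

module Prefix {n m : ℕ} {d d′ : ℕ → ℕ} (m≤n : m ≤ n)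
  (interior  : ∀ i → i < n → 2 ≤ d i → i < m) (interior′ : ∀ i → i < n → i < m → 2 ≤ d′ i)
  (same : ∀ (ψ : ℕ → ℕ) → ∑ n (ψ ∘ d) ≡ ∑ n (ψ ∘ d′)) where

  module Threshold (j t : ℕ) (j≤m : j ≤ m) (below : ∀ i → i < j → d i ≤ t) (above : ∀ i → j ≤ i → i < m → t ≤ d i) where

    -- The deficit of an interior degree below the threshold; leaves have none. A degree plus its
    -- deficit is at least `t`, with equality for degrees up to `t`. As the total deficit depends
    -- only on the multiset, the two sums of first degrees can be compared without sorting.
    ψ : ℕ → ℕ
    ψ x = χ (2 ℕ.≤? x) * (t ∸ x)

    private
      j≤n : j ≤ n
      j≤n = ℕ.≤-trans j≤m m≤n

      ψ≤ : ∀ x → ψ x ≤ t ∸ x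
      ψ≤ x = ℕ.≤-trans (ℕ.*-monoˡ-≤ (t ∸ x) (χ≤1 (2 ℕ.≤? x))) (ℕ.≤-reflexive (ℕ.*-identityˡ (t ∸ x)))

      upper : ∑ j d + ∑ n (ψ ∘ d) ≤ ∑ j (λ _ → t)
      upper = begin
        ∑ j d + ∑ n (ψ ∘ d)                        ≤⟨ ℕ.+-monoʳ-≤ (∑ j d) (∑-mono n tail) ⟩
        ∑ j d + ∑ n (λ i → χ (i ℕ.<? j) * (t ∸ d i))  ≡⟨ cong (λ z → ∑ j d + z) (∑-χ-< n (λ i → t ∸ d i) j≤n) ⟩
        ∑ j d + ∑ j (λ i → t ∸ d i)                ≡⟨ ∑-+ j d (λ i → t ∸ d i) ⟨
        ∑ j (λ i → d i + (t ∸ d i))                ≡⟨ ∑-cong j (λ i i<j → ℕ.m+[n∸m]≡n (below i i<j)) ⟩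
        ∑ j (λ _ → t)                              ∎
        where
        open ℕ.≤-Reasoning
        tail : ∀ i → i < n → ψ (d i) ≤ χ (i ℕ.<? j) * (t ∸ d i)
        tail i i<n with i ℕ.<? j
        ... | yes _ = ℕ.≤-trans (ψ≤ (d i)) (ℕ.≤-reflexive (sym (ℕ.*-identityˡ _)))
        ... | no ¬i<j with 2 ℕ.≤? d i
        ...   | no _    = z≤n
        ...   | yes 2≤d = ℕ.≤-reflexive (trans (ℕ.+-identityʳ _) (ℕ.m≤n⇒m∸n≡0 (above i (ℕ.≮⇒≥ ¬i<j) (interior i i<n 2≤d))))

      lower-term : ∀ i → i < j → t ≤ d′ i + ψ (d′ i)
      lower-term i i<j = ℕ.≤-trans (ℕ.m≤n+m∸n t (d′ i)) (ℕ.≤-reflexive (cong (λ z → d′ i + z)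
        (sym (trans (cong (_* (t ∸ d′ i)) (χ-yes (2 ℕ.≤? d′ i) (interior′ i (ℕ.<-≤-trans i<j j≤n) (ℕ.<-≤-trans i<j j≤m)))) (ℕ.*-identityˡ _)))))

      lower : ∑ j (λ _ → t) ≤ ∑ j d′ + ∑ j (ψ ∘ d′)
      lower = ℕ.≤-trans (∑-mono j lower-term) (ℕ.≤-reflexive (∑-+ j d′ (ψ ∘ d′)))

      ∑ψ-mono : ∑ j (ψ ∘ d′) ≤ ∑ n (ψ ∘ d′)
      ∑ψ-mono = ∑-mono-range (ψ ∘ d′) j≤n

    prefix≤ : ∑ j d ≤ ∑ j d′
    prefix≤ = ℕ.+-cancelʳ-≤ (∑ n (ψ ∘ d)) (∑ j d) (∑ j d′)
      (ℕ.≤-trans upper (ℕ.≤-trans lower (ℕ.+-monoʳ-≤ (∑ j d′) (ℕ.≤-trans ∑ψ-mono (ℕ.≤-reflexive (sym (same ψ)))))))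

    module _ (eq : ∑ j d ≡ ∑ j d′) where
      private
        total : ∑ j d′ + ∑ n (ψ ∘ d′) ≤ ∑ j (λ _ → t)
        total = subst₂ (λ p q → p + q ≤ ∑ j (λ _ → t)) eq (same ψ) upper

      -- Equality of the two sums makes every estimate behind `prefix≤` sharp, so the same threshold
      -- separates the entries of `d′` at `j`.
      below′ : ∀ i → i < j → d′ i ≤ t
      below′ i i<j = ℕ.≤-trans (ℕ.m≤m+n (d′ i) (ψ (d′ i))) (ℕ.≤-reflexive (sym (∑-squeeze j lower-term
        (ℕ.≤-trans (ℕ.≤-reflexive (∑-+ j d′ (ψ ∘ d′))) (ℕ.≤-trans (ℕ.+-monoʳ-≤ (∑ j d′) ∑ψ-mono) total)) i i<j)))

      above′ : ∀ i → j ≤ i → i < m → t ≤ d′ i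
      above′ i j≤i i<m = ℕ.m∸n≡0⇒m≤n (trans (sym (trans (cong (_* (t ∸ d′ i)) (χ-yes (2 ℕ.≤? d′ i) (interior′ i i<n i<m))) (ℕ.*-identityˡ _)))
          (trans (sym (∑-squeeze n {λ i → χ (i ℕ.<? j) * ψ (d′ i)} {ψ ∘ d′} le
            (ℕ.≤-trans (ℕ.+-cancelˡ-≤ (∑ j d′) _ _ (ℕ.≤-trans total lower)) (ℕ.≤-reflexive (sym (∑-χ-< n (ψ ∘ d′) j≤n)))) i i<n))
            (cong (_* ψ (d′ i)) (χ-no (i ℕ.<? j) (ℕ.≤⇒≯ j≤i)))))
        where
        i<n : i < n
        i<n = ℕ.<-≤-trans i<m m≤n
        le : ∀ i → i < n → χ (i ℕ.<? j) * ψ (d′ i) ≤ ψ (d′ i)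
        le i _ = ℕ.≤-trans (ℕ.*-monoˡ-≤ (ψ (d′ i)) (χ≤1 (i ℕ.<? j))) (ℕ.≤-reflexive (ℕ.*-identityˡ _))

  prefix-sum≤ : (∀ i j → i ≤ j → j < m → d i ≤ d j) → ∀ j → j ≤ m → ∑ j d ≤ ∑ j d′
  prefix-sum≤ mono zero    _   = z≤n
  prefix-sum≤ mono (suc j) j<m = Threshold.prefix≤ (suc j) (d j) j<m
    (λ i i<j → mono i j (s≤s⁻¹ i<j) j<m) (λ i j<i i<m → mono j i (ℕ.<⇒≤ j<i) i<m)

interior-count : ∀ n (d : ℕ → ℕ) → (∀ i j → i ≤ j → j < n → 2 ≤ d j → 2 ≤ d i) →
  let m = ∑ n (λ i → χ (2 ℕ.≤? d i)) in m ≤ n × (∀ i → i < n → 2 ≤ d i → i < m) × (∀ i → i < n → i < m → 2 ≤ d i)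
interior-count zero    d first = z≤n , (λ _ ()) , (λ _ ())
interior-count (suc n) d first with 2 ℕ.≤? d n | interior-count n d (λ i j i≤j j<n → first i j i≤j (ℕ.m<n⇒m<1+n j<n))
... | no ¬2≤ | m≤n , f , g = subst (λ m → m ≤ suc n × (∀ i → i < suc n → 2 ≤ d i → i < m) × (∀ i → i < suc n → i < m → 2 ≤ d i))
    (sym (ℕ.+-identityʳ _)) (ℕ.m≤n⇒m≤1+n m≤n , f′ , (λ i _ i<m → g i (ℕ.<-≤-trans i<m m≤n) i<m))
  where
  f′ : ∀ i → i < suc n → 2 ≤ d i → i < ∑ n (λ i → χ (2 ℕ.≤? d i))
  f′ i i<1+n 2≤ with i ℕ.≟ n
  ... | yes refl = contradiction 2≤ ¬2≤
  ... | no i≢n   = f i (ℕ.≤∧≢⇒< (s≤s⁻¹ i<1+n) i≢n) 2≤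
... | yes 2≤ | _ = subst (λ m → m ≤ suc n × (∀ i → i < suc n → 2 ≤ d i → i < m) × (∀ i → i < suc n → i < m → 2 ≤ d i))
    (trans (cong suc (sym count)) (ℕ.+-comm 1 _)) (ℕ.≤-refl , (λ i i<n _ → i<n) , (λ i _ i<n → all i (s≤s⁻¹ i<n)))
  where
  all : ∀ i → i ≤ n → 2 ≤ d i
  all i i≤n = first i n i≤n ℕ.≤-refl 2≤
  count : ∑ n (λ i → χ (2 ℕ.≤? d i)) ≡ n
  count = trans (∑-cong n λ i i<n → χ-yes (2 ℕ.≤? d i) (all i (ℕ.<⇒≤ i<n))) (∑-ones n)

-- Summation by parts of the quadratic form

∑ʳ-truncate : ∀ n {m f} → m ≤ n → (∀ i → m ≤ i → i < n → f i ≈ 0ℝ) → ∑ʳ n f ≈ ∑ʳ m f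
∑ʳ-truncate n {m} {f} m≤n f≈0 with ℕ.m≤n⇒m<n∨m≡n m≤n
... | inj₂ refl = ≈-refl
∑ʳ-truncate (suc n) {m} {f} m≤n f≈0 | inj₁ (s≤s m≤n′) = ≈-trans
  (+ʳ-cong (∑ʳ-truncate n m≤n′ λ i m≤i i<n → f≈0 i m≤i (ℕ.m<n⇒m<1+n i<n)) (f≈0 n m≤n′ ℕ.≤-refl)) (+ʳ-identityʳ _)

∑-χ-⊓ : ∀ j k (f : ℕ → ℕ) → ∑ k (λ i → χ (i ℕ.<? j) * f i) ≡ ∑ (j ⊓ k) f
∑-χ-⊓ j k f with ℕ.≤-total j k
... | inj₁ j≤k = trans (∑-χ-< k f j≤k) (cong (λ l → ∑ l f) (sym (ℕ.m≤n⇒m⊓n≡m j≤k)))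
... | inj₂ k≤j = trans (∑-cong k λ i i<k → trans (cong (_* f i) (χ-yes (i ℕ.<? j) (ℕ.<-≤-trans i<k k≤j))) (ℕ.*-identityˡ (f i)))
  (cong (λ l → ∑ l f) (sym (ℕ.m≥n⇒m⊓n≡n k≤j)))

abel-truncated : ∀ m (u x : ℕ → ℝ) → u m ≈ 0ℝ →
  ∑ʳ m (λ i → u i *ʳ x i) ≈ ∑ʳ m (λ p → (u p -ʳ u (suc p)) *ʳ ∑ʳ (suc p) x)
abel-truncated m u x um≈0 = ≈-trans (abel-summation m u x) (≈-trans (+ʳ-cong ≈-refl (*ʳ-zeroˡ um≈0)) (+ʳ-identityʳ _))

module AbelEnergy {n : ℕ} {a : ℕ → ℕ → ℕ} (adjacency : IsAdjacency n a) (d : ℕ → ℕ)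
  (m : ℕ) (m<n : m < n) (g : ℕ → ℝ) (g≈0 : ∀ i → m ≤ i → i < n → g i ≈ 0ℝ) where
  open EdgeCount adjacency
  open Energy adjacency d
  open ≈-Reasoning

  -- The sum of the Laplacian entries in the first `j` rows and `k` columns. For a graph it is
  -- N(j,k): the degree sum of the smaller segment minus the pairs staying inside the larger.
  M : ℕ → ℕ → ℝ
  M j k = ι (∑ (j ⊓ k) d) -ʳ ι (e j k)

  δ : ℕ → ℝ
  δ p = g p -ʳ g (suc p)

  private
    c : ℕ → ℕ → ℝ
    c j i = ι (χ (i ℕ.<? j) * d i) -ʳ ι (∑ j (λ x → a x i))

    c-sum : ∀ j k → ∑ʳ k (c j) ≈ M j k
    c-sum j k = begin
      ∑ʳ k (c j)
        ≈⟨ ∑ʳ-sub k (λ i → ι (χ (i ℕ.<? j) * d i)) (λ i → ι (∑ j (λ x → a x i))) ⟩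
      ∑ʳ k (λ i → ι (χ (i ℕ.<? j) * d i)) -ʳ ∑ʳ k (λ i → ι (∑ j (λ x → a x i)))
        ≈⟨ +ʳ-cong (ι-∑ k (λ i → χ (i ℕ.<? j) * d i)) (-ʳ-cong (ι-∑ k (λ i → ∑ j (λ x → a x i)))) ⟨
      ι (∑ k (λ i → χ (i ℕ.<? j) * d i)) -ʳ ι (∑ k (λ i → ∑ j (λ x → a x i)))
        ≈⟨ +ʳ-cong (ℝR.reflexive (cong ι (∑-χ-⊓ j k d))) (-ʳ-cong (ℝR.reflexive (cong ι (sym (∑-swap j k a))))) ⟩
      M j k ∎

    Δ-sum : ∀ j → j ≤ m → ∑ʳ j (Δ g) ≈ ∑ʳ m (λ i → g i *ʳ c j i)
    Δ-sum j j≤m = begin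
      ∑ʳ j (Δ g)
        ≈⟨ ∑ʳ-sub j (λ i → ι (d i) *ʳ g i) (λ x → ∑ʳ n (λ i → ι (a x i) *ʳ g i)) ⟩
      ∑ʳ j (λ i → ι (d i) *ʳ g i) -ʳ ∑ʳ j (λ x → ∑ʳ n (λ i → ι (a x i) *ʳ g i))
        ≈⟨ +ʳ-cong diagonal (-ʳ-cong off) ⟩
      ∑ʳ m (λ i → g i *ʳ ι (χ (i ℕ.<? j) * d i)) -ʳ ∑ʳ m (λ i → g i *ʳ ι (∑ j (λ x → a x i)))
        ≈⟨ ∑ʳ-sub m (λ i → g i *ʳ ι (χ (i ℕ.<? j) * d i)) (λ i → g i *ʳ ι (∑ j (λ x → a x i))) ⟨
      ∑ʳ m (λ i → g i *ʳ ι (χ (i ℕ.<? j) * d i) -ʳ g i *ʳ ι (∑ j (λ x → a x i)))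
        ≈⟨ Σʳ.∑-cong m (λ i _ → solve 3 (λ g x y → g :* x :- g :* y := g :* (x :- y)) ≈-refl (g i) (ι (χ (i ℕ.<? j) * d i)) (ι (∑ j (λ x → a x i)))) ⟩
      ∑ʳ m (λ i → g i *ʳ c j i) ∎
      where
      open ℝ-Solver
      diagonal : ∑ʳ j (λ i → ι (d i) *ʳ g i) ≈ ∑ʳ m (λ i → g i *ʳ ι (χ (i ℕ.<? j) * d i))
      diagonal = ≈-sym (≈-trans
        (∑ʳ-truncate m j≤m λ i j≤i _ → *ʳ-zeroʳ (≈-trans (ℝR.reflexive (cong (λ z → ι (z * d i)) (χ-no (i ℕ.<? j) (ℕ.≤⇒≯ j≤i)))) ι-0))
        (Σʳ.∑-cong j λ i i<j → ≈-trans (*ʳ-comm _ _) (*ʳ-cong (ℝR.reflexive (cong ι (trans (cong (_* d i) (χ-yes (i ℕ.<? j) i<j)) (ℕ.*-identityˡ (d i))))) ≈-refl)))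
      off : ∑ʳ j (λ x → ∑ʳ n (λ i → ι (a x i) *ʳ g i)) ≈ ∑ʳ m (λ i → g i *ʳ ι (∑ j (λ x → a x i)))
      off = begin
        ∑ʳ j (λ x → ∑ʳ n (λ i → ι (a x i) *ʳ g i))
          ≈⟨ Σʳ.∑-swap j n (λ x i → ι (a x i) *ʳ g i) ⟩
        ∑ʳ n (λ i → ∑ʳ j (λ x → ι (a x i) *ʳ g i))
          ≈⟨ Σʳ.∑-cong n (λ i _ → ≈-trans (Σʳ.∑-cong j λ x _ → *ʳ-comm _ _) (≈-trans (≈-sym (Σʳ.∑-*ˡ j (g i) (λ x → ι (a x i)))) (*ʳ-cong ≈-refl (≈-sym (ι-∑ j (λ x → a x i)))))) ⟩
        ∑ʳ n (λ i → g i *ʳ ι (∑ j (λ x → a x i)))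
          ≈⟨ ∑ʳ-truncate n (ℕ.<⇒≤ m<n) (λ i m≤i i<n → *ʳ-zeroˡ (g≈0 i m≤i i<n)) ⟩
        ∑ʳ m (λ i → g i *ʳ ι (∑ j (λ x → a x i))) ∎

  -- Summation by parts in both variables. The end terms vanish because `m` is still a position of
  -- the array and `g` is zero there.
  energy-abel : energy g ≈ ∑ʳ m (λ p → ∑ʳ m (λ q → (δ p *ʳ δ q) *ʳ M (suc p) (suc q)))
  energy-abel = begin
    energy g
      ≈⟨ ∑ʳ-truncate n (ℕ.<⇒≤ m<n) (λ i m≤i i<n → *ʳ-zeroˡ (g≈0 i m≤i i<n)) ⟩
    ∑ʳ m (λ i → g i *ʳ Δ g i)
      ≈⟨ abel-truncated m g (Δ g) gm≈0 ⟩
    ∑ʳ m (λ p → δ p *ʳ ∑ʳ (suc p) (Δ g))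
      ≈⟨ Σʳ.∑-cong m (λ p p<m → begin
           δ p *ʳ ∑ʳ (suc p) (Δ g)
             ≈⟨ *ʳ-cong ≈-refl (≈-trans (Δ-sum (suc p) p<m) (≈-trans (abel-truncated m g (c (suc p)) gm≈0)
                  (Σʳ.∑-cong m λ q _ → *ʳ-cong ≈-refl (c-sum (suc p) (suc q))))) ⟩
           δ p *ʳ ∑ʳ m (λ q → δ q *ʳ M (suc p) (suc q))
             ≈⟨ ≈-trans (Σʳ.∑-*ˡ m (δ p) (λ q → δ q *ʳ M (suc p) (suc q))) (Σʳ.∑-cong m λ q _ → ≈-sym (*ʳ-assoc _ _ _)) ⟩
           ∑ʳ m (λ q → (δ p *ʳ δ q) *ʳ M (suc p) (suc q)) ∎) ⟩
    ∑ʳ m (λ p → ∑ʳ m (λ q → (δ p *ʳ δ q) *ʳ M (suc p) (suc q))) ∎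
    where
    gm≈0 : g m ≈ 0ℝ
    gm≈0 = g≈0 m ℕ.≤-refl m<n

-- Comparison of an arbitrary tree H with a breadth-first tree S

ι-injective : ∀ {a b} → ι a ≈ ι b → a ≡ b
ι-injective {a} {b} eq = ℕ.≤-antisym (ℕ.≮⇒≥ (not-less (≈-sym eq))) (ℕ.≮⇒≥ (not-less eq))
  where
  open ℝ-Solver
  not-less : ∀ {a b} → ι a ≈ ι b → ¬ a < b
  not-less {a} {b} eq a<b = Pos⇒≉0 (ι-pos (b ∸ suc a)) (begin
    ι (suc (b ∸ suc a))                     ≈⟨ solve 2 (λ x y → x := (y :+ x) :- y) ≈-refl (ι (suc (b ∸ suc a))) (ι a) ⟩
    (ι a +ʳ ι (suc (b ∸ suc a))) -ʳ ι a     ≈⟨ +ʳ-cong (≈-trans (≈-sym (ι-+ a _)) (ℝR.reflexive (cong ι (trans (ℕ.+-suc a _) (ℕ.m+[n∸m]≡n a<b))))) ≈-refl ⟩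
    ι b -ʳ ι a                              ≈⟨ ≈-⇒-≈0 (≈-sym eq) ⟩
    0ℝ                                      ∎)
    where open ≈-Reasoning

record Comparable (n m : ℕ) (aS aH : ℕ → ℕ → ℕ) (dS dH : ℕ → ℕ) : Set where
  field
    adjS       : IsAdjacency n aS
    adjH       : IsAdjacency n aH
    dS≡∑       : ∀ i → dS i ≡ ∑ n (aS i)
    dH≡∑       : ∀ i → dH i ≡ ∑ n (aH i)
    bfsS       : IsBFS n aS dS
    m<n        : m < n
    interiorS  : ∀ i → i < n → 2 ≤ dS i → i < m
    interiorS′ : ∀ i → i < n → i < m → 2 ≤ dS i
    interiorH  : ∀ i → i < n → 2 ≤ dH i → i < m
    interiorH′ : ∀ i → i < n → i < m → 2 ≤ dH i
    same       : ∀ (ψ : ℕ → ℕ) → ∑ n (ψ ∘ dS) ≡ ∑ n (ψ ∘ dH)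
    forestH    : ∀ j i → j ≤ i → i < n → EdgeCount.e adjH j j + 2 * ∑ j (λ x → aH x i) ≤ 2 * j

module Comparison {n m : ℕ} {aS aH : ℕ → ℕ → ℕ} {dS dH : ℕ → ℕ} (comparable : Comparable n m aS aH dS dH) where
  open Comparable comparable public
  module ES = EdgeCount adjS
  module EH = EdgeCount adjH
  module BS = IsBFS bfsS
  module CS = BFSCount adjS dS≡∑ bfsS

  eS eH : ℕ → ℕ → ℕ
  eS = ES.e
  eH = EH.e

  open Prefix {n} {m} {dS} {dH} (ℕ.<⇒≤ m<n) interiorS interiorH′ same public

  dS-mono : ∀ i j → i ≤ j → j < m → dS i ≤ dS j
  dS-mono i j i≤j j<m = BS.d-mono i j i≤j (ℕ.<-trans j<m m<n) (interiorS′ j (ℕ.<-trans j<m m<n) j<m)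

  eH-square : ∀ j → j < n → eH (suc j) (suc j) ≤ j + j
  eH-square j j<n = subst₂ _≤_ (sym (EH.e-suc j)) (cong (λ z → j + z) (ℕ.+-identityʳ j)) (forestH j j ℕ.≤-refl j<n)

  -- By convexity this is the mean of the forest bounds 2j and 2k for the two squares.
  eH≤j+k : ∀ j k → j ≤ k → k < n → eH (suc j) (suc k) ≤ j + k
  eH≤j+k j k j≤k k<n = ℕ.*-cancelˡ-≤ 2 (begin
    2 * eH (suc j) (suc k)                       ≡⟨ cong (λ z → eH (suc j) (suc k) + z) (ℕ.+-identityʳ _) ⟩
    eH (suc j) (suc k) + eH (suc j) (suc k)      ≤⟨ subst (λ l → eH (suc j) l + eH (suc j) l ≤ eH (suc j) (suc j) + eH l l) (cong suc (ℕ.m+[n∸m]≡n j≤k)) (EH.e-convex (suc j) (k ∸ j)) ⟩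
    eH (suc j) (suc j) + eH (suc k) (suc k)      ≤⟨ ℕ.+-mono-≤ (eH-square j (ℕ.≤-<-trans j≤k k<n)) (eH-square k k<n) ⟩
    (j + j) + (k + k)                            ≡⟨ solve 2 (λ j k → (j :+ j) :+ (k :+ k) := con 2 :* (j :+ k)) refl j k ⟩
    2 * (j + k)                                  ∎)
    where
    open ℕ.≤-Reasoning
    open ℕ-Solver

  eH≤degrees : ∀ j k → k ≤ n → eH j k ≤ ∑ j dH
  eH≤degrees j k k≤n = ∑-mono j λ i _ → ℕ.≤-trans (∑-mono-range (aH i) k≤n) (ℕ.≤-reflexive (sym (dH≡∑ i)))

  -- The comparison of N for S and H with the subtractions moved across. Either S has the smallest
  -- degree sum and the largest possible number of inner pairs, or N vanishes for S.
  core-≤ : ∀ j k → j ≤ k → k < m → ∑ (suc j) dS + eH (suc j) (suc k) ≤ ∑ (suc j) dH + eS (suc j) (suc k)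
  core-≤ j k j≤k k<m with CS.e-dichotomy j k j≤k (ℕ.<-trans k<m m<n)
  ... | inj₁ eq = ℕ.+-mono-≤ (prefix-sum≤ dS-mono (suc j) (ℕ.≤-<-trans j≤k k<m)) (ℕ.≤-trans (eH≤j+k j k j≤k (ℕ.<-trans k<m m<n)) (ℕ.≤-reflexive (sym eq)))
  ... | inj₂ eq = ℕ.≤-trans (ℕ.+-monoʳ-≤ (∑ (suc j) dS) (eH≤degrees (suc j) (suc k) (ℕ.<-trans k<m m<n)))
    (ℕ.≤-reflexive (trans (ℕ.+-comm (∑ (suc j) dS) _) (cong (λ z → ∑ (suc j) dH + z) (sym eq))))

  core : ∀ p q → p < m → q < m → ∑ (suc p ⊓ suc q) dS + eH (suc p) (suc q) ≤ ∑ (suc p ⊓ suc q) dH + eS (suc p) (suc q)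
  core p q p<m q<m with ℕ.≤-total p q
  ... | inj₁ p≤q = subst (λ l → ∑ l dS + eH (suc p) (suc q) ≤ ∑ l dH + eS (suc p) (suc q)) (sym (ℕ.m≤n⇒m⊓n≡m (s≤s p≤q))) (core-≤ p q p≤q q<m)
  ... | inj₂ q≤p = subst₂ _≤_ (cong₂ (λ l z → ∑ l dS + z) (sym (ℕ.m≥n⇒m⊓n≡n (s≤s q≤p))) (EH.e-sym (suc q) (suc p)))
    (cong₂ (λ l z → ∑ l dH + z) (sym (ℕ.m≥n⇒m⊓n≡n (s≤s q≤p))) (ES.e-sym (suc q) (suc p))) (core-≤ q p q≤p p<m)

  module Energies (g : ℕ → ℝ) (g≈0 : ∀ i → m ≤ i → i < n → g i ≈ 0ℝ) (sorted : ∀ i → suc i < n → g (suc i) ≤ʳ g i) where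
    module AS = AbelEnergy adjS dS m m<n g g≈0
    module AH = AbelEnergy adjH dH m m<n g g≈0

    energyS energyH : ℝ
    energyS = Energy.energy adjS dS g
    energyH = Energy.energy adjH dH g

    δ : ℕ → ℝ
    δ = AS.δ

    0≤δ : ∀ p → p < m → 0ℝ ≤ʳ δ p
    0≤δ p p<m = ≤⇒0≤- (sorted p (ℕ.≤-<-trans p<m m<n))

    M-difference : ∀ p q → AH.M (suc p) (suc q) -ʳ AS.M (suc p) (suc q) ≈
      ι (∑ (suc p ⊓ suc q) dH + eS (suc p) (suc q)) -ʳ ι (∑ (suc p ⊓ suc q) dS + eH (suc p) (suc q))
    M-difference p q = ≈-trans
      (solve 4 (λ a b c d → (a :- b) :- (c :- d) := (a :+ d) :- (c :+ b)) ≈-refl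
        (ι (∑ (suc p ⊓ suc q) dH)) (ι (eH (suc p) (suc q))) (ι (∑ (suc p ⊓ suc q) dS)) (ι (eS (suc p) (suc q))))
      (≈-sym (+ʳ-cong (ι-+ _ _) (-ʳ-cong (ι-+ _ _))))
      where open ℝ-Solver

    term : ℕ → ℕ → ℝ
    term p q = (δ p *ʳ δ q) *ʳ (AH.M (suc p) (suc q) -ʳ AS.M (suc p) (suc q))

    0≤term : ∀ p q → p < m → q < m → 0ℝ ≤ʳ term p q
    0≤term p q p<m q<m = 0≤ʳ-* (0≤ʳ-* (0≤δ p p<m) (0≤δ q q<m)) (0≤-resp-≈ (≈-sym (M-difference p q)) (≤⇒0≤- (ι-mono (core p q p<m q<m))))

    energy-difference : energyH -ʳ energyS ≈ ∑ʳ m (λ p → ∑ʳ m (term p))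
    energy-difference = begin
      energyH -ʳ energyS
        ≈⟨ +ʳ-cong AH.energy-abel (-ʳ-cong AS.energy-abel) ⟩
      ∑ʳ m (λ p → ∑ʳ m (λ q → (δ p *ʳ δ q) *ʳ AH.M (suc p) (suc q))) -ʳ ∑ʳ m (λ p → ∑ʳ m (λ q → (δ p *ʳ δ q) *ʳ AS.M (suc p) (suc q)))
        ≈⟨ ∑ʳ-sub m _ _ ⟨
      ∑ʳ m (λ p → ∑ʳ m (λ q → (δ p *ʳ δ q) *ʳ AH.M (suc p) (suc q)) -ʳ ∑ʳ m (λ q → (δ p *ʳ δ q) *ʳ AS.M (suc p) (suc q)))
        ≈⟨ Σʳ.∑-cong m (λ p _ → ≈-trans (≈-sym (∑ʳ-sub m _ _))
             (Σʳ.∑-cong m λ q _ → solve 3 (λ D x y → D :* x :- D :* y := D :* (x :- y)) ≈-refl (δ p *ʳ δ q) (AH.M (suc p) (suc q)) (AS.M (suc p) (suc q)))) ⟩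
      ∑ʳ m (λ p → ∑ʳ m (term p)) ∎
      where
      open ≈-Reasoning
      open ℝ-Solver

    energyS≤energyH : energyS ≤ʳ energyH
    energyS≤energyH = 0≤-⇒≤ (0≤-resp-≈ (≈-sym energy-difference) (∑ʳ-nonneg m λ p p<m → ∑ʳ-nonneg m λ q q<m → 0≤term p q p<m q<m))

    -- The energy difference is a sum of nonnegative terms, so all of them vanish, and where both
    -- drops of `g` are positive the integer factor must be zero. A failed tie gives positivity only
    -- under a double negation, enough for an equality of natural numbers.
    core-equality : energyH ≤ʳ energyS → ∀ p q → p < m → q < m → ¬ g p ≈ g (suc p) → ¬ g q ≈ g (suc q) →
      ∑ (suc p ⊓ suc q) dS + eH (suc p) (suc q) ≡ ∑ (suc p ⊓ suc q) dH + eS (suc p) (suc q)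
    core-equality le p q p<m q<m p-break q-break = ℕ.≤-antisym (core p q p<m q<m) (ℕ.≮⇒≥ λ lt →
      ¬¬-excluded-middle {A = Pos (δ p)} λ where
        (no ¬pos) → p-break (-≈0⇒≈ (0≤∧¬Pos⇒≈0 (0≤δ p p<m) ¬pos))
        (yes δp) → ¬¬-excluded-middle {A = Pos (δ q)} λ where
          (no ¬pos) → q-break (-≈0⇒≈ (0≤∧¬Pos⇒≈0 (0≤δ q q<m) ¬pos))
          (yes δq) → ℕ.<-irrefl (ι-injective (≈-sym (-≈0⇒≈ (≈-trans (≈-sym (M-difference p q)) (Pos-*-cancel-≈0 (Pos-* δp δq) term≈0))))) lt)
      where
      difference≈0 : energyH -ʳ energyS ≈ 0ℝ
      difference≈0 = ≈-⇒-≈0 (≤ʳ-antisym le energyS≤energyH)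
      term≈0 : term p q ≈ 0ℝ
      term≈0 = ∑ʳ-nonneg-zero m (λ q q<m → 0≤term p q p<m q<m)
        (∑ʳ-nonneg-zero m (λ p p<m → ∑ʳ-nonneg m λ q q<m → 0≤term p q p<m q<m) (≈-trans (≈-sym energy-difference) difference≈0) p p<m) q q<m

-- The equality case: ties of the eigenvector

∑-last : ∀ n f → 1 ≤ ∑ n f → ∃[ l ] (l < n × 1 ≤ f l × (∀ c → l < c → c < n → ¬ 1 ≤ f c))
∑-last (suc n) f le with 1 ℕ.≤? f n
... | yes 1≤ = n , ℕ.≤-refl , 1≤ , λ c n<c c<1+n → contradiction (s≤s⁻¹ c<1+n) (ℕ.<⇒≱ n<c)
... | no ¬1≤ with ∑-last n f (subst (1 ≤_) (trans (cong (λ z → ∑ n f + z) (ℕ.n<1⇒n≡0 (ℕ.≰⇒> ¬1≤))) (ℕ.+-identityʳ _)) le)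
...   | l , l<n , 1≤ , last = l , ℕ.m<n⇒m<1+n l<n , 1≤ , last′
  where
  last′ : ∀ c → l < c → c < suc n → ¬ 1 ≤ f c
  last′ c l<c c<1+n with c ℕ.≟ n
  ... | yes refl = ¬1≤
  ... | no c≢n   = last c l<c (ℕ.≤∧≢⇒< (s≤s⁻¹ c<1+n) c≢n)

∑-split : ∀ j t f → ∑ (j + t) f ≡ ∑ j f + ∑ t (λ x → f (j + x))
∑-split j zero    f = trans (cong (λ k → ∑ k f) (ℕ.+-identityʳ j)) (sym (ℕ.+-identityʳ _))
∑-split j (suc t) f = trans (cong (λ k → ∑ k f) (ℕ.+-suc j t)) (trans (cong (_+ f (j + t)) (∑-split j t f)) (ℕ.+-assoc (∑ j f) _ _))

module Rigidity {n m : ℕ} {aS aH : ℕ → ℕ → ℕ} {dS dH : ℕ → ℕ} (comparable : Comparable n m aS aH dS dH)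
  (1≤m : 1 ≤ m) (dS-pos : ∀ i → i < n → 1 ≤ dS i) (dH-pos : ∀ i → i < n → 1 ≤ dH i)
  (g : ℕ → ℝ) (g≈0 : ∀ i → m ≤ i → i < n → g i ≈ 0ℝ) (g-pos : ∀ i → i < m → Pos (g i))
  (antitone : ∀ i j → i ≤ j → j < n → g j ≤ʳ g i)
  (tie? : ∀ i j → i < n → j < n → Dec (g i ≈ g j)) (μ : ℝ)
  (harmonic : Energy.Harmonic (Comparable.adjS comparable) dS μ g)
  (core-eq : ∀ p q → p < m → q < m → ¬ g p ≈ g (suc p) → ¬ g q ≈ g (suc q) →
    ∑ (suc p ⊓ suc q) dS + EdgeCount.e (Comparable.adjH comparable) (suc p) (suc q) ≡
    ∑ (suc p ⊓ suc q) dH + EdgeCount.e (Comparable.adjS comparable) (suc p) (suc q)) where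
  open Comparison comparable
  open BS

  private
    module IS = IsAdjacency adjS
    module IH = IsAdjacency adjH

  1<n : 1 < n
  1<n = ℕ.≤-<-trans 1≤m m<n

  tie⇒interior : ∀ {i c} → i < m → c < n → g c ≈ g i → c < m
  tie⇒interior {i} {c} i<m c<n tie = ℕ.≰⇒> λ m≤c → Pos⇒≉0 (g-pos i i<m) (≈-trans (≈-sym tie) (g≈0 c m≤c c<n))

  tie-between : ∀ {i j k} → i ≤ j → j ≤ k → k < n → g i ≈ g k → g j ≈ g k
  tie-between {i} {j} {k} i≤j j≤k k<n tie = ≤ʳ-antisym
    (≤ʳ-trans (antitone i j i≤j (ℕ.≤-<-trans j≤k k<n)) (≈⇒≤ʳ tie)) (antitone j k j≤k k<n)

  -- Neighbours in S.  The root has no parent; its first child takes that role.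

  up : ℕ → ℕ
  up zero    = 1
  up (suc i) = par (suc i)

  up<n : ∀ i → i < n → up i < n
  up<n zero    _   = 1<n
  up<n (suc i) i<n = ℕ.<-trans (par< (suc i) i<n (s≤s z≤n)) i<n

  par1≡0 : par 1 ≡ 0
  par1≡0 = ℕ.n<1⇒n≡0 (par< 1 1<n ℕ.≤-refl)

  aS-up : ∀ i → i < n → aS i (up i) ≡ 1
  aS-up i i<n = ℕ.≤-antisym (IS.a≤1 i (up i)) (ℕ.≤-trans (one i i<n) (ℕ.≤-reflexive (sym (a≡ i (up i) i<n (up<n i i<n)))))
    where
    one : ∀ i → i < n → 1 ≤ χ (par (up i) ℕ.≟ i) + χ (par i ℕ.≟ up i)
    one zero    _ = ℕ.≤-trans (ℕ.≤-reflexive (sym (χ-yes (par 1 ℕ.≟ 0) par1≡0))) (ℕ.m≤m+n _ _)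
    one (suc i) _ = ℕ.≤-trans (ℕ.≤-reflexive (sym (χ-yes (par (suc i) ℕ.≟ par (suc i)) refl))) (ℕ.m≤n+m _ _)

  down : ℕ → ℕ → ℕ
  down i c = aS i c ∸ χ (up i ℕ.≟ c)

  aS-split : ∀ i → i < n → ∀ c → aS i c ≡ down i c + χ (up i ℕ.≟ c)
  aS-split i i<n c = sym (ℕ.m∸n+n≡m (le c))
    where
    le : ∀ c → χ (up i ℕ.≟ c) ≤ aS i c
    le c with up i ℕ.≟ c
    ... | yes refl = ℕ.≤-reflexive (sym (aS-up i i<n))
    ... | no _     = z≤n

  down-parent : ∀ i c → i < n → c < n → 1 ≤ down i c → 1 ≤ c × par c ≡ i
  down-parent i c i<n c<n 1≤ = positive c parent , parent
    where
    not-up : up i ≢ c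
    not-up refl = contradiction (subst (1 ≤_) (trans (cong (aS i (up i) ∸_) (χ-yes (up i ℕ.≟ up i) refl)) (ℕ.m≤n⇒m∸n≡0 (IS.a≤1 i (up i)))) 1≤) λ ()
    edge : 1 ≤ χ (par c ℕ.≟ i) + χ (par i ℕ.≟ c)
    edge = subst (1 ≤_) (a≡ i c i<n c<n) (ℕ.≤-trans 1≤ (ℕ.m∸n≤m (aS i c) (χ (up i ℕ.≟ c))))
    no-up : ∀ i → up i ≢ c → χ (par i ℕ.≟ c) ≡ 0
    no-up zero    _   = χ-no (par 0 ℕ.≟ c) λ { refl → ℕ.<⇒≱ c<n par-root }
    no-up (suc i) neq = χ-no (par (suc i) ℕ.≟ c) neq
    parent : par c ≡ i
    parent = χ-1≤ (par c ℕ.≟ i) (subst (1 ≤_) (trans (cong (λ z → χ (par c ℕ.≟ i) + z) (no-up i not-up)) (ℕ.+-identityʳ _)) edge)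
    positive : ∀ c → par c ≡ i → 1 ≤ c
    positive zero    eq = contradiction (subst (n ≤_) eq par-root) (ℕ.<⇒≱ i<n)
    positive (suc c) eq = s≤s z≤n

  down> : ∀ i c → i < n → c < n → 1 ≤ down i c → i < c
  down> i c i<n c<n 1≤ = let 1≤c , eq = down-parent i c i<n c<n 1≤ in subst (_< c) eq (par< c c<n 1≤c)

  child-down : ∀ c → 1 ≤ c → c < n → (par c ≡ 0 → c ≢ 1) → 1 ≤ down (par c) c
  child-down c 1≤c c<n not-first = subst (1 ≤_) (trans (ℕ.+-identityʳ _) (ℕ.+-identityʳ _)) (ℕ.≤-trans
    (ℕ.≤-reflexive (sym (χ-yes (par c ℕ.≟ par c) refl))) (ℕ.≤-trans (ℕ.m≤m+n _ _) (ℕ.≤-reflexive (trans (sym (a≡ p c p<n c<n))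
      (trans (aS-split p p<n c) (trans (cong (λ z → down p c + z) (χ-no (up p ℕ.≟ c) (not-up p refl))) (sym (ℕ.+-identityʳ _))))))))
    where
    p : ℕ
    p = par c
    p<n : p < n
    p<n = ℕ.<-trans (par< c c<n 1≤c) c<n
    not-up : ∀ q → q ≡ p → up q ≢ c
    not-up zero    eq refl = not-first (sym eq) refl
    not-up (suc q) eq up≡c = ℕ.<-asym (par< c c<n 1≤c)
      (subst₂ _<_ up≡c eq (par< (suc q) (subst (_< n) (sym eq) p<n) (s≤s z≤n)))

  down-ordered : ∀ {i i′ c c′} → i < i′ → i′ < n → c < n → c′ < n → 1 ≤ down i c → 1 ≤ down i′ c′ → c < c′
  down-ordered {i} {i′} {c} {c′} i<i′ i′<n c<n c′<n p q = ℕ.≰⇒> λ c′≤c →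
    let _ , eq = down-parent i c (ℕ.<-trans i<i′ i′<n) c<n p
        1≤c′ , eq′ = down-parent i′ c′ i′<n c′<n q
    in ℕ.<⇒≱ i<i′ (subst₂ _≤_ eq′ eq (par-mono c′ c 1≤c′ c′≤c c<n))

  down-sum : ∀ i → i < n → dS i ≡ suc (∑ n (down i))
  down-sum i i<n = trans (dS≡∑ i) (trans (∑-cong n λ c _ → aS-split i i<n c)
    (trans (∑-+ n (down i) (λ c → χ (up i ℕ.≟ c))) (trans (cong (λ z → ∑ n (down i) + z) (∑-χ-≡ n (up<n i i<n))) (ℕ.+-comm _ 1))))

  has-down : ∀ i → i < m → 1 ≤ ∑ n (down i)
  has-down i i<m = s≤s⁻¹ (subst (2 ≤_) (down-sum i (ℕ.<-trans i<m m<n)) (interiorS′ i (ℕ.<-trans i<m m<n) i<m))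

  -- At the root `up` is position 1; a tie of a later position with the root gives position 1 the
  -- maximal value as well.
  up-antitone : ∀ i i′ → i < i′ → i′ < n → g i ≈ g i′ → g (up i′) ≤ʳ g (up i)
  up-antitone zero (suc i′) i<i′ i′<n tie = ≤ʳ-trans (antitone 0 (par (suc i′)) z≤n (up<n (suc i′) i′<n))
    (≤ʳ-trans (≈⇒≤ʳ tie) (antitone 1 (suc i′) (s≤s z≤n) i′<n))
  up-antitone (suc i) (suc i′) i<i′ i′<n tie = antitone (par (suc i)) (par (suc i′))
    (par-mono (suc i) (suc i′) (s≤s z≤n) (ℕ.<⇒≤ i<i′) i′<n) (up<n (suc i′) i′<n)

  -- Let `s` be the value at the last down neighbour of `i`. Down neighbours of `i` have values at
  -- least `s`, and those of `i′`, which come later, at most `s`. Subtracting the eigenvalue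
  -- equations at the tied positions leaves a vanishing sum of four nonnegative quantities: the
  -- deviations from `s` on either side, the excess degree of `i′` times g i - s, and the drop from
  -- `up i` to `up i′`.
  module Tie {i i′ : ℕ} (i<i′ : i < i′) (i′<m : i′ < m) (tie : g i ≈ g i′) where
    open ℝ-Solver
    open ≈-Reasoning

    i<m : i < m
    i<m = ℕ.<-trans i<i′ i′<m

    i<n : i < n
    i<n = ℕ.<-trans i<m m<n

    i′<n : i′ < n
    i′<n = ℕ.<-trans i′<m m<n

    private
      last : ∃[ l ] (l < n × 1 ≤ down i l × (∀ c → l < c → c < n → ¬ 1 ≤ down i c))
      last = ∑-last n (down i) (has-down i i<m)

    l : ℕ
    l = proj₁ last

    l<n : l < n
    l<n = proj₁ (proj₂ last)

    l-down : 1 ≤ down i l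
    l-down = proj₁ (proj₂ (proj₂ last))

    s : ℝ
    s = g l

    private
      A B : ℕ → ℝ
      A c = ι (down i c) *ʳ (g c -ʳ s)
      B c = ι (down i′ c) *ʳ (s -ʳ g c)

      0≤ι* : ∀ k {x} → (1 ≤ k → 0ℝ ≤ʳ x) → 0ℝ ≤ʳ ι k *ʳ x
      0≤ι* zero    _   = ≈⇒≤ʳ (≈-sym (*ʳ-zeroˡ ι-0))
      0≤ι* (suc k) 0≤x = 0≤ʳ-* (ι-nonneg (suc k)) (0≤x (s≤s z≤n))

      0≤A : ∀ c → c < n → 0ℝ ≤ʳ A c
      0≤A c c<n = 0≤ι* (down i c) λ 1≤ → ≤⇒0≤- (antitone c l (ℕ.≮⇒≥ λ l<c → proj₂ (proj₂ (proj₂ last)) c l<c c<n 1≤) l<n)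

      0≤B : ∀ c → c < n → 0ℝ ≤ʳ B c
      0≤B c c<n = 0≤ι* (down i′ c) λ 1≤ → ≤⇒0≤- (antitone l c (ℕ.<⇒≤ (down-ordered i<i′ i′<n l<n c<n l-down 1≤)) c<n)

      Δ-form : ∀ i → i < n → Energy.Δ adjS dS g i ≈ (g i -ʳ g (up i)) +ʳ (ι (∑ n (down i)) *ʳ g i -ʳ ∑ʳ n (λ c → ι (down i c) *ʳ g c))
      Δ-form i i<n = begin
        ι (dS i) *ʳ g i -ʳ ∑ʳ n (λ c → ι (aS i c) *ʳ g c)
          ≈⟨ +ʳ-cong (*ʳ-cong (≈-trans (ℝR.reflexive (cong ι (down-sum i i<n))) (≈-trans (ι-+ 1 _) (+ʳ-cong ι-1 ≈-refl))) ≈-refl) (-ʳ-cong neighbours) ⟩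
        (1ℝ +ʳ ι (∑ n (down i))) *ʳ g i -ʳ (∑ʳ n (λ c → ι (down i c) *ʳ g c) +ʳ g (up i))
          ≈⟨ solve 4 (λ k x S u → (con 1ℚ :+ k) :* x :- (S :+ u) := (x :- u) :+ (k :* x :- S)) ≈-refl (ι (∑ n (down i))) (g i) (∑ʳ n (λ c → ι (down i c) *ʳ g c)) (g (up i)) ⟩
        (g i -ʳ g (up i)) +ʳ (ι (∑ n (down i)) *ʳ g i -ʳ ∑ʳ n (λ c → ι (down i c) *ʳ g c)) ∎
        where
        single : ∀ N k → k < N → ∑ʳ N (λ c → ι (χ (k ℕ.≟ c)) *ʳ g c) ≈ g k
        single (suc N) k k<1+N with k ℕ.≟ N
        ... | yes refl = ≈-trans (+ʳ-cong (Σʳ.∑-zero N λ c c<N → *ʳ-zeroˡ (≈-trans (ℝR.reflexive (cong ι (χ-no (k ℕ.≟ c) λ { refl → ℕ.<-irrefl refl c<N }))) ι-0)) (≈-trans (*ʳ-cong ι-1 ≈-refl) (*ʳ-identityˡ (g k)))) (+ʳ-identityˡ _)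
        ... | no k≢N = ≈-trans (+ʳ-cong (single N k (ℕ.≤∧≢⇒< (s≤s⁻¹ k<1+N) k≢N)) (*ʳ-zeroˡ ι-0)) (+ʳ-identityʳ _)
        neighbours : ∑ʳ n (λ c → ι (aS i c) *ʳ g c) ≈ ∑ʳ n (λ c → ι (down i c) *ʳ g c) +ʳ g (up i)
        neighbours = ≈-trans (Σʳ.∑-cong n λ c _ → ≈-trans (*ʳ-cong (≈-trans (ℝR.reflexive (cong ι (aS-split i i<n c))) (ι-+ (down i c) _)) ≈-refl) (*ʳ-distribʳ (g c) _ _))
          (≈-trans (Σʳ.∑-+ n (λ c → ι (down i c) *ʳ g c) (λ c → ι (χ (up i ℕ.≟ c)) *ʳ g c)) (+ʳ-cong ≈-refl (single n (up i) (up<n i i<n))))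

      A-sum : ∑ʳ n A ≈ ∑ʳ n (λ c → ι (down i c) *ʳ g c) -ʳ ι (∑ n (down i)) *ʳ s
      A-sum = ≈-trans (Σʳ.∑-cong n λ c _ → solve 3 (λ k x s → k :* (x :- s) := k :* x :- s :* k) ≈-refl (ι (down i c)) (g c) s)
        (≈-trans (∑ʳ-sub n (λ c → ι (down i c) *ʳ g c) (λ c → s *ʳ ι (down i c)))
          (+ʳ-cong ≈-refl (-ʳ-cong (≈-trans (≈-sym (Σʳ.∑-*ˡ n s (λ c → ι (down i c)))) (≈-trans (*ʳ-comm _ _) (*ʳ-cong (≈-sym (ι-∑ n (down i))) ≈-refl))))))

      B-sum : ∑ʳ n B ≈ ι (∑ n (down i′)) *ʳ s -ʳ ∑ʳ n (λ c → ι (down i′ c) *ʳ g c)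
      B-sum = ≈-trans (Σʳ.∑-cong n λ c _ → solve 3 (λ k x s → k :* (s :- x) := s :* k :- k :* x) ≈-refl (ι (down i′ c)) (g c) s)
        (≈-trans (∑ʳ-sub n (λ c → s *ʳ ι (down i′ c)) (λ c → ι (down i′ c) *ʳ g c))
          (+ʳ-cong (≈-trans (≈-sym (Σʳ.∑-*ˡ n s (λ c → ι (down i′ c)))) (≈-trans (*ʳ-comm _ _) (*ʳ-cong (≈-sym (ι-∑ n (down i′))) ≈-refl))) ≈-refl))

      excess : ℕ
      excess = ∑ n (down i′) ∸ ∑ n (down i)

      down-sum≤ : ∑ n (down i) ≤ ∑ n (down i′)
      down-sum≤ = s≤s⁻¹ (subst₂ _≤_ (down-sum i i<n) (down-sum i′ i′<n) (dS-mono i i′ (ℕ.<⇒≤ i<i′) i′<m))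

      excess-ι : ι (∑ n (down i′)) ≈ ι (∑ n (down i)) +ʳ ι excess
      excess-ι = ≈-trans (ℝR.reflexive (cong ι (sym (ℕ.m+[n∸m]≡n down-sum≤)))) (ι-+ _ _)

      C : ℝ
      C = ι excess *ʳ (g i -ʳ s)

      0≤C : 0ℝ ≤ʳ C
      0≤C = 0≤ʳ-* (ι-nonneg excess) (≤⇒0≤- (antitone i l (ℕ.<⇒≤ (down> i l i<n l<n l-down)) l<n))

      U : ℝ
      U = g (up i) -ʳ g (up i′)

      0≤U : 0ℝ ≤ʳ U
      0≤U = ≤⇒0≤- (up-antitone i i′ i<i′ i′<n tie)

      balance : (∑ʳ n A +ʳ ∑ʳ n B) +ʳ (C +ʳ U) ≈ 0ℝ
      balance = begin
        (∑ʳ n A +ʳ ∑ʳ n B) +ʳ (C +ʳ U)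
          ≈⟨ +ʳ-cong (+ʳ-cong A-sum (≈-trans B-sum (+ʳ-cong (*ʳ-cong excess-ι ≈-refl) ≈-refl))) ≈-refl ⟩
        ((SA -ʳ k *ʳ s) +ʳ ((k +ʳ ι excess) *ʳ s -ʳ SB)) +ʳ (C +ʳ U)
          ≈⟨ solve 8 (λ SA SB k x s t u u′ → ((SA :- k :* s) :+ ((k :+ x) :* s :- SB)) :+ (x :* (t :- s) :+ (u :- u′)) :=
               ((t :- u′) :+ ((k :+ x) :* t :- SB)) :- ((t :- u) :+ (k :* t :- SA))) ≈-refl SA SB k (ι excess) s (g i) (g (up i)) (g (up i′)) ⟩
        ((g i -ʳ g (up i′)) +ʳ ((k +ʳ ι excess) *ʳ g i -ʳ SB)) -ʳ ((g i -ʳ g (up i)) +ʳ (k *ʳ g i -ʳ SA))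
          ≈⟨ +ʳ-cong (+ʳ-cong (+ʳ-cong tie ≈-refl) (+ʳ-cong (*ʳ-cong (≈-sym excess-ι) tie) ≈-refl)) ≈-refl ⟩
        ((g i′ -ʳ g (up i′)) +ʳ (ι (∑ n (down i′)) *ʳ g i′ -ʳ SB)) -ʳ ((g i -ʳ g (up i)) +ʳ (k *ʳ g i -ʳ SA))
          ≈⟨ +ʳ-cong (Δ-form i′ i′<n) (-ʳ-cong (Δ-form i i<n)) ⟨
        Energy.Δ adjS dS g i′ -ʳ Energy.Δ adjS dS g i
          ≈⟨ +ʳ-cong (harmonic i′ i′<n (interiorS′ i′ i′<n i′<m)) (-ʳ-cong (harmonic i i<n (interiorS′ i i<n i<m))) ⟩
        μ *ʳ g i′ -ʳ μ *ʳ g i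
          ≈⟨ ≈-⇒-≈0 (*ʳ-cong ≈-refl (≈-sym tie)) ⟩
        0ℝ ∎
        where
        SA SB k : ℝ
        SA = ∑ʳ n (λ c → ι (down i c) *ʳ g c)
        SB = ∑ʳ n (λ c → ι (down i′ c) *ʳ g c)
        k = ι (∑ n (down i))

      0≤AB : 0ℝ ≤ʳ ∑ʳ n A +ʳ ∑ʳ n B
      0≤AB = 0≤ʳ-+ (∑ʳ-nonneg n 0≤A) (∑ʳ-nonneg n 0≤B)

      AB≈0 : ∑ʳ n A +ʳ ∑ʳ n B ≈ 0ℝ
      AB≈0 = 0≤-sum-zeroˡ 0≤AB (0≤ʳ-+ 0≤C 0≤U) balance

      C≈0 : C ≈ 0ℝ
      C≈0 = 0≤-sum-zeroˡ 0≤C 0≤U (0≤-sum-zeroʳ 0≤AB (0≤ʳ-+ 0≤C 0≤U) balance)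

      cancel-ι : ∀ {k x} → 1 ≤ k → ι k *ʳ x ≈ 0ℝ → x ≈ 0ℝ
      cancel-ι {suc k} _ = Pos-*-cancel-≈0 (ι-pos k)

    down-value : ∀ c → c < n → 1 ≤ down i c → g c ≈ s
    down-value c c<n 1≤ = -≈0⇒≈ (cancel-ι 1≤ (∑ʳ-nonneg-zero n 0≤A (0≤-sum-zeroˡ (∑ʳ-nonneg n 0≤A) (∑ʳ-nonneg n 0≤B) AB≈0) c c<n))

    down-value′ : ∀ c → c < n → 1 ≤ down i′ c → g c ≈ s
    down-value′ c c<n 1≤ = ≈-sym (-≈0⇒≈ (cancel-ι 1≤ (∑ʳ-nonneg-zero n 0≤B (0≤-sum-zeroʳ (∑ʳ-nonneg n 0≤A) (∑ʳ-nonneg n 0≤B) AB≈0) c c<n)))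

    -- The excess degree times g i - s vanishes, so a strict descent leaves no excess.
    degree : ¬ g l ≈ g i → dS i ≡ dS i′
    degree ¬tie = trans (down-sum i i<n) (trans (cong suc (ℕ.≤-antisym down-sum≤ (ℕ.m∸n≡0⇒m≤n (zero-excess excess refl)))) (sym (down-sum i′ i′<n)))
      where
      zero-excess : ∀ x → x ≡ excess → excess ≡ 0
      zero-excess zero    eq = sym eq
      zero-excess (suc x) eq = contradiction (≈-sym (-≈0⇒≈ (cancel-ι (subst (1 ≤_) eq (s≤s z≤n)) C≈0))) ¬tie

  -- If `c` is tied with `i`, then `Tie` makes the down neighbours of `c` tied with `c` in turn.
  -- This repeats with ever larger interior positions until the array is exhausted.
  down-strict : ∀ i c → i < m → c < n → 1 ≤ down i c → ¬ g c ≈ g i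
  down-strict i c = go n i c (ℕ.m≤n+m n i)
    where
    go : ∀ k i c → n ≤ i + k → i < m → c < n → 1 ≤ down i c → ¬ g c ≈ g i
    go zero i c le i<m _ _ _ = ℕ.<⇒≱ (ℕ.<-trans i<m m<n) (subst (n ≤_) (ℕ.+-identityʳ i) le)
    go (suc k) i c le i<m c<n 1≤ tie =
      let c<m = tie⇒interior i<m c<n tie
          i<c = down> i c (ℕ.<-trans i<m m<n) c<n 1≤
          c₂ , c₂<n , 1≤₂ = ∑-witness n (down c) (has-down c c<m)
          module T = Tie i<c c<m (≈-sym tie)
      in go k c c₂ (ℕ.≤-trans le (ℕ.≤-trans (ℕ.≤-reflexive (ℕ.+-suc i k)) (ℕ.+-monoˡ-≤ k i<c))) c<m c₂<n 1≤₂
           (≈-trans (T.down-value′ c₂ c₂<n 1≤₂) (≈-sym (T.down-value c c<n 1≤)))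

  tie-degree : ∀ i i′ → i < m → i′ < m → g i ≈ g i′ → dS i ≡ dS i′
  tie-degree i i′ i<m i′<m tie with ℕ.<-cmp i i′
  ... | tri≈ _ refl _ = refl
  ... | tri< i<i′ _ _ = let module T = Tie i<i′ i′<m tie in T.degree (down-strict i T.l i<m T.l<n T.l-down)
  ... | tri> _ _ i′<i = let module T = Tie i′<i i<m (≈-sym tie) in sym (T.degree (down-strict i′ T.l i′<m T.l<n T.l-down))

  opaque
    tie-down : ∀ {x y} → x < m → y < m → x ≢ y → g x ≈ g y →
      ∃[ s ] ((∀ c → c < n → 1 ≤ down x c → g c ≈ s) × (∀ c → c < n → 1 ≤ down y c → g c ≈ s))
    tie-down {x} {y} x<m y<m x≢y tie with ℕ.<-cmp x y
    ... | tri≈ _ eq _ = contradiction eq x≢y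
    ... | tri< x<y _ _ = let module T = Tie x<y y<m tie in T.s , T.down-value , T.down-value′
    ... | tri> _ _ y<x = let module T = Tie y<x x<m (≈-sym tie) in T.s , T.down-value′ , T.down-value

  -- The root has a second child because it is interior, so the parent of position 2 is the root. A
  -- third member of its class would tie position 2 with the root, against `down-strict`.
  root-class : ∀ x → x < n → g x ≈ g 0 → x < 2
  root-class x x<n tie = ℕ.≰⇒> λ 2≤x →
    let c , c<n , 1≤ = ∑-witness n (down 0) (has-down 0 1≤m)
        2<n = ℕ.≤-<-trans 2≤x x<n
        1≤c , par-c = down-parent 0 c (ℕ.<-trans 1≤m m<n) c<n 1≤
        par-2 = ℕ.n≤0⇒n≡0 (subst (par 2 ≤_) par-c (par-mono 2 c (s≤s z≤n) (second c 1≤ 1≤c) c<n))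
    in down-strict 0 2 1≤m 2<n (subst (λ p → 1 ≤ down p 2) par-2 (child-down 2 (s≤s z≤n) 2<n λ _ ()))
         (≈-trans (tie-between z≤n 2≤x x<n (≈-sym tie)) tie)
    where
    second : ∀ c → 1 ≤ down 0 c → 1 ≤ c → 2 ≤ c
    second 1 1≤ _ = contradiction (subst (1 ≤_) (ℕ.m≤n⇒m∸n≡0 (IS.a≤1 0 1)) 1≤) λ ()
    second (suc (suc c)) _ _ = s≤s (s≤s z≤n)

  par-interior : ∀ c → 1 ≤ c → c < n → par c < m
  par-interior c 1≤c c<n = cases (par c) refl
    where
    cases : ∀ p → p ≡ par c → par c < m
    cases zero    eq = subst (_< m) eq 1≤m
    cases (suc p) eq = interiorS (par c) p<n (subst (2 ≤_) (sym (down-sum (par c) p<n))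
        (s≤s (ℕ.≤-trans (child-down c 1≤c c<n λ eq′ → contradiction (trans eq eq′) λ ()) (term≤∑ n (down (par c)) c<n))))
      where
      p<n : par c < n
      p<n = ℕ.<-trans (par< c c<n 1≤c) c<n

  S-edge : ∀ x y → x < y → y < n → 1 ≤ aS x y → par y ≡ x
  S-edge x y x<y y<n 1≤ = χ-1≤ (par y ℕ.≟ x) (subst (1 ≤_) (trans (a≡ x y (ℕ.<-trans x<y y<n) y<n)
    (trans (cong (λ z → χ (par y ℕ.≟ x) + z) (χ-no (par x ℕ.≟ y) (not-parent x x<y))) (ℕ.+-identityʳ _))) 1≤)
    where
    not-parent : ∀ x → x < y → par x ≢ y
    not-parent zero    _   refl = ℕ.<⇒≱ y<n par-root
    not-parent (suc x) x<y refl = ℕ.<-asym x<y (par< (suc x) (ℕ.<-trans x<y y<n) (s≤s z≤n))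

  -- Every edge of S other than the one between 0 and 1 joins a position to one of its down
  -- neighbours, where `g` is strictly smaller.
  S-tie-edge : ∀ x y → x < y → y < n → 1 ≤ aS x y → g x ≈ g y → x ≡ 0 × y ≡ 1
  S-tie-edge x y x<y y<n 1≤ tie with y ℕ.≟ 1
  ... | yes refl = ℕ.n<1⇒n≡0 x<y , refl
  ... | no y≢1 = ⊥-elim (down-strict (par y) y (par-interior y 1≤y y<n) y<n (child-down y 1≤y y<n λ _ → y≢1)
      (≈-sym (subst (λ z → g z ≈ g y) (sym (S-edge x y x<y y<n 1≤)) tie)))
    where
    1≤y : 1 ≤ y
    1≤y = ℕ.≤-trans (s≤s z≤n) x<y

  -- Class sums in H and S

  -- A cut of the numbering between two level sets of `g`, or one of its ends. The cuts in the
  -- middle have p < m because `g` vanishes from `m` on.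
  Break : ℕ → Set
  Break j = (j ≡ 0) ⊎ ((j ≡ n) ⊎ ∃[ p ] (j ≡ suc p × p < m × ¬ g p ≈ g (suc p)))

  -- On the diagonal `core-eq` adds up two inequalities, one between degree sums and one between
  -- edge counts; equality of the totals makes both sharp.
  break-both : ∀ p → p < m → ¬ g p ≈ g (suc p) → ∑ (suc p) dS ≡ ∑ (suc p) dH × eH (suc p) (suc p) ≡ p + p
  break-both p p<m p-break = let eq , eq′ = +-squeeze (prefix-sum≤ dS-mono (suc p) p<m)
                                              (ℕ.≤-trans (eH-square p p<n) (ℕ.≤-reflexive (sym square)))
                                              (ℕ.≤-reflexive (sym equality))
                             in eq , trans eq′ square
    where
    p<n : p < n
    p<n = ℕ.<-trans p<m m<n
    square : eS (suc p) (suc p) ≡ p + p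
    square = CS.e-square p p<n
    equality : ∑ (suc p) dS + eH (suc p) (suc p) ≡ ∑ (suc p) dH + eS (suc p) (suc p)
    equality = subst (λ l → ∑ l dS + eH (suc p) (suc p) ≡ ∑ l dH + eS (suc p) (suc p)) (ℕ.⊓-idem (suc p)) (core-eq p p p<m p<m p-break p-break)

  break-degrees : ∀ {j} → Break j → ∑ j dS ≡ ∑ j dH
  break-degrees (inj₁ refl)                            = refl
  break-degrees (inj₂ (inj₁ refl))                     = same id
  break-degrees (inj₂ (inj₂ (p , refl , p<m , p-break))) = proj₁ (break-both p p<m p-break)

  e-n : ∀ {a d} (adj : IsAdjacency n a) → (∀ i → d i ≡ ∑ n (a i)) → ∀ k → EdgeCount.e adj n k ≡ ∑ k d
  e-n adj d≡∑ k = trans (EdgeCount.e-sym adj n k) (∑-cong k λ i _ → sym (d≡∑ i))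

  -- At the full array the count is a degree sum; at two inner cuts the degree sums cancel from
  -- `core-eq`.
  break-e : ∀ {j k} → Break j → Break k → eH j k ≡ eS j k
  break-e (inj₁ refl) _ = refl
  break-e {j} (inj₂ _) (inj₁ refl) = trans (EH.e-sym j 0) (ES.e-sym 0 j)
  break-e {k = k} (inj₂ (inj₁ refl)) k-break@(inj₂ _) =
    trans (e-n adjH dH≡∑ k) (trans (sym (break-degrees k-break)) (sym (e-n adjS dS≡∑ k)))
  break-e {j} j-break@(inj₂ (inj₂ _)) (inj₂ (inj₁ refl)) =
    trans (EH.e-sym j n) (trans (e-n adjH dH≡∑ j) (trans (sym (break-degrees j-break)) (trans (sym (e-n adjS dS≡∑ j)) (ES.e-sym n j))))
  break-e (inj₂ (inj₂ (p , refl , p<m , p-break))) (inj₂ (inj₂ (q , refl , q<m , q-break))) =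
    ℕ.+-cancelˡ-≡ (∑ (suc p ⊓ suc q) dS) _ _ (trans (core-eq p q p<m q<m p-break q-break) (cong (_+ eS (suc p) (suc q)) (sym minimum)))
    where
    minimum : ∑ (suc p ⊓ suc q) dS ≡ ∑ (suc p ⊓ suc q) dH
    minimum with ℕ.⊓-sel (suc p) (suc q)
    ... | inj₁ eq = subst (λ l → ∑ l dS ≡ ∑ l dH) (sym eq) (proj₁ (break-both p p<m p-break))
    ... | inj₂ eq = subst (λ l → ∑ l dS ≡ ∑ l dH) (sym eq) (proj₁ (break-both q q<m q-break))

  nontie⇒interior : ∀ p → suc p < n → ¬ g p ≈ g (suc p) → p < m
  nontie⇒interior p p<n ¬tie = ℕ.≰⇒> λ m≤p → ¬tie (≈-trans (g≈0 p m≤p (ℕ.<⇒≤ p<n)) (≈-sym (g≈0 (suc p) (ℕ.m≤n⇒m≤1+n m≤p) p<n)))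

  record Class (i : ℕ) : Set where
    field
      lo hi    : ℕ
      lo≤i     : lo ≤ i
      i<hi     : i < hi
      hi≤n     : hi ≤ n
      lo-break : Break lo
      hi-break : Break hi
      inside   : ∀ x → lo ≤ x → x < hi → g x ≈ g i

  find-lo : ∀ i → i < n → ∃[ lo ] (lo ≤ i × Break lo × (∀ x → lo ≤ x → x ≤ i → g x ≈ g i))
  find-lo zero    _   = 0 , z≤n , inj₁ refl , (λ { zero _ _ → ≈-refl })
  find-lo (suc p) p<n with tie? p (suc p) (ℕ.<⇒≤ p<n) p<n
  ... | no ¬tie = suc p , ℕ.≤-refl , inj₂ (inj₂ (p , refl , nontie⇒interior p p<n ¬tie , ¬tie))
      , (λ x lo≤x x≤i → ℝR.reflexive (cong g (ℕ.≤-antisym x≤i lo≤x)))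
  ... | yes tie with find-lo p (ℕ.<⇒≤ p<n)
  ...   | lo , lo≤p , lo-break , inside = lo , ℕ.m≤n⇒m≤1+n lo≤p , lo-break , inside′
    where
    inside′ : ∀ x → lo ≤ x → x ≤ suc p → g x ≈ g (suc p)
    inside′ x lo≤x x≤1+p with x ℕ.≟ suc p
    ... | yes refl = ≈-refl
    ... | no x≢    = ≈-trans (inside x lo≤x (s≤s⁻¹ (ℕ.≤∧≢⇒< x≤1+p x≢))) tie

  find-hi : ∀ t i → suc (i + t) ≡ n → ∃[ hi ] (i < hi × hi ≤ n × Break hi × (∀ x → i ≤ x → x < hi → g x ≈ g i))
  find-hi zero i eq = suc i , ℕ.≤-refl , ℕ.≤-reflexive 1+i≡n , inj₂ (inj₁ 1+i≡n)
      , (λ x i≤x x≤i → ℝR.reflexive (cong g (ℕ.≤-antisym (s≤s⁻¹ x≤i) i≤x)))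
    where
    1+i≡n : suc i ≡ n
    1+i≡n = trans (cong suc (sym (ℕ.+-identityʳ i))) eq
  find-hi (suc t) i eq with tie? i (suc i) (ℕ.<⇒≤ 1+i<n) 1+i<n | find-hi t (suc i) (trans (cong suc (sym (ℕ.+-suc i t))) eq)
    where
    1+i<n : suc i < n
    1+i<n = subst (suc (suc i) ≤_) (trans (cong suc (sym (ℕ.+-suc i t))) eq) (s≤s (s≤s (ℕ.m≤m+n i t)))
  ... | no ¬tie | _ = suc i , ℕ.≤-refl , ℕ.<⇒≤ 1+i<n , inj₂ (inj₂ (i , refl , nontie⇒interior i 1+i<n ¬tie , ¬tie))
      , (λ x i≤x x≤i → ℝR.reflexive (cong g (ℕ.≤-antisym (s≤s⁻¹ x≤i) i≤x)))
    where
    1+i<n : suc i < n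
    1+i<n = subst (suc (suc i) ≤_) (trans (cong suc (sym (ℕ.+-suc i t))) eq) (s≤s (s≤s (ℕ.m≤m+n i t)))
  ... | yes tie | hi , i<hi , hi≤n , hi-break , inside = hi , ℕ.<⇒≤ i<hi , hi≤n , hi-break , inside′
    where
    inside′ : ∀ x → i ≤ x → x < hi → g x ≈ g i
    inside′ x i≤x x<hi with i ℕ.≟ x
    ... | yes refl = ≈-refl
    ... | no i≢x   = ≈-trans (inside x (ℕ.≤∧≢⇒< i≤x i≢x) x<hi) (≈-sym tie)

  opaque
    class : ∀ i → i < n → Class i
    class i i<n with find-lo i i<n | find-hi (n ∸ suc i) i (ℕ.m+[n∸m]≡n i<n)
    ... | lo , lo≤i , lo-break , below | hi , i<hi , hi≤n , hi-break , above = record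
      { lo = lo ; hi = hi ; lo≤i = lo≤i ; i<hi = i<hi ; hi≤n = hi≤n ; lo-break = lo-break ; hi-break = hi-break
      ; inside = λ x lo≤x x<hi → [ below x lo≤x , (λ i≤x → above x i≤x x<hi) ]′ (ℕ.≤-total x i) }

  -- The degrees of S are constant on the level set of an interior `i`, so `dS i` is a threshold at
  -- both of its ends. The sharp comparison at `lo` bounds `dH i` from below by it, the one at `hi`
  -- from above.
  degrees-agree : ∀ i → i < n → dS i ≡ dH i
  degrees-agree i i<n with i ℕ.<? m
  ... | no ¬i<m = trans (leaf dS dS-pos interiorS) (sym (leaf dH dH-pos interiorH))
    where
    leaf : ∀ (d : ℕ → ℕ) → (∀ i → i < n → 1 ≤ d i) → (∀ i → i < n → 2 ≤ d i → i < m) → d i ≡ 1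
    leaf d d-pos int = ℕ.≤-antisym (s≤s⁻¹ (ℕ.≰⇒> λ 2≤ → ¬i<m (int i i<n 2≤))) (d-pos i i<n)
  ... | yes i<m = ℕ.≤-antisym
      (Threshold.above′ lo (dS i) (ℕ.≤-trans lo≤i (ℕ.<⇒≤ i<m)) (λ x x<lo → dS-mono x i (ℕ.≤-trans (ℕ.<⇒≤ x<lo) lo≤i) i<m) above (break-degrees lo-break) i lo≤i i<m)
      (Threshold.below′ hi (dS i) hi≤m below (λ x hi≤x x<m → dS-mono i x (ℕ.≤-trans (ℕ.<⇒≤ i<hi) hi≤x) x<m) (break-degrees hi-break) i i<hi)
    where
    open Class (class i i<n)
    above : ∀ x → lo ≤ x → x < m → dS i ≤ dS x
    above x lo≤x x<m with ℕ.≤-total i x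
    ... | inj₁ i≤x = dS-mono i x i≤x x<m
    ... | inj₂ x≤i = ℕ.≤-reflexive (tie-degree i x i<m x<m (≈-sym (inside x lo≤x (ℕ.≤-<-trans x≤i i<hi))))
    below : ∀ x → x < hi → dS x ≤ dS i
    below x x<hi with ℕ.≤-total x i
    ... | inj₁ x≤i = dS-mono x i x≤i i<m
    ... | inj₂ i≤x = let tie = inside x (ℕ.≤-trans lo≤i i≤x) x<hi
                         x<m = tie⇒interior i<m (ℕ.<-≤-trans x<hi hi≤n) tie
                     in ℕ.≤-reflexive (tie-degree x i x<m i<m tie)
    hi≤m : hi ≤ m
    hi≤m = ℕ.≮⇒≥ λ m<hi → Pos⇒≉0 (g-pos i i<m) (≈-trans (≈-sym (inside m (ℕ.≤-trans lo≤i (ℕ.<⇒≤ i<m)) m<hi)) (g≈0 m ℕ.≤-refl m<n))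

  -- Inclusion and exclusion for the block of `a` with corner (j,k), without subtraction.
  rectangle : ∀ (a : ℕ → ℕ → ℕ) j s k t →
    ∑ (j + s) (λ x → ∑ (k + t) (a x)) + ∑ j (λ x → ∑ k (a x)) ≡
    (∑ j (λ x → ∑ (k + t) (a x)) + ∑ (j + s) (λ x → ∑ k (a x))) + ∑ s (λ x → ∑ t (λ y → a (j + x) (k + y)))
  rectangle a j s k t = begin
    ∑ (j + s) (λ x → ∑ (k + t) (a x)) + e₀₀
      ≡⟨ cong (_+ e₀₀) (trans (∑-split j s (λ x → ∑ (k + t) (a x)))
           (cong (λ z → e₀₁ + z) (trans (∑-cong s λ x _ → ∑-split k t (a (j + x))) (∑-+ s (λ x → ∑ k (a (j + x))) (λ x → ∑ t (λ y → a (j + x) (k + y))))))) ⟩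
    (e₀₁ + (z + r)) + e₀₀
      ≡⟨ solve 4 (λ a z r b → (a :+ (z :+ r)) :+ b := (a :+ (b :+ z)) :+ r) refl e₀₁ z r e₀₀ ⟩
    (e₀₁ + (e₀₀ + z)) + r
      ≡⟨ cong (λ w → (e₀₁ + w) + r) (∑-split j s (λ x → ∑ k (a x))) ⟨
    (e₀₁ + ∑ (j + s) (λ x → ∑ k (a x))) + r ∎
    where
    open ≡-Reasoning
    open ℕ-Solver
    e₀₀ e₀₁ z r : ℕ
    e₀₀ = ∑ j (λ x → ∑ k (a x))
    e₀₁ = ∑ j (λ x → ∑ (k + t) (a x))
    z = ∑ s (λ x → ∑ k (a (j + x)))
    r = ∑ s (λ x → ∑ t (λ y → a (j + x) (k + y)))

  opaque
    -- The counts agree at all cuts, so H and S have the same number of adjacent pairs between any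
    -- two level sets; an edge of H has a counterpart in S with the same values at its ends.
    transfer : ∀ i c → i < n → c < n → 1 ≤ aH i c → ∃₂ λ x y → x < n × y < n × g x ≈ g i × g y ≈ g c × 1 ≤ aS x y
    transfer i c i<n c<n 1≤ =
        let x , x<s , 1≤x = ∑-witness s (λ x → ∑ t (λ y → aS (I.lo + x) (C.lo + y))) S-count
            y , y<t , 1≤y = ∑-witness t (λ y → aS (I.lo + x) (C.lo + y)) 1≤x
            x<hi = subst (I.lo + x <_) I≡ (ℕ.+-monoʳ-< I.lo x<s)
            y<hi = subst (C.lo + y <_) C≡ (ℕ.+-monoʳ-< C.lo y<t)
        in I.lo + x , C.lo + y , ℕ.<-≤-trans x<hi I.hi≤n , ℕ.<-≤-trans y<hi C.hi≤n
           , I.inside (I.lo + x) (ℕ.m≤m+n I.lo x) x<hi , C.inside (C.lo + y) (ℕ.m≤m+n C.lo y) y<hi , 1≤y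
      where
      module I = Class (class i i<n)
      module C = Class (class c c<n)
      s t : ℕ
      s = I.hi ∸ I.lo
      t = C.hi ∸ C.lo
      I≡ : I.lo + s ≡ I.hi
      I≡ = ℕ.m+[n∸m]≡n (ℕ.≤-trans I.lo≤i (ℕ.<⇒≤ I.i<hi))
      C≡ : C.lo + t ≡ C.hi
      C≡ = ℕ.m+[n∸m]≡n (ℕ.≤-trans C.lo≤i (ℕ.<⇒≤ C.i<hi))
      I-break : Break (I.lo + s)
      I-break = subst Break (sym I≡) I.hi-break
      C-break : Break (C.lo + t)
      C-break = subst Break (sym C≡) C.hi-break
      counts : ∑ s (λ x → ∑ t (λ y → aH (I.lo + x) (C.lo + y))) ≡ ∑ s (λ x → ∑ t (λ y → aS (I.lo + x) (C.lo + y)))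
      counts = ℕ.+-cancelˡ-≡ (eS I.lo (C.lo + t) + eS (I.lo + s) C.lo) _ _ (trans
        (cong (_+ ∑ s (λ x → ∑ t (λ y → aH (I.lo + x) (C.lo + y)))) (sym (cong₂ _+_ (break-e I.lo-break C-break) (break-e I-break C.lo-break))))
        (trans (sym (rectangle aH I.lo s C.lo t))
          (trans (cong₂ _+_ (break-e I-break C-break) (break-e I.lo-break C.lo-break)) (rectangle aS I.lo s C.lo t))))
      i≡ : I.lo + (i ∸ I.lo) ≡ i
      i≡ = ℕ.m+[n∸m]≡n I.lo≤i
      c≡ : C.lo + (c ∸ C.lo) ≡ c
      c≡ = ℕ.m+[n∸m]≡n C.lo≤i
      S-count : 1 ≤ ∑ s (λ x → ∑ t (λ y → aS (I.lo + x) (C.lo + y)))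
      S-count = subst (1 ≤_) counts (ℕ.≤-trans (subst₂ (λ i c → 1 ≤ aH i c) (sym i≡) (sym c≡) 1≤)
        (ℕ.≤-trans (term≤∑ t (λ y → aH (I.lo + (i ∸ I.lo)) (C.lo + y)) (ℕ.∸-monoˡ-< C.i<hi C.lo≤i))
          (term≤∑ s (λ x → ∑ t (λ y → aH (I.lo + x) (C.lo + y))) (ℕ.∸-monoˡ-< I.i<hi I.lo≤i))))

  -- Parents in H

  -- The counterpart in S of such an edge has the root as an end, so both ends lie in the class of
  -- the root, which has at most two members.
  H-tie-edge : ∀ x y → x < y → y < n → 1 ≤ aH x y → g x ≈ g y → x ≡ 0 × y ≡ 1
  H-tie-edge x y x<y y<n 1≤ tie with transfer x y (ℕ.<-trans x<y y<n) y<n 1≤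
  ... | x₁ , y₁ , x₁<n , y₁<n , tx , ty , 1≤₁ = ℕ.n<1⇒n≡0 (ℕ.<-≤-trans x<y (s≤s⁻¹ y<2)) , ℕ.≤-antisym (s≤s⁻¹ y<2) (ℕ.≤-trans (s≤s z≤n) x<y)
    where
    0-tie : g 0 ≈ g y
    0-tie with ℕ.<-cmp x₁ y₁
    ... | tri≈ _ refl _ = contradiction (subst (1 ≤_) (IS.a-diag x₁) 1≤₁) λ ()
    ... | tri< x₁<y₁ _ _ = ≈-trans (ℝR.reflexive (cong g (sym (proj₁ (S-tie-edge x₁ y₁ x₁<y₁ y₁<n 1≤₁ (≈-trans tx (≈-trans tie (≈-sym ty)))))))) (≈-trans tx tie)
    ... | tri> _ _ y₁<x₁ = ≈-trans (ℝR.reflexive (cong g (sym (proj₁ (S-tie-edge y₁ x₁ y₁<x₁ x₁<n (subst (1 ≤_) (IS.a-sym x₁ y₁) 1≤₁) (≈-trans ty (≈-trans (≈-sym tie) (≈-sym tx)))))))) ty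
    y<2 : y < 2
    y<2 = root-class y y<n (≈-sym 0-tie)

  bH : ℕ → ℕ
  bH i = ∑ i (λ x → aH x i)

  -- No earlier neighbour lies in the class of `i` unless that class contains the root. Before the
  -- class there is at most one, because the segment ending at the cut already has the maximal
  -- number of edges of a forest.
  bH≤ : ∀ i → i < n → bH i ≤ χ (1 ℕ.≤? i)
  bH≤ zero    _ = z≤n
  bH≤ (suc i) i<n = cases (Class.lo-break K)
    where
    K : Class (suc i)
    K = class (suc i) i<n
    open Class K
    cases : Break lo → bH (suc i) ≤ 1
    cases (inj₂ (inj₁ lo≡n)) = contradiction (subst (_≤ suc i) lo≡n lo≤i) (ℕ.<⇒≱ i<n)
    cases (inj₁ lo≡0) = first i refl
      where
      root : suc i < 2
      root = root-class (suc i) i<n (≈-sym (inside 0 (ℕ.≤-reflexive lo≡0) (ℕ.≤-<-trans z≤n i<hi)))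
      first : ∀ j → j ≡ i → bH (suc j) ≤ 1
      first zero    _  = IH.a≤1 0 1
      first (suc j) eq = contradiction root (ℕ.≤⇒≯ (s≤s (subst (1 ≤_) eq (s≤s z≤n))))
    cases (inj₂ (inj₂ (p , lo≡ , p<m , p-break))) = ℕ.≤-trans (ℕ.≤-reflexive prefix-only) below
      where
      1+p≤ : suc p ≤ suc i
      1+p≤ = subst (_≤ suc i) lo≡ lo≤i
      c : ℕ
      c = ∑ (suc p) (λ x → aH x (suc i))
      below : c ≤ 1
      below = ℕ.*-cancelˡ-≤ 2 (ℕ.+-cancelˡ-≤ (p + p) (2 * c) 2 (subst₂ _≤_
        (cong (_+ 2 * c) (proj₂ (break-both p p<m p-break))) (solve 1 (λ p → con 2 :* (con 1 :+ p) := p :+ p :+ con 2) refl p)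
        (forestH (suc p) (suc i) 1+p≤ i<n)))
        where open ℕ-Solver
      prefix-only : bH (suc i) ≡ c
      prefix-only = trans (cong (λ k → ∑ k (λ x → aH x (suc i))) (sym (ℕ.m+[n∸m]≡n 1+p≤)))
        (trans (∑-split (suc p) (i ∸ p) (λ x → aH x (suc i)))
          (trans (cong (λ z → c + z) (∑-zero (i ∸ p) λ x x< → none (suc p + x) (ℕ.m≤m+n (suc p) x)
            (subst (suc p + x <_) (ℕ.m+[n∸m]≡n 1+p≤) (ℕ.+-monoʳ-< (suc p) x<)))) (ℕ.+-identityʳ c)))
        where
        none : ∀ x → suc p ≤ x → x < suc i → aH x (suc i) ≡ 0
        none x p<x x<i = ℕ.n<1⇒n≡0 (ℕ.≰⇒> λ 1≤ → contradiction
          (proj₁ (H-tie-edge x (suc i) x<i i<n 1≤ (inside x (subst (_≤ x) (sym lo≡) p<x) (ℕ.<-trans x<i i<hi))))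
          (ℕ.m<n⇒n≢0 p<x))

  -- H has as many edges as S, namely n - 1, so all the bounds of `bH≤` are attained.
  bH≡1 : ∀ i → 1 ≤ i → i < n → bH i ≡ 1
  bH≡1 i 1≤i i<n = trans (∑-squeeze n bH≤ (ℕ.≤-reflexive total) i i<n) (χ-yes (1 ℕ.≤? i) 1≤i)
    where
    n≡ : suc (n ∸ 1) ≡ n
    n≡ = ℕ.m+[n∸m]≡n (ℕ.<⇒≤ 1<n)
    total : ∑ n (λ i → χ (1 ℕ.≤? i)) ≡ ∑ n bH
    total = ℕ.*-cancelˡ-≡ _ _ 2 (begin
      2 * ∑ n (λ i → χ (1 ℕ.≤? i))   ≡⟨ cong (2 *_) (trans (cong (λ k → ∑ k (λ i → χ (1 ℕ.≤? i))) (sym n≡)) (∑-all-but-first (n ∸ 1) (λ i → χ (1 ℕ.≤? i)) refl λ i 1≤i _ → χ-yes (1 ℕ.≤? i) 1≤i)) ⟩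
      2 * (n ∸ 1)                    ≡⟨ cong (λ z → n ∸ 1 + z) (ℕ.+-identityʳ (n ∸ 1)) ⟩
      (n ∸ 1) + (n ∸ 1)              ≡⟨ CS.e-square (n ∸ 1) (ℕ.≤-reflexive n≡) ⟨
      eS (suc (n ∸ 1)) (suc (n ∸ 1)) ≡⟨ cong (λ k → eS k k) n≡ ⟩
      eS n n                         ≡⟨ break-e {n} {n} (inj₂ (inj₁ refl)) (inj₂ (inj₁ refl)) ⟨
      eH n n                         ≡⟨ EH.e-sum n ⟩
      2 * ∑ n bH                     ∎)
      where open ≡-Reasoning

  open Parents adjH bH≡1 public

  S-down : ∀ {x c} → x < n → c < n → 1 ≤ aS x c → g c ≤ʳ g x → ¬ g c ≈ g x → (x ≡ 0 → c ≢ 1) → x < m × 1 ≤ down x c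
  S-down {x} {c} x<n c<n 1≤ le ¬tie not-first = subst (_< m) par-c (par-interior c 1≤c c<n)
      , subst (λ p → 1 ≤ down p c) par-c (child-down c 1≤c c<n λ eq → not-first (trans (sym par-c) eq))
    where
    x<c : x < c
    x<c = ℕ.≰⇒> λ c≤x → ¬tie (≤ʳ-antisym le (antitone c x c≤x x<n))
    1≤c : 1 ≤ c
    1≤c = ℕ.≤-trans (s≤s z≤n) x<c
    par-c : par c ≡ x
    par-c = S-edge x c x<c c<n 1≤

  -- If k′ < k, the transferred edges force k and k′ to tie, and then the down
  -- neighbours of their common class to tie as well.
  parent-mono : ∀ {i i′ k k′} → i < i′ → i′ < n → ¬ g i ≈ g i′ → k < i → k′ < i′ → 1 ≤ aH k i → 1 ≤ aH k′ i′ → k ≤ k′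
  parent-mono {i} {i′} {k} {k′} i<i′ i′<n ¬tie k<i k′<i′ 1≤ 1≤′ = ℕ.≮⇒≥ λ k′<k →
      no-inversion k′<k (transfer k i k<n i<n 1≤) (transfer k′ i′ (ℕ.<-trans k′<i′ i′<n) i′<n 1≤′)
    where
    i<n : i < n
    i<n = ℕ.<-trans i<i′ i′<n
    k<n : k < n
    k<n = ℕ.<-trans k<i i<n
    no-inversion : k′ < k →
      (∃₂ λ x y → x < n × y < n × g x ≈ g k × g y ≈ g i × 1 ≤ aS x y) →
      (∃₂ λ x y → x < n × y < n × g x ≈ g k′ × g y ≈ g i′ × 1 ≤ aS x y) → ⊥
    no-inversion k′<k (k₁ , i₁ , k₁<n , i₁<n , tk , ti , 1≤₁) (k₂ , i₂ , k₂<n , i₂<n , tk′ , ti′ , 1≤₂) = finish (k₁ ℕ.≟ k₂) (k₁ ℕ.≟ k)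
      where
      1≤k : 1 ≤ k
      1≤k = ℕ.≤-trans (s≤s z≤n) k′<k
      ¬ki : ¬ g k ≈ g i
      ¬ki tie = contradiction (proj₁ (H-tie-edge k i k<i i<n 1≤ tie)) (ℕ.m<n⇒n≢0 1≤k)
      ¬ki′ : ¬ g k′ ≈ g i′
      ¬ki′ tie = contradiction (subst (i <_) (proj₂ (H-tie-edge k′ i′ k′<i′ i′<n 1≤′ tie)) i<i′) (ℕ.≤⇒≯ (ℕ.≤-trans 1≤k (ℕ.<⇒≤ k<i)))
      i₁<i₂ : i₁ < i₂
      i₁<i₂ = ℕ.≰⇒> λ i₂≤i₁ → ¬tie (≤ʳ-antisym
        (≤ʳ-trans (≈⇒≤ʳ (≈-sym ti)) (≤ʳ-trans (antitone i₂ i₁ i₂≤i₁ i₁<n) (≈⇒≤ʳ ti′))) (antitone i i′ (ℕ.<⇒≤ i<i′) i′<n))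
      ¬k₁i₁ : ¬ g i₁ ≈ g k₁
      ¬k₁i₁ tie = ¬ki (≈-trans (≈-sym tk) (≈-trans (≈-sym tie) ti))
      ¬k₂i₂ : ¬ g i₂ ≈ g k₂
      ¬k₂i₂ tie = ¬ki′ (≈-trans (≈-sym tk′) (≈-trans (≈-sym tie) ti′))
      le₁ : g i₁ ≤ʳ g k₁
      le₁ = ≤ʳ-trans (≈⇒≤ʳ ti) (≤ʳ-trans (antitone k i (ℕ.<⇒≤ k<i) i<n) (≈⇒≤ʳ (≈-sym tk)))
      le₂ : g i₂ ≤ʳ g k₂
      le₂ = ≤ʳ-trans (≈⇒≤ʳ ti′) (≤ʳ-trans (antitone k′ i′ (ℕ.<⇒≤ k′<i′) i′<n) (≈⇒≤ʳ (≈-sym tk′)))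
      k₁<i₁ : k₁ < i₁
      k₁<i₁ = ℕ.≰⇒> λ i₁≤k₁ → ¬k₁i₁ (≤ʳ-antisym le₁ (antitone i₁ k₁ i₁≤k₁ k₁<n))
      k₂<i₂ : k₂ < i₂
      k₂<i₂ = ℕ.≰⇒> λ i₂≤k₂ → ¬k₂i₂ (≤ʳ-antisym le₂ (antitone i₂ k₂ i₂≤k₂ k₂<n))
      k₁≤k₂ : k₁ ≤ k₂
      k₁≤k₂ = subst₂ _≤_ (S-edge k₁ i₁ k₁<i₁ i₁<n 1≤₁) (S-edge k₂ i₂ k₂<i₂ i₂<n 1≤₂)
        (par-mono i₁ i₂ (ℕ.≤-trans (s≤s z≤n) k₁<i₁) (ℕ.<⇒≤ i₁<i₂) i₂<n)
      kk′ : g k ≈ g k′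
      kk′ = ≤ʳ-antisym (antitone k′ k (ℕ.<⇒≤ k′<k) k<n) (≤ʳ-trans (≈⇒≤ʳ (≈-sym tk′)) (≤ʳ-trans (antitone k₁ k₂ k₁≤k₂ k₂<n) (≈⇒≤ʳ tk)))
      root-tie : ∀ {x c} → g x ≈ g k → ¬ g c ≈ g x → x ≡ 0 → c ≢ 1
      root-tie tx ¬tie refl refl = ¬tie (≈-trans (tie-between z≤n 1≤k k<n tx) (≈-sym tx))
      down₁ : k₁ < m × 1 ≤ down k₁ i₁
      down₁ = S-down k₁<n i₁<n 1≤₁ le₁ ¬k₁i₁ (root-tie tk ¬k₁i₁)
      down₂ : k₂ < m × 1 ≤ down k₂ i₂
      down₂ = S-down k₂<n i₂<n 1≤₂ le₂ ¬k₂i₂ (root-tie (≈-trans tk′ (≈-sym kk′)) ¬k₂i₂)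
      k<m : k < m
      k<m = tie⇒interior (proj₁ down₁) k<n (≈-sym tk)
      k′<m : k′ < m
      k′<m = tie⇒interior k<m (ℕ.<-trans k′<k k<n) (≈-sym kk′)
      conclude : g i₁ ≈ g i₂ → ⊥
      conclude tie = ¬tie (≈-trans (≈-sym ti) (≈-trans tie ti′))
      -- When both edges transfer to the same upper position of S, a second tied position is still
      -- required; `k` and `k′` are distinct, so one of them serves.
      common : ∀ {z} → z < m → k₁ ≢ z → g k₁ ≈ g z → k₁ ≡ k₂ → ⊥
      common z<m k₁≢z tie k₁≡k₂ =
        let s , v , _ = tie-down (proj₁ down₁) z<m k₁≢z tie
        in conclude (≈-trans {y = s} (v i₁ i₁<n (proj₂ down₁)) (≈-sym (v i₂ i₂<n (subst (λ z → 1 ≤ down z i₂) (sym k₁≡k₂) (proj₂ down₂)))))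
      finish : Dec (k₁ ≡ k₂) → Dec (k₁ ≡ k) → ⊥
      finish (yes k₁≡k₂) (no k₁≢k) = common k<m k₁≢k tk k₁≡k₂
      finish (yes k₁≡k₂) (yes k₁≡k) = common k′<m (λ eq → ℕ.<-irrefl (trans (sym eq) k₁≡k) k′<k) (≈-trans tk kk′) k₁≡k₂
      finish (no k₁≢k₂) _ =
        let s , v₁ , v₂ = tie-down (proj₁ down₁) (proj₁ down₂) k₁≢k₂ (≈-trans tk (≈-trans kk′ (≈-sym tk′)))
        in conclude (≈-trans {y = s} (v₁ i₁ i₁<n (proj₂ down₁)) (≈-sym (v₂ i₂ i₂<n (proj₂ down₂))))

  bfsH : (∀ {i i′ k k′} → i < i′ → i′ < n → g i ≈ g i′ → k < i → k′ < i′ → 1 ≤ aH k i → 1 ≤ aH k′ i′ → k ≤ k′) → IsBFS n aH dH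
  bfsH within = parents⇒bfs ordered
      (λ i j i≤j j<n 2≤ → interiorH′ i (ℕ.≤-<-trans i≤j j<n) (ℕ.≤-<-trans i≤j (interiorH j j<n 2≤)))
      (λ i j i≤j j<n 2≤ → subst₂ _≤_ (degrees-agree i (ℕ.≤-<-trans i≤j j<n)) (degrees-agree j j<n) (dS-mono i j i≤j (interiorH j j<n 2≤)))
    where
    ordered : ∀ {i i′ k k′} → i < i′ → i′ < n → k < i → k′ < i′ → 1 ≤ aH k i → 1 ≤ aH k′ i′ → k ≤ k′
    ordered {i} {i′} i<i′ i′<n k<i k′<i′ 1≤ 1≤′ = case tie? i i′ (ℕ.<-trans i<i′ i′<n) i′<n of λ where
      (yes tie) → within i<i′ i′<n tie k<i k′<i′ 1≤ 1≤′
      (no ¬tie) → parent-mono i<i′ i′<n ¬tie k<i k′<i′ 1≤ 1≤′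

-- Comparison of eigenvalues

sum-allFin : ∀ {n} (h : Fin n → ℕ) → sumˡ (map h (allFin n)) ≡ ℕΣ.sum h
sum-allFin h = trans (cong sumˡ (List.map-tabulate id h)) (sum-tabulate h)
  where
  sum-tabulate : ∀ {n} (h : Fin n → ℕ) → sumˡ (List.tabulate h) ≡ ℕΣ.sum h
  sum-tabulate {zero}  h = refl
  sum-tabulate {suc n} h = cong (λ z → h zero + z) (sum-tabulate (h ∘ suc))

module _ (G : TreeWithBoundary) {π : List ℕ} (G∈ : 𝒯 π G) where
  open Tree G

  order≡length : order ≡ length π
  order≡length = trans (sym (trans (List.length-map deg (allFin order)) (List.length-tabulate id))) (↭-length G∈)

  degree-sums : ∀ (ν : Numbering order) (ψ : ℕ → ℕ) → ∑ order (ψ ∘ Numbered.d ν) ≡ sumˡ (map ψ π)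
  degree-sums ν ψ = trans (sym (Numbering.sum-at ν (ψ ∘ deg))) (trans (sym (sum-allFin (ψ ∘ deg)))
    (trans (cong sumˡ (List.map-∘ (allFin order))) (sum-↭ (↭-map⁺ ψ G∈))))

-- What the comparison uses of the breadth-first tree. With `n` as a parameter the data are
-- transported at once to the order of the other tree.
record BFSArray (μ : ℝ) (π : List ℕ) (n : ℕ) : Set where
  field
    a           : ℕ → ℕ → ℕ
    d           : ℕ → ℕ
    adjacency   : IsAdjacency n a
    d≡∑         : ∀ i → d i ≡ ∑ n (a i)
    d-pos       : ∀ i → i < n → 1 ≤ d i
    bfs         : IsBFS n a d
    degree-sum  : ∀ (ψ : ℕ → ℕ) → ∑ n (ψ ∘ d) ≡ sumˡ (map ψ π)
    φ φ⁻¹       : ℕ → ℝ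
    φ-supported : Energy.Supported adjacency d φ
    φ-harmonic  : Energy.Harmonic adjacency d μ φ
    φ-pos       : ∀ i → i < n → 2 ≤ d i → Pos (φ i)
    φ-inv       : ∀ i → i < n → 2 ≤ d i → φ i *ʳ φ⁻¹ i ≈ 1ℝ

TreeBFS : TreeWithBoundary → Set
TreeBFS G = Σ[ ν ∈ Numbering order ] IsBFS order (Numbered.a ν) (Numbered.d ν)
  where open Tree G

bfsArray : ∀ G {π} → 𝒯 π G → TreeBFS G → BFSArray (Ground.μ G) π (length π)
bfsArray G {π} G∈ (ν , bfs) = subst (BFSArray (Ground.μ G) π) (order≡length G G∈) (record
  { a = a ; d = d ; adjacency = adjacency ; d≡∑ = d≡∑ ; d-pos = λ i _ → deg-pos (at i) ; bfs = bfs
  ; degree-sum = degree-sums G G∈ ν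
  ; φ = F ∘ at ; φ⁻¹ = F⁻¹ ∘ at
  ; φ-supported = array-supported F-eigenfunction ; φ-harmonic = array-harmonic F-eigenfunction
  ; φ-pos = λ i _ → F-pos (at i) ; φ-inv = λ i _ → F-inv (at i) })
  where
  open Tree G
  open Numbered ν
  open Ground G

argmin : ∀ n k (P : ℕ → Set) → (∀ i → i < n → Dec (P i)) → (f : ℕ → ℕ) → k < n → P k →
  ∃[ l ] (k ≤ l × l < n × P l × (∀ i → k ≤ i → i < n → P i → f l ≤ f i))
argmin (suc n) k P P? f k<1+n Pk with k ℕ.≟ n
... | yes refl = k , ℕ.≤-refl , k<1+n , Pk , λ i k≤i i<1+k _ → ℕ.≤-reflexive (cong f (ℕ.≤-antisym k≤i (s≤s⁻¹ i<1+k)))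
... | no k≢n with argmin n k P (λ i i<n → P? i (ℕ.m<n⇒m<1+n i<n)) f (ℕ.≤∧≢⇒< (s≤s⁻¹ k<1+n) k≢n) Pk
... | l , k≤l , l<n , Pl , min = choose (P? n ℕ.≤-refl) (f n ℕ.<? f l)
  where
  extend : ∀ l′ → f l′ ≤ f l → (P n → f l′ ≤ f n) → ∀ i → k ≤ i → i < suc n → P i → f l′ ≤ f i
  extend l′ le le-n i k≤i i<1+n Pi with i ℕ.≟ n
  ... | yes refl = le-n Pi
  ... | no i≢n   = ℕ.≤-trans le (min i k≤i (ℕ.≤∧≢⇒< (s≤s⁻¹ i<1+n) i≢n) Pi)
  choose : Dec (P n) → Dec (f n < f l) → ∃[ l ] (k ≤ l × l < suc n × P l × (∀ i → k ≤ i → i < suc n → P i → f l ≤ f i))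
  choose (yes Pn) (yes lt) = n , s≤s⁻¹ k<1+n , ℕ.≤-refl , Pn , extend n (ℕ.<⇒≤ lt) (λ _ → ℕ.≤-refl)
  choose (yes Pn) (no ¬lt) = l , k≤l , ℕ.m<n⇒m<1+n l<n , Pl , extend l ℕ.≤-refl (λ _ → ℕ.≮⇒≥ ¬lt)
  choose (no ¬Pn) _        = l , k≤l , ℕ.m<n⇒m<1+n l<n , Pl , extend l ℕ.≤-refl (λ Pn → contradiction Pn ¬Pn)

module Transposition (k l : ℕ) where

  τ : ℕ → ℕ
  τ i with i ℕ.≟ k
  ... | yes _ = l
  ... | no _ with i ℕ.≟ l
  ...   | yes _ = k
  ...   | no _  = i

  τ-k : τ k ≡ l
  τ-k with k ℕ.≟ k
  ... | yes _  = refl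
  ... | no k≢k = contradiction refl k≢k

  τ-l : τ l ≡ k
  τ-l with l ℕ.≟ k
  ... | yes l≡k = l≡k
  ... | no _ with l ℕ.≟ l
  ...   | yes _  = refl
  ...   | no l≢l = contradiction refl l≢l

  τ-other : ∀ i → i ≢ k → i ≢ l → τ i ≡ i
  τ-other i i≢k i≢l with i ℕ.≟ k
  ... | yes i≡k = contradiction i≡k i≢k
  ... | no _ with i ℕ.≟ l
  ...   | yes i≡l = contradiction i≡l i≢l
  ...   | no _    = refl

  τ-elim : ∀ (Q : ℕ → ℕ → Set) → Q k l → Q l k → (∀ i → i ≢ k → i ≢ l → Q i i) → ∀ i → Q i (τ i)
  τ-elim Q qk ql qi i = cases (i ℕ.≟ k) (i ℕ.≟ l)
    where
    cases : Dec (i ≡ k) → Dec (i ≡ l) → Q i (τ i)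
    cases (yes refl) _          = subst (Q i) (sym τ-k) qk
    cases (no _)     (yes refl) = subst (Q i) (sym τ-l) ql
    cases (no i≢k)   (no i≢l)   = subst (Q i) (sym (τ-other i i≢k i≢l)) (qi i i≢k i≢l)

  τ-involutive : ∀ i → τ (τ i) ≡ i
  τ-involutive = τ-elim (λ i j → τ j ≡ i) τ-l τ-k τ-other

-- Rearranging the eigenfunction of a tree on a breadth-first tree

module Against (H : TreeWithBoundary) {π : List ℕ} (H∈ : 𝒯 π H) {μS : ℝ} (S : BFSArray μS π (TreeWithBoundary.order H)) where
  open Tree H
  open Ground H renaming (μ to μH)

  private
    module S = BFSArray S
    module ES = Energy S.adjacency S.d
    module B = IsBFS S.bfs

  record Sorted (ν : Numbering order) : Set where
    open Numbering ν
    field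
      antitone : ∀ i j → i ≤ j → j < order → F (at j) ≤ʳ F (at i)

  module WithSorted (ν : Numbering order) (sorted : Sorted ν) where
    open Numbered ν public
    open Sorted sorted public

    g : ℕ → ℝ
    g i = F (at i)

    interior-first : ∀ i j → i ≤ j → j < n → 2 ≤ d j → 2 ≤ d i
    interior-first i j i≤j j<n 2≤ = cases (interior? (at i))
      where
      cases : Dec (IsInterior (at i)) → 2 ≤ d i
      cases (yes int) = int
      cases (no ¬int) = contradiction (≤ʳ-antisym
        (≤ʳ-trans (antitone i j i≤j j<n) (≈⇒≤ʳ (IsEigenfunction.boundary F-eigenfunction (at i) ¬int)))
        (Pos⇒0≤ (F-pos (at j) 2≤))) (Pos⇒≉0 (F-pos (at j) 2≤))

    m : ℕ
    m = ∑ n (λ i → χ (2 ℕ.≤? d i))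

    private
      countS = interior-count n S.d (IsBFS.interior-first S.bfs)
      countH = interior-count n d interior-first

      mS≡m : ∑ n (λ i → χ (2 ℕ.≤? S.d i)) ≡ m
      mS≡m = trans (S.degree-sum (λ x → χ (2 ℕ.≤? x))) (sym (degree-sums H H∈ ν (λ x → χ (2 ℕ.≤? x))))

    interiorH : ∀ i → i < n → 2 ≤ d i → i < m
    interiorH = proj₁ (proj₂ countH)

    m<n : m < n
    m<n = let v , boundary = hasBoundary in
      ℕ.≤-<-trans (ℕ.≮⇒≥ λ lt → contradiction (proj₂ (proj₂ countH) (pos v) (pos<n v) lt)
        (ℕ.<⇒≱ (ℕ.≤-reflexive (cong suc (trans (cong deg (at-pos v)) boundary))))) (pos<n v)

    1≤m : 1 ≤ m
    1≤m = let v , int = hasInterior in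
      ℕ.≤-trans (s≤s z≤n) (interiorH (pos v) (pos<n v) (subst IsInterior (sym (at-pos v)) int))

    comparable : Comparable n m S.a a S.d d
    comparable = record
      { adjS = S.adjacency ; adjH = adjacency ; dS≡∑ = S.d≡∑ ; dH≡∑ = d≡∑ ; bfsS = S.bfs ; m<n = m<n
      ; interiorS = λ i i<n 2≤ → subst (i <_) mS≡m (proj₁ (proj₂ countS) i i<n 2≤)
      ; interiorS′ = λ i i<n i<m → proj₂ (proj₂ countS) i i<n (subst (i <_) (sym mS≡m) i<m)
      ; interiorH = interiorH
      ; interiorH′ = proj₂ (proj₂ countH)
      ; same = λ ψ → trans (S.degree-sum ψ) (sym (degree-sums H H∈ ν ψ))
      ; forestH = prefix-bound }

    open Comparable comparable using (interiorS; interiorS′; interiorH′)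

    g≈0 : ∀ i → m ≤ i → i < n → g i ≈ 0ℝ
    g≈0 i m≤i i<n = IsEigenfunction.boundary F-eigenfunction (at i) λ int → ℕ.<⇒≱ (interiorH i i<n int) m≤i

    g-pos : ∀ i → i < m → Pos (g i)
    g-pos i i<m = F-pos (at i) (interiorH′ i (ℕ.<-trans i<m m<n) i<m)

    g-supported : ES.Supported g
    g-supported i i<n ¬2≤ = g≈0 i (ℕ.≮⇒≥ λ i<m → ¬2≤ (interiorS′ i i<n i<m)) i<n

    open Comparison.Energies comparable g g≈0 (λ i i<n → antitone i (suc i) (ℕ.n≤1+n i) i<n) public

    module J = ES.Jacobi μS S.φ S.φ⁻¹ S.φ-supported S.φ-harmonic S.φ-pos S.φ-inv g g-supported

    norm-pos : ¬ ¬ Pos (norm g)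
    norm-pos ¬pos = Pos⇒≉0 (g-pos 0 1≤m) (norm-definite g (0≤∧¬Pos⇒≈0 (0≤norm g) ¬pos) 0 (ℕ.<-trans 1≤m m<n))

    energyH≈ : energyH ≈ μH *ʳ norm g
    energyH≈ = harmonic-energy (array-supported F-eigenfunction) (array-harmonic F-eigenfunction)

    μS-norm≤ : μS *ʳ norm g ≤ʳ energyS
    μS-norm≤ = 0≤-⇒≤ J.rayleigh

    -- With `g` the sorted eigenfunction of H, the chain is μS ‖g‖² ≤ energyS ≤ energyH = μH ‖g‖²;
    -- the norm is the same in both trees.
    μS≤μH : μS ≤ʳ μH
    μS≤μH = ≤ʳ-stable λ k → norm-pos λ pos → k (0≤-⇒≤ (Pos-*-cancel-0≤ pos (0≤-resp-≈
      (solve 3 (λ n x y → x :* n :- y :* n := n :* (x :- y)) ≈-refl (norm g) μH μS)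
      (≤⇒0≤- (≤ʳ-trans μS-norm≤ (≤ʳ-trans energyS≤energyH (≈⇒≤ʳ energyH≈)))))))
      where open ℝ-Solver

    module Equality (le : μH ≤ʳ μS) (tie? : ∀ i j → i < n → j < n → Dec (g i ≈ g j)) where

      μ-norm≤ : μH *ʳ norm g ≤ʳ μS *ʳ norm g
      μ-norm≤ = 0≤-⇒≤ (0≤-resp-≈ (solve 3 (λ n x y → (x :- y) :* n := x :* n :- y :* n) ≈-refl (norm g) μS μH) (0≤ʳ-* (≤⇒0≤- le) (0≤norm g)))
        where open ℝ-Solver

      h-edge : ∀ i j → i < n → j < n → 2 ≤ S.d i → 2 ≤ S.d j → S.a i j ≡ 1 → J.h i ≈ J.h j
      h-edge = J.rayleigh-equality (≈-⇒-≈0 (≤ʳ-antisym (≤ʳ-trans energyS≤energyH (≤ʳ-trans (≈⇒≤ʳ energyH≈) μ-norm≤)) μS-norm≤))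

      -- Equality in the Rayleigh bound makes the quotient of `g` by φ agree along interior edges of
      -- S, and parents lead from every position to the root. Hence `g` is a multiple of φ and
      -- inherits its eigenvalue equation.
      h-constant : ∀ i → i < m → J.h i ≈ J.h 0
      h-constant = <-rec _ λ where
        zero    rec _   → ≈-refl
        (suc i) rec i<m →
          let i<n = ℕ.<-trans i<m m<n
              p<i = B.par< (suc i) i<n (s≤s z≤n)
              p<m = ℕ.<-trans p<i i<m
              p<n = ℕ.<-trans p<i i<n
          in ≈-trans (h-edge (suc i) (B.par (suc i)) i<n p<n (interiorS′ (suc i) i<n i<m) (interiorS′ (B.par (suc i)) p<n p<m)
               (ℕ.≤-antisym (IsAdjacency.a≤1 S.adjacency _ _) (ℕ.≤-trans (ℕ.≤-trans (ℕ.≤-reflexive (sym (χ-yes (B.par (suc i) ℕ.≟ B.par (suc i)) refl)))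
                 (ℕ.m≤n+m _ (χ (B.par (B.par (suc i)) ℕ.≟ suc i)))) (ℕ.≤-reflexive (sym (B.a≡ (suc i) (B.par (suc i)) i<n p<n))))))
               (rec p<i p<m)

      g≈hφ : ∀ i → i < n → g i ≈ J.h 0 *ʳ S.φ i
      g≈hφ i i<n = cases (i ℕ.<? m)
        where
        cases : Dec (i < m) → g i ≈ J.h 0 *ʳ S.φ i
        cases (yes i<m) = ≈-trans (≈-sym (J.hφ≈g i i<n)) (*ʳ-cong (h-constant i i<m) ≈-refl)
        cases (no ¬i<m) = ≈-trans (g≈0 i (ℕ.≮⇒≥ ¬i<m) i<n) (≈-sym (*ʳ-zeroʳ (S.φ-supported i i<n λ 2≤ → ¬i<m (interiorS i i<n 2≤))))

      g-harmonic : ES.Harmonic μS g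
      g-harmonic i i<n 2≤ = begin
        ES.Δ g i
          ≈⟨ +ʳ-cong (*ʳ-cong ≈-refl (g≈hφ i i<n)) (-ʳ-cong (Σʳ.∑-cong n λ j j<n → ≈-trans (*ʳ-cong ≈-refl (g≈hφ j j<n))
               (solve 3 (λ a h p → a :* (h :* p) := h :* (a :* p)) ≈-refl (ι (S.a i j)) (J.h 0) (S.φ j)))) ⟩
        ι (S.d i) *ʳ (J.h 0 *ʳ S.φ i) -ʳ ∑ʳ n (λ j → J.h 0 *ʳ (ι (S.a i j) *ʳ S.φ j))
          ≈⟨ +ʳ-cong ≈-refl (-ʳ-cong (Σʳ.∑-*ˡ n (J.h 0) (λ j → ι (S.a i j) *ʳ S.φ j))) ⟨
        ι (S.d i) *ʳ (J.h 0 *ʳ S.φ i) -ʳ J.h 0 *ʳ ∑ʳ n (λ j → ι (S.a i j) *ʳ S.φ j)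
          ≈⟨ solve 4 (λ d h p s → d :* (h :* p) :- h :* s := h :* (d :* p :- s)) ≈-refl (ι (S.d i)) (J.h 0) (S.φ i) (∑ʳ n (λ j → ι (S.a i j) *ʳ S.φ j)) ⟩
        J.h 0 *ʳ ES.Δ S.φ i
          ≈⟨ *ʳ-cong ≈-refl (S.φ-harmonic i i<n 2≤) ⟩
        J.h 0 *ʳ (μS *ʳ S.φ i)
          ≈⟨ solve 3 (λ h m p → h :* (m :* p) := m :* (h :* p)) ≈-refl (J.h 0) μS (S.φ i) ⟩
        μS *ʳ (J.h 0 *ʳ S.φ i)
          ≈⟨ *ʳ-cong ≈-refl (g≈hφ i i<n) ⟨
        μS *ʳ g i ∎
        where
        open ℝ-Solver
        open ≈-Reasoning

      module R = Rigidity comparable 1≤m S.d-pos (λ i _ → deg-pos (at i)) g g≈0 g-pos antitone tie? μS g-harmonic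
        (core-equality (≤ʳ-trans (≈⇒≤ʳ energyH≈) (≤ʳ-trans μ-norm≤ μS-norm≤)))

      -- The invariant of the sort: inside a level set the parents increase, for pairs whose earlier
      -- position is below `K`. Pairs from different level sets are settled by `parent-mono`.
      Ordered : ℕ → Set
      Ordered K = ∀ {i i′ k k′} → i < K → i < i′ → i′ < n → g i ≈ g i′ → k < i → k′ < i′ → 1 ≤ a k i → 1 ≤ a k′ i′ → k ≤ k′

  tie-dec : (∀ u v → Dec (F u ≤ʳ F v)) → ∀ u v → Dec (F u ≈ F v)
  tie-dec leq? u v = decide (leq? u v) (leq? v u)
    where
    decide : Dec (F u ≤ʳ F v) → Dec (F v ≤ʳ F u) → Dec (F u ≈ F v)
    decide (yes p) (yes q) = yes (≤ʳ-antisym p q)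
    decide (no ¬p) _       = no λ tie → ¬p (≈⇒≤ʳ tie)
    decide (yes _) (no ¬q) = no λ tie → ¬q (≈⇒≤ʳ (≈-sym tie))

  -- Selection sort inside the level sets

  module Selection (le : μH ≤ʳ μS) (leq? : ∀ u v → Dec (F u ≤ʳ F v)) where

    module E (ν : Numbering order) (s : Sorted ν) where
      open WithSorted ν s public
      open Equality le (λ i j _ _ → tie-dec leq? (at i) (at j)) public

    State : ℕ → Set
    State K = Σ[ ν ∈ Numbering order ] Σ[ s ∈ Sorted ν ] E.Ordered ν s K

    -- One step of selection sort inside the tie class of position K: the
    -- member whose parent comes first is moved to position K.
    module Step (K : ℕ) (K<n : K < order) (ν : Numbering order) (s : Sorted ν) (ordered : E.Ordered ν s K) where
      open E ν s

      p : ℕ → ℕ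
      p i = pick (1 ℕ.≤? i) (i ℕ.<? n)
        where
        pick : Dec (1 ≤ i) → Dec (i < n) → ℕ
        pick (yes 1≤i) (yes i<n) = proj₁ (R.parent i 1≤i i<n)
        -- A default at the root and outside the array.
        pick _ _ = 0

      p≡ : ∀ i k → i < n → k < i → 1 ≤ a k i → p i ≡ k
      p≡ i k i<n k<i 1≤ with 1 ℕ.≤? i | i ℕ.<? n
      ... | yes 1≤i | yes i<n′ = let k′<i , 1≤′ = proj₂ (R.parent i 1≤i i<n′) in R.parent-unique i _ k i<n k′<i k<i 1≤′ 1≤
      ... | no ¬1≤i | _        = contradiction (ℕ.≤-trans (s≤s z≤n) k<i) ¬1≤i
      ... | yes _   | no ¬i<n  = contradiction i<n ¬i<n

      opaque
        chosen : ∃[ l ] (K ≤ l × l < n × g l ≈ g K × (∀ i → K ≤ i → i < n → g i ≈ g K → p l ≤ p i))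
        chosen = argmin n K (λ i → g i ≈ g K) (λ i _ → tie-dec leq? (at i) (at K)) p K<n ≈-refl

      L : ℕ
      L = proj₁ chosen

      K≤L : K ≤ L
      K≤L = proj₁ (proj₂ chosen)

      L<n : L < n
      L<n = proj₁ (proj₂ (proj₂ chosen))

      L-tie : g L ≈ g K
      L-tie = proj₁ (proj₂ (proj₂ (proj₂ chosen)))

      L-min : ∀ i → K ≤ i → i < n → g i ≈ g K → p L ≤ p i
      L-min = proj₂ (proj₂ (proj₂ (proj₂ chosen)))

      open Transposition K L

      τ<n : ∀ i → i < n → τ i < n
      τ<n = τ-elim (λ i j → i < n → j < n) (λ _ → L<n) (λ _ → K<n) (λ _ _ _ i<n → i<n)

      gτ : ∀ i → g (τ i) ≈ g i
      gτ = τ-elim (λ i j → g j ≈ g i) L-tie (≈-sym L-tie) (λ _ _ _ → ≈-refl)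

      ν′ : Numbering order
      ν′ = record
        { at = λ i → at (τ i) ; pos = λ v → τ (pos v) ; pos<n = λ v → τ<n (pos v) (pos<n v)
        ; at-pos = λ v → trans (cong at (τ-involutive (pos v))) (at-pos v)
        ; pos-at = λ i i<n → trans (cong τ (pos-at (τ i) (τ<n i i<n))) (τ-involutive i) }

      s′ : Sorted ν′
      s′ = record { antitone = λ i j i≤j j<n → ≤ʳ-resp (≈-sym (gτ j)) (≈-sym (gτ i)) (antitone i j i≤j j<n) }

      module E′ = E ν′ s′

      -- Both parents lie in other level sets than their children: a tied edge would join 0 and 1,
      -- and then either `i′` would be a third member of the root class or there would be no room
      -- for `k` below `i`. In the class of `K` the exchange therefore moves children but not their
      -- parents. Pairs starting below `K` come from the invariant, pairs starting at `K` from the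
      -- minimal choice of `L`.
      ordered′ : E′.Ordered (suc K)
      ordered′ {i} {i′} {k} {k′} i<1+K i<i′ i′<n tie′ k<i k′<i′ 1≤ 1≤′ = by-class (tie-dec leq? (at i) (at K))
        where
        i<n : i < n
        i<n = ℕ.<-trans i<i′ i′<n
        tie : g i ≈ g i′
        tie = ≈-trans (≈-sym (gτ i)) (≈-trans tie′ (gτ i′))
        ¬ki : ¬ g k ≈ g i
        ¬ki t = let k≡0 , i≡1 = E′.R.H-tie-edge k i k<i i<n 1≤ (≈-trans (gτ k) (≈-trans t (≈-sym (gτ i)))) in
          ℕ.<⇒≱ (subst (_< i′) i≡1 i<i′) (s≤s⁻¹ (E′.R.root-class i′ i′<n
            (≈-trans (gτ i′) (≈-trans (≈-sym tie) (≈-trans (≈-sym t) (subst (λ z → g k ≈ E′.g z) k≡0 (≈-sym (gτ k))))))))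
        ¬ki′ : ¬ g k′ ≈ g i′
        ¬ki′ t = let _ , i′≡1 = E′.R.H-tie-edge k′ i′ k′<i′ i′<n 1≤′ (≈-trans (gτ k′) (≈-trans t (≈-sym (gτ i′)))) in
          ℕ.<⇒≱ (ℕ.≤-trans (s≤s z≤n) k<i) (s≤s⁻¹ (subst (i <_) i′≡1 i<i′))
        before : ∀ {x y} → x < K → y ≡ τ x → y ≡ x
        before x<K eq = trans eq (τ-other _ (ℕ.<⇒≢ x<K) (ℕ.<⇒≢ (ℕ.<-≤-trans x<K K≤L)))
        by-class : Dec (g i ≈ g K) → k ≤ k′
        by-class (no ¬iK) = ordered i<K i<i′ i′<n tie k<i k′<i′
            (subst₂ (λ x y → 1 ≤ a x y) (before (ℕ.<-trans k<i i<K) refl) (before i<K refl) 1≤)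
            (subst₂ (λ x y → 1 ≤ a x y) (before (ℕ.<-trans k′<i′ i′<K) refl) (before i′<K refl) 1≤′)
          where
          i<K : i < K
          i<K = ℕ.≤∧≢⇒< (s≤s⁻¹ i<1+K) λ { refl → ¬iK ≈-refl }
          i′<K : i′ < K
          i′<K = ℕ.≰⇒> λ K≤i′ → ¬iK (≈-trans tie (≈-sym (R.tie-between (ℕ.<⇒≤ i<K) K≤i′ i′<n tie)))
        by-class (yes iK) = by-position (ℕ.m≤n⇒m<n∨m≡n (s≤s⁻¹ i<1+K))
          where
          fixed : ∀ {x} → ¬ g x ≈ g i → τ x ≡ x
          fixed ¬tie = τ-other _ (λ { refl → ¬tie (≈-sym iK) }) (λ { refl → ¬tie (≈-trans L-tie (≈-sym iK)) })
          τk′ : τ k′ ≡ k′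
          τk′ = fixed λ t → ¬ki′ (≈-trans t tie)
          edge : 1 ≤ a k (τ i)
          edge = subst (λ x → 1 ≤ a x (τ i)) (fixed ¬ki) 1≤
          edge′ : 1 ≤ a k′ (τ i′)
          edge′ = subst (λ x → 1 ≤ a x (τ i′)) τk′ 1≤′
          k′<τi′ : k′ < τ i′
          k′<τi′ = ℕ.≰⇒> λ τi′≤k′ → ¬ki′ (≤ʳ-antisym
            (≤ʳ-trans (antitone (τ i′) k′ τi′≤k′ (ℕ.<-trans k′<i′ i′<n)) (≈⇒≤ʳ (gτ i′))) (antitone k′ i′ (ℕ.<⇒≤ k′<i′) i′<n))
          by-position : i < K ⊎ i ≡ K → k ≤ k′
          by-position (inj₁ i<K) = ordered i<K
            (τ-elim (λ x y → i < x → i < y) (λ _ → ℕ.<-≤-trans i<K K≤L) (λ _ → i<K) (λ _ _ _ lt → lt) i′ i<i′)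
            (τ<n i′ i′<n) (≈-trans tie (≈-sym (gτ i′))) k<i k′<τi′ (subst (λ x → 1 ≤ a k x) (before i<K refl) edge) edge′
          by-position (inj₂ refl) = subst₂ _≤_
            (p≡ L k L<n (ℕ.<-≤-trans k<i K≤L) (subst (λ x → 1 ≤ a k x) τ-k edge)) (p≡ (τ i′) k′ (τ<n i′ i′<n) k′<τi′ edge′)
            (L-min (τ i′) (τ-elim (λ x y → K < x → K ≤ y) (λ _ → K≤L) (λ _ → ℕ.≤-refl) (λ _ _ _ → ℕ.<⇒≤) i′ i<i′)
              (τ<n i′ i′<n) (≈-trans (gτ i′) (≈-sym tie)))

    advance : ∀ K → K < order → State K → State (suc K)
    advance zero    _   (ν , s , _) = ν , s , λ i<1 _ _ _ k<i _ _ _ → contradiction (ℕ.<-≤-trans k<i (s≤s⁻¹ i<1)) λ ()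
    advance (suc K) K<n (ν , s , ordered) = ν′ , s′ , ordered′
      where open Step (suc K) K<n ν s ordered

    select : ∀ K → K ≤ order → State 0 → State K
    select zero    _   st = st
    select (suc K) K<n st = advance K K<n (select K (ℕ.<⇒≤ K<n) st)

    sorted⇒bfs : ∀ ν → Sorted ν → TreeBFS H
    sorted⇒bfs ν s = finish (select order ℕ.≤-refl (ν , s , λ ()))
      where
      finish : State order → TreeBFS H
      finish (ν , s , ordered) = ν , E.R.bfsH ν s (λ i<i′ i′<n → ordered (ℕ.<-trans i<i′ i′<n) i<i′ i′<n)

  module _ (leq? : ∀ u v → Dec (F u ≤ʳ F v)) where

    _⊏_ : Rel V 0ℓ
    u ⊏ v = ¬ F u ≤ʳ F v ⊎ (F u ≈ F v × toℕ u < toℕ v)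

    ⊏-trans : ∀ {u v w} → u ⊏ v → v ⊏ w → u ⊏ w
    ⊏-trans (inj₁ p) (inj₁ q)             = inj₁ λ le → p (≤ʳ-trans le (≰ʳ⇒≥ʳ q))
    ⊏-trans (inj₁ p) (inj₂ (eq , _))      = inj₁ λ le → p (≤ʳ-trans le (≈⇒≤ʳ (≈-sym eq)))
    ⊏-trans (inj₂ (eq , _)) (inj₁ q)      = inj₁ λ le → q (≤ʳ-trans (≈⇒≤ʳ (≈-sym eq)) le)
    ⊏-trans (inj₂ (eq , p)) (inj₂ (eq′ , q)) = inj₂ (≈-trans eq eq′ , ℕ.<-trans p q)

    ⊏⇒≥ : ∀ {u v} → u ⊏ v → F v ≤ʳ F u
    ⊏⇒≥ (inj₁ p)        = ≰ʳ⇒≥ʳ p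
    ⊏⇒≥ (inj₂ (eq , _)) = ≈⇒≤ʳ (≈-sym eq)

    ⊏-irrefl : ∀ {u} → ¬ u ⊏ u
    ⊏-irrefl (inj₁ p)       = p (≈⇒≤ʳ ≈-refl)
    ⊏-irrefl (inj₂ (_ , p)) = ℕ.<-irrefl refl p

    ⊏-compare : ∀ u v → Tri (u ⊏ v) (u ≡ v) (v ⊏ u)
    ⊏-compare u v = decide (leq? u v) (leq? v u) (Fin.<-cmp u v)
      where
      less : u ⊏ v → Tri (u ⊏ v) (u ≡ v) (v ⊏ u)
      less p = tri< p (λ { refl → ⊏-irrefl p }) (λ q → ⊏-irrefl (⊏-trans p q))
      greater : v ⊏ u → Tri (u ⊏ v) (u ≡ v) (v ⊏ u)
      greater p = tri> (λ q → ⊏-irrefl (⊏-trans p q)) (λ { refl → ⊏-irrefl p }) p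
      decide : Dec (F u ≤ʳ F v) → Dec (F v ≤ʳ F u) → Tri (toℕ u < toℕ v) (u ≡ v) (toℕ v < toℕ u) → Tri (u ⊏ v) (u ≡ v) (v ⊏ u)
      decide (no ¬p) _       _ = less (inj₁ ¬p)
      decide (yes _) (no ¬q) _ = greater (inj₁ ¬q)
      decide (yes p) (yes q) (tri< u<v _ _) = less (inj₂ (≤ʳ-antisym p q , u<v))
      decide (yes p) (yes q) (tri> _ _ v<u) = greater (inj₂ (≤ʳ-antisym q p , v<u))
      decide (yes p) (yes q) (tri≈ _ refl _) = tri≈ ⊏-irrefl refl ⊏-irrefl

    ⊏-isStrictTotalOrder : IsStrictTotalOrder _≡_ _⊏_
    ⊏-isStrictTotalOrder = isStrictTotalOrderᶜ (record { isEquivalence = ≡-isEquivalence ; trans = ⊏-trans ; compare = ⊏-compare })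

    sortedNumbering : Numbering order
    sortedNumbering = numbering ⊏-isStrictTotalOrder (vertex i₀)

    sortedNumbering-sorted : Sorted sortedNumbering
    sortedNumbering-sorted = record { antitone = antitone }
      where
      open Numbering sortedNumbering
      antitone : ∀ i j → i ≤ j → j < order → F (at j) ≤ʳ F (at i)
      antitone i j i≤j j<n = decide (⊏-compare (at i) (at j))
        where
        decide : Tri (at i ⊏ at j) (at i ≡ at j) (at j ⊏ at i) → F (at j) ≤ʳ F (at i)
        decide (tri< p _ _)  = ⊏⇒≥ p
        decide (tri≈ _ eq _) = ≈⇒≤ʳ (ℝR.reflexive (cong F (sym eq)))
        decide (tri> _ _ p)  = contradiction i≤j (ℕ.<⇒≱ (subst₂ _<_ (pos-at j j<n) (pos-at i (ℕ.≤-<-trans i≤j j<n)) (numbering-mono ⊏-isStrictTotalOrder (vertex i₀) p)))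

  -- Double negations may be gathered over a finite range; all comparisons of eigenfunction values
  -- thereby become decidable together.
  ¬¬-∀ : ∀ {n} {P : Fin n → Set} → (∀ i → ¬ ¬ P i) → ¬ ¬ (∀ i → P i)
  ¬¬-∀ {zero}  nn k = k λ ()
  ¬¬-∀ {suc n} nn k = nn zero λ p₀ → ¬¬-∀ (nn ∘ suc) λ p → k λ { zero → p₀ ; (suc i) → p i }

  comparisons : ¬ ¬ (∀ u v → Dec (F u ≤ʳ F v))
  comparisons = ¬¬-∀ λ u → ¬¬-∀ λ v → ¬¬-excluded-middle

  minimal : μS ≤ʳ μH
  minimal = ≤ʳ-stable λ k → comparisons λ leq? → k (WithSorted.μS≤μH (sortedNumbering leq?) (sortedNumbering-sorted leq?))

  equality⇒bfs : μH ≤ʳ μS → ¬ ¬ TreeBFS H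
  equality⇒bfs le k = comparisons λ leq? → k (Selection.sorted⇒bfs le leq? (sortedNumbering leq?) (sortedNumbering-sorted leq?))

-- Spiral-like orderings and breadth-first numberings

module SLO⇒BFS (G : TreeWithBoundary) (root : TreeWithBoundary.V G) (_≺_ : Rel (TreeWithBoundary.V G) 0ℓ) (slo* : IsSLO* G root _≺_) where
  open Tree G
  open IsSLO* slo*
  open IsSLO isSLO
  private
    module O = IsStrictTotalOrder isStrictTotalOrder

  ν : Numbering order
  ν = numbering isStrictTotalOrder root

  open Numbered ν

  pos-mono : ∀ {u v} → u ≺ v → pos u < pos v
  pos-mono = numbering-mono isStrictTotalOrder root

  pos-reflect : ∀ {u v} → pos u < pos v → u ≺ v
  pos-reflect {u} {v} lt with O.compare u v
  ... | tri< u≺v _ _  = u≺v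
  ... | tri≈ _ refl _ = contradiction lt (ℕ.<-irrefl refl)
  ... | tri> _ _ v≺u  = contradiction lt (ℕ.<-asym (pos-mono v≺u))

  at-mono : ∀ {i j} → i < j → j < n → at i ≺ at j
  at-mono i<j j<n = pos-reflect (subst₂ _<_ (sym (pos-at _ (ℕ.<-trans i<j j<n))) (sym (pos-at _ j<n)) i<j)

  h-reflect : ∀ {u v} → h u < h v → u ≺ v
  h-reflect {u} {v} lt with O.compare u v
  ... | tri< u≺v _ _  = u≺v
  ... | tri≈ _ refl _ = contradiction lt (ℕ.<-irrefl refl)
  ... | tri> _ _ v≺u  = contradiction (S1 v≺u) (ℕ.<⇒≱ lt)

  parent-vertex : ∀ v → v ≢ root → ∃[ u ] Child u v
  parent-vertex v v≢root = first (h v) refl (proj₁ (h-dist v))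
    where
    first : ∀ k → k ≡ h v → Walk v root k → ∃[ u ] Child u v
    first .0 eq [] = contradiction refl v≢root
    first (suc k) eq (_∷_ {v = u} edge w) = u , subst T (adj-sym v u) edge
      , trans (sym eq) (cong suc (ℕ.≤-antisym
          (s≤s⁻¹ (subst (_≤ suc (h u)) (sym eq) (proj₂ (h-dist v) (suc (h u)) (edge ∷ proj₁ (h-dist u))))) (proj₂ (h-dist u) k w)))

  child-pos : ∀ {u v} → Child u v → pos u < pos v
  child-pos (_ , eq) = pos-mono (h-reflect (ℕ.≤-reflexive (sym eq)))

  earlier : ∀ i → 1 ≤ i → i < n → ∃[ k ] (k < i × 1 ≤ a k i × Child (at k) (at i))
  earlier i 1≤i i<n = locate (parent-vertex (at i) not-root)
    where
    not-root : at i ≢ root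
    not-root eq = ℕ.<⇒≱ 1≤i (ℕ.≤-reflexive (trans (sym (pos-at i i<n)) (at-root eq)))
      where
      root-first : ∀ v → ¬ v ≺ root
      root-first v v≺root = O.irrefl (walk-root v (ℕ.n≤0⇒n≡0 (ℕ.≤-trans (S1 v≺root) (proj₂ (h-dist root) 0 [])))) v≺root
        where
        walk-root : ∀ v → h v ≡ 0 → v ≡ root
        walk-root v eq with h v | proj₁ (h-dist v)
        walk-root v refl | _ | [] = refl
      at-root : at i ≡ root → pos (at i) ≡ 0
      at-root eq = ℕ.n≤0⇒n≡0 (ℕ.≮⇒≥ λ 0<pos → root-first (at 0)
        (pos-reflect (subst₂ _<_ (sym (pos-at 0 (ℕ.≤-<-trans z≤n i<n))) (cong pos eq) 0<pos)))
    locate : ∃[ u ] Child u (at i) → ∃[ k ] (k < i × 1 ≤ a k i × Child (at k) (at i))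
    locate (u , child) = pos u , subst (pos u <_) (pos-at i i<n) (child-pos child)
      , ℕ.≤-reflexive (sym (T⇒bit (subst (λ w → Adj w (at i)) (sym (at-pos u)) (proj₁ child))))
      , subst (λ w → Child w (at i)) (sym (at-pos u)) child

  -- The parent is one earlier neighbour of every position but the first, and the n - 1 edges of the
  -- tree leave room for no second one.
  one-earlier : ∀ i → 1 ≤ i → i < n → ∑ i (λ x → a x i) ≡ 1
  one-earlier i 1≤i i<n = trans (sym (∑-squeeze n {λ i → χ (1 ℕ.≤? i)} {λ i → ∑ i (λ x → a x i)} at-least (ℕ.≤-reflexive total) i i<n)) (χ-yes (1 ℕ.≤? i) 1≤i)
    where
    at-least : ∀ i → i < n → χ (1 ℕ.≤? i) ≤ ∑ i (λ x → a x i)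
    at-least zero    _   = z≤n
    at-least (suc i) i<n = let k , k<i , 1≤ , _ = earlier (suc i) (s≤s z≤n) i<n in ℕ.≤-trans 1≤ (term≤∑ (suc i) (λ x → a x (suc i)) k<i)
    n≡ : n ≡ suc (n ∸ 1)
    n≡ = sym (ℕ.m+[n∸m]≡n (ℕ.≤-trans 1≤i (ℕ.<⇒≤ i<n)))
    total : ∑ n (λ i → ∑ i (λ x → a x i)) ≡ ∑ n (λ i → χ (1 ℕ.≤? i))
    total = ℕ.*-cancelˡ-≡ _ _ 2 (trans (sym (e-sum n)) (trans (e-total (n ∸ 1) n≡)
      (cong (2 *_) (sym (trans (cong (λ k → ∑ k (λ i → χ (1 ℕ.≤? i))) n≡) (∑-all-but-first (n ∸ 1) (λ i → χ (1 ℕ.≤? i)) refl λ i 1≤i _ → χ-yes (1 ℕ.≤? i) 1≤i))))))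

  open Parents adjacency one-earlier

  child : ∀ {i k} → i < n → k < i → 1 ≤ a k i → Child (at k) (at i)
  child {i} {k} i<n k<i 1≤ =
    let k′ , k′<i , 1≤′ , c = earlier i (ℕ.≤-trans (s≤s z≤n) k<i) i<n
    in subst (λ k → Child (at k) (at i)) (parent-unique i k′ k i<n k′<i k<i 1≤′ 1≤) c

  treeBFS : TreeBFS G
  treeBFS = ν , parents⇒bfs ordered interior-first d-mono
    where
    ordered : ∀ {i i′ k k′} → i < i′ → i′ < n → k < i → k′ < i′ → 1 ≤ a k i → 1 ≤ a k′ i′ → k ≤ k′
    ordered {i} {i′} i<i′ i′<n k<i k′<i′ 1≤ 1≤′ = ℕ.≮⇒≥ λ k′<k →
      let i<n = ℕ.<-trans i<i′ i′<n in
      ℕ.<-asym i<i′ (subst₂ _<_ (pos-at i′ i′<n) (pos-at i i<n)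
        (pos-mono (S2 (at-mono k′<k (ℕ.<-trans k<i i<n)) (child i′<n k′<i′ 1≤′) (child i<n k<i 1≤))))
    interior-first : ∀ i j → i ≤ j → j < n → 2 ≤ d j → 2 ≤ d i
    interior-first i j i≤j j<n 2≤ with ℕ.m≤n⇒m<n∨m≡n i≤j | interior? (at i)
    ... | inj₂ refl | _        = 2≤
    ... | inj₁ _    | yes int  = int
    ... | inj₁ i<j  | no ¬int  = contradiction (subst (2 ≤_) (S3 (at-mono i<j j<n) (¬interior⇒boundary ¬int)) 2≤) λ { (s≤s ()) }
    d-mono : ∀ i j → i ≤ j → j < n → 2 ≤ d j → d i ≤ d j
    d-mono i j i≤j j<n 2≤ with ℕ.m≤n⇒m<n∨m≡n i≤j
    ... | inj₂ refl = ℕ.≤-refl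
    ... | inj₁ i<j  = S4 (interior-first i j i≤j j<n 2≤) 2≤ (at-mono i<j j<n)

module BFS⇒SLO (G : TreeWithBoundary) (bfs : TreeBFS G) where
  open Tree G
  open Numbered (proj₁ bfs)
  open IsBFS (proj₂ bfs)

  -- The number of parent steps down to position 0. The first argument is fuel; as parents have
  -- smaller positions, any fuel not below the position suffices.
  depth : ℕ → ℕ → ℕ
  depth zero    i       = 0
  depth (suc f) zero    = 0
  depth (suc f) (suc i) = suc (depth f (par (suc i)))

  depth-fuel : ∀ f f′ i → i < n → i ≤ f → i ≤ f′ → depth f i ≡ depth f′ i
  depth-fuel zero    zero     zero    _ _ _ = refl
  depth-fuel zero    (suc f′) zero    _ _ _ = refl
  depth-fuel (suc f) zero     zero    _ _ _ = refl
  depth-fuel (suc f) (suc f′) zero    _ _ _ = refl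
  depth-fuel (suc f) (suc f′) (suc i) i<n (s≤s i≤f) (s≤s i≤f′) = cong suc (depth-fuel f f′ (par (suc i)) (ℕ.<-trans p<i i<n)
      (ℕ.≤-trans (s≤s⁻¹ p<i) i≤f) (ℕ.≤-trans (s≤s⁻¹ p<i) i≤f′))
    where
    p<i : par (suc i) < suc i
    p<i = par< (suc i) i<n (s≤s z≤n)

  height : ℕ → ℕ
  height = depth n

  0<n : 0 < n
  0<n = ℕ.≤-<-trans z≤n (pos<n (proj₁ hasInterior))

  height-0 : height 0 ≡ 0
  height-0 = depth-fuel n 0 0 0<n z≤n z≤n

  height-par : ∀ i → 1 ≤ i → i < n → height i ≡ suc (height (par i))
  height-par (suc i) _ i<n = trans (depth-fuel n (suc i) (suc i) i<n (ℕ.<⇒≤ i<n) ℕ.≤-refl)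
      (cong suc (depth-fuel i n (par (suc i)) (ℕ.<-trans p<i i<n) (s≤s⁻¹ p<i) (ℕ.<⇒≤ (ℕ.<-trans p<i i<n))))
    where
    p<i : par (suc i) < suc i
    p<i = par< (suc i) i<n (s≤s z≤n)

  par-edge : ∀ i → 1 ≤ i → i < n → Adj (at i) (at (par i))
  par-edge i 1≤i i<n = bit⇒T (ℕ.≤-trans (ℕ.≤-trans (ℕ.≤-reflexive (sym (χ-yes (par i ℕ.≟ par i) refl)))
    (ℕ.m≤n+m _ (χ (par (par i) ℕ.≟ i)))) (ℕ.≤-reflexive (sym (a≡ i (par i) i<n (ℕ.<-trans (par< i i<n 1≤i) i<n)))))

  edge-par : ∀ {u v} → Adj u v → par (pos v) ≡ pos u ⊎ par (pos u) ≡ pos v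
  edge-par {u} {v} edge = decide (par (pos v) ℕ.≟ pos u) (par (pos u) ℕ.≟ pos v)
    (trans (sym (a≡ (pos u) (pos v) (pos<n u) (pos<n v))) (trans (cong₂ (λ x y → bit (adj x y)) (at-pos u) (at-pos v)) (T⇒bit edge)))
    where
    decide : (p : Dec (par (pos v) ≡ pos u)) (q : Dec (par (pos u) ≡ pos v)) → χ p + χ q ≡ 1 → par (pos v) ≡ pos u ⊎ par (pos u) ≡ pos v
    decide (yes p) _       _ = inj₁ p
    decide (no _)  (yes q) _ = inj₂ q

  height-child : ∀ {u v} → par (pos v) ≡ pos u → height (pos v) ≡ suc (height (pos u))
  height-child {u} {v} eq = trans (height-par (pos v) (positive (pos v) eq) (pos<n v)) (cong (suc ∘ height) eq)
    where
    positive : ∀ i → par i ≡ pos u → 1 ≤ i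
    positive zero    eq = contradiction (subst (n ≤_) eq par-root) (ℕ.<⇒≱ (pos<n u))
    positive (suc i) _  = s≤s z≤n

  root : V
  root = at 0

  walk-down : ∀ i → i < n → Walk (at i) root (height i)
  walk-down = <-rec _ λ where
    zero    rec _   → subst (Walk root root) (sym height-0) []
    (suc i) rec i<n → let p<i = par< (suc i) i<n (s≤s z≤n) in
      subst (Walk (at (suc i)) root) (sym (height-par (suc i) (s≤s z≤n) i<n)) (par-edge (suc i) (s≤s z≤n) i<n ∷ rec p<i (ℕ.<-trans p<i i<n))

  walk-length : ∀ {v k} → Walk v root k → height (pos v) ≤ k
  walk-length [] = ℕ.≤-reflexive (trans (cong height (pos-at 0 0<n)) height-0)
  walk-length (_∷_ {u} {v} edge w) = ℕ.≤-trans (one (edge-par edge)) (s≤s (walk-length w))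
    where
    one : par (pos v) ≡ pos u ⊎ par (pos u) ≡ pos v → height (pos u) ≤ suc (height (pos v))
    one (inj₁ eq) = ℕ.≤-trans (ℕ.n≤1+n _) (ℕ.≤-trans (ℕ.≤-reflexive (sym (height-child {u} {v} eq))) (ℕ.n≤1+n _))
    one (inj₂ eq) = ℕ.≤-reflexive (height-child {v} {u} eq)

  height-mono : ∀ j i → i ≤ j → j < n → height i ≤ height j
  height-mono = <-rec _ λ where
    j       rec zero    _         _   → ℕ.≤-trans (ℕ.≤-reflexive height-0) z≤n
    (suc j) rec (suc i) i≤j j<n →
      let i<n = ℕ.≤-<-trans i≤j j<n in subst₂ _≤_ (sym (height-par (suc i) (s≤s z≤n) i<n)) (sym (height-par (suc j) (s≤s z≤n) j<n))
        (s≤s (rec (par< (suc j) j<n (s≤s z≤n)) (par (suc i)) (par-mono (suc i) (suc j) (s≤s z≤n) i≤j j<n) (ℕ.<-trans (par< (suc j) j<n (s≤s z≤n)) j<n)))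

  _≺_ : Rel V 0ℓ
  u ≺ v = pos u < pos v

  pos-injective : ∀ {u v} → pos u ≡ pos v → u ≡ v
  pos-injective {u} {v} eq = trans (sym (at-pos u)) (trans (cong at eq) (at-pos v))

  ≺-compare : ∀ u v → Tri (u ≺ v) (u ≡ v) (v ≺ u)
  ≺-compare u v with ℕ.<-cmp (pos u) (pos v)
  ... | tri< p ¬q ¬r = tri< p (¬q ∘ cong pos) ¬r
  ... | tri≈ ¬p q ¬r = tri≈ ¬p (pos-injective q) ¬r
  ... | tri> ¬p ¬q r = tri> ¬p (¬q ∘ cong pos) r

  interior-pos : ∀ {v} → IsInterior v → 2 ≤ d (pos v)
  interior-pos {v} = subst (2 ≤_) (cong deg (sym (at-pos v)))

  isSLO : IsSLO G root _≺_
  isSLO = record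
    { isStrictTotalOrder = isStrictTotalOrderᶜ (record { isEquivalence = ≡-isEquivalence ; trans = ℕ.<-trans ; compare = ≺-compare })
    ; h = height ∘ pos
    ; h-dist = λ v → subst (λ w → Walk w root (height (pos v))) (at-pos v) (walk-down (pos v) (pos<n v)) , (λ k → walk-length)
    ; S1 = λ {v} {w} lt → height-mono (pos w) (pos v) (ℕ.<⇒≤ lt) (pos<n w)
    ; S2 = S2
    ; S3 = λ {v} {w} lt boundary → ¬interior⇒boundary λ int → ℕ.<⇒≱
        (subst (2 ≤_) (trans (cong deg (at-pos v)) boundary) (interior-first (pos v) (pos w) (ℕ.<⇒≤ lt) (pos<n w) (interior-pos int))) ℕ.≤-refl }
    where
    child-par : ∀ {v w} → Adj v w → height (pos w) ≡ suc (height (pos v)) → par (pos w) ≡ pos v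
    child-par {v} {w} edge eq with edge-par {v} {w} edge
    ... | inj₁ p = p
    ... | inj₂ p = contradiction (trans eq (cong suc (height-child {w} {v} p))) (ℕ.<⇒≢ (s≤s (ℕ.n≤1+n _)))
    S2 : ∀ {v₁ v₂ w₁ w₂} → v₁ ≺ v₂ → Adj v₁ w₁ × height (pos w₁) ≡ suc (height (pos v₁)) → Adj v₂ w₂ × height (pos w₂) ≡ suc (height (pos v₂)) → w₁ ≺ w₂
    S2 {v₁} {v₂} {w₁} {w₂} lt (e₁ , h₁) (e₂ , h₂) = ℕ.≰⇒> λ le → ℕ.<⇒≱ lt
      (subst₂ _≤_ (child-par {v₂} {w₂} e₂ h₂) (child-par {v₁} {w₁} e₁ h₁) (par-mono (pos w₂) (pos w₁) (positive (pos w₂) h₂) le (pos<n w₁)))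
      where
      positive : ∀ i → height i ≡ suc (height (pos v₂)) → 1 ≤ i
      positive zero    eq = contradiction (trans (sym eq) height-0) λ ()
      positive (suc i) _  = s≤s z≤n

  isSLO*Tree : IsSLO*Tree G
  isSLO*Tree = root , _≺_ , record
    { isSLO = isSLO
    ; S4 = λ {v} {w} _ int lt → subst₂ _≤_ (cong deg (at-pos v)) (cong deg (at-pos w)) (d-mono (pos v) (pos w) (ℕ.<⇒≤ lt) (pos<n w) (interior-pos int)) }

-- The breadth-first tree of a degree sequence

module ParentSearch (n : ℕ) (d : ℕ → ℕ) where

  children : ℕ → ℕ
  children zero    = d 0
  children (suc i) = d (suc i) ∸ 1

  -- P i is the number of vertices found once the vertices before i have been
  -- expanded, so that the children of i are P i , … , P (suc i) - 1.
  P : ℕ → ℕ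
  P zero    = 1
  P (suc i) = P i + children i

  -- The last index up to `j` whose children begin no later than `w`: the vertex that has `w` as a
  -- child.
  find : ℕ → ℕ → ℕ
  find zero    w = 0
  find (suc j) w with P (suc j) ℕ.≤? w
  ... | yes _ = suc j
  ... | no _  = find j w

  par : ℕ → ℕ
  par zero    = n
  par (suc w) = find n (suc w)

  related : ℕ → ℕ → Bool
  related i j = ⌊ par j ℕ.≟ i ⌋ ∨ ⌊ par i ℕ.≟ j ⌋

module Construction (n : ℕ) (d : ℕ → ℕ) (d-pos : ∀ i → i < n → 1 ≤ d i)
  (interior-first : ∀ i j → i ≤ j → j < n → 2 ≤ d j → 2 ≤ d i) (1<n : 1 < n) (root-interior : 2 ≤ d 0)
  (total : ∑ n d ≡ (n ∸ 1) + (n ∸ 1)) where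
  open ParentSearch n d

  n≡ : suc (n ∸ 1) ≡ n
  n≡ = ℕ.m+[n∸m]≡n (ℕ.<⇒≤ 1<n)

  P-sum : ∀ j → j < n → P (suc j) + j ≡ suc (∑ (suc j) d)
  P-sum zero    _   = ℕ.+-identityʳ (suc (d 0))
  P-sum (suc j) j<n = begin
    (P (suc j) + (d (suc j) ∸ 1)) + suc j   ≡⟨ solve 3 (λ p x j → (p :+ x) :+ (con 1 :+ j) := (p :+ j) :+ (x :+ con 1)) refl (P (suc j)) (d (suc j) ∸ 1) j ⟩
    (P (suc j) + j) + (d (suc j) ∸ 1 + 1)   ≡⟨ cong₂ _+_ (P-sum j (ℕ.<⇒≤ j<n)) (ℕ.m∸n+n≡m (d-pos (suc j) j<n)) ⟩
    suc (∑ (suc j) d) + d (suc j)           ∎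
    where
    open ≡-Reasoning
    open ℕ-Solver

  P-n : P n ≡ n
  P-n = ℕ.+-cancelʳ-≡ (n ∸ 1) (P n) n (trans (cong (λ k → P k + (n ∸ 1)) (sym n≡)) (trans (P-sum (n ∸ 1) (ℕ.≤-reflexive n≡))
    (trans (cong suc (trans (cong (λ k → ∑ k d) n≡) total)) (cong (_+ (n ∸ 1)) n≡))))

  P-mono : ∀ {i j} → i ≤ j → P i ≤ P j
  P-mono {i} {j} i≤j = subst (λ k → P i ≤ P k) (ℕ.m+[n∸m]≡n i≤j) (go (j ∸ i))
    where
    go : ∀ t → P i ≤ P (i + t)
    go zero    = ℕ.≤-reflexive (cong P (sym (ℕ.+-identityʳ i)))
    go (suc t) = ℕ.≤-trans (go t) (ℕ.≤-trans (ℕ.m≤m+n _ _) (ℕ.≤-reflexive (cong P (sym (ℕ.+-suc i t)))))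

  children-pos : ∀ i → 2 ≤ d i → 1 ≤ children i
  children-pos zero    2≤ = ℕ.<⇒≤ 2≤
  children-pos (suc i) 2≤ = ℕ.m<n⇒0<n∸m 2≤

  P-interior : ∀ i → i ≤ n → (∀ j → j < i → 2 ≤ d j) → suc i ≤ P i
  P-interior zero    _   _   = ℕ.≤-refl
  P-interior (suc i) i<n all = ℕ.≤-trans (ℕ.≤-reflexive (ℕ.+-comm 1 (suc i)))
    (ℕ.+-mono-≤ (P-interior i (ℕ.<⇒≤ i<n) λ j j<i → all j (ℕ.m<n⇒m<1+n j<i)) (children-pos i (all i ℕ.≤-refl)))

  P-leaves : ∀ i t → 1 ≤ i → i + t ≤ n → ¬ 2 ≤ d i → P (i + t) ≡ P i
  P-leaves i zero    _   _  _ = cong P (ℕ.+-identityʳ i)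
  P-leaves i (suc t) 1≤i le ¬2≤ = trans (cong P (ℕ.+-suc i t)) (trans (cong₂ _+_ (P-leaves i t 1≤i (ℕ.<⇒≤ lt) ¬2≤) (leaf (i + t) (ℕ.≤-trans 1≤i (ℕ.m≤m+n i t)) ¬2≤′)) (ℕ.+-identityʳ _))
    where
    lt : i + t < n
    lt = ℕ.≤-trans (ℕ.≤-reflexive (sym (ℕ.+-suc i t))) le
    ¬2≤′ : ¬ 2 ≤ d (i + t)
    ¬2≤′ 2≤ = ¬2≤ (interior-first i (i + t) (ℕ.m≤m+n i t) lt 2≤)
    leaf : ∀ i → 1 ≤ i → ¬ 2 ≤ d i → children i ≡ 0
    leaf (suc i) _ ¬2≤ = ℕ.m≤n⇒m∸n≡0 (s≤s⁻¹ (ℕ.≰⇒> ¬2≤))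

  -- The construction never runs out of vertices to expand: interior vertices come first and each
  -- finds at least one new vertex, and from the first leaf on `P` keeps its final value, which the
  -- degree sum of a tree makes equal to `n`.
  i<P : ∀ i → i < n → i < P i
  i<P i i<n with 2 ℕ.≤? d i
  ... | yes 2≤ = P-interior i (ℕ.<⇒≤ i<n) λ j j<i → interior-first j i (ℕ.<⇒≤ j<i) i<n 2≤
  ... | no ¬2≤ = ℕ.≤-trans i<n (ℕ.≤-reflexive (trans (sym P-n) (trans (cong P (sym (ℕ.m+[n∸m]≡n (ℕ.<⇒≤ i<n))))
      (P-leaves i (n ∸ i) (positive i ¬2≤) (ℕ.≤-reflexive (ℕ.m+[n∸m]≡n (ℕ.<⇒≤ i<n))) ¬2≤))))
    where
    positive : ∀ i → ¬ 2 ≤ d i → 1 ≤ i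
    positive zero    ¬2≤ = contradiction root-interior ¬2≤
    positive (suc i) _   = s≤s z≤n

  find-spec : ∀ j w → 1 ≤ w → find j w ≤ j × P (find j w) ≤ w × (∀ i → find j w < i → i ≤ j → w < P i)
  find-spec zero    w 1≤w = z≤n , 1≤w , λ { zero () _ ; (suc i) _ () }
  find-spec (suc j) w 1≤w with P (suc j) ℕ.≤? w
  ... | yes le = ℕ.≤-refl , le , λ i j<i i≤j → contradiction i≤j (ℕ.<⇒≱ j<i)
  ... | no ¬le with find-spec j w 1≤w
  ...   | f≤j , P≤w , above = ℕ.m≤n⇒m≤1+n f≤j , P≤w , above′
    where
    above′ : ∀ i → find j w < i → i ≤ suc j → w < P i
    above′ i f<i i≤1+j with i ℕ.≟ suc j
    ... | yes refl = ℕ.≰⇒> ¬le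
    ... | no i≢    = above i f<i (s≤s⁻¹ (ℕ.≤∧≢⇒< i≤1+j i≢))

  P-par≤ : ∀ w → 1 ≤ w → P (par w) ≤ w
  P-par≤ (suc w) 1≤w = proj₁ (proj₂ (find-spec n (suc w) 1≤w))

  <P : ∀ w i → 1 ≤ w → par w < i → i ≤ n → w < P i
  <P (suc w) i 1≤w = proj₂ (proj₂ (find-spec n (suc w) 1≤w)) i

  par≤n : ∀ w → par w ≤ n
  par≤n zero    = ℕ.≤-refl
  par≤n (suc w) = proj₁ (find-spec n (suc w) (s≤s z≤n))

  par< : ∀ w → w < n → 1 ≤ w → par w < w
  par< w w<n 1≤w = ℕ.≰⇒> λ w≤p → ℕ.<⇒≱ (ℕ.<-≤-trans (i<P w w<n) (P-mono w≤p)) (P-par≤ w 1≤w)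

  par-mono : ∀ i j → 1 ≤ i → i ≤ j → j < n → par i ≤ par j
  par-mono i j 1≤i i≤j j<n = ℕ.≮⇒≥ λ p<p → ℕ.<⇒≱ (<P j (par i) (ℕ.≤-trans 1≤i i≤j) p<p (par≤n i)) (ℕ.≤-trans (P-par≤ i 1≤i) i≤j)

  not-both : ∀ i j → i < n → j < n → par j ≡ i → par i ≢ j
  not-both zero    zero    i<n j<n refl eq = ℕ.<-irrefl refl i<n
  not-both zero    (suc j) i<n j<n _  refl = ℕ.<-irrefl refl j<n
  not-both (suc i) zero    i<n j<n refl _  = ℕ.<-irrefl refl i<n
  not-both (suc i) (suc j) i<n j<n p  q    = ℕ.<-asym (subst (_< suc j) p (par< (suc j) j<n (s≤s z≤n))) (subst (_< suc i) q (par< (suc i) i<n (s≤s z≤n)))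

  related-bit : ∀ i j → i < n → j < n → bit (related i j) ≡ χ (par j ℕ.≟ i) + χ (par i ℕ.≟ j)
  related-bit i j i<n j<n with par j ℕ.≟ i | par i ℕ.≟ j
  ... | yes p | yes q = contradiction q (not-both i j i<n j<n p)
  ... | yes _ | no _  = refl
  ... | no _  | yes _ = refl
  ... | no _  | no _  = refl

  related-sym : ∀ i j → related i j ≡ related j i
  related-sym i j = Bool.∨-comm ⌊ par j ℕ.≟ i ⌋ ⌊ par i ℕ.≟ j ⌋

  related-irrefl : ∀ i → i < n → related i i ≡ false
  related-irrefl i i<n with par i ℕ.≟ i
  ... | yes p = contradiction p (not-both i i i<n i<n p)
  ... | no _  = refl

  related⇒par : ∀ i j → T (related i j) → par j ≡ i ⊎ par i ≡ j
  related⇒par i j edge with par j ℕ.≟ i | par i ℕ.≟ j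
  ... | yes p | _     = inj₁ p
  ... | no _  | yes q = inj₂ q

  related-par : ∀ i → 1 ≤ i → i < n → T (related i (par i))
  related-par i 1≤i i<n = bit⇒T (ℕ.≤-trans (ℕ.≤-trans (ℕ.≤-reflexive (sym (χ-yes (par i ℕ.≟ par i) refl))) (ℕ.m≤n+m _ (χ (par (par i) ℕ.≟ i))))
    (ℕ.≤-reflexive (sym (related-bit i (par i) i<n (ℕ.<-trans (par< i i<n 1≤i) i<n)))))

  related-later : ∀ i j → i < n → j < n → j ≤ i → T (related i j) → par i ≡ j
  related-later i j i<n j<n j≤i edge = [ (λ p → contradiction j≤i (ℕ.<⇒≱ (subst (_< j) p (par< j j<n (positive j p))))) , id ]′ (related⇒par i j edge)
    where
    positive : ∀ j → par j ≡ i → 1 ≤ j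
    positive zero    eq = contradiction i<n (ℕ.<-irrefl (sym eq))
    positive (suc j) _  = s≤s z≤n

  -- The children of `i` are exactly what extends the first `P i` positions to the first
  -- `P (suc i)`, so indicators are compared and `P i` is cancelled.
  child-count : ∀ i → i < n → ∑ n (λ j → χ (par j ℕ.≟ i)) ≡ children i
  child-count i i<n = ℕ.+-cancelʳ-≡ (P i) _ _ (begin
      ∑ n (λ j → χ (par j ℕ.≟ i)) + P i                             ≡⟨ cong (λ z → ∑ n (λ j → χ (par j ℕ.≟ i)) + z) (prefix (P i) (Pi≤n (ℕ.<⇒≤ i<n))) ⟨
      ∑ n (λ j → χ (par j ℕ.≟ i)) + ∑ n (λ j → χ (j ℕ.<? P i))      ≡⟨ ∑-+ n (λ j → χ (par j ℕ.≟ i)) (λ j → χ (j ℕ.<? P i)) ⟨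
      ∑ n (λ j → χ (par j ℕ.≟ i) + χ (j ℕ.<? P i))                  ≡⟨ ∑-cong n term ⟩
      ∑ n (λ j → χ (j ℕ.<? P (suc i)))                              ≡⟨ prefix (P (suc i)) (Pi≤n i<n) ⟩
      P i + children i                                              ≡⟨ ℕ.+-comm (P i) (children i) ⟩
      children i + P i                                              ∎)
    where
    open ≡-Reasoning
    Pi≤n : ∀ {k} → k ≤ n → P k ≤ n
    Pi≤n k≤n = ℕ.≤-trans (P-mono k≤n) (ℕ.≤-reflexive P-n)
    prefix : ∀ k → k ≤ n → ∑ n (λ j → χ (j ℕ.<? k)) ≡ k
    prefix k k≤n = trans (∑-cong n λ j _ → sym (ℕ.*-identityʳ _)) (trans (∑-χ-< n (λ _ → 1) k≤n) (∑-ones k))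
    term : ∀ j → j < n → χ (par j ℕ.≟ i) + χ (j ℕ.<? P i) ≡ χ (j ℕ.<? P (suc i))
    term zero _ = trans (cong₂ _+_ (χ-no (n ℕ.≟ i) λ { refl → ℕ.<-irrefl refl i<n }) (χ-yes (0 ℕ.<? P i) (ℕ.≤-<-trans z≤n (i<P i i<n))))
      (sym (χ-yes (0 ℕ.<? P (suc i)) (ℕ.<-≤-trans (ℕ.≤-<-trans z≤n (i<P i i<n)) (ℕ.m≤m+n (P i) (children i)))))
    term (suc j) j<n with ℕ.<-cmp (par (suc j)) i
    ... | tri< lt ¬eq _ = trans (cong₂ _+_ (χ-no (par (suc j) ℕ.≟ i) ¬eq) (χ-yes (suc j ℕ.<? P i) (<P (suc j) i (s≤s z≤n) lt (ℕ.<⇒≤ i<n))))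
        (sym (χ-yes (suc j ℕ.<? P (suc i)) (<P (suc j) (suc i) (s≤s z≤n) (ℕ.m<n⇒m<1+n lt) i<n)))
    ... | tri≈ _ refl _ = trans (cong₂ _+_ (χ-yes (par (suc j) ℕ.≟ i) refl) (χ-no (suc j ℕ.<? P i) (ℕ.≤⇒≯ (P-par≤ (suc j) (s≤s z≤n)))))
        (sym (χ-yes (suc j ℕ.<? P (suc i)) (<P (suc j) (suc i) (s≤s z≤n) ℕ.≤-refl i<n)))
    ... | tri> _ ¬eq gt = trans (cong₂ _+_ (χ-no (par (suc j) ℕ.≟ i) ¬eq) (χ-no (suc j ℕ.<? P i) (ℕ.≤⇒≯ (ℕ.≤-trans (P-mono (ℕ.<⇒≤ gt)) (P-par≤ (suc j) (s≤s z≤n))))))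
        (sym (χ-no (suc j ℕ.<? P (suc i)) (ℕ.≤⇒≯ (ℕ.≤-trans (P-mono gt) (P-par≤ (suc j) (s≤s z≤n))))))

  related-degree : ∀ i → i < n → ∑ n (λ j → bit (related i j)) ≡ d i
  related-degree i i<n = trans (∑-cong n λ j j<n → related-bit i j i<n j<n)
    (trans (∑-+ n (λ j → χ (par j ℕ.≟ i)) (λ j → χ (par i ℕ.≟ j))) (trans (cong₂ _+_ (child-count i i<n) (∑-χ-par n (par i))) (finish i i<n)))
    where
    finish : ∀ i → i < n → children i + χ (par i ℕ.<? n) ≡ d i
    finish zero    _   = trans (cong (λ z → d 0 + z) (χ-no (n ℕ.<? n) (ℕ.<-irrefl refl))) (ℕ.+-identityʳ (d 0))
    finish (suc i) i<n = trans (cong (λ z → d (suc i) ∸ 1 + z) (χ-yes (par (suc i) ℕ.<? n) (ℕ.<-trans (par< (suc i) i<n (s≤s z≤n)) i<n))) (ℕ.m∸n+n≡m (d-pos (suc i) i<n))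

argmax : ∀ {k} (f : Fin (suc k) → ℕ) → ∃[ i ] (∀ j → f j ≤ f i)
argmax {zero}  f = zero , λ { zero → ℕ.≤-refl }
argmax {suc k} f with argmax (f ∘ suc)
... | i , max with f zero ℕ.≤? f (suc i)
...   | yes le = suc i , λ { zero → le ; (suc j) → max j }
...   | no ¬le = zero , λ { zero → ℕ.≤-refl ; (suc j) → ℕ.≤-trans (max j) (ℕ.<⇒≤ (ℕ.≰⇒> ¬le)) }

module _ (G : Graph) where
  open Graph G

  cycle-step : (C : Cycle) → let open Cycle C in ∀ i j → toℕ j ≡ suc (toℕ i) → Adj (c i) (c j)
  cycle-step C i j eq = subst₂ (λ x y → Adj (c x) (c y))
      (Fin.toℕ-injective (trans (Fin.toℕ-inject₁ _) (Fin.toℕ-fromℕ< i<k))) (Fin.toℕ-injective (trans (cong suc (Fin.toℕ-fromℕ< i<k)) (sym eq)))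
      (step (fromℕ< i<k))
    where
    open Cycle C
    i<k : toℕ i < k
    i<k = s≤s⁻¹ (subst (_< suc k) eq (Fin.toℕ<n j))

  cycle-neighbours : (C : Cycle) → let open Cycle C in ∀ i → ∃₂ λ l r → l ≢ r × Adj (c i) (c l) × Adj (c i) (c r)
  cycle-neighbours C i = cases (toℕ i) refl (toℕ i ℕ.≟ k)
    where
    open Cycle C
    flip : ∀ {u v} → Adj u v → Adj v u
    flip {u} {v} = subst T (adj-sym u v)
    different : ∀ {x y : Fin (suc k)} → toℕ x ≢ toℕ y → x ≢ y
    different neq eq = neq (cong toℕ eq)
    node : ∀ x → x < suc k → ∃[ y ] toℕ y ≡ x
    node x x<1+k = fromℕ< x<1+k , Fin.toℕ-fromℕ< x<1+k
    top : ∀ {x} → toℕ x ≡ k → Adj (c x) (c zero)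
    top eq = subst (λ x → Adj (c x) (c zero)) (Fin.toℕ-injective (trans (Fin.toℕ-fromℕ k) (sym eq))) close
    cases : ∀ x → toℕ i ≡ x → Dec (toℕ i ≡ k) → ∃₂ λ l r → l ≢ r × Adj (c i) (c l) × Adj (c i) (c r)
    cases zero eq _ =
      let l , l≡ = node k ℕ.≤-refl
          r , r≡ = node 1 (s≤s (ℕ.<⇒≤ 2≤k))
      in l , r , different (λ e → ℕ.<⇒≢ 2≤k (trans (sym r≡) (trans (sym e) l≡)))
         , subst (λ x → Adj (c x) (c l)) (Fin.toℕ-injective (sym eq)) (flip (top l≡))
         , cycle-step C i r (trans r≡ (cong suc (sym eq)))
    cases (suc x) eq (yes i≡k) =
      let l , l≡ = node x (ℕ.<⇒≤ (subst (_< suc k) eq (Fin.toℕ<n i)))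
      in l , zero , different (λ e → ℕ.<⇒≢ 2≤k (trans (cong suc (trans (sym e) l≡)) (trans (sym eq) i≡k)))
         , flip (cycle-step C l i (trans eq (cong suc (sym l≡)))) , top i≡k
    cases (suc x) eq (no i≢k) =
      let l , l≡ = node x (ℕ.<⇒≤ (subst (_< suc k) eq (Fin.toℕ<n i)))
          r , r≡ = node (suc (toℕ i)) (s≤s (ℕ.≤∧≢⇒< (s≤s⁻¹ (Fin.toℕ<n i)) i≢k))
      in l , r , different (λ e → ℕ.<⇒≢ (ℕ.m<n⇒m<1+n (ℕ.n<1+n x)) (trans (sym l≡) (trans e (trans r≡ (cong suc eq)))))
         , flip (cycle-step C l i (trans eq (cong suc (sym l≡)))) , cycle-step C i r r≡

  _++ʷ_ : ∀ {u v w k l} → Walk u v k → Walk v w l → Walk u w (k + l)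
  []      ++ʷ q = q
  (e ∷ p) ++ʷ q = e ∷ (p ++ʷ q)

  reverse : ∀ {u v k} → Walk u v k → ∃[ l ] Walk v u l
  reverse [] = 0 , []
  reverse (_∷_ {u} {v} e p) = _ , proj₂ (reverse p) ++ʷ (subst T (adj-sym u v) e ∷ [])

module BreadthFirstTree (G : TreeWithBoundary) where
  open Tree G
  open Ground G using (deg≤order; i₀)

  -- Sorting by this key puts the interior vertices in order of increasing degree and the boundary
  -- last, since no degree exceeds the order.
  key : V → ℕ
  key v = if ⌊ interior? v ⌋ then deg v else suc order

  key-interior : ∀ {v} → IsInterior v → key v ≡ deg v
  key-interior {v} int with interior? v
  ... | yes _   = refl
  ... | no ¬int = contradiction int ¬int

  key-boundary : ∀ {v} → ¬ IsInterior v → key v ≡ suc order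
  key-boundary {v} ¬int with interior? v
  ... | yes int = contradiction int ¬int
  ... | no _    = refl

  _⊏_ : Rel V 0ℓ
  u ⊏ v = key u < key v ⊎ (key u ≡ key v × toℕ u < toℕ v)

  ⊏⇒≤ : ∀ {u v} → u ⊏ v → key u ≤ key v
  ⊏⇒≤ (inj₁ lt)       = ℕ.<⇒≤ lt
  ⊏⇒≤ (inj₂ (eq , _)) = ℕ.≤-reflexive eq

  ⊏-trans : ∀ {u v w} → u ⊏ v → v ⊏ w → u ⊏ w
  ⊏-trans (inj₁ p) q = inj₁ (ℕ.<-≤-trans p (⊏⇒≤ q))
  ⊏-trans (inj₂ (eq , _)) (inj₁ q) = inj₁ (subst (_< _) (sym eq) q)
  ⊏-trans (inj₂ (eq , p)) (inj₂ (eq′ , q)) = inj₂ (trans eq eq′ , ℕ.<-trans p q)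

  ⊏-irrefl : ∀ {u} → ¬ u ⊏ u
  ⊏-irrefl (inj₁ p)       = ℕ.<-irrefl refl p
  ⊏-irrefl (inj₂ (_ , p)) = ℕ.<-irrefl refl p

  ⊏-compare : ∀ u v → Tri (u ⊏ v) (u ≡ v) (v ⊏ u)
  ⊏-compare u v = decide (ℕ.<-cmp (key u) (key v)) (Fin.<-cmp u v)
    where
    less : u ⊏ v → Tri (u ⊏ v) (u ≡ v) (v ⊏ u)
    less p = tri< p (λ { refl → ⊏-irrefl {u} p }) (λ q → ⊏-irrefl {u} (⊏-trans {u} {v} {u} p q))
    greater : v ⊏ u → Tri (u ⊏ v) (u ≡ v) (v ⊏ u)
    greater p = tri> (λ q → ⊏-irrefl {v} (⊏-trans {v} {u} {v} p q)) (λ { refl → ⊏-irrefl {u} p }) p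
    decide : Tri (key u < key v) (key u ≡ key v) (key v < key u) → Tri (toℕ u < toℕ v) (u ≡ v) (toℕ v < toℕ u) → Tri (u ⊏ v) (u ≡ v) (v ⊏ u)
    decide (tri< lt _ _) _ = less (inj₁ lt)
    decide (tri> _ _ gt) _ = greater (inj₁ gt)
    decide (tri≈ _ eq _) (tri< lt _ _)   = less (inj₂ (eq , lt))
    decide (tri≈ _ eq _) (tri> _ _ gt)   = greater (inj₂ (sym eq , gt))
    decide (tri≈ _ eq _) (tri≈ _ refl _) = tri≈ (⊏-irrefl {u}) refl (⊏-irrefl {u})

  ⊏-isStrictTotalOrder : IsStrictTotalOrder _≡_ _⊏_
  ⊏-isStrictTotalOrder = isStrictTotalOrderᶜ (record { isEquivalence = ≡-isEquivalence
    ; trans = λ {u} {v} {w} → ⊏-trans {u} {v} {w} ; compare = ⊏-compare })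

  ν : Numbering order
  ν = numbering ⊏-isStrictTotalOrder (vertex i₀)

  open Numbered ν

  key-mono : ∀ i j → i ≤ j → j < n → key (at i) ≤ key (at j)
  key-mono i j i≤j j<n = decide (⊏-compare (at i) (at j))
    where
    decide : Tri (at i ⊏ at j) (at i ≡ at j) (at j ⊏ at i) → key (at i) ≤ key (at j)
    decide (tri< p _ _)  = ⊏⇒≤ {at i} {at j} p
    decide (tri≈ _ eq _) = ℕ.≤-reflexive (cong key eq)
    decide (tri> _ _ p)  = contradiction i≤j (ℕ.<⇒≱ (subst₂ _<_ (pos-at j j<n) (pos-at i (ℕ.≤-<-trans i≤j j<n)) (numbering-mono ⊏-isStrictTotalOrder (vertex i₀) p)))

  interior-first : ∀ i j → i ≤ j → j < n → 2 ≤ d j → 2 ≤ d i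
  interior-first i j i≤j j<n 2≤ = decide (interior? (at i))
    where
    decide : Dec (IsInterior (at i)) → 2 ≤ d i
    decide (yes int) = int
    decide (no ¬int) = contradiction (subst₂ _≤_ (key-boundary ¬int) (key-interior 2≤) (key-mono i j i≤j j<n)) (ℕ.<⇒≱ (s≤s (deg≤order (at j))))

  d-mono : ∀ i j → i ≤ j → j < n → 2 ≤ d j → d i ≤ d j
  d-mono i j i≤j j<n 2≤ = subst₂ _≤_ (key-interior (interior-first i j i≤j j<n 2≤)) (key-interior 2≤) (key-mono i j i≤j j<n)

  1<n : 1 < n
  1<n = ℕ.≤-trans (proj₂ hasInterior) (deg≤order (proj₁ hasInterior))

  total : ∑ n d ≡ (n ∸ 1) + (n ∸ 1)
  total = trans (sym (e-row n)) (trans (e-total (n ∸ 1) (sym (ℕ.m+[n∸m]≡n (ℕ.<⇒≤ 1<n)))) (cong (λ z → n ∸ 1 + z) (ℕ.+-identityʳ (n ∸ 1))))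

  open ParentSearch n d
  open Construction n d (λ i _ → deg-pos (at i)) interior-first 1<n
    (interior-first 0 (pos (proj₁ hasInterior)) z≤n (pos<n (proj₁ hasInterior)) (subst IsInterior (sym (at-pos (proj₁ hasInterior))) (proj₂ hasInterior))) total

  -- The vertices are those of the given tree and keep their degrees; only the edges are new. The
  -- degree sequence is thus preserved vertex by vertex.
  bfs-graph : Graph
  bfs-graph = record
    { order = order
    ; adj = λ u v → related (pos u) (pos v)
    ; adj-sym = λ u v → related-sym (pos u) (pos v)
    ; no-loop = λ v → related-irrefl (pos v) (pos<n v) }

  module B = Graph bfs-graph

  bfs-deg : ∀ v → B.deg v ≡ deg v
  bfs-deg v = trans (deg≡sum bfs-graph v) (trans (sum-at (λ w → bit (related (pos v) (pos w))))
    (trans (∑-cong n λ j j<n → cong (λ k → bit (related (pos v) k)) (pos-at j j<n)) (trans (related-degree (pos v) (pos<n v)) (cong deg (at-pos v)))))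

  par-adj : ∀ i → 1 ≤ i → i < n → B.Adj (at i) (at (par i))
  par-adj i 1≤i i<n = subst₂ (λ x y → T (related x y)) (sym (pos-at i i<n)) (sym (pos-at (par i) (ℕ.<-trans (par< i i<n 1≤i) i<n))) (related-par i 1≤i i<n)

  to-root : ∀ i → i < n → ∃[ k ] B.Walk (at i) (at 0) k
  to-root = <-rec _ λ where
    zero    rec _   → 0 , B.[]
    (suc i) rec i<n → let p<i = par< (suc i) i<n (s≤s z≤n)
                          k , w = rec p<i (ℕ.<-trans p<i i<n)
                      in suc k , par-adj (suc i) (s≤s z≤n) i<n B.∷ w

  bfs-connected : B.Connected
  bfs-connected u v =
    let k , p = to-root (pos u) (pos<n u)
        l , q = to-root (pos v) (pos<n v)
        m , q′ = reverse bfs-graph q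
    in k + m , subst₂ (λ x y → B.Walk x y (k + m)) (at-pos u) (at-pos v) (_++ʷ_ bfs-graph p q′)

  -- Both cycle neighbours of the vertex with the largest number are its parent.
  bfs-acyclic : ¬ B.Cycle
  bfs-acyclic C = clash (argmax (pos ∘ c))
    where
    open B.Cycle C
    clash : ¬ (∃[ i ] (∀ j → pos (c j) ≤ pos (c i)))
    clash (i , max) = conflict (cycle-neighbours bfs-graph C i)
      where
      pos-injective : ∀ {u v} → pos u ≡ pos v → u ≡ v
      pos-injective {u} {v} eq = trans (sym (at-pos u)) (trans (cong at eq) (at-pos v))
      is-parent : ∀ j → B.Adj (c i) (c j) → par (pos (c i)) ≡ pos (c j)
      is-parent j = related-later (pos (c i)) (pos (c j)) (pos<n (c i)) (pos<n (c j)) (max j)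
      conflict : ¬ (∃₂ λ l r → l ≢ r × B.Adj (c i) (c l) × B.Adj (c i) (c r))
      conflict (l , r , l≢r , p , q) = l≢r (distinct (pos-injective (trans (sym (is-parent l p)) (is-parent r q))))

  tree : TreeWithBoundary
  tree = record
    { graph = bfs-graph
    ; isTree = bfs-connected , bfs-acyclic
    ; deg-pos = λ v → subst (1 ≤_) (sym (bfs-deg v)) (deg-pos v)
    ; hasBoundary = proj₁ hasBoundary , trans (bfs-deg (proj₁ hasBoundary)) (proj₂ hasBoundary)
    ; hasInterior = proj₁ hasInterior , subst (2 ≤_) (sym (bfs-deg (proj₁ hasInterior))) (proj₂ hasInterior) }

  tree∈ : ∀ {π} → 𝒯 π G → 𝒯 π tree
  tree∈ {π} = subst (_↭ π) (List.map-cong (λ v → sym (bfs-deg v)) (allFin order))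

  treeBFS : TreeBFS tree
  treeBFS = ν , record
    { par = par ; par-root = ℕ.≤-refl ; par< = par< ; par-mono = par-mono
    ; a≡ = λ i j i<n j<n → trans (cong₂ (λ x y → bit (related x y)) (pos-at i i<n) (pos-at j j<n)) (related-bit i j i<n j<n)
    ; interior-first = λ i j i≤j j<n 2≤ → subst (2 ≤_) (sym (bfs-deg (at i))) (interior-first i j i≤j j<n (subst (2 ≤_) (bfs-deg (at j)) 2≤))
    ; d-mono = λ i j i≤j j<n 2≤ → subst₂ _≤_ (sym (bfs-deg (at i))) (sym (bfs-deg (at j))) (d-mono i j i≤j j<n (subst (2 ≤_) (bfs-deg (at j)) 2≤)) }

-- Isomorphisms

bit-injective : ∀ {b c} → bit b ≡ bit c → b ≡ c
bit-injective {true}  {true}  _ = refl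
bit-injective {false} {false} _ = refl

module _ (G H : TreeWithBoundary) {π : List ℕ} (G∈ : 𝒯 π G) (H∈ : 𝒯 π H) where
  private
    module G = Tree G
    module H = Tree H

  order≡ : G.order ≡ H.order
  order≡ = trans (order≡length G G∈) (sym (order≡length H H∈))

  -- Both lists of interior degrees increase, so each has the smallest sums of first degrees and the
  -- lists coincide. The degrees then determine the breadth-first array, and matching positions is
  -- an isomorphism.
  bfs⇒≅ : TreeBFS G → TreeBFS H → G.graph ≅ H.graph
  bfs⇒≅ (νG , bfsG) (νH , bfsH) = record
    { bijection = mk↔ₛ′ (λ u → NH.at (NG.pos u)) (λ w → NG.at (NH.pos w))
        (λ w → trans (cong NH.at (NG.pos-at (NH.pos w) (subst (NH.pos w <_) (sym order≡) (NH.pos<n w)))) (NH.at-pos w))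
        (λ u → trans (cong NG.at (NH.pos-at (NG.pos u) (subst (NG.pos u <_) order≡ (NG.pos<n u)))) (NG.at-pos u))
    ; preserves = λ u v → bit-injective (trans (sym (arrays-agree (NG.pos u) (NG.pos v) (NG.pos<n u) (NG.pos<n v)))
        (cong₂ (λ x y → bit (G.adj x y)) (NG.at-pos u) (NG.at-pos v))) }
    where
    module NG = G.Numbered νG
    module NH = H.Numbered νH
    n : ℕ
    n = G.order

    dH≡∑ : ∀ i → NH.d i ≡ ∑ n (NH.a i)
    dH≡∑ i = trans (NH.d≡∑ i) (cong (λ n → ∑ n (NH.a i)) (sym order≡))
    bfsH′ : IsBFS n NH.a NH.d
    bfsH′ = subst (λ n → IsBFS n NH.a NH.d) (sym order≡) bfsH
    same : ∀ (ψ : ℕ → ℕ) → ∑ n (ψ ∘ NG.d) ≡ ∑ n (ψ ∘ NH.d)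
    same ψ = trans (degree-sums G G∈ νG ψ) (trans (sym (degree-sums H H∈ νH ψ)) (cong (λ n → ∑ n (ψ ∘ NH.d)) (sym order≡)))
    m : ℕ
    m = ∑ n (λ i → χ (2 ℕ.≤? NG.d i))
    countG : m ≤ n × (∀ i → i < n → 2 ≤ NG.d i → i < m) × (∀ i → i < n → i < m → 2 ≤ NG.d i)
    countG = interior-count n NG.d (IsBFS.interior-first bfsG)
    countH : m ≤ n × (∀ i → i < n → 2 ≤ NH.d i → i < m) × (∀ i → i < n → i < m → 2 ≤ NH.d i)
    countH = subst (λ m → m ≤ n × (∀ i → i < n → 2 ≤ NH.d i → i < m) × (∀ i → i < n → i < m → 2 ≤ NH.d i))
      (sym (same (λ x → χ (2 ℕ.≤? x)))) (interior-count n NH.d (IsBFS.interior-first bfsH′))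
    module PG = Prefix {n} {m} {NG.d} {NH.d} (proj₁ countG) (proj₁ (proj₂ countG)) (proj₂ (proj₂ countH)) same
    module PH = Prefix {n} {m} {NH.d} {NG.d} (proj₁ countG) (proj₁ (proj₂ countH)) (proj₂ (proj₂ countG)) (λ ψ → sym (same ψ))
    prefix≡ : ∀ j → j ≤ m → ∑ j NG.d ≡ ∑ j NH.d
    prefix≡ j j≤m = ℕ.≤-antisym
      (PG.prefix-sum≤ (λ i j i≤j j<m → IsBFS.d-mono bfsG i j i≤j (m<n j<m) (proj₂ (proj₂ countG) j (m<n j<m) j<m)) j j≤m)
      (PH.prefix-sum≤ (λ i j i≤j j<m → IsBFS.d-mono bfsH′ i j i≤j (m<n j<m) (proj₂ (proj₂ countH) j (m<n j<m) j<m)) j j≤m)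
      where
      m<n : ∀ {j} → j < m → j < n
      m<n j<m = ℕ.<-≤-trans j<m (proj₁ countG)
    degrees-agree : ∀ i → i < n → NG.d i ≡ NH.d i
    degrees-agree i i<n with i ℕ.<? m
    ... | yes i<m = ℕ.+-cancelˡ-≡ (∑ i NG.d) _ _ (trans (prefix≡ (suc i) i<m) (cong (_+ NH.d i) (sym (prefix≡ i (ℕ.<⇒≤ i<m)))))
    ... | no ¬i<m = trans (G.¬interior⇒boundary λ int → ¬i<m (proj₁ (proj₂ countG) i i<n int))
                      (sym (H.¬interior⇒boundary λ int → ¬i<m (proj₁ (proj₂ countH) i i<n int)))
    adjH : IsAdjacency n NH.a
    adjH = record { a≤1 = NH.a≤1 ; a-sym = NH.a-sym ; a-diag = NH.a-diag }
    arrays-agree : ∀ i j → i < n → j < n → NG.a i j ≡ NH.a i j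
    arrays-agree = bfs-unique NG.adjacency adjH NG.d≡∑ dH≡∑ bfsG bfsH′ degrees-agree

  ≅⇒bfs : G.graph ≅ H.graph → TreeBFS H → TreeBFS G
  ≅⇒bfs iso (νH , bfsH) = ν , record
    { par = par ; par-root = subst (_≤ par 0) (sym order≡) par-root
    ; par< = λ i i<n → par< i (shift i<n)
    ; par-mono = λ i j 1≤i i≤j j<n → par-mono i j 1≤i i≤j (shift j<n)
    ; a≡ = λ i j i<n j<n → trans (a≡H i j) (a≡ i j (shift i<n) (shift j<n))
    ; interior-first = λ i j i≤j j<n 2≤ → subst (2 ≤_) (sym (d≡H i)) (interior-first i j i≤j (shift j<n) (subst (2 ≤_) (d≡H j) 2≤))
    ; d-mono = λ i j i≤j j<n 2≤ → subst₂ _≤_ (sym (d≡H i)) (sym (d≡H j)) (d-mono i j i≤j (shift j<n) (subst (2 ≤_) (d≡H j) 2≤)) }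
    where
    open _≅_ iso
    open Inverse bijection using (to; from; strictlyInverseˡ; strictlyInverseʳ)
    module NH = H.Numbered νH
    open IsBFS bfsH
    shift : ∀ {i} → i < G.order → i < H.order
    shift {i} = subst (i <_) order≡
    ν : Numbering G.order
    ν = record
      { at = λ i → from (NH.at i) ; pos = λ u → NH.pos (to u)
      ; pos<n = λ u → subst (NH.pos (to u) <_) (sym order≡) (NH.pos<n (to u))
      ; at-pos = λ u → trans (cong from (NH.at-pos (to u))) (strictlyInverseʳ u)
      ; pos-at = λ i i<n → trans (cong NH.pos (strictlyInverseˡ (NH.at i))) (NH.pos-at i (shift i<n)) }
    module NG = G.Numbered ν
    a≡H : ∀ i j → NG.a i j ≡ NH.a i j
    a≡H i j = cong bit (trans (sym (preserves (from (NH.at i)) (from (NH.at j)))) (cong₂ H.adj (strictlyInverseˡ (NH.at i)) (strictlyInverseˡ (NH.at j))))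
    d≡H : ∀ i → NG.d i ≡ NH.d i
    d≡H i = trans (NG.d≡∑ i) (trans (∑-cong G.order λ j _ → a≡H i j) (trans (cong (λ n → ∑ n (NH.a i)) order≡) (sym (NH.d≡∑ i))))

-- Decidability of graph isomorphism

any-vector? : ∀ m {n} {P : Vec (Fin n) m → Set} → (∀ xs → Dec (P xs)) → Dec (∃ P)
any-vector? zero P? with P? []
... | yes p = yes ([] , p)
... | no ¬p = no λ { ([] , p) → ¬p p }
any-vector? (suc m) P? with Fin.any? (λ x → any-vector? m (λ xs → P? (x ∷ xs)))
... | yes (x , xs , p) = yes (x ∷ xs , p)
... | no ¬p = no λ { (x ∷ xs , p) → ¬p (x , xs , p) }

module _ (G H : Graph) where
  private
    module G = Graph G
    module H = Graph H

  -- An isomorphism and its inverse as value tables. Tables of a fixed length can be searched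
  -- exhaustively, and their entries are compared pointwise.
  IsoVectors : Vec H.V G.order → Vec G.V H.order → Set
  IsoVectors xs ys = (∀ u → Vec.lookup ys (Vec.lookup xs u) ≡ u) × (∀ w → Vec.lookup xs (Vec.lookup ys w) ≡ w) ×
    (∀ u v → H.adj (Vec.lookup xs u) (Vec.lookup xs v) ≡ G.adj u v)

  isoVectors? : ∀ xs ys → Dec (IsoVectors xs ys)
  isoVectors? xs ys = Fin.all? (λ u → Vec.lookup ys (Vec.lookup xs u) Fin.≟ u) ×-dec
    (Fin.all? (λ w → Vec.lookup xs (Vec.lookup ys w) Fin.≟ w) ×-dec
      Fin.all? (λ u → Fin.all? λ v → H.adj (Vec.lookup xs u) (Vec.lookup xs v) Bool.≟ G.adj u v))

  isomorphic? : Dec (G ≅ H)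
  isomorphic? with any-vector? G.order (λ xs → any-vector? H.order (isoVectors? xs))
  ... | yes (xs , ys , inverseʳ , inverseˡ , preserves) = yes (record
        { bijection = mk↔ₛ′ (Vec.lookup xs) (Vec.lookup ys) inverseˡ inverseʳ ; preserves = preserves })
  ... | no none = no λ iso → let open _≅_ iso ; open Inverse bijection in
    none (tabulate to , tabulate from
      , (λ u → trans (lookup∘tabulate from _) (trans (cong from (lookup∘tabulate to u)) (strictlyInverseʳ u)))
      , (λ w → trans (lookup∘tabulate to _) (trans (cong to (lookup∘tabulate from w)) (strictlyInverseˡ w)))
      , (λ u v → trans (cong₂ H.adj (lookup∘tabulate to u) (lookup∘tabulate to v)) (preserves u v)))

-- The Faber-Krahn property of breadth-first trees

module _ (π : List ℕ) where

  bfs⇒μ≤ : ∀ G H → 𝒯 π G → 𝒯 π H → TreeBFS G → Ground.μ G ≤ʳ Ground.μ H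
  bfs⇒μ≤ G H G∈ H∈ bfs = Against.minimal H H∈ (subst (BFSArray (Ground.μ G) π) (sym (order≡length H H∈)) (bfsArray G G∈ bfs))

  bfs⇒faberKrahn : ∀ G → 𝒯 π G → TreeBFS G → FaberKrahn (𝒯 π) G
  bfs⇒faberKrahn G G∈ bfs = G∈ , λ H H∈ → ≤⇒≤λ G H (bfs⇒μ≤ G H G∈ H∈ bfs)

  -- The ties of an eigenvector cannot be decided, but isomorphism of finite
  -- graphs can, and this removes the double negation.
  faberKrahn⇒bfs : ∀ S → 𝒯 π S → TreeBFS S → ∀ G → FaberKrahn (𝒯 π) G → TreeBFS G
  faberKrahn⇒bfs S S∈ bfsS G (G∈ , minimal) = ≅⇒bfs G S G∈ S∈ (decidable-stable (isomorphic? (Tree.graph G) (Tree.graph S)) λ ¬iso →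
    Against.equality⇒bfs G G∈ (subst (BFSArray (Ground.μ S) π) (sym (order≡length G G∈)) (bfsArray S S∈ bfsS)) (≤λ⇒≤ G S (minimal S S∈))
      λ bfsG → ¬iso (bfs⇒≅ G S G∈ S∈ bfsG bfsS)) bfsS

theorem3 : (π : List ℕ) → ∃ (𝒯 π) →
    (∀ G → 𝒯 π G → FaberKrahn (𝒯 π) G ⇔ IsSLO*Tree G)
    × (∃[ G ] FaberKrahn (𝒯 π) G)
    × (∀ G H → FaberKrahn (𝒯 π) G → FaberKrahn (𝒯 π) H → TreeWithBoundary.graph G ≅ TreeWithBoundary.graph H)
theorem3 π (G₀ , G₀∈) =
    (λ G G∈ → mk⇔ (λ fk → BFS⇒SLO.isSLO*Tree G (fk⇒bfs G fk))
                  (λ (root , _≺_ , slo*) → bfs⇒faberKrahn π G G∈ (SLO⇒BFS.treeBFS G root _≺_ slo*)))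
  , (S , bfs⇒faberKrahn π S S∈ bfsS)
  , λ G H fkG fkH → bfs⇒≅ G H (proj₁ fkG) (proj₁ fkH) (fk⇒bfs G fkG) (fk⇒bfs H fkH)
  where
  S : TreeWithBoundary
  S = BreadthFirstTree.tree G₀
  S∈ : 𝒯 π S
  S∈ = BreadthFirstTree.tree∈ G₀ G₀∈
  bfsS : TreeBFS S
  bfsS = BreadthFirstTree.treeBFS G₀
  fk⇒bfs : ∀ G → FaberKrahn (𝒯 π) G → TreeBFS G
  fk⇒bfs = faberKrahn⇒bfs π S S∈ bfsS
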